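{- Fix an integer $k\geq 15$. Let $H\sim\mathcal{G}(n,m)$ with $\frac16(7k-1)n\leq m\leq n\log n$, and let $G$ be the graph obtained from $H$ by adding $\lfloor n/8\rfloor$ new edges chosen uniformly at random (a uniformly random set of $\lfloor n/8\rfloor$ pairs among those not in $E(H)$). Then the probability that $H^{(k)}$ is Hamiltonian and, at the same time, $G^{(k)}$ is connected but not Hamiltonian, is $o(n^{ -3})$.
   Context: $\mathcal{G}(n,m)$ is the uniform distribution on graphs on vertex set $[n]$ with exactly $m$ edges. The $k$-core $F^{(k)}$ of a graph $F$ is its unique maximal (possibly empty) subgraph of minimum degree at least $k$. $\log$ is the natural logarithm. -}

module Defs where

open import Data.Bool using (Bool; true; false; _∧_; _∨_; not; if_then_else_)
open import Data.Nat using (ℕ; zero; suc; _+_; _*_; _∸_; _^_; _≤_; _≤ᵇ_; _/_)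
open import Data.Nat using (_!)
open import Data.Bool.ListAction using (any; all)
open import Data.Fin using (Fin; toℕ)
open import Data.Fin.Properties using (_≟_)
open import Data.List using (List; []; _∷_; map; concatMap; filterᵇ; length; allFin; _++_)
open import Data.Product using (_×_; _,_; proj₁; proj₂)
open import Relation.Nullary.Decidable using (⌊_⌋)

_==_ : ∀ {n} → Fin n → Fin n → Bool
a == b = ⌊ a ≟ b ⌋

-- All subsequences (sub-lists) of a list; on a duplicate-free list these are
-- exactly the subsets, each listed once.
sublists : ∀ {A : Set} → List A → List (List A)
sublists [] = [] ∷ []
sublists (x ∷ xs) = let r = sublists xs in map (x ∷_) r ++ r

memV : ∀ {n} → Fin n → List (Fin n) → Bool
memV v U = any (v ==_) U

-- A simple graph on vertex set [n] = Fin n is given by its edge set: a list of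
-- unordered pairs, each pair {i,j} (i < j) encoded as (i , j).
Edge : ℕ → Set
Edge n = Fin n × Fin n

allPairs : (n : ℕ) → List (Edge n)
allPairs n = concatMap (λ i → map (i ,_) (filterᵇ (λ j → suc (toℕ i) ≤ᵇ toℕ j) (allFin n))) (allFin n)

memE : ∀ {n} → Edge n → List (Edge n) → Bool
memE (a , b) E = any (λ e → (proj₁ e == a) ∧ (proj₂ e == b)) E

adj : ∀ {n} → List (Edge n) → Fin n → Fin n → Bool
adj E u v = any (λ e → ((proj₁ e == u) ∧ (proj₂ e == v)) ∨ ((proj₁ e == v) ∧ (proj₂ e == u))) E

-- Graphs on [n] with exactly m edges (the support of G(n,m), each listed once).
graphsWith : (n m : ℕ) → List (List (Edge n))
graphsWith n m = filterᵇ (λ E → length E Data.Nat.≡ᵇ m) (sublists (allPairs n))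

addSets : ∀ {n} → List (Edge n) → ℕ → List (List (Edge n))
addSets {n} H t = filterᵇ (λ S → length S Data.Nat.≡ᵇ t) (sublists (filterᵇ (λ e → not (memE e H)) (allPairs n)))

degIn : ∀ {n} → List (Edge n) → List (Fin n) → Fin n → ℕ
degIn E U u = length (filterᵇ (adj E u) U)

minDegAtLeast : ∀ {n} → ℕ → List (Edge n) → List (Fin n) → Bool
minDegAtLeast k E U = all (λ u → k ≤ᵇ degIn E U u) U

-- Vertex set of the k-core: the union of all vertex sets U whose induced
-- subgraph has minimum degree ≥ k (this union is the vertex set of the unique
-- maximal subgraph of minimum degree ≥ k). The k-core itself is the subgraph
-- induced on this vertex set.
coreV : ∀ n → ℕ → List (Edge n) → List (Fin n)
coreV n k E = filterᵇ (λ v → any (λ U → minDegAtLeast k E U ∧ memV v U) (sublists (allFin n))) (allFin n)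

insertions : ∀ {A : Set} → A → List A → List (List A)
insertions x [] = (x ∷ []) ∷ []
insertions x (y ∷ ys) = (x ∷ y ∷ ys) ∷ map (y ∷_) (insertions x ys)

perms : ∀ {A : Set} → List A → List (List A)
perms [] = [] ∷ []
perms (x ∷ xs) = concatMap (insertions x) (perms xs)

pathAdj : ∀ {n} → List (Edge n) → List (Fin n) → Bool
pathAdj E [] = true
pathAdj E (x ∷ []) = true
pathAdj E (x ∷ y ∷ ys) = adj E x y ∧ pathAdj E (y ∷ ys)

lastOr : ∀ {n} → Fin n → List (Fin n) → Fin n
lastOr d [] = d
lastOr d (x ∷ xs) = lastOr x xs

isCycleOrder : ∀ {n} → List (Edge n) → List (Fin n) → Bool
isCycleOrder E [] = false
isCycleOrder E (x ∷ xs) = pathAdj E (x ∷ xs) ∧ adj E (lastOr x xs) x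

hamiltonian : ∀ {n} → List (Edge n) → List (Fin n) → Bool
hamiltonian E C = (3 ≤ᵇ length C) ∧ any (isCycleOrder E) (perms C)

connected : ∀ {n} → List (Edge n) → List (Fin n) → Bool
connected E [] = false
connected E C@(_ ∷ _) =
  all (λ U → ((length U Data.Nat.≡ᵇ 0) ∨ (length U Data.Nat.≡ᵇ length C))
             ∨ any (λ u → any (λ w → not (memV w U) ∧ adj E u w) C) U)
      (sublists C)

event : ∀ n → ℕ → List (Edge n) × List (Edge n) → Bool
event n k (H , S) =
  hamiltonian H (coreV n k H)
  ∧ connected (H ++ S) (coreV n k (H ++ S))
  ∧ not (hamiltonian (H ++ S) (coreV n k (H ++ S)))

-- Joint sample space: pairs (H , S) with H ∈ G(n,m) and S a set of ⌊n/8⌋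
-- non-edges of H. The uniform measure on this list is exactly the law of
-- (H , S) (every H has the same number of choices for S).
samples : (n m : ℕ) → List (List (Edge n) × List (Edge n))
samples n m = concatMap (λ H → map (H ,_) (addSets H (n / 8))) (graphsWith n m)

favourable : (n m k : ℕ) → ℕ
favourable n m k = length (filterᵇ (event n k) (samples n m))

-- expPart m J = J! · Σ_{j=0}^{J} m^j / j!   (an integer).
expPart : ℕ → ℕ → ℕ
expPart m zero = 1
expPart m (suc J) = suc J * expPart m J + m ^ suc J

-- m ≤ n log n  ⇔  e^m ≤ n^n  ⇔  every partial sum Σ_{j≤J} m^j/j! ≤ n^n.
LeNLogN : ℕ → ℕ → Set
LeNLogN m n = ∀ J → expPart m J ≤ (n ^ n) * (J !)

-- Let K₀ be the core of H. Adding to H the new edges that are not inside K₀ already produces the core K of G, and the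
-- remaining new edges S₂ are then a uniform set of pairs inside K₀ (grouped by size). Outside exponentially or polynomially
-- unlikely events, |V ∖ K₀| ≤ z for some small z, and every set U of at most 6n/25 vertices of K has more than 2|U|
-- neighbours in K ∖ U: for |U| ≤ z because U ∪ N(U) would be too dense, for larger U because H has no large empty
-- bipartite subgraphs. By Pósa's rotations a non-Hamiltonian graph on K containing these edges has a constant proportion
-- of boosters inside K₀, pairs whose addition lengthens a longest path or closes a Hamilton cycle. The Hamilton cycle
-- of K₀ leaves a deficit of at most z, so the potential 2^deficit starts below 2^z; each edge of S₂ multiplies its mean
-- by at most 39/40, and n/8 such edges beat 2^z.
--
-- Probabilities are computed by comparing uniform m-subsets with the product measure of density m/N, at the cost of a
-- factor N + 1 because m is the mode of the binomial distribution.

module Submission where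


open import Defs
open import Data.Bool using (Bool; true; false; _∧_; _∨_; not; if_then_else_)
open import Data.Bool.ListAction using (any; all)
open import Data.Nat using (ℕ; zero; suc; _+_; _*_; _∸_; _^_; _≤_; _<_; z≤n; s≤s; _≤ᵇ_; _≡ᵇ_; _≤?_; NonZero; _/_; _!)
import Data.Nat.DivMod
open import Data.Nat.Properties
open import Algebra.Properties.CommutativeSemigroup +-commutativeSemigroup using () renaming (interchange to +-interchange)
open import Algebra.Properties.CommutativeSemigroup *-commutativeSemigroup using () renaming (interchange to *-interchange)
open import Data.Fin using (Fin; toℕ)
open import Data.Fin.Properties using (toℕ-injective) renaming (_≟_ to _≟F_)
open import Data.List using (List; []; _∷_; map; concatMap; filterᵇ; length; allFin; upTo; _++_; _ʳ++_)
open import Data.List.Properties using (length-++; length-map; length-upTo; length-tabulate)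
open import Data.List.Membership.Propositional using (_∈_; _∉_; find; lose)
open import Data.List.Membership.Propositional.Properties using (∈-∃++; ∈-++⁺ˡ; ∈-++⁺ʳ; ∈-++⁻; ∈-map⁺; ∈-map⁻; ∈-concatMap⁺; ∈-concatMap⁻; ∈-allFin; ∈-upTo⁺; ∈-upTo⁻)
open import Data.List.Relation.Unary.Any using (here; there)
open import Data.List.Relation.Unary.All using ([]; _∷_) renaming (tabulate to tabAll; lookup to lookupAll)
open import Data.List.Relation.Unary.AllPairs using ([]; _∷_)
open import Data.List.Relation.Unary.Unique.Propositional using (Unique)
import Data.List.Relation.Unary.Unique.Propositional.Properties as Uniqueₚ
open import Data.List.Relation.Binary.Permutation.Propositional using (_↭_; ↭-sym; ↭-trans; prep; swap; ↭-reflexive) renaming (refl to ↭refl; trans to ↭trans)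
open import Data.List.Relation.Binary.Permutation.Propositional.Properties using (shift; ∈-resp-↭; ↭-length; drop-∷; ++↭ʳ++; ↭-empty-inv; All-resp-↭) renaming (++-comm to ↭-++-comm)
open import Data.Nat.Tactic.RingSolver using (solve-∀)
open import Data.Product using (Σ; ∃; _×_; _,_; proj₁; proj₂)
open import Data.Sum using (_⊎_; inj₁; inj₂)
open import Data.Empty using (⊥; ⊥-elim)
open import Function using (_∘_; id; case_of_)
open import Relation.Binary.Definitions using (tri<; tri≈; tri>)
open import Relation.Nullary using (¬_; Dec; yes; no)
open import Relation.Binary.PropositionalEquality using (_≡_; _≢_; refl; sym; trans; cong; cong₂; subst; subst₂; module ≡-Reasoning)

-- The core of `G` depends on the random edges, so no union bound can run over subsets of it. The
-- bad events therefore range over all pairs `U`, `X` of vertex sets: sparse cuts and closed pairs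
-- concern `H` alone, dense pairs `H ++ S`, and the at most `z` vertices missing from the core are
-- put into `X`. The scale is `D = ⌊m/n⌋ ≥ k + 2 ≥ 17`. Sparse cuts must beat the `(3n/z)^z` choices
-- of a set; dense pairs need a large tilt `lam` with `lam² u D ≈ 4n`. The choice `z ≈ 16n/D³`
-- serves both. Degree `15` gives `lam^15` per vertex of `U`; at most about `lam^9` pays for
-- choosing `U` and `X`, and `lam^6` is gained. Sets of fewer than five vertices cannot be dense,
-- and at `u = 5` the gain is `n^15` up to logarithms, against losses of order `n^8`: `n^3` from the
-- claim, the rest from the two modes and the sum over sizes. `ℓ ≈ 6n/25` is large enough for one
-- pair in twenty to be a booster, and small enough that the roughly `u (n - 3u)` forbidden pairs
-- beat all `4^n` choices of two sets. All estimates live in the natural numbers: exponential decay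
-- appears as powers of `h/(h+1)`, obtained from Bernoulli's inequality.

private variable
  A B : Set

-- Sums, products and Boolean lists

𝟙 : Bool → ℕ
𝟙 true = 1
𝟙 false = 0

𝟙≤1 : ∀ b → 𝟙 b ≤ 1
𝟙≤1 true = ≤-refl
𝟙≤1 false = z≤n

∑ : List A → (A → ℕ) → ℕ
∑ [] f = 0
∑ (x ∷ xs) f = f x + ∑ xs f

∏ : List A → (A → ℕ) → ℕ
∏ [] f = 1
∏ (x ∷ xs) f = f x * ∏ xs f

∑-mono∈ : ∀ (L : List A) {f g} → (∀ x → x ∈ L → f x ≤ g x) → ∑ L f ≤ ∑ L g
∑-mono∈ [] h = z≤n
∑-mono∈ (x ∷ L) h = +-mono-≤ (h x (here refl)) (∑-mono∈ L (λ y y∈ → h y (there y∈)))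

∑-mono : ∀ (L : List A) {f g} → (∀ x → f x ≤ g x) → ∑ L f ≤ ∑ L g
∑-mono L h = ∑-mono∈ L (λ x _ → h x)

∑-cong∈ : ∀ (L : List A) {f g} → (∀ x → x ∈ L → f x ≡ g x) → ∑ L f ≡ ∑ L g
∑-cong∈ [] h = refl
∑-cong∈ (x ∷ L) h = cong₂ _+_ (h x (here refl)) (∑-cong∈ L (λ y y∈ → h y (there y∈)))

∑-cong : ∀ (L : List A) {f g} → (∀ x → f x ≡ g x) → ∑ L f ≡ ∑ L g
∑-cong L h = ∑-cong∈ L (λ x _ → h x)

∑-++ : ∀ (L M : List A) f → ∑ (L ++ M) f ≡ ∑ L f + ∑ M f
∑-++ [] M f = refl
∑-++ (x ∷ L) M f = trans (cong (f x +_) (∑-++ L M f)) (sym (+-assoc (f x) _ _))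

∑-map : ∀ (h : A → B) L f → ∑ (map h L) f ≡ ∑ L (f ∘ h)
∑-map h [] f = refl
∑-map h (x ∷ L) f = cong (f (h x) +_) (∑-map h L f)

∑-concatMap : ∀ (h : A → List B) L f → ∑ (concatMap h L) f ≡ ∑ L (λ x → ∑ (h x) f)
∑-concatMap h [] f = refl
∑-concatMap h (x ∷ L) f = trans (∑-++ (h x) (concatMap h L) f) (cong (∑ (h x) f +_) (∑-concatMap h L f))

∑-filter : ∀ (p : A → Bool) L f → ∑ (filterᵇ p L) f ≡ ∑ L (λ x → 𝟙 (p x) * f x)
∑-filter p [] f = refl
∑-filter p (x ∷ L) f with p x
... | true = cong₂ _+_ (sym (+-identityʳ (f x))) (∑-filter p L f)
... | false = ∑-filter p L f

∑-+ : ∀ (L : List A) f g → ∑ L (λ x → f x + g x) ≡ ∑ L f + ∑ L g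
∑-+ [] f g = refl
∑-+ (x ∷ L) f g = trans (cong (f x + g x +_) (∑-+ L f g)) (+-interchange (f x) (g x) _ _)

∑-*ˡ : ∀ c (L : List A) f → ∑ L (λ x → c * f x) ≡ c * ∑ L f
∑-*ˡ c [] f = sym (*-zeroʳ c)
∑-*ˡ c (x ∷ L) f = trans (cong (c * f x +_) (∑-*ˡ c L f)) (sym (*-distribˡ-+ c (f x) _))

∑-*ʳ : ∀ c (L : List A) f → ∑ L (λ x → f x * c) ≡ ∑ L f * c
∑-*ʳ c L f = trans (∑-cong L (λ x → *-comm (f x) c)) (trans (∑-*ˡ c L f) (*-comm c _))

∑-0 : ∀ (L : List A) → ∑ L (λ _ → 0) ≡ 0
∑-0 [] = refl
∑-0 (x ∷ L) = ∑-0 L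

∑-const : ∀ (L : List A) c → ∑ L (λ _ → c) ≡ length L * c
∑-const [] c = refl
∑-const (x ∷ L) c = cong (c +_) (∑-const L c)

∑-swap : ∀ (L : List A) (M : List B) (f : A → B → ℕ) → ∑ L (λ x → ∑ M (f x)) ≡ ∑ M (λ y → ∑ L (λ x → f x y))
∑-swap [] M f = sym (∑-0 M)
∑-swap (x ∷ L) M f = trans (cong (∑ M (f x) +_) (∑-swap L M f)) (sym (∑-+ M (f x) _))

length-∑ : ∀ (L : List A) → length L ≡ ∑ L (λ _ → 1)
length-∑ L = sym (trans (∑-const L 1) (*-identityʳ _))

length-filter-∑ : ∀ (p : A → Bool) L → length (filterᵇ p L) ≡ ∑ L (𝟙 ∘ p)
length-filter-∑ p L = trans (length-∑ (filterᵇ p L)) (trans (∑-filter p L _) (∑-cong L (λ x → *-identityʳ _)))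

∈⇒≤∑ : ∀ {L : List A} {x} f → x ∈ L → f x ≤ ∑ L f
∈⇒≤∑ f (here refl) = m≤m+n _ _
∈⇒≤∑ {L = y ∷ L} f (there x∈) = ≤-trans (∈⇒≤∑ f x∈) (m≤n+m _ (f y))

∑-↭ : ∀ {L M : List A} f → L ↭ M → ∑ L f ≡ ∑ M f
∑-↭ f ↭refl = refl
∑-↭ f (prep x p) = cong (f x +_) (∑-↭ f p)
∑-↭ {M = _ ∷ _ ∷ M} f (swap x y p) = trans (cong (λ s → f x + (f y + s)) (∑-↭ f p))
  (trans (sym (+-assoc (f x) (f y) _)) (trans (cong (_+ ∑ M f) (+-comm (f x) (f y))) (+-assoc (f y) (f x) _)))
∑-↭ f (↭trans p q) = trans (∑-↭ f p) (∑-↭ f q)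

∈-unshift : ∀ {x z : A} as bs → z ≢ x → z ∈ as ++ x ∷ bs → z ∈ as ++ bs
∈-unshift as bs z≢x z∈ with ∈-++⁻ as z∈
... | inj₁ p = ∈-++⁺ˡ p
... | inj₂ (here e) = ⊥-elim (z≢x e)
... | inj₂ (there p) = ∈-++⁺ʳ as p

∑-unique-⊆ : ∀ {xs ys : List A} f → Unique xs → (∀ {x} → x ∈ xs → x ∈ ys) → ∑ xs f ≤ ∑ ys f
∑-unique-⊆ {xs = []} f u h = z≤n
∑-unique-⊆ {xs = x ∷ xs} f (x∉ ∷ u) h with ∈-∃++ (h (here refl))
... | as , bs , refl = ≤-trans
  (+-monoʳ-≤ (f x) (∑-unique-⊆ {ys = as ++ bs} f u (λ {z} z∈ → ∈-unshift as bs (λ e → lookupAll x∉ z∈ (sym e)) (h (there z∈)))))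
  (≤-reflexive (sym (∑-↭ f (shift x as bs))))

unique-⊆-length : ∀ {xs ys : List A} → Unique xs → (∀ {x} → x ∈ xs → x ∈ ys) → length xs ≤ length ys
unique-⊆-length {xs = xs} {ys} u h = subst₂ _≤_ (sym (length-∑ xs)) (sym (length-∑ ys)) (∑-unique-⊆ _ u h)

unique-⊆-↭ : ∀ {xs ys : List A} → Unique xs → (∀ {x} → x ∈ xs → x ∈ ys) → length ys ≤ length xs → xs ↭ ys
unique-⊆-↭ {xs = []} {[]} u h le = ↭refl
unique-⊆-↭ {xs = x ∷ xs} (x∉ ∷ u) h le with ∈-∃++ (h (here refl))
... | as , bs , refl = ↭-trans (prep x (unique-⊆-↭ {ys = as ++ bs} u
    (λ {z} z∈ → ∈-unshift as bs (λ e → lookupAll x∉ z∈ (sym e)) (h (there z∈)))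
    (≤-pred (subst (_≤ _) (↭-length (shift x as bs)) le)))) (↭-sym (shift x as bs))

∏-mono∈ : ∀ (L : List A) {f g} → (∀ x → x ∈ L → f x ≤ g x) → ∏ L f ≤ ∏ L g
∏-mono∈ [] h = ≤-refl
∏-mono∈ (x ∷ L) h = *-mono-≤ (h x (here refl)) (∏-mono∈ L (λ y y∈ → h y (there y∈)))

∏-cong : ∀ (L : List A) {f g} → (∀ x → f x ≡ g x) → ∏ L f ≡ ∏ L g
∏-cong [] h = refl
∏-cong (x ∷ L) h = cong₂ _*_ (h x) (∏-cong L h)

∏-const : ∀ (L : List A) c → ∏ L (λ _ → c) ≡ c ^ length L
∏-const [] c = refl
∏-const (x ∷ L) c = cong (c *_) (∏-const L c)

∏-++ : ∀ (L M : List A) f → ∏ (L ++ M) f ≡ ∏ L f * ∏ M f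
∏-++ [] M f = sym (+-identityʳ _)
∏-++ (x ∷ L) M f = trans (cong (f x *_) (∏-++ L M f)) (sym (*-assoc (f x) _ _))

∏-* : ∀ (L : List A) f g → ∏ L (λ x → f x * g x) ≡ ∏ L f * ∏ L g
∏-* [] f g = refl
∏-* (x ∷ L) f g = trans (cong (f x * g x *_) (∏-* L f g)) (*-interchange (f x) (g x) _ _)

∏-^ : ∀ b (L : List A) c → ∏ L (λ x → b ^ c x) ≡ b ^ ∑ L c
∏-^ b [] c = refl
∏-^ b (x ∷ L) c = trans (cong (b ^ c x *_) (∏-^ b L c)) (sym (^-distribˡ-+-* b (c x) _))

∏-if : ∀ (p : A → Bool) L a b → ∏ L (λ x → if p x then a else b) ≡ a ^ ∑ L (𝟙 ∘ p) * b ^ ∑ L (𝟙 ∘ not ∘ p)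
∏-if p [] a b = refl
∏-if p (x ∷ L) a b with p x | ∏-if p L a b
... | true | ih = trans (cong (a *_) ih) (sym (*-assoc a _ _))
... | false | ih = trans (cong (b *_) ih) (x∙yz b (a ^ ∑ L (𝟙 ∘ p)) _)
  where
  x∙yz : ∀ x y z → x * (y * z) ≡ y * (x * z)
  x∙yz x y z = trans (sym (*-assoc x y z)) (trans (cong (_* z) (*-comm x y)) (*-assoc y x z))

∑-not : ∀ (p : A → Bool) L → ∑ L (𝟙 ∘ p) + ∑ L (𝟙 ∘ not ∘ p) ≡ length L
∑-not p L = trans (sym (∑-+ L _ _)) (trans (∑-cong L (λ x → h (p x))) (sym (length-∑ L)))
  where
  h : ∀ b → 𝟙 b + 𝟙 (not b) ≡ 1
  h true = refl
  h false = refl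

∧-true : ∀ {a b} → a ∧ b ≡ true → a ≡ true × b ≡ true
∧-true {true} {true} e = refl , refl

∧-intro : ∀ {a b} → a ≡ true → b ≡ true → a ∧ b ≡ true
∧-intro refl refl = refl

∨-true : ∀ {a b} → a ∨ b ≡ true → a ≡ true ⊎ b ≡ true
∨-true {true} e = inj₁ refl
∨-true {false} e = inj₂ e

∨-introˡ : ∀ {a b} → a ≡ true → a ∨ b ≡ true
∨-introˡ refl = refl

∨-introʳ : ∀ {a b} → b ≡ true → a ∨ b ≡ true
∨-introʳ {true} refl = refl
∨-introʳ {false} refl = refl

not-true : ∀ {a} → not a ≡ true → a ≢ true
not-true {false} e ()

not-intro : ∀ {a} → a ≢ true → not a ≡ true
not-intro {true} h = ⊥-elim (h refl)
not-intro {false} h = refl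

true? : ∀ b → Dec (b ≡ true)
true? true = yes refl
true? false = no (λ ())

≢true : ∀ {a} → a ≢ true → a ≡ false
≢true {true} h = ⊥-elim (h refl)
≢true {false} h = refl

⇔-≡ : ∀ {a b} → (a ≡ true → b ≡ true) → (b ≡ true → a ≡ true) → a ≡ b
⇔-≡ {true} {b} f g = sym (f refl)
⇔-≡ {false} {true} f g = g refl
⇔-≡ {false} {false} f g = refl

𝟙-mono : ∀ {a b} → (a ≡ true → b ≡ true) → 𝟙 a ≤ 𝟙 b
𝟙-mono {true} h rewrite h refl = ≤-refl
𝟙-mono {false} h = z≤n

𝟙-≤ : ∀ b {c} → (b ≡ true → 1 ≤ c) → 𝟙 b ≤ c
𝟙-≤ true h = h refl
𝟙-≤ false h = z≤n

𝟙-true : ∀ {b} → b ≡ true → 1 ≤ 𝟙 b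
𝟙-true refl = ≤-refl

dec : ∀ {P C : Set} → Dec P → (P → C) → (¬ P → C) → C
dec (yes p) f g = f p
dec (no ¬p) f g = g ¬p

≤ᵇ-true : ∀ {m n} → (m ≤ᵇ n) ≡ true → m ≤ n
≤ᵇ-true {m} {n} e = ≤ᵇ⇒≤ m n (subst Data.Bool.T (sym e) _)

≤ᵇ-intro : ∀ {m n} → m ≤ n → (m ≤ᵇ n) ≡ true
≤ᵇ-intro {m} {n} h with m ≤ᵇ n | ≤⇒≤ᵇ h
... | true | _ = refl

≡ᵇ-true : ∀ {m n} → (m ≡ᵇ n) ≡ true → m ≡ n
≡ᵇ-true {m} {n} e = ≡ᵇ⇒≡ m n (subst Data.Bool.T (sym e) _)

≡ᵇ-intro : ∀ {m n} → m ≡ n → (m ≡ᵇ n) ≡ true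
≡ᵇ-intro {m} {n} h with m ≡ᵇ n | ≡⇒≡ᵇ m n h
... | true | _ = refl

any-true : ∀ {p : A → Bool} L → any p L ≡ true → ∃ λ x → x ∈ L × p x ≡ true
any-true (x ∷ L) e with ∨-true e
... | inj₁ px = x , here refl , px
... | inj₂ e' with any-true L e'
... | y , y∈ , py = y , there y∈ , py

any-intro : ∀ {p : A → Bool} {L x} → x ∈ L → p x ≡ true → any p L ≡ true
any-intro (here refl) px = ∨-introˡ px
any-intro {p = p} {L = y ∷ L} (there x∈) px = ∨-introʳ {p y} (any-intro x∈ px)

all-true : ∀ {p : A → Bool} {L x} → all p L ≡ true → x ∈ L → p x ≡ true
all-true e (here refl) = proj₁ (∧-true e)
all-true {p = p} {L = y ∷ L} e (there x∈) = all-true (proj₂ (∧-true {p y} e)) x∈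

all-intro : ∀ {p : A → Bool} L → (∀ {x} → x ∈ L → p x ≡ true) → all p L ≡ true
all-intro [] h = refl
all-intro {p = p} (x ∷ L) h = ∧-intro (h (here refl)) (all-intro L (h ∘ there))

any-find : ∀ (p : A → Bool) L → (∃ λ x → x ∈ L × p x ≡ true) ⊎ (∀ {x} → x ∈ L → p x ≢ true)
any-find p L with true? (any p L)
... | yes e = inj₁ (any-true L e)
... | no ¬e = inj₂ (λ x∈ px → ¬e (any-intro x∈ px))

∈-filter⁻ : ∀ {p : A → Bool} L {x} → x ∈ filterᵇ p L → x ∈ L × p x ≡ true
∈-filter⁻ {p = p} (y ∷ L) x∈ with p y in eq
∈-filter⁻ (y ∷ L) (here refl) | true = here refl , eq
∈-filter⁻ (y ∷ L) (there x∈) | true = there (proj₁ (∈-filter⁻ L x∈)) , proj₂ (∈-filter⁻ L x∈)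
... | false = there (proj₁ (∈-filter⁻ L x∈)) , proj₂ (∈-filter⁻ L x∈)

∈-filter⁺ : ∀ {p : A → Bool} {L x} → x ∈ L → p x ≡ true → x ∈ filterᵇ p L
∈-filter⁺ {p = p} {y ∷ L} (here refl) px rewrite px = here refl
∈-filter⁺ {p = p} {y ∷ L} (there x∈) px with p y
... | true = there (∈-filter⁺ x∈ px)
... | false = ∈-filter⁺ x∈ px

filter-cong : ∀ {p q : A → Bool} L → (∀ x → p x ≡ q x) → filterᵇ p L ≡ filterᵇ q L
filter-cong [] h = refl
filter-cong {p = p} {q} (x ∷ L) h with p x | q x | h x
... | true | true | _ = cong (x ∷_) (filter-cong L h)
... | false | false | _ = filter-cong L h

unique-filter : ∀ (p : A → Bool) {L} → Unique L → Unique (filterᵇ p L)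
unique-filter p {[]} u = []
unique-filter p {x ∷ L} (x∉ ∷ u) with p x
... | true = tabAll (λ y∈ → lookupAll x∉ (proj₁ (∈-filter⁻ L y∈))) ∷ unique-filter p u
... | false = unique-filter p u

filter-∈-sublists : ∀ (p : A → Bool) L → filterᵇ p L ∈ sublists L
filter-∈-sublists p [] = here refl
filter-∈-sublists p (x ∷ L) with p x
... | true = ∈-++⁺ˡ (∈-map⁺ (x ∷_) (filter-∈-sublists p L))
... | false = ∈-++⁺ʳ (map (x ∷_) (sublists L)) (filter-∈-sublists p L)

sublists-⊆ : ∀ (L : List A) {S x} → S ∈ sublists L → x ∈ S → x ∈ L
sublists-⊆ [] (here refl) ()
sublists-⊆ (y ∷ L) S∈ x∈ with ∈-++⁻ (map (y ∷_) (sublists L)) S∈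
... | inj₂ q = there (sublists-⊆ L q x∈)
... | inj₁ q with ∈-map⁻ (y ∷_) q
sublists-⊆ (y ∷ L) S∈ (here e) | inj₁ q | S' , S'∈ , refl = here e
sublists-⊆ (y ∷ L) S∈ (there x∈) | inj₁ q | S' , S'∈ , refl = there (sublists-⊆ L S'∈ x∈)

sublists-unique : ∀ {L : List A} {S} → Unique L → S ∈ sublists L → Unique S
sublists-unique {L = []} u (here refl) = []
sublists-unique {L = y ∷ L} (y∉ ∷ u) S∈ with ∈-++⁻ (map (y ∷_) (sublists L)) S∈
... | inj₂ q = sublists-unique u q
... | inj₁ q with ∈-map⁻ (y ∷_) q
... | S' , S'∈ , refl = tabAll (λ z∈ → lookupAll y∉ (sublists-⊆ L S'∈ z∈)) ∷ sublists-unique u S'∈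

==-refl : ∀ {n} (a : Fin n) → (a == a) ≡ true
==-refl a with a ≟F a
... | yes _ = refl
... | no ¬p = ⊥-elim (¬p refl)

==-true : ∀ {n} {a b : Fin n} → (a == b) ≡ true → a ≡ b
==-true {a = a} {b} e with a ≟F b
... | yes p = p

memV-true : ∀ {n} {v : Fin n} U → memV v U ≡ true → v ∈ U
memV-true U e with any-true U e
... | x , x∈ , eq with ==-true eq
... | refl = x∈

memV-intro : ∀ {n} {v : Fin n} {U} → v ∈ U → memV v U ≡ true
memV-intro {v = v} v∈ = any-intro v∈ (==-refl v)

memV? : ∀ {n} (v : Fin n) U → Dec (v ∈ U)
memV? v U with true? (memV v U)
... | yes e = yes (memV-true U e)
... | no ¬e = no (λ v∈ → ¬e (memV-intro v∈))

-- Sets of given size and the binomial distribution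

-- `graphsWith n m` and `addSets H t` unfold to `subs m (allPairs n)` and `subs t (nonEdges H)`, so
-- what is proved here applies to the sample space without conversion.
subs : ℕ → List A → List (List A)
subs j L = filterᵇ (λ S → length S ≡ᵇ j) (sublists L)

∑-subs : ∀ j (L : List A) F → ∑ (subs j L) F ≡ ∑ (sublists L) (λ S → 𝟙 (length S ≡ᵇ j) * F S)
∑-subs j L F = ∑-filter _ (sublists L) F

∑-sublists-∷ : ∀ x (L : List A) F → ∑ (sublists (x ∷ L)) F ≡ ∑ (sublists L) (F ∘ (x ∷_)) + ∑ (sublists L) F
∑-sublists-∷ x L F = trans (∑-++ (map (x ∷_) (sublists L)) (sublists L) F) (cong (_+ ∑ (sublists L) F) (∑-map (x ∷_) (sublists L) F))

∑-subs-suc : ∀ j x (L : List A) F → ∑ (subs (suc j) (x ∷ L)) F ≡ ∑ (subs j L) (F ∘ (x ∷_)) + ∑ (subs (suc j) L) F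
∑-subs-suc j x L F = trans (∑-subs (suc j) (x ∷ L) F) (trans (∑-sublists-∷ x L _)
  (sym (cong₂ _+_ (∑-subs j L _) (∑-subs (suc j) L F))))

∑-subs-zero : ∀ x (L : List A) F → ∑ (subs 0 (x ∷ L)) F ≡ ∑ (subs 0 L) F
∑-subs-zero x L F = trans (∑-subs 0 (x ∷ L) F) (trans (∑-sublists-∷ x L _)
  (trans (cong (_+ ∑ (sublists L) (λ S → 𝟙 (length S ≡ᵇ 0) * F S)) (∑-0 (sublists L))) (sym (∑-subs 0 L F))))

binom : ℕ → ℕ → ℕ
binom q zero = 1
binom zero (suc j) = 0
binom (suc q) (suc j) = binom q j + binom q (suc j)

subs-count : ∀ j (L : List A) c → ∑ (subs j L) (λ _ → c) ≡ binom (length L) j * c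
subs-count zero [] c = refl
subs-count (suc j) [] c = refl
subs-count zero (x ∷ L) c = trans (∑-subs-zero x L (λ _ → c)) (subs-count zero L c)
subs-count (suc j) (x ∷ L) c = trans (∑-subs-suc j x L (λ _ → c))
  (trans (cong₂ _+_ (subs-count j L c) (subs-count (suc j) L c)) (sym (*-distribʳ-+ c (binom (length L) j) (binom (length L) (suc j)))))

subs-empty : ∀ j (L : List A) F → length L < j → ∑ (subs j L) F ≡ 0
subs-empty (suc j) [] F h = refl
subs-empty (suc j) (x ∷ L) F (s≤s h) = trans (∑-subs-suc j x L F)
  (cong₂ _+_ (subs-empty j L _ h) (subs-empty (suc j) L F (m<n⇒m<1+n h)))

∈-subs : ∀ {j} {L : List A} {S} → S ∈ subs j L → S ∈ sublists L × length S ≡ j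
∈-subs {L = L} S∈ = proj₁ (∈-filter⁻ (sublists L) S∈) , ≡ᵇ-true (proj₂ (∈-filter⁻ (sublists L) S∈))

-- Expanding the product on the right gives one term `x^|S| y^(N-|S|) ∏ S f` for every sublist `S`
-- of `L`, with `N = length L`; the left side keeps those with `|S| = j`. Sums over uniform random
-- sets pass to independent choices in this way.
subs-∏-bound : ∀ x y (f : A → ℕ) L j l → j + l ≡ length L →
  x ^ j * y ^ l * ∑ (subs j L) (λ S → ∏ S f) ≤ ∏ L (λ e → y + x * f e)
subs-∏-bound x y f [] zero zero e = ≤-refl
subs-∏-bound x y f (e₀ ∷ L) zero (suc l) e = begin
  1 * (y * y ^ l) * ∑ (subs 0 (e₀ ∷ L)) (λ S → ∏ S f)  ≡⟨ cong (1 * (y * y ^ l) *_) (∑-subs-zero e₀ L _) ⟩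
  1 * (y * y ^ l) * ∑ (subs 0 L) (λ S → ∏ S f)         ≡⟨ ring y (y ^ l) (∑ (subs 0 L) (λ S → ∏ S f)) ⟩
  y * (1 * y ^ l * ∑ (subs 0 L) (λ S → ∏ S f))         ≤⟨ *-mono-≤ (m≤m+n y (x * f e₀)) (subs-∏-bound x y f L zero l (suc-injective e)) ⟩
  (y + x * f e₀) * ∏ L (λ e → y + x * f e)             ∎
  where
  open ≤-Reasoning
  ring : ∀ a b c → 1 * (a * b) * c ≡ a * (1 * b * c)
  ring = solve-∀
subs-∏-bound x y f (e₀ ∷ L) (suc j) l e = begin
  x * x ^ j * y ^ l * ∑ (subs (suc j) (e₀ ∷ L)) (λ S → ∏ S f)
    ≡⟨ cong (x * x ^ j * y ^ l *_) (∑-subs-suc j e₀ L _) ⟩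
  x * x ^ j * y ^ l * (∑ (subs j L) (λ S → f e₀ * ∏ S f) + E')
    ≡⟨ cong (λ s → x * x ^ j * y ^ l * (s + E')) (∑-*ˡ (f e₀) (subs j L) _) ⟩
  x * x ^ j * y ^ l * (f e₀ * E + E')
    ≡⟨ ring x (x ^ j) (y ^ l) (f e₀) E E' ⟩
  x * f e₀ * (x ^ j * y ^ l * E) + x * x ^ j * y ^ l * E'
    ≤⟨ +-mono-≤ (*-monoʳ-≤ (x * f e₀) (subs-∏-bound x y f L j l (suc-injective e))) (rest l e) ⟩
  x * f e₀ * P + y * P
    ≡⟨ ring' (x * f e₀) y P ⟩
  (y + x * f e₀) * P  ∎
  where
  open ≤-Reasoning
  E = ∑ (subs j L) (λ S → ∏ S f)
  E' = ∑ (subs (suc j) L) (λ S → ∏ S f)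
  P = ∏ L (λ e → y + x * f e)
  ring : ∀ x a b c d e → x * a * b * (c * d + e) ≡ x * c * (a * b * d) + x * a * b * e
  ring = solve-∀
  ring' : ∀ a b c → a * c + b * c ≡ (b + a) * c
  ring' = solve-∀
  ring'' : ∀ y b c d → b * (y * c) * d ≡ y * (b * c * d)
  ring'' = solve-∀
  rest : ∀ l → suc j + l ≡ suc (length L) → x * x ^ j * y ^ l * E' ≤ y * P
  -- With `l = 0` the tail is shorter than `suc j`: it contributes nothing, and there is no factor
  -- `y` to spend.
  rest zero e = ≤-trans (≤-reflexive (trans (cong (x * x ^ j * 1 *_) (subs-empty (suc j) L _
    (s≤s (≤-reflexive (trans (suc-injective (sym e)) (+-identityʳ j)))))) (*-zeroʳ (x * x ^ j * 1)))) z≤n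
  rest (suc l) e = ≤-trans (≤-reflexive (ring'' y (x * x ^ j) (y ^ l) E'))
    (*-monoʳ-≤ y (subs-∏-bound x y f L (suc j) l (trans (sym (+-suc j l)) (suc-injective e))))

-- Absorption identity with the factor `q - j` split and moved across, so that no truncated
-- subtraction enters the induction.
binom-absorb : ∀ q j → suc j * binom q (suc j) + j * binom q j ≡ q * binom q j
binom-absorb zero zero = refl
binom-absorb zero (suc j) = cong₂ _+_ (*-zeroʳ (suc (suc j))) (*-zeroʳ (suc j))
binom-absorb (suc q) zero = trans (ring (binom q 1)) (cong suc (trans (cong (_+ 0) (sym (+-identityʳ _))) (binom-absorb q zero)))
  where
  ring : ∀ b → 1 * (1 + b) + 0 ≡ suc (b + 0)
  ring = solve-∀
binom-absorb (suc q) (suc i) = trans (ring i (binom q i) (binom q (suc i)) (binom q (suc (suc i))))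
  (trans (cong₂ (λ s t → s + t + (binom q i + binom q (suc i))) (binom-absorb q (suc i)) (binom-absorb q i))
    (ring' q (binom q i) (binom q (suc i))))
  where
  ring : ∀ i a b c → suc (suc i) * (b + c) + suc i * (a + b) ≡ (suc (suc i) * c + suc i * b) + (suc i * b + i * a) + (a + b)
  ring = solve-∀
  ring' : ∀ q a b → q * b + q * a + (a + b) ≡ suc q * (a + b)
  ring' = solve-∀

binom-step : ∀ j i → suc j * binom (j + i) (suc j) ≡ i * binom (j + i) j
binom-step j i = +-cancelʳ-≡ (j * binom (j + i) j) _ _ (trans (binom-absorb (j + i) j)
  (trans (*-distribʳ-+ (binom (j + i) j) j i) (+-comm (j * binom (j + i) j) _)))

length-∈-sublists : ∀ (L : List A) {S} → S ∈ sublists L → length S ≤ length L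
length-∈-sublists [] (here refl) = z≤n
length-∈-sublists (x ∷ L) S∈ with ∈-++⁻ (map (x ∷_) (sublists L)) S∈
... | inj₂ q = m≤n⇒m≤1+n (length-∈-sublists L q)
... | inj₁ q with ∈-map⁻ (x ∷_) q
... | S' , S'∈ , refl = s≤s (length-∈-sublists L S'∈)

∑-sublists-power : ∀ x y (L : List A) → ∑ (sublists L) (λ S → x ^ length S * y ^ (length L ∸ length S)) ≡ (x + y) ^ length L
∑-sublists-power x y [] = refl
∑-sublists-power x y (e ∷ L) = trans (∑-sublists-∷ e L _) (trans (cong₂ _+_
    (trans (∑-cong (sublists L) (λ S → *-assoc x _ _)) (trans (∑-*ˡ x (sublists L) _) (cong (x *_) (∑-sublists-power x y L))))
    (trans (∑-cong∈ (sublists L) (λ S S∈ → trans (cong (λ s → x ^ length S * y ^ s) (+-∸-assoc 1 (length-∈-sublists L S∈)))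
        (ring (x ^ length S) y (y ^ (length L ∸ length S)))))
      (trans (∑-*ˡ y (sublists L) _) (cong (y *_) (∑-sublists-power x y L)))))
  (sym (*-distribʳ-+ _ x y)))
  where
  ring : ∀ a b c → a * (b * c) ≡ b * (a * c)
  ring = solve-∀

∑-by-length : ∀ (φ : ℕ → ℕ) (L : List A) (w : List A → ℕ) →
  ∑ (sublists L) (λ S → φ (length S) * w S) ≤ ∑ (upTo (suc (length L))) (λ j → φ j * ∑ (subs j L) w)
∑-by-length φ L w = begin
  ∑ (sublists L) (λ S → φ (length S) * w S)
    ≤⟨ ∑-mono∈ (sublists L) (λ S S∈ → ≤-trans (≤-reflexive (h S)) (∈⇒≤∑ (λ j → φ j * (𝟙 (length S ≡ᵇ j) * w S)) (∈-upTo⁺ (s≤s (length-∈-sublists L S∈))))) ⟩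
  ∑ (sublists L) (λ S → ∑ (upTo (suc (length L))) (λ j → φ j * (𝟙 (length S ≡ᵇ j) * w S)))
    ≡⟨ ∑-swap (sublists L) (upTo (suc (length L))) _ ⟩
  ∑ (upTo (suc (length L))) (λ j → ∑ (sublists L) (λ S → φ j * (𝟙 (length S ≡ᵇ j) * w S)))
    ≡⟨ ∑-cong (upTo (suc (length L))) (λ j → trans (∑-*ˡ (φ j) (sublists L) _) (cong (φ j *_) (sym (∑-subs j L w)))) ⟩
  ∑ (upTo (suc (length L))) (λ j → φ j * ∑ (subs j L) w)  ∎
  where
  open ≤-Reasoning
  h : ∀ S → φ (length S) * w S ≡ φ (length S) * (𝟙 (length S ≡ᵇ length S) * w S)
  h S rewrite ≡ᵇ-intro {length S} refl = cong (φ (length S) *_) (sym (*-identityˡ (w S)))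

-- The binomial distribution with parameters m + l and m / (m + l) has its mode at m.
module Mode (m l : ℕ) where
  N = m + l

  term : ℕ → ℕ → ℕ
  term j i = binom N j * (m ^ j * l ^ i)

  -- Consecutive terms have ratio `(suc i * m) / (suc j * l)`. Below the mode `suc j ≤ m` and hence
  -- `l ≤ suc i`; above it, in `down`, both comparisons are reversed.
  up : ∀ j i → suc j + i ≡ N → suc j ≤ m → term j (suc i) ≤ term (suc j) i
  up j i e h = *-cancelˡ-≤ (suc j) (begin
    suc j * (binom N j * (m ^ j * (l * l ^ i)))        ≡⟨ ring (suc j) (binom N j) (m ^ j) l (l ^ i) ⟩
    suc j * l * (binom N j * m ^ j * l ^ i)            ≤⟨ *-monoˡ-≤ (binom N j * m ^ j * l ^ i) (*-mono-≤ h l≤) ⟩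
    m * suc i * (binom N j * m ^ j * l ^ i)            ≡⟨ ring' m (suc i) (binom N j) (m ^ j) (l ^ i) ⟩
    suc i * binom N j * (m * m ^ j * l ^ i)            ≡⟨ cong (_* (m * m ^ j * l ^ i)) (sym step) ⟩
    suc j * binom N (suc j) * (m * m ^ j * l ^ i)      ≡⟨ *-assoc (suc j) (binom N (suc j)) (m * m ^ j * l ^ i) ⟩
    suc j * (binom N (suc j) * (m * m ^ j * l ^ i))    ∎)
    where
    open ≤-Reasoning
    ring : ∀ s b p l q → s * (b * (p * (l * q))) ≡ s * l * (b * p * q)
    ring = solve-∀
    ring' : ∀ m s b p q → m * s * (b * p * q) ≡ s * b * (m * p * q)
    ring' = solve-∀
    step : suc j * binom N (suc j) ≡ suc i * binom N j
    step = subst (λ N → suc j * binom N (suc j) ≡ suc i * binom N j) (trans (+-suc j i) e) (binom-step j (suc i))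
    l≤ : l ≤ suc i
    l≤ = m≤n⇒m≤1+n (+-cancelˡ-≤ m l i (≤-trans (≤-reflexive (sym e)) (+-monoˡ-≤ i h)))

  down : ∀ j i → suc j + i ≡ N → m ≤ j → term (suc j) i ≤ term j (suc i)
  down j i e h = *-cancelˡ-≤ (suc j) (begin
    suc j * (binom N (suc j) * (m * m ^ j * l ^ i))    ≡⟨ sym (*-assoc (suc j) (binom N (suc j)) (m * m ^ j * l ^ i)) ⟩
    suc j * binom N (suc j) * (m * m ^ j * l ^ i)      ≡⟨ cong (_* (m * m ^ j * l ^ i)) step ⟩
    suc i * binom N j * (m * m ^ j * l ^ i)            ≡⟨ ring' m (suc i) (binom N j) (m ^ j) (l ^ i) ⟩
    m * suc i * (binom N j * m ^ j * l ^ i)            ≤⟨ *-monoˡ-≤ (binom N j * m ^ j * l ^ i) (*-mono-≤ (m≤n⇒m≤1+n h) i≤) ⟩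
    suc j * l * (binom N j * m ^ j * l ^ i)            ≡⟨ ring (suc j) (binom N j) (m ^ j) l (l ^ i) ⟩
    suc j * (binom N j * (m ^ j * (l * l ^ i)))        ∎)
    where
    open ≤-Reasoning
    ring : ∀ s b p l q → s * l * (b * p * q) ≡ s * (b * (p * (l * q)))
    ring = solve-∀
    ring' : ∀ m s b p q → s * b * (m * p * q) ≡ m * s * (b * p * q)
    ring' = solve-∀
    step : suc j * binom N (suc j) ≡ suc i * binom N j
    step = subst (λ N → suc j * binom N (suc j) ≡ suc i * binom N j) (trans (+-suc j i) e) (binom-step j (suc i))
    i≤ : suc i ≤ l
    i≤ = +-cancelˡ-≤ m (suc i) l (≤-trans (+-monoˡ-≤ (suc i) h) (≤-reflexive (trans (+-suc j i) e)))

  up* : ∀ d j → j + d ≡ m → term j (d + l) ≤ term m l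
  up* zero j e rewrite +-identityʳ j | e = ≤-refl
  up* (suc d) j e = ≤-trans (up j (d + l) (trans (sym (+-assoc (suc j) d l)) (cong (_+ l) e')) (subst (suc j ≤_) e' (m≤m+n (suc j) d)))
      (up* d (suc j) e')
    where
    e' : suc j + d ≡ m
    e' = trans (sym (+-suc j d)) e

  down* : ∀ d i → d + i ≡ l → term (m + d) i ≤ term m l
  down* zero i refl rewrite +-identityʳ m = ≤-refl
  down* (suc d) i e = ≤-trans (subst (λ s → term s i ≤ term (m + d) (suc i)) (sym (+-suc m d))
      (down (m + d) i (trans (trans (cong (_+ i) (sym (+-suc m d))) (+-assoc m (suc d) i)) (cong (m +_) e)) (m≤m+n m d)))
      (down* d (suc i) (trans (+-suc d i) e))

  term≤ : ∀ j → j ≤ N → term j (N ∸ j) ≤ term m l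
  term≤ j j≤ with ≤-total j m
  ... | inj₁ j≤m = subst (λ s → term j s ≤ term m l)
          (trans (+-comm (m ∸ j) l) (trans (sym (+-∸-assoc l j≤m)) (cong (_∸ j) (+-comm l m)))) (up* (m ∸ j) j (m+[n∸m]≡n j≤m))
  ... | inj₂ m≤j = subst (λ s → term s (N ∸ j) ≤ term m l) (m+[n∸m]≡n m≤j)
          (down* (j ∸ m) (N ∸ j) (+-cancelˡ-≡ m _ _ (trans (sym (+-assoc m (j ∸ m) _)) (trans (cong (_+ (N ∸ j)) (m+[n∸m]≡n m≤j)) (m+[n∸m]≡n j≤)))))

  mode : ∀ (L : List A) → length L ≡ N → N ^ N ≤ suc N * term m l
  mode L e = begin
    N ^ N ≡⟨ trans (cong (N ^_) (sym e)) (sym (∑-sublists-power m l L)) ⟩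
    ∑ (sublists L) (λ S → m ^ length S * l ^ (length L ∸ length S))
      ≡⟨ ∑-cong (sublists L) (λ S → sym (*-identityʳ _)) ⟩
    ∑ (sublists L) (λ S → m ^ length S * l ^ (length L ∸ length S) * 1)
      ≤⟨ ∑-by-length (λ j → m ^ j * l ^ (length L ∸ j)) L (λ _ → 1) ⟩
    ∑ (upTo (suc (length L))) (λ j → m ^ j * l ^ (length L ∸ j) * ∑ (subs j L) (λ _ → 1))
      ≤⟨ ∑-mono∈ (upTo (suc (length L))) (λ j j∈ → ≤-trans
           (≤-reflexive (trans (cong (m ^ j * l ^ (length L ∸ j) *_) (trans (subs-count j L 1) (*-identityʳ _))) (*-comm (m ^ j * l ^ (length L ∸ j)) (binom (length L) j))))
           (subst (λ q → j ≤ q → binom q j * (m ^ j * l ^ (q ∸ j)) ≤ term m l) (sym e) (term≤ j) (≤-pred (∈-upTo⁻ j∈)))) ⟩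
    ∑ (upTo (suc (length L))) (λ j → term m l)
      ≡⟨ trans (∑-const (upTo (suc (length L))) _) (cong (_* term m l) (trans (length-upTo (suc (length L))) (cong suc e))) ⟩
    suc N * term m l ∎
    where open ≤-Reasoning

-- Double counting over sets

module _ {n : ℕ} where
  eqE : Edge n → Edge n → Bool
  eqE (a , b) (c , d) = (a == c) ∧ (b == d)

  eqE-true : ∀ {e f} → eqE e f ≡ true → e ≡ f
  eqE-true h with ∧-true h
  ... | p , q = cong₂ _,_ (==-true p) (==-true q)

  eqE-refl : ∀ e → eqE e e ≡ true
  eqE-refl (a , b) = ∧-intro (==-refl a) (==-refl b)

  memE-true : ∀ {e} S → memE e S ≡ true → e ∈ S
  memE-true {e} S h with any-true S h
  ... | x , x∈ , q with eqE-true {x} {e} q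
  ... | refl = x∈

  memE-intro : ∀ {e} {S} → e ∈ S → memE e S ≡ true
  memE-intro {e} e∈ = any-intro e∈ (eqE-refl e)

  memE-∷ : ∀ {e x} S → x ≢ e → memE e (x ∷ S) ≡ memE e S
  memE-∷ {e} {x} S x≢e = cong (_∨ memE e S) (≢true {eqE x e} (λ q → x≢e (eqE-true q)))

  memE-∷-same : ∀ x S → memE x (x ∷ S) ≡ true
  memE-∷-same x S = memE-intro {x} {x ∷ S} (here refl)

  memE-∉ : ∀ {e S} → e ∉ S → memE e S ≡ false
  memE-∉ {e} {S} e∉ = ≢true (λ h → e∉ (memE-true S h))

  -- Both sides sum w (e ∷ S) over pairs of a set S of size b and an element e outside S.
  subs-double-count : ∀ Q → Unique Q → ∀ b (w : List (Edge n) → ℕ) → (∀ {S T} → S ↭ T → w S ≡ w T) →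
    suc b * ∑ (subs (suc b) Q) w ≡ ∑ (subs b Q) (λ S → ∑ Q (λ e → 𝟙 (not (memE e S)) * w (e ∷ S)))
  subs-double-count [] u zero w wi = refl
  subs-double-count [] u (suc b) w wi = *-zeroʳ (suc (suc b))
  subs-double-count (x ∷ Q) (x∉ ∷ u) b w wi = begin
    suc b * ∑ (subs (suc b) (x ∷ Q)) w
      ≡⟨ cong (suc b *_) (∑-subs-suc b x Q w) ⟩
    suc b * (∑ (subs b Q) (w ∘ (x ∷_)) + ∑ (subs (suc b) Q) w)
      ≡⟨ *-distribˡ-+ (suc b) (∑ (subs b Q) (w ∘ (x ∷_))) _ ⟩
    ∑ (subs b Q) (w ∘ (x ∷_)) + b * ∑ (subs b Q) (w ∘ (x ∷_)) + suc b * ∑ (subs (suc b) Q) w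
      ≡⟨ cong₂ (λ s t → ∑ (subs b Q) (w ∘ (x ∷_)) + s + t) (inner b) (subs-double-count Q u b w wi) ⟩
    ∑ (subs b Q) (w ∘ (x ∷_)) + in' b + ∑ (subs b Q) (λ S → ∑ Q (g S))
      ≡⟨ ring (∑ (subs b Q) (w ∘ (x ∷_))) (in' b) _ ⟩
    in' b + (∑ (subs b Q) (w ∘ (x ∷_)) + ∑ (subs b Q) (λ S → ∑ Q (g S)))
      ≡⟨ cong (in' b +_) (sym (trans (∑-cong∈ (subs b Q) out) (∑-+ (subs b Q) (w ∘ (x ∷_)) _))) ⟩
    in' b + ∑ (subs b Q) F
      ≡⟨ sym (peel b) ⟩
    ∑ (subs b (x ∷ Q)) F ∎
    where
    open ≡-Reasoning
    g : List (Edge n) → Edge n → ℕ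
    g S e = 𝟙 (not (memE e S)) * w (e ∷ S)
    F : List (Edge n) → ℕ
    F S = ∑ (x ∷ Q) (g S)
    -- The contribution of the sets that contain `x`. It vanishes at `b = 0`, where the recursion of
    -- `subs` has no such branch.
    in' : ℕ → ℕ
    in' zero = 0
    in' (suc c) = ∑ (subs c Q) (λ S → F (x ∷ S))
    peel : ∀ b → ∑ (subs b (x ∷ Q)) F ≡ in' b + ∑ (subs b Q) F
    peel zero = ∑-subs-zero x Q F
    peel (suc c) = ∑-subs-suc c x Q F
    inner : ∀ b → b * ∑ (subs b Q) (w ∘ (x ∷_)) ≡ in' b
    inner zero = refl
    inner (suc c) = trans (subs-double-count Q u c (w ∘ (x ∷_)) (wi ∘ prep x))
      (∑-cong (subs c Q) (λ S → trans (∑-cong∈ Q (λ e e∈ → cong₂ (λ s t → 𝟙 (not s) * t)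
          (sym (memE-∷ S (lookupAll x∉ e∈))) (wi (swap x e ↭refl))))
        (cong (λ s → 𝟙 (not s) * w (x ∷ x ∷ S) + ∑ Q (g (x ∷ S))) (sym (memE-∷-same x S)))))
    out : ∀ S → S ∈ subs b Q → F S ≡ w (x ∷ S) + ∑ Q (g S)
    out S S∈ = cong (_+ ∑ Q (g S)) (trans (cong (λ s → 𝟙 (not s) * w (x ∷ S))
      (memE-∉ (λ x∈ → lookupAll x∉ (sublists-⊆ Q (proj₁ (∈-subs {L = Q} S∈)) x∈) refl))) (+-identityʳ _))
    ring : ∀ a b c → a + b + c ≡ b + (a + c)
    ring = solve-∀

  ∑-∉-sublist : ∀ Q → Unique Q → ∀ {S} → S ∈ sublists Q → ∑ Q (λ e → 𝟙 (not (memE e S))) + length S ≡ length Q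
  ∑-∉-sublist [] u (here refl) = refl
  ∑-∉-sublist (x ∷ Q) (x∉ ∷ u) {S} S∈ with ∈-++⁻ (map (x ∷_) (sublists Q)) S∈
  ... | inj₂ q = trans (cong (λ s → 𝟙 (not s) + ∑ Q (λ e → 𝟙 (not (memE e S))) + length S)
          (memE-∉ (λ x∈ → lookupAll x∉ (sublists-⊆ Q q x∈) refl))) (cong suc (∑-∉-sublist Q u q))
  ... | inj₁ q with ∈-map⁻ (x ∷_) q
  ... | S' , S'∈ , refl = trans (cong₂ (λ s t → 𝟙 (not s) + t + suc (length S')) (memE-∷-same x S')
            (∑-cong∈ Q (λ e e∈ → cong (𝟙 ∘ not) (memE-∷ S' (lookupAll x∉ e∈)))))
          (trans (+-suc _ (length S')) (cong suc (∑-∉-sublist Q u S'∈)))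

  -- The hypothesis says that adding a uniform element outside `S` multiplies `w` by at most `g / h`
  -- on average. The conclusion is what revealing a random `b`-set one element at a time would give;
  -- double counting replaces the orderings.
  subs-level : ∀ h g Q → Unique Q → (w : List (Edge n) → ℕ) → (∀ {S T} → S ↭ T → w S ≡ w T) →
    (∀ {S} → S ∈ sublists Q → h * ∑ Q (λ e → 𝟙 (not (memE e S)) * w (e ∷ S)) ≤ g * (∑ Q (λ e → 𝟙 (not (memE e S))) * w S)) →
    ∀ b → h ^ b * ∑ (subs b Q) w ≤ g ^ b * (binom (length Q) b * w [])
  subs-level h g Q u w wi hyp zero = ≤-reflexive (cong (1 *_) (zeroth Q))
    where
    zeroth : ∀ Q → ∑ (subs 0 Q) w ≡ 1 * w []
    zeroth [] = refl
    zeroth (x ∷ Q) = trans (∑-subs-zero x Q w) (zeroth Q)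
  subs-level h g Q u w wi hyp (suc b) with ≤-<-connex (length Q) b
  ... | inj₁ q≤b = ≤-trans (≤-reflexive (trans (cong (h * h ^ b *_) (subs-empty (suc b) Q w (s≤s q≤b))) (*-zeroʳ (h * h ^ b)))) z≤n
  ... | inj₂ b<q = *-cancelˡ-≤ (suc b) (begin
    suc b * (h * h ^ b * ∑ (subs (suc b) Q) w)
      ≡⟨ ring (suc b) h (h ^ b) _ ⟩
    h ^ b * (h * (suc b * ∑ (subs (suc b) Q) w))
      ≡⟨ cong (λ s → h ^ b * (h * s)) (subs-double-count Q u b w wi) ⟩
    h ^ b * (h * ∑ (subs b Q) (λ S → ∑ Q (λ e → 𝟙 (not (memE e S)) * w (e ∷ S))))
      ≡⟨ cong (h ^ b *_) (sym (∑-*ˡ h (subs b Q) _)) ⟩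
    h ^ b * ∑ (subs b Q) (λ S → h * ∑ Q (λ e → 𝟙 (not (memE e S)) * w (e ∷ S)))
      ≤⟨ *-monoʳ-≤ (h ^ b) (∑-mono∈ (subs b Q) (λ S S∈ → ≤-trans (hyp (proj₁ (∈-subs {L = Q} S∈)))
            (≤-reflexive (trans (cong (λ s → g * (s * w S)) (outside S S∈)) (sym (*-assoc g i (w S))))))) ⟩
    h ^ b * ∑ (subs b Q) (λ S → g * i * w S)
      ≡⟨ trans (cong (h ^ b *_) (∑-*ˡ (g * i) (subs b Q) w)) (ring₂ (h ^ b) (g * i) _) ⟩
    g * i * (h ^ b * ∑ (subs b Q) w)
      ≤⟨ *-monoʳ-≤ (g * i) (subs-level h g Q u w wi hyp b) ⟩
    g * i * (g ^ b * (binom (length Q) b * w []))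
      ≡⟨ ring₃ g i (g ^ b) (binom (length Q) b) (w []) ⟩
    g * g ^ b * (i * binom (length Q) b * w [])
      ≡⟨ cong (λ s → g * g ^ b * (s * w [])) (sym (subst (λ q → suc b * binom q (suc b) ≡ i * binom q b) (m+[n∸m]≡n (<⇒≤ b<q)) (binom-step b i))) ⟩
    g * g ^ b * (suc b * binom (length Q) (suc b) * w [])
      ≡⟨ ring₄ (g * g ^ b) (suc b) (binom (length Q) (suc b)) (w []) ⟩
    suc b * (g * g ^ b * (binom (length Q) (suc b) * w [])) ∎)
    where
    open ≤-Reasoning
    i = length Q ∸ b
    outside : ∀ S → S ∈ subs b Q → ∑ Q (λ e → 𝟙 (not (memE e S))) ≡ i
    outside S S∈ with ∈-subs {L = Q} S∈
    ... | S∈' , refl = trans (sym (m+n∸n≡m _ (length S))) (cong (_∸ length S) (∑-∉-sublist Q u S∈'))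
    ring : ∀ s h a w → s * (h * a * w) ≡ a * (h * (s * w))
    ring = solve-∀
    ring₂ : ∀ a c w → a * (c * w) ≡ c * (a * w)
    ring₂ = solve-∀
    ring₃ : ∀ g i a b w → g * i * (a * (b * w)) ≡ g * a * (i * b * w)
    ring₃ = solve-∀
    ring₄ : ∀ a s b w → a * (s * b * w) ≡ s * (a * (b * w))
    ring₄ = solve-∀

filter-∷-true : ∀ {p : A → Bool} {x} L → p x ≡ true → filterᵇ p (x ∷ L) ≡ x ∷ filterᵇ p L
filter-∷-true L e rewrite e = refl

filter-∷-false : ∀ {p : A → Bool} {x} L → p x ≡ false → filterᵇ p (x ∷ L) ≡ filterᵇ p L
filter-∷-false L e rewrite e = refl

-- A subset of `R` is an independent choice of its parts in the two classes of `p`. This allows the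
-- new edges that leave the core of `H` to be fixed before those inside it.
∑-sublists-split : ∀ (p : A → Bool) R (G : List A → List A → ℕ) →
  ∑ (sublists R) (λ S → G (filterᵇ p S) (filterᵇ (not ∘ p) S)) ≡
  ∑ (sublists (filterᵇ p R)) (λ S → ∑ (sublists (filterᵇ (not ∘ p) R)) (G S))
∑-sublists-split p [] G = cong (_+ 0) (sym (+-identityʳ (G [] [])))
∑-sublists-split p (x ∷ R) G with p x in eq
... | true = trans (∑-sublists-∷ x R _) (trans (cong₂ _+_
    (trans (∑-cong (sublists R) (λ S → cong₂ G (filter-∷-true S eq) (filter-∷-false {p = not ∘ p} S (cong not eq))))
      (∑-sublists-split p R (λ S → G (x ∷ S))))
    (∑-sublists-split p R G)) (sym (∑-sublists-∷ x (filterᵇ p R) _)))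
... | false = trans (∑-sublists-∷ x R _) (trans (cong₂ _+_
    (trans (∑-cong (sublists R) (λ S → cong₂ G (filter-∷-false S eq) (filter-∷-true {p = not ∘ p} S (cong not eq))))
      (∑-sublists-split p R (λ S T → G S (x ∷ T))))
    (∑-sublists-split p R G))
    (trans (sym (∑-+ (sublists (filterᵇ p R)) _ _)) (∑-cong (sublists (filterᵇ p R)) (λ S → sym (∑-sublists-∷ x (filterᵇ (not ∘ p) R) (G S))))))

-- Pairs, degrees and cores

lt : ∀ {n} → Fin n → Fin n → Bool
lt i j = suc (toℕ i) ≤ᵇ toℕ j

∑-delta : ∀ {n} {L : List (Fin n)} → Unique L → ∀ i (f : Fin n → ℕ) → i ∈ L → ∑ L (λ j → 𝟙 (i == j) * f j) ≡ f i
∑-delta {L = x ∷ L} (x∉ ∷ u) i f (here refl) = trans (cong₂ (λ s t → 𝟙 s * f i + t) (==-refl i)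
  (trans (∑-cong∈ L (λ j j∈ → cong (λ s → 𝟙 s * f j) (≢true {i == j} (λ q → lookupAll x∉ j∈ (==-true q))))) (∑-0 L)))
  (trans (+-identityʳ _) (+-identityʳ _))
∑-delta {L = x ∷ L} (x∉ ∷ u) i f (there i∈) = trans (cong (λ s → 𝟙 s * f x + ∑ L (λ j → 𝟙 (i == j) * f j))
  (≢true {i == x} (λ q → lookupAll x∉ i∈ (sym (==-true q))))) (∑-delta u i f i∈)

∑-delta-≤ : ∀ {n} {L : List (Fin n)} → Unique L → ∀ i → ∑ L (λ j → 𝟙 (i == j)) ≤ 𝟙 (memV i L)
∑-delta-≤ {L = L} u i with memV? i L
... | yes i∈ rewrite memV-intro i∈ = ≤-reflexive (trans (∑-cong L (λ j → sym (*-identityʳ _))) (∑-delta u i (λ _ → 1) i∈))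
... | no i∉ = ≤-trans (≤-reflexive (trans (∑-cong∈ L (λ j j∈ → cong 𝟙 (≢true {i == j} (λ q → i∉ (subst (_∈ L) (sym (==-true q)) j∈))))) (∑-0 L))) z≤n

allFin-unique : ∀ n → Unique (allFin n)
allFin-unique = Uniqueₚ.allFin⁺

module _ {n : ℕ} where

  V : List (Fin n)
  V = allFin n

  length-V : length V ≡ n
  length-V = length-tabulate id

  ∑-V-const : ∀ c → ∑ V (λ _ → c) ≡ n * c
  ∑-V-const c = trans (∑-const V c) (cong (λ s → s * c) length-V)

  row : Fin n → List (Edge n)
  row i = map (i ,_) (filterᵇ (lt i) V)

  ∈-row : ∀ {i e} → e ∈ row i → proj₁ e ≡ i × lt i (proj₂ e) ≡ true
  ∈-row e∈ with ∈-map⁻ _ e∈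
  ... | j , j∈ , refl = refl , proj₂ (∈-filter⁻ V j∈)

  rows-∈ : ∀ I {e} → e ∈ concatMap row I → proj₁ e ∈ I × lt (proj₁ e) (proj₂ e) ≡ true
  rows-∈ (i ∷ I) e∈ with ∈-++⁻ (row i) e∈
  ... | inj₁ q with ∈-row {i} q
  ... | refl , l = here refl , l
  rows-∈ (i ∷ I) e∈ | inj₂ q = there (proj₁ (rows-∈ I q)) , proj₂ (rows-∈ I q)

  ∈-allPairs⁻ : ∀ {e} → e ∈ allPairs n → lt (proj₁ e) (proj₂ e) ≡ true
  ∈-allPairs⁻ e∈ = proj₂ (rows-∈ V e∈)

  rows-unique : ∀ {I} → Unique I → Unique (concatMap row I)
  rows-unique [] = []
  rows-unique {i ∷ I} (i∉ ∷ u) = Uniqueₚ.++⁺ (Uniqueₚ.map⁺ (cong proj₂) (unique-filter (lt i) (allFin-unique n))) (rows-unique u)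
    (λ { (p , q) → lookupAll i∉ (proj₁ (rows-∈ I q)) (sym (proj₁ (∈-row {i} p))) })

  allPairs-unique : Unique (allPairs n)
  allPairs-unique = rows-unique (allFin-unique n)

  ∑-allPairs : ∀ g → ∑ (allPairs n) g ≡ ∑ V (λ i → ∑ V (λ j → 𝟙 (lt i j) * g (i , j)))
  ∑-allPairs g = trans (∑-concatMap row V g) (∑-cong V (λ i → trans (∑-map (i ,_) (filterᵇ (lt i) V) g) (∑-filter (lt i) V _)))

  trichotomy : ∀ (i j : Fin n) x → 𝟙 (lt i j) * x + 𝟙 (lt j i) * x + 𝟙 (i == j) * x ≡ x
  trichotomy i j x with <-cmp (toℕ i) (toℕ j)
  ... | tri< a ¬b ¬c
    rewrite ≤ᵇ-intro a | ≢true {lt j i} (λ q → ¬c (≤ᵇ-true q)) | ≢true {i == j} (λ q → ¬b (cong toℕ (==-true q))) = ring x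
    where
    ring : ∀ x → x + 0 + 0 + 0 ≡ x
    ring = solve-∀
  ... | tri> ¬a ¬b c
    rewrite ≤ᵇ-intro c | ≢true {lt i j} (λ q → ¬a (≤ᵇ-true q)) | ≢true {i == j} (λ q → ¬b (cong toℕ (==-true q))) = ring x
    where
    ring : ∀ x → x + 0 + 0 ≡ x
    ring = solve-∀
  ... | tri≈ ¬a b ¬c
    rewrite ≢true {lt i j} (λ q → ¬a (≤ᵇ-true q)) | ≢true {lt j i} (λ q → ¬c (≤ᵇ-true q)) | toℕ-injective b | ==-refl j = +-identityʳ x

  -- Each unordered pair is seen twice by the double sum over V × V.
  ∑-pairs-symmetric : ∀ (g : Fin n → Fin n → ℕ) → (∀ i j → g i j ≡ g j i) →
    ∑ (allPairs n) (λ e → g (proj₁ e) (proj₂ e)) + ∑ (allPairs n) (λ e → g (proj₁ e) (proj₂ e)) + ∑ V (λ i → g i i)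
      ≡ ∑ V (λ i → ∑ V (g i))
  ∑-pairs-symmetric g gs = sym (begin
    ∑ V (λ i → ∑ V (g i))
      ≡⟨ ∑-cong V (λ i → trans (∑-cong V (λ j → sym (trichotomy i j (g i j)))) (trans (∑-+ V _ _) (cong (_+ ∑ V (λ j → 𝟙 (i == j) * g i j)) (∑-+ V _ _)))) ⟩
    ∑ V (λ i → ∑ V (λ j → 𝟙 (lt i j) * g i j) + ∑ V (λ j → 𝟙 (lt j i) * g i j) + ∑ V (λ j → 𝟙 (i == j) * g i j))
      ≡⟨ trans (∑-+ V _ _) (cong₂ _+_ (∑-+ V _ _) (∑-cong V (λ i → ∑-delta (allFin-unique n) i (g i) (∈-allFin i)))) ⟩
    ∑ V (λ i → ∑ V (λ j → 𝟙 (lt i j) * g i j)) + ∑ V (λ i → ∑ V (λ j → 𝟙 (lt j i) * g i j)) + ∑ V (λ i → g i i)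
      ≡⟨ cong₂ (λ s t → s + t + ∑ V (λ i → g i i)) (sym (∑-allPairs (λ e → g (proj₁ e) (proj₂ e))))
           (trans (∑-swap V V _) (trans (∑-cong V (λ j → ∑-cong V (λ i → cong (𝟙 (lt j i) *_) (gs i j)))) (sym (∑-allPairs (λ e → g (proj₁ e) (proj₂ e)))))) ⟩
    ∑ (allPairs n) (λ e → g (proj₁ e) (proj₂ e)) + ∑ (allPairs n) (λ e → g (proj₁ e) (proj₂ e)) + ∑ V (λ i → g i i) ∎)
    where open ≡-Reasoning

  length-allPairs : length (allPairs n) + length (allPairs n) + n ≡ n * n
  length-allPairs = trans (cong₂ (λ s t → s + s + t) (length-∑ (allPairs n)) (trans (sym length-V) (length-∑ V)))
    (trans (∑-pairs-symmetric (λ _ _ → 1) (λ _ _ → refl)) (trans (∑-cong V (λ i → trans (∑-const V 1) (trans (*-identityʳ _) length-V)))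
      (trans (∑-const V n) (cong (_* n) length-V))))

  canon : (Fin n → Bool) → List (Fin n)
  canon p = filterᵇ p V

  canon-∈ : ∀ p → canon p ∈ sublists V
  canon-∈ p = filter-∈-sublists p V

  ∈-canon⁺ : ∀ {p v} → p v ≡ true → v ∈ canon p
  ∈-canon⁺ {p} {v} pv = ∈-filter⁺ (∈-allFin v) pv

  ∈-canon⁻ : ∀ {p v} → v ∈ canon p → p v ≡ true
  ∈-canon⁻ v∈ = proj₂ (∈-filter⁻ V v∈)

  canon-unique : ∀ p → Unique (canon p)
  canon-unique p = unique-filter p (allFin-unique n)

  memV-canon : ∀ p v → memV v (canon p) ≡ p v
  memV-canon p v = ⇔-≡ (λ h → ∈-canon⁻ {p} (memV-true (canon p) h)) (λ h → memV-intro (∈-canon⁺ {p} h))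

  length-canon : ∀ p → length (canon p) ≡ ∑ V (𝟙 ∘ p)
  length-canon p = length-filter-∑ p V

  canon-memV-length : ∀ {U} → Unique U → length (canon (λ x → memV x U)) ≡ length U
  canon-memV-length {U} u = ↭-length (unique-⊆-↭ (canon-unique (λ x → memV x U)) (λ x∈ → memV-true U (∈-canon⁻ {λ x → memV x U} x∈))
    (unique-⊆-length u (λ x∈ → ∈-canon⁺ {λ x → memV x U} (memV-intro x∈))))

  joins : Fin n → Fin n → Edge n → Bool
  joins u v e = ((proj₁ e == u) ∧ (proj₂ e == v)) ∨ ((proj₁ e == v) ∧ (proj₂ e == u))

  joins-true : ∀ {u v e} → joins u v e ≡ true → e ≡ (u , v) ⊎ e ≡ (v , u)
  joins-true {e = a , b} h with ∨-true {(a == _) ∧ (b == _)} h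
  ... | inj₁ q = inj₁ (cong₂ _,_ (==-true (proj₁ (∧-true q))) (==-true (proj₂ (∧-true {a == _} q))))
  ... | inj₂ q = inj₂ (cong₂ _,_ (==-true (proj₁ (∧-true q))) (==-true (proj₂ (∧-true {a == _} q))))

  joins-intro : ∀ u v → joins u v (u , v) ≡ true
  joins-intro u v = ∨-introˡ (∧-intro (==-refl u) (==-refl v))

  joins-introʳ : ∀ u v → joins u v (v , u) ≡ true
  joins-introʳ u v = ∨-introʳ {(v == u) ∧ (u == v)} (∧-intro (==-refl v) (==-refl u))

  adj-true : ∀ {u v} E → adj E u v ≡ true → (u , v) ∈ E ⊎ (v , u) ∈ E
  adj-true {u} {v} E h with any-true E h
  ... | e , e∈ , q with joins-true {u} {v} {e} q
  ... | inj₁ refl = inj₁ e∈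
  ... | inj₂ refl = inj₂ e∈

  adj-intro : ∀ {u v E} → (u , v) ∈ E → adj E u v ≡ true
  adj-intro {u} {v} e∈ = any-intro e∈ (joins-intro u v)

  adj-introʳ : ∀ {u v E} → (v , u) ∈ E → adj E u v ≡ true
  adj-introʳ {u} {v} e∈ = any-intro e∈ (joins-introʳ u v)

  adj-sym : ∀ {u v} E → adj E u v ≡ true → adj E v u ≡ true
  adj-sym E h with adj-true E h
  ... | inj₁ q = adj-introʳ q
  ... | inj₂ q = adj-intro q

  adj-mono : ∀ {E F u v} → (∀ {e} → e ∈ E → e ∈ F) → adj E u v ≡ true → adj F u v ≡ true
  adj-mono {E} s h with adj-true E h
  ... | inj₁ q = adj-intro (s q)
  ... | inj₂ q = adj-introʳ (s q)

  _⊑_ : List (Edge n) → List (Edge n) → Set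
  E ⊑ F = ∀ u v → adj E u v ≡ true → adj F u v ≡ true

  degIn-∑ : ∀ (E : List (Edge n)) (U : List (Fin n)) (u : Fin n) → degIn E U u ≡ ∑ U (λ w → 𝟙 (adj E u w))
  degIn-∑ E U u = length-filter-∑ (adj E u) U

  degIn-mono : ∀ (E F : List (Edge n)) (U W : List (Fin n)) u → Unique U → (∀ {w} → w ∈ U → w ∈ W) → (∀ w → adj E u w ≡ true → adj F u w ≡ true) → degIn E U u ≤ degIn F W u
  degIn-mono E F U W u un s a = subst₂ _≤_ (sym (degIn-∑ E U u)) (sym (degIn-∑ F W u))
    (≤-trans (∑-mono U (λ w → 𝟙-mono {adj E u w} {adj F u w} (a w))) (∑-unique-⊆ _ un s))

  module _ (k : ℕ) where
    ∈-core⁻ : ∀ {E v} → v ∈ coreV n k E → ∃ λ U → U ∈ sublists V × (∀ {u} → u ∈ U → k ≤ degIn E U u) × v ∈ U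
    ∈-core⁻ {E} {v} v∈ with any-true (sublists V) (proj₂ (∈-filter⁻ V v∈))
    ... | U , U∈ , q with ∧-true {minDegAtLeast k E U} q
    ... | md , mv = U , U∈ , (λ u∈ → ≤ᵇ-true (all-true md u∈)) , memV-true U mv

    ∈-core⁺ : ∀ E {v U} → U ∈ sublists V → (∀ {u} → u ∈ U → k ≤ degIn E U u) → v ∈ U → v ∈ coreV n k E
    ∈-core⁺ E {v} {U} U∈ d v∈ = ∈-filter⁺ (∈-allFin v) (any-intro U∈ (∧-intro (all-intro U (λ u∈ → ≤ᵇ-intro (d u∈))) (memV-intro v∈)))

    core-unique : ∀ E → Unique (coreV n k E)
    core-unique E = unique-filter _ (allFin-unique n)

    -- The union that defines `coreV` keeps minimum degree `k`, because degrees only grow with the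
    -- vertex set.
    core-degree : ∀ {E v} → v ∈ coreV n k E → k ≤ degIn E (coreV n k E) v
    core-degree {E} {v} v∈ with ∈-core⁻ {E} v∈
    ... | U , U∈ , d , v∈U = ≤-trans (d v∈U) (degIn-mono E E U (coreV n k E) v (sublists-unique (allFin-unique n) U∈) (λ w∈ → ∈-core⁺ E U∈ d w∈) (λ w h → h))

    core-mono : ∀ {E F} → E ⊑ F → ∀ {v} → v ∈ coreV n k E → v ∈ coreV n k F
    core-mono {E} {F} a v∈ with ∈-core⁻ {E} v∈
    ... | U , U∈ , d , v∈U = ∈-core⁺ F U∈ (λ {u} u∈ → ≤-trans (d u∈) (degIn-mono E F U U u (sublists-unique (allFin-unique n) U∈) id (a u))) v∈U

    -- A set of minimum degree k in F becomes one in E once it is joined with the core of H.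
    core-absorb : ∀ {H E F} → H ⊑ E → E ⊑ F →
      (∀ u v → adj F u v ≡ true → adj E u v ≡ true ⊎ u ∈ coreV n k H) → coreV n k F ≡ coreV n k E
    core-absorb {H} {E} {F} he ef fe = filter-cong V (λ v → ⇔-≡ (λ h → proj₂ (∈-filter⁻ V (back (∈-filter⁺ (∈-allFin v) h))))
        (λ h → proj₂ (∈-filter⁻ V (core-mono {E} {F} ef (∈-filter⁺ (∈-allFin v) h)))))
      where
      back : ∀ {v} → v ∈ coreV n k F → v ∈ coreV n k E
      back {v} v∈ with ∈-core⁻ {F} v∈
      ... | U , U∈ , d , v∈U = ∈-core⁺ E (canon-∈ p) deg (∈-canon⁺ {p} (∨-introˡ (memV-intro v∈U)))
        where
        p : Fin n → Bool
        p x = memV x U ∨ memV x (coreV n k H)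
        deg : ∀ {u} → u ∈ canon p → k ≤ degIn E (canon p) u
        deg {u} u∈ with memV? u (coreV n k H)
        ... | yes u∈H = ≤-trans (core-degree {H} u∈H) (degIn-mono H E (coreV n k H) (canon p) u (core-unique H)
                (λ {w} w∈ → ∈-canon⁺ {p} (∨-introʳ {memV w U} (memV-intro w∈))) (he u))
        ... | no u∉H with ∨-true {memV u U} (∈-canon⁻ {p} u∈)
        ... | inj₂ q = ⊥-elim (u∉H (memV-true _ q))
        ... | inj₁ q = ≤-trans (d (memV-true U q)) (degIn-mono F E U (canon p) u (sublists-unique (allFin-unique n) U∈)
                (λ w∈ → ∈-canon⁺ {p} (∨-introˡ (memV-intro w∈))) (λ w h → case fe u w h of λ { (inj₁ e) → e ; (inj₂ u∈H) → ⊥-elim (u∉H u∈H) }))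

-- Paths and Pósa rotations

unique-↭ : ∀ {xs ys : List A} → xs ↭ ys → Unique xs → Unique ys
unique-↭ ↭refl u = u
unique-↭ (prep x p) (x∉ ∷ u) = All-resp-↭ p x∉ ∷ unique-↭ p u
unique-↭ (swap x y p) ((x≢y ∷ x∉) ∷ y∉ ∷ u) = ((λ e → x≢y (sym e)) ∷ All-resp-↭ p y∉) ∷ All-resp-↭ p x∉ ∷ unique-↭ p u
unique-↭ (↭trans p q) u = unique-↭ q (unique-↭ p u)

insertions-∈ : ∀ (x : A) as bs → as ++ x ∷ bs ∈ insertions x (as ++ bs)
insertions-∈ x [] [] = here refl
insertions-∈ x [] (b ∷ bs) = here refl
insertions-∈ x (a ∷ as) bs = there (∈-map⁺ (a ∷_) (insertions-∈ x as bs))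

insertions-↭ : ∀ {x : A} l {Q} → Q ∈ insertions x l → Q ↭ x ∷ l
insertions-↭ [] (here refl) = ↭refl
insertions-↭ (y ∷ l) (here refl) = ↭refl
insertions-↭ {x = x} (y ∷ l) (there Q∈) with ∈-map⁻ (y ∷_) Q∈
... | Q' , Q'∈ , refl = ↭trans (prep y (insertions-↭ l Q'∈)) (swap y x ↭refl)

perms-complete : ∀ {K Q : List A} → Q ↭ K → Q ∈ perms K
perms-complete {K = []} p with ↭-empty-inv p
... | refl = here refl
perms-complete {K = x ∷ K} p with ∈-∃++ (∈-resp-↭ (↭-sym p) (here refl))
... | as , bs , refl = ∈-concatMap⁺ (insertions x) (lose (perms-complete (drop-∷ (↭trans (↭-sym (shift x as bs)) p))) (insertions-∈ x as bs))

perms-sound : ∀ {K Q : List A} → Q ∈ perms K → Q ↭ K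
perms-sound {K = []} (here refl) = ↭refl
perms-sound {K = x ∷ K} Q∈ with find (∈-concatMap⁻ (insertions x) {xs = perms K} Q∈)
... | l , l∈ , q = ↭trans (insertions-↭ l q) (prep x (perms-sound l∈))

-- Adjacency along a list, with a direction. Rotations reverse part of a path, so statements about
-- its undirected edges take the disjunction of both directions.
data Consec {A : Set} : List A → A → A → Set where
  here  : ∀ {a b l} → Consec (a ∷ b ∷ l) a b
  there : ∀ {a b x l} → Consec l a b → Consec (x ∷ l) a b

data Head {A : Set} : List A → A → Set where
  hd : ∀ {a l} → Head (a ∷ l) a

data Last {A : Set} : List A → A → Set where
  one  : ∀ {a} → Last (a ∷ []) a
  more : ∀ {a x l} → Last l a → Last (x ∷ l) a

module _ {A : Set} where
  consec-suffix : ∀ pre {t a b} → Consec {A} t a b → Consec (pre ʳ++ t) a b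
  consec-suffix [] c = c
  consec-suffix (x ∷ pre) c = consec-suffix pre (there c)

  consec-reverse : ∀ pre {t a b} → Consec {A} pre a b → Consec (pre ʳ++ t) b a
  consec-reverse (a ∷ b ∷ l) here = consec-suffix l here
  consec-reverse (x ∷ l) (there c) = consec-reverse l c

  -- `pre ʳ++ t` is the Pósa rotation of `pre ++ t`: with the prefix reversed, the only new
  -- adjacency runs from the head of `pre` to the head of `t`.
  reverse-consec : ∀ pre {t a b} → Consec {A} (pre ʳ++ t) a b → Consec pre b a ⊎ (Head pre a × Head t b) ⊎ Consec t a b
  reverse-consec [] c = inj₂ (inj₂ c)
  reverse-consec (x ∷ pre) c with reverse-consec pre c
  ... | inj₁ d = inj₁ (there d)
  ... | inj₂ (inj₁ (hd , hd)) = inj₁ here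
  ... | inj₂ (inj₂ here) = inj₂ (inj₁ (hd , hd))
  ... | inj₂ (inj₂ (there d)) = inj₂ (inj₂ d)

  consec-split : ∀ pre {t a b} → Consec {A} (pre ++ t) a b → Consec pre a b ⊎ (Last pre a × Head t b) ⊎ Consec t a b
  consec-split [] c = inj₂ (inj₂ c)
  consec-split (x ∷ []) here = inj₂ (inj₁ (one , hd))
  consec-split (x ∷ []) (there c) = inj₂ (inj₂ c)
  consec-split (x ∷ y ∷ pre) here = inj₁ here
  consec-split (x ∷ y ∷ pre) (there c) with consec-split (y ∷ pre) c
  ... | inj₁ d = inj₁ (there d)
  ... | inj₂ (inj₁ (l , h)) = inj₂ (inj₁ (more l , h))
  ... | inj₂ (inj₂ d) = inj₂ (inj₂ d)

  consec-++ˡ : ∀ {pre t a b} → Consec {A} pre a b → Consec (pre ++ t) a b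
  consec-++ˡ here = here
  consec-++ˡ (there c) = there (consec-++ˡ c)

  consec-++ʳ : ∀ pre {t a b} → Consec {A} t a b → Consec (pre ++ t) a b
  consec-++ʳ [] c = c
  consec-++ʳ (x ∷ pre) c = there (consec-++ʳ pre c)

  consec-join : ∀ {pre t a b} → Last {A} pre a → Head t b → Consec (pre ++ t) a b
  consec-join one hd = here
  consec-join (more l) h = there (consec-join l h)

  last-suffix : ∀ pre {t v} → Last {A} t v → Last (pre ʳ++ t) v
  last-suffix [] l = l
  last-suffix (x ∷ pre) l = last-suffix pre (more l)

  last-++⁻ : ∀ pre {y ys v} → Last {A} (pre ++ y ∷ ys) v → Last (y ∷ ys) v
  last-++⁻ [] l = l
  last-++⁻ (x ∷ []) (more l) = l
  last-++⁻ (x ∷ y ∷ pre) (more l) = last-++⁻ (y ∷ pre) l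

  head-reverse : ∀ {pre t v} → Last {A} pre v → Head (pre ʳ++ t) v
  head-reverse one = hd
  head-reverse (more l) = head-reverse l

  last-reverse : ∀ {pre v} → Head {A} pre v → Last (pre ʳ++ []) v
  last-reverse {v ∷ pre} hd = last-suffix pre one

  last-exists : ∀ x l → ∃ (Last {A} (x ∷ l))
  last-exists x [] = x , one
  last-exists x (y ∷ l) with last-exists y l
  ... | v , p = v , more p

  last-functional : ∀ {l u v} → Last {A} l u → Last l v → u ≡ v
  last-functional one one = refl
  last-functional (more p) (more q) = last-functional p q

  head-functional : ∀ {l u v} → Head {A} l u → Head l v → u ≡ v
  head-functional hd hd = refl

  last-∈ : ∀ {l v} → Last {A} l v → v ∈ l
  last-∈ one = here refl
  last-∈ (more p) = there (last-∈ p)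

  head-∈ : ∀ {l v} → Head {A} l v → v ∈ l
  head-∈ hd = here refl

  consec-∈ˡ : ∀ {l a b} → Consec {A} l a b → a ∈ l
  consec-∈ˡ here = here refl
  consec-∈ˡ (there c) = there (consec-∈ˡ c)

  consec-∈ʳ : ∀ {x l a b} → Consec {A} (x ∷ l) a b → b ∈ l
  consec-∈ʳ here = here refl
  consec-∈ʳ {l = y ∷ l} (there c) = there (consec-∈ʳ c)

  pred-unique : ∀ {l a a' y} → Unique l → Consec {A} l a y → Consec l a' y → a ≡ a'
  pred-unique u here here = refl
  pred-unique (_ ∷ y∉ ∷ u) here (there c) = ⊥-elim (lookupAll y∉ (consec-∈ʳ c) refl)
  pred-unique (_ ∷ y∉ ∷ u) (there c) here = ⊥-elim (lookupAll y∉ (consec-∈ʳ c) refl)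
  pred-unique (_ ∷ u) (there c) (there d) = pred-unique u c d

  succ-unique : ∀ {l y b b'} → Unique l → Consec {A} l y b → Consec l y b' → b ≡ b'
  succ-unique u here here = refl
  succ-unique (y∉ ∷ u) here (there c) = ⊥-elim (lookupAll y∉ (consec-∈ˡ c) refl)
  succ-unique (y∉ ∷ u) (there c) here = ⊥-elim (lookupAll y∉ (consec-∈ˡ c) refl)
  succ-unique (_ ∷ u) (there c) (there d) = succ-unique u c d

  consec-asym : ∀ {l a b} → Unique l → Consec {A} l a b → Consec l b a → ⊥
  consec-asym ((a≢b ∷ _) ∷ u) here here = a≢b refl
  consec-asym (a∉ ∷ u) here (there c) = lookupAll a∉ (there (consec-∈ʳ c)) refl
  consec-asym (a∉ ∷ u) (there c) here = lookupAll a∉ (there (consec-∈ʳ c)) refl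
  consec-asym (_ ∷ u) (there c) (there d) = consec-asym u c d

  last-no-succ : ∀ {l y a} → Unique l → Last {A} l y → Consec l y a → ⊥
  last-no-succ u one (there ())
  last-no-succ (y∉ ∷ u) (more p) here = lookupAll y∉ (last-∈ p) refl
  last-no-succ (_ ∷ u) (more p) (there c) = last-no-succ u p c

  pred-or-head : ∀ {l y} → y ∈ l → Head {A} l y ⊎ (∃ λ a → Consec l a y)
  pred-or-head (here refl) = inj₁ hd
  pred-or-head {x ∷ l} (there y∈) with pred-or-head y∈
  ... | inj₁ hd = inj₂ (x , here)
  ... | inj₂ (a , c) = inj₂ (a , there c)

  succ-or-last : ∀ {l y} → y ∈ l → Last {A} l y ⊎ (∃ λ b → Consec l y b)
  succ-or-last {x ∷ []} (here refl) = inj₁ one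
  succ-or-last {x ∷ y ∷ l} (here refl) = inj₂ (y , here)
  succ-or-last {x ∷ l} (there y∈) with succ-or-last y∈
  ... | inj₁ p = inj₁ (more p)
  ... | inj₂ (b , c) = inj₂ (b , there c)

module _ {n : ℕ} where
  next : List (Fin n) → Fin n → List (Fin n)
  next [] v = []
  next (x ∷ []) v = []
  next (x ∷ y ∷ l) v = if x == v then y ∷ [] else next (y ∷ l) v

  prev : List (Fin n) → Fin n → List (Fin n)
  prev [] v = []
  prev (x ∷ []) v = []
  prev (x ∷ y ∷ l) v = if y == v then x ∷ [] else prev (y ∷ l) v

  next-length : ∀ l v → length (next l v) ≤ 1
  next-length [] v = z≤n
  next-length (x ∷ []) v = z≤n
  next-length (x ∷ y ∷ l) v with x == v | next-length (y ∷ l) v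
  ... | true | _ = ≤-refl
  ... | false | ih = ih

  prev-length : ∀ l v → length (prev l v) ≤ 1
  prev-length [] v = z≤n
  prev-length (x ∷ []) v = z≤n
  prev-length (x ∷ y ∷ l) v with y == v | prev-length (y ∷ l) v
  ... | true | _ = ≤-refl
  ... | false | ih = ih

  ∈-next : ∀ {l a b} → Unique l → Consec l a b → b ∈ next l a
  ∈-next {a ∷ b ∷ l} u here rewrite ==-refl a = here refl
  ∈-next {x ∷ y ∷ l} {a} (x∉ ∷ u) (there c) with x == a in eq
  ... | true = ⊥-elim (lookupAll x∉ (consec-∈ˡ c) (==-true eq))
  ... | false = ∈-next u c

  ∈-prev : ∀ {l a b} → Unique l → Consec l a b → a ∈ prev l b
  ∈-prev {a ∷ b ∷ l} u here rewrite ==-refl b = here refl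
  ∈-prev {x ∷ y ∷ l} {b = b} (_ ∷ y∉ ∷ u) (there c) with y == b in eq
  ... | true = ⊥-elim (lookupAll y∉ (consec-∈ʳ c) (==-true eq))
  ... | false = ∈-prev (y∉ ∷ u) c

  neighbours : List (Fin n) → List (Fin n) → List (Fin n)
  neighbours P U = concatMap (λ u → next P u ++ prev P u) U

  neighbours-length : ∀ P U → length (neighbours P U) ≤ 2 * length U
  neighbours-length P [] = z≤n
  neighbours-length P (u ∷ U) rewrite length-++ (next P u ++ prev P u) {neighbours P U} | length-++ (next P u) {prev P u} =
    ≤-trans (+-mono-≤ (+-mono-≤ (next-length P u) (prev-length P u)) (neighbours-length P U)) (≤-reflexive (ring (length U)))
    where
    ring : ∀ x → 2 + 2 * x ≡ 2 * suc x
    ring = solve-∀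

  ∈-neighbours : ∀ {P U u y} → Unique P → u ∈ U → Consec P u y ⊎ Consec P y u → y ∈ neighbours P U
  ∈-neighbours {P} {U} {u} un u∈ (inj₁ c) = ∈-concatMap⁺ _ (lose u∈ (∈-++⁺ˡ (∈-next un c)))
  ∈-neighbours {P} {U} {u} un u∈ (inj₂ c) = ∈-concatMap⁺ _ (lose u∈ (∈-++⁺ʳ (next P u) (∈-prev un c)))

  Walk : List (Edge n) → List (Fin n) → Set
  Walk E Q = ∀ {a b} → Consec Q a b → adj E a b ≡ true

  walk⇒pathAdj : ∀ {E} Q → Walk E Q → pathAdj E Q ≡ true
  walk⇒pathAdj [] w = refl
  walk⇒pathAdj (x ∷ []) w = refl
  walk⇒pathAdj (x ∷ y ∷ l) w = ∧-intro (w here) (walk⇒pathAdj (y ∷ l) (w ∘ there))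

  pathAdj⇒walk : ∀ {E} Q → pathAdj E Q ≡ true → Walk E Q
  pathAdj⇒walk (x ∷ y ∷ l) h here = proj₁ (∧-true h)
  pathAdj⇒walk {E} (x ∷ y ∷ l) h (there c) = pathAdj⇒walk (y ∷ l) (proj₂ (∧-true {adj E x y} h)) c
  pathAdj⇒walk (x ∷ []) h (there ())

  walk-∷ : ∀ {E Q u y} → Head Q u → adj E y u ≡ true → Walk E Q → Walk E (y ∷ Q)
  walk-∷ hd yu w here = yu
  walk-∷ hd yu w (there c) = w c

  IsPath : List (Edge n) → List (Fin n) → List (Fin n) → Set
  IsPath E K Q = Unique Q × (∀ {v} → v ∈ Q → v ∈ K) × Walk E Q

  -- An edge that avoids every forbidden `X` of size at most `2|U|` amounts to `U` having more than
  -- `2|U|` neighbours in `K` outside itself, but it hands over the edge directly. Rotations forbid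
  -- the path neighbours of `U`; the opening of cycles forbids nothing.
  Expander : List (Edge n) → List (Fin n) → ℕ → Set
  Expander E K ℓ = ∀ U X → Unique U → (∀ {u} → u ∈ U → u ∈ K) → 1 ≤ length U → length U ≤ ℓ → length X ≤ 2 * length U →
    ∃ λ u → ∃ λ y → u ∈ U × y ∈ K × y ∉ U × y ∉ X × adj E u y ≡ true

  module Posa (E : List (Edge n)) (K : List (Fin n)) (ℓ : ℕ) (expand : Expander E K ℓ) where

    Longest : List (Fin n) → Set
    Longest P = IsPath E K P × (∀ Q → IsPath E K Q → length Q ≤ length P)

    Ends : List (Fin n) → Fin n → Fin n → List (Fin n) → Set
    Ends P u v Q = Q ↭ P × Walk E Q × Head Q u × Last Q v

    -- Posa rotations with the end v fixed. Every edge of P that the rotations have broken meets U, the set of ends reached so far.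
    module Rotate (P : List (Fin n)) (P-longest : Longest P) (p v : Fin n) (P-head : Head P p) (P-last : Last P v) where
      P-unique = proj₁ (proj₁ P-longest)

      Keeps : List (Fin n) → List (Fin n) → Set
      Keeps U Q = ∀ {a b} → Consec P a b → a ∉ U → b ∉ U → Consec Q a b ⊎ Consec Q b a

      State : List (Fin n) → Set
      State U = Unique U × p ∈ U × (∀ {u} → u ∈ U → ∃ λ Q → Ends P u v Q × Keeps U Q)

      -- Neither `y` nor its neighbours on `P` lie in `U`, so all edges of `P` at `y` survive in
      -- `Q`, and the predecessor `y'` of `y` in `Q` is a neighbour of `y` on `P`. Were `y'` in `U`,
      -- then `y` would belong to `neighbours P U`. Hence every rotation produces a new end.
      rotated-end : ∀ {Q u y y' pre ys U} → Ends P u v Q → Keeps U Q → Q ≡ pre ++ y ∷ ys → Last pre y' →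
        p ∈ U → y ∉ U → y ∉ neighbours P U → y' ∉ U
      rotated-end {Q} {u} {y} {y'} {pre} {ys} {U} (Q↭P , walk , h , l) keeps refl pl p∈ y∉ y∉N y'∈
        with pred-or-head (∈-resp-↭ Q↭P (∈-++⁺ʳ pre (here refl)))
      ... | inj₁ hP = y∉ (subst (_∈ U) (head-functional P-head hP) p∈)
      ... | inj₂ (a , ca) = go (keeps ca a∉ y∉)
        where
        Q-unique = unique-↭ (↭-sym Q↭P) P-unique
        a∉ : a ∉ U
        a∉ a∈ = y∉N (∈-neighbours P-unique a∈ (inj₁ ca))
        step : Consec (pre ++ y ∷ ys) y' y
        step = consec-join pl hd
        go : Consec (pre ++ y ∷ ys) a y ⊎ Consec (pre ++ y ∷ ys) y a → ⊥
        go (inj₁ c) = a∉ (subst (_∈ U) (sym (pred-unique Q-unique c step)) y'∈)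
        go (inj₂ c) with succ-or-last (∈-resp-↭ Q↭P (∈-++⁺ʳ pre (here refl)))
        ... | inj₁ lP = last-no-succ Q-unique (subst (Last (pre ++ y ∷ ys)) (last-functional P-last lP) l) c
        ... | inj₂ (b , cb) = go' (keeps cb y∉ b∉)
          where
          b∉ : b ∉ U
          b∉ b∈ = y∉N (∈-neighbours P-unique b∈ (inj₂ cb))
          go' : Consec (pre ++ y ∷ ys) y b ⊎ Consec (pre ++ y ∷ ys) b y → ⊥
          go' (inj₁ d) with succ-unique Q-unique c d
          ... | refl = consec-asym P-unique ca cb
          go' (inj₂ d) = b∉ (subst (_∈ U) (sym (pred-unique Q-unique d step)) y'∈)

      extend : ∀ {U} → State U → length U ≤ ℓ → ∃ λ y' → State (y' ∷ U)
      extend {U} (U-unique , p∈ , paths) U≤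
        with expand U (neighbours P U) U-unique (λ u∈ → proj₁ (proj₂ (proj₁ P-longest)) (let (Q , (Q↭P , _ , h , _) , _) = paths u∈ in ∈-resp-↭ Q↭P (head-∈ h)))
               (nonempty p∈) U≤ (neighbours-length P U)
        where
        nonempty : ∀ {p U} → p ∈ U → 1 ≤ length {A = Fin n} U
        nonempty (here _) = s≤s z≤n
        nonempty (there _) = s≤s z≤n
      ... | u , y , u∈ , y∈K , y∉U , y∉N , uy with paths u∈
      ... | Q , ends@(Q↭P , walk , h , l) , keeps with memV? y Q
      -- Prefixing `y` to `Q` would give a path longer than `P`.
      ... | no y∉Q = ⊥-elim (<-irrefl refl (≤-trans (s≤s (≤-reflexive (sym (↭-length Q↭P)))) (proj₂ P-longest (y ∷ Q)
              ( tabAll (λ z∈ e → y∉Q (subst (_∈ Q) (sym e) z∈)) ∷ unique-↭ (↭-sym Q↭P) P-unique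
              , (λ { (here refl) → y∈K ; (there v∈) → proj₁ (proj₂ (proj₁ P-longest)) (∈-resp-↭ Q↭P v∈) })
              , walk'))))
        where
        walk' : Walk E (y ∷ Q)
        walk' = walk-∷ {E} h (adj-sym E uy) walk
      ... | yes y∈Q with ∈-∃++ y∈Q
      ... | [] , ys , refl = case h of λ { hd → ⊥-elim (y∉U u∈) }
      ... | x ∷ pre , ys , refl with last-exists x pre
      ... | y' , pl = y' , (tabAll (λ z∈ e → y'∉ (subst (_∈ U) (sym e) z∈)) ∷ U-unique) , there p∈ , paths'
        where
        y'∉ : y' ∉ U
        y'∉ = rotated-end {pre = x ∷ pre} ends keeps refl pl p∈ y∉U y∉N
        Q' = (x ∷ pre) ʳ++ (y ∷ ys)
        walk' : Walk E Q'
        walk' c with reverse-consec (x ∷ pre) c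
        ... | inj₁ d = adj-sym E (walk (consec-++ˡ d))
        ... | inj₂ (inj₂ d) = walk (consec-++ʳ (x ∷ pre) d)
        ... | inj₂ (inj₁ (hd , hd)) = subst (λ s → adj E s y ≡ true) (head-functional h hd) uy
        keeps' : Keeps (y' ∷ U) Q'
        keeps' c a∉ b∉ = go (keeps c (a∉ ∘ there) (b∉ ∘ there))
          where
          one-way : ∀ {a b} → a ∉ y' ∷ U → Consec ((x ∷ pre) ++ y ∷ ys) a b → Consec Q' a b ⊎ Consec Q' b a
          one-way a∉ d with consec-split (x ∷ pre) d
          ... | inj₁ e = inj₂ (consec-reverse (x ∷ pre) e)
          ... | inj₂ (inj₂ e) = inj₁ (consec-suffix (x ∷ pre) e)
          -- The single edge lost in the rotation is the one from `y'` to `y`, and `y'` has just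
          -- joined the set of ends.
          ... | inj₂ (inj₁ (e , _)) = ⊥-elim (a∉ (here (last-functional e pl)))
          go : Consec ((x ∷ pre) ++ y ∷ ys) _ _ ⊎ Consec ((x ∷ pre) ++ y ∷ ys) _ _ → Consec Q' _ _ ⊎ Consec Q' _ _
          go (inj₁ d) = one-way a∉ d
          go (inj₂ d) with one-way b∉ d
          ... | inj₁ e = inj₂ e
          ... | inj₂ e = inj₁ e
        paths' : ∀ {w} → w ∈ y' ∷ U → ∃ λ Q → Ends P w v Q × Keeps (y' ∷ U) Q
        paths' (here refl) = Q' , (↭trans (↭-sym (++↭ʳ++ (x ∷ pre) (y ∷ ys))) Q↭P , walk' , head-reverse {pre = x ∷ pre} pl ,
          last-suffix (x ∷ pre) (last-++⁻ (x ∷ pre) l)) , keeps'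
        paths' (there w∈) with paths w∈
        ... | R , e , k = R , e , λ c a∉ b∉ → k c (a∉ ∘ there) (b∉ ∘ there)

      ends : ∀ j → j ≤ ℓ → ∃ λ U → length U ≡ suc j × State U
      ends zero j≤ = p ∷ [] , refl , [] ∷ [] , here refl ,
        λ { (here refl) → P , (↭refl , proj₂ (proj₂ (proj₁ P-longest)) , P-head , P-last) , λ c _ _ → inj₁ c }
      ends (suc j) j≤ with ends j (<⇒≤ j≤)
      ... | U , len , st with extend st (subst (_≤ ℓ) (sym len) j≤)
      ... | y' , st' = y' ∷ U , cong suc len , st'

    path-ends : ∀ {P p v} → Longest P → Head P p → Last P v →
      ∃ λ U → length U ≡ suc ℓ × Unique U × (∀ {u} → u ∈ U → ∃ λ Q → Ends P u v Q)
    path-ends {P} {p} {v} longest h l with Rotate.ends P longest p v h l ℓ ≤-refl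
    ... | U , len , u , _ , paths = U , len , u , λ u∈ → let (Q , e , _) = paths u∈ in Q , e

    -- Each end `r` found with `v` fixed becomes the fixed end of the reversed path, which is
    -- rotated again. The partners `X` depend on `r`, but all the paths remain permutations of `P`
    -- and therefore longest.
    path-end-pairs : ∀ {P p v} → Longest P → Head P p → Last P v →
      ∃ λ R → length R ≡ suc ℓ × Unique R × (∀ {r} → r ∈ R → ∃ λ X → length X ≡ suc ℓ × Unique X × (∀ {x} → x ∈ X → ∃ λ Q → Ends P x r Q))
    path-end-pairs {P} longest h l with path-ends longest h l
    ... | R , len , u , paths = R , len , u , second
      where
      second : ∀ {r} → r ∈ R → ∃ λ X → length X ≡ suc ℓ × Unique X × (∀ {x} → x ∈ X → ∃ λ Q → Ends P x r Q)
      second r∈ with paths r∈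
      ... | Q , Q↭P , walk , qh , ql with path-ends {Q ʳ++ []} longest' (head-reverse ql) (last-reverse qh)
        where
        rev↭ : Q ʳ++ [] ↭ P
        rev↭ = ↭trans (↭-sym (++↭ʳ++ Q [])) (↭trans (↭-reflexive (Data.List.Properties.++-identityʳ Q)) Q↭P)
        walk' : Walk E (Q ʳ++ [])
        walk' c with reverse-consec Q c
        ... | inj₁ d = adj-sym E (walk d)
        ... | inj₂ (inj₁ (_ , ()))
        longest' : Longest (Q ʳ++ [])
        longest' = (unique-↭ (↭-sym rev↭) (proj₁ (proj₁ longest)) , (λ v∈ → proj₁ (proj₂ (proj₁ longest)) (∈-resp-↭ rev↭ v∈)) , walk') ,
          λ Q' pQ' → ≤-trans (proj₂ longest Q' pQ') (≤-reflexive (sym (↭-length rev↭)))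
      ... | X , xlen , xu , xpaths = X , xlen , xu , λ x∈ → let (S , S↭ , rest) = xpaths x∈ in S , ↭trans S↭ rev↭ , rest
        where
        rev↭ : Q ʳ++ [] ↭ P
        rev↭ = ↭trans (↭-sym (++↭ʳ++ Q [])) (↭trans (↭-reflexive (Data.List.Properties.++-identityʳ Q)) Q↭P)

-- Longest paths and boosters

best : (ℕ → Bool) → ℕ → ℕ
-- The default is attained for path lengths, since the empty sequence is a path.
best p zero = 0
best p (suc l) = if p (suc l) then suc l else best p l

best-true : ∀ (p : ℕ → Bool) l → p 0 ≡ true → p (best p l) ≡ true
best-true p zero h = h
best-true p (suc l) h with p (suc l) in eq
... | true = eq
... | false = best-true p l h

best-max : ∀ (p : ℕ → Bool) l {j} → j ≤ l → p j ≡ true → j ≤ best p l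
best-max p zero j≤ h = j≤
best-max p (suc l) {j} j≤ h with p (suc l) in eq
... | true = j≤
... | false with m≤n⇒m<n∨m≡n j≤
... | inj₁ (s≤s j≤l) = best-max p l j≤l h
... | inj₂ refl = case trans (sym h) eq of λ ()

best-≤ : ∀ p l → best p l ≤ l
best-≤ p zero = z≤n
best-≤ p (suc l) with p (suc l)
... | true = ≤-refl
... | false = m≤n⇒m≤1+n (best-≤ p l)

module _ {n : ℕ} where
  lastOr-last : ∀ {x xs r} → Last (x ∷ xs) r → lastOr {n} x xs ≡ r
  lastOr-last {xs = []} one = refl
  lastOr-last {xs = y ∷ xs} (more l) = lastOr-last l

  ham-intro : ∀ E {K Q x r} → 3 ≤ length K → Q ↭ K → Walk E Q → Head Q x → Last Q r → adj {n} E r x ≡ true → hamiltonian E K ≡ true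
  ham-intro E {K} {x ∷ xs} 3≤ Q↭K w hd l a = ∧-intro (≤ᵇ-intro 3≤) (any-intro (perms-complete Q↭K)
    (∧-intro (walk⇒pathAdj {E = E} (x ∷ xs) w) (subst (λ v → adj E v x ≡ true) (sym (lastOr-last l)) a)))

  ham-elim : ∀ E {K} → hamiltonian {n} E K ≡ true →
    3 ≤ length K × ∃ λ Q → ∃ λ x → ∃ λ r → Q ↭ K × Walk E Q × Head Q x × Last Q r × adj E r x ≡ true
  ham-elim E {K} h with ∧-true {3 ≤ᵇ length K} h
  ... | 3≤ , c with any-true (perms K) c
  ... | x ∷ xs , Q∈ , q with ∧-true {pathAdj E (x ∷ xs)} q | last-exists x xs
  ... | p , a | r , l = ≤ᵇ-true 3≤ , x ∷ xs , x , r , perms-sound Q∈ , pathAdj⇒walk {E = E} (x ∷ xs) p , hd , l ,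
    subst (λ v → adj E v x ≡ true) (lastOr-last l) a

  ham-mono : ∀ E F {K} → E ⊑ F → hamiltonian {n} E K ≡ true → hamiltonian F K ≡ true
  ham-mono E F {K} ef h with ham-elim E {K} h
  ... | 3≤ , Q , x , r , Q↭ , w , hh , l , a = ham-intro F {K} 3≤ Q↭ (λ c → ef _ _ (w c)) hh l (ef _ _ a)

  isPath-mono : ∀ E F {K Q} → E ⊑ F → IsPath {n} E K Q → IsPath F K Q
  isPath-mono E F ef (u , s , w) = u , s , λ c → ef _ _ (w c)

  seqs : List (Fin n) → ℕ → List (List (Fin n))
  seqs K zero = [] ∷ []
  seqs K (suc l) = concatMap (λ x → map (x ∷_) (seqs K l)) K

  seqs-complete : ∀ {K} Q → (∀ {v} → v ∈ Q → v ∈ K) → Q ∈ seqs K (length Q)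
  seqs-complete [] s = here refl
  seqs-complete (x ∷ Q) s = ∈-concatMap⁺ _ (lose (s (here refl)) (∈-map⁺ (x ∷_) (seqs-complete Q (s ∘ there))))

  seqs-sound : ∀ {K} l {Q} → Q ∈ seqs K l → length Q ≡ l × (∀ {v} → v ∈ Q → v ∈ K)
  seqs-sound zero (here refl) = refl , λ ()
  seqs-sound {K} (suc l) Q∈ with find (∈-concatMap⁻ (λ x → map (x ∷_) (seqs K l)) {xs = K} Q∈)
  ... | x , x∈ , q with ∈-map⁻ (x ∷_) q
  ... | Q' , Q'∈ , refl with seqs-sound l Q'∈
  ... | e , s = cong suc e , λ { (here refl) → x∈ ; (there v∈) → s v∈ }

  uniqueᵇ : List (Fin n) → Bool
  uniqueᵇ [] = true
  uniqueᵇ (x ∷ l) = not (memV x l) ∧ uniqueᵇ l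

  uniqueᵇ-true : ∀ l → uniqueᵇ l ≡ true → Unique l
  uniqueᵇ-true [] h = []
  uniqueᵇ-true (x ∷ l) h = tabAll (λ z∈ e → not-true (proj₁ (∧-true h)) (memV-intro (subst (_∈ l) (sym e) z∈))) ∷
    uniqueᵇ-true l (proj₂ (∧-true {not (memV x l)} h))

  uniqueᵇ-intro : ∀ {l} → Unique l → uniqueᵇ l ≡ true
  uniqueᵇ-intro [] = refl
  uniqueᵇ-intro {x ∷ l} (x∉ ∷ u) = ∧-intro (not-intro (λ h → lookupAll x∉ (memV-true l h) refl)) (uniqueᵇ-intro u)

  hasPath : List (Edge n) → List (Fin n) → ℕ → Bool
  hasPath E K l = any (λ Q → uniqueᵇ Q ∧ pathAdj E Q) (seqs K l)

  hasPath-intro : ∀ E {K Q} → IsPath E K Q → hasPath E K (length Q) ≡ true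
  hasPath-intro E {K} {Q} (u , s , w) = any-intro (seqs-complete Q s) (∧-intro (uniqueᵇ-intro u) (walk⇒pathAdj {E = E} Q w))

  hasPath-elim : ∀ E {K l} → hasPath E K l ≡ true → ∃ λ Q → IsPath E K Q × length Q ≡ l
  hasPath-elim E {K} {l} h with any-true (seqs K l) h
  ... | Q , Q∈ , q with ∧-true {uniqueᵇ Q} q | seqs-sound l Q∈
  ... | u , p | e , s = Q , (uniqueᵇ-true Q u , s , pathAdj⇒walk {E = E} Q p) , e

  longestPath : List (Edge n) → List (Fin n) → ℕ
  longestPath E K = best (hasPath E K) (length K)

  longestPath-path : ∀ E K → ∃ λ Q → IsPath E K Q × length Q ≡ longestPath E K
  longestPath-path E K = hasPath-elim E {K} {longestPath E K} (best-true (hasPath E K) (length K) refl)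

  longestPath-max : ∀ E {K Q} → IsPath E K Q → length Q ≤ longestPath E K
  longestPath-max E {K} {Q} p = best-max (hasPath E K) (length K) (unique-⊆-length (proj₁ p) (proj₁ (proj₂ p))) (hasPath-intro E p)

  longestPath-mono : ∀ E F K → E ⊑ F → longestPath E K ≤ longestPath F K
  longestPath-mono E F K ef with longestPath-path E K
  ... | Q , p , e = subst (_≤ longestPath F K) e (longestPath-max F (isPath-mono E F ef p))

  -- The potential of the booster process: a booster halves it, or sends it to 0 by closing a Hamilton cycle.
  weight : List (Edge n) → List (Fin n) → ℕ
  weight E K = if hamiltonian E K then 0 else 2 ^ (length K ∸ longestPath E K)

  weight-ham : ∀ E K → hamiltonian E K ≡ true → weight E K ≡ 0
  weight-ham E K h rewrite h = refl

  weight-nonham : ∀ E K → hamiltonian E K ≢ true → weight E K ≡ 2 ^ (length K ∸ longestPath E K)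
  weight-nonham E K h rewrite ≢true h = refl

  weight-mono : ∀ E F K → E ⊑ F → weight F K ≤ weight E K
  weight-mono E F K ef with true? (hamiltonian F K)
  ... | yes h = subst (_≤ weight E K) (sym (weight-ham F K h)) z≤n
  ... | no ¬h = subst₂ _≤_ (sym (weight-nonham F K ¬h)) (sym (weight-nonham E K (λ h → ¬h (ham-mono E F {K} ef h))))
    (^-monoʳ-≤ 2 (∸-monoʳ-≤ (length K) (longestPath-mono E F K ef)))

  weight-cong : ∀ E F K → E ⊑ F → F ⊑ E → weight E K ≡ weight F K
  weight-cong E F K ef fe = ≤-antisym (weight-mono F E K fe) (weight-mono E F K ef)

  weight-halve : ∀ E F K → hamiltonian E K ≢ true → longestPath E K < longestPath F K → 2 * weight F K ≤ weight E K
  weight-halve E F K ¬h lt' with true? (hamiltonian F K)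
  ... | yes h = subst (λ s → 2 * s ≤ weight E K) (sym (weight-ham F K h)) z≤n
  ... | no ¬hF = subst₂ (λ s t → 2 * s ≤ t) (sym (weight-nonham F K ¬hF)) (sym (weight-nonham E K ¬h))
    (^-monoʳ-≤ 2 (≤-trans (≤-reflexive (sym (+-∸-assoc 1 (best-≤ (hasPath F K) (length K))))) (∸-monoʳ-≤ (suc (length K)) lt')))

  -- A cycle through the vertices of Q is Hamiltonian or, by expansion of the small set it misses, can be opened into a longer path.
  close-cycle : ∀ E F K ℓ → Expander E K ℓ → E ⊑ F → Unique K → 3 ≤ length K → ∀ {Q x r} → IsPath F K Q → length K ≤ length Q + ℓ →
    Head Q x → Last Q r → adj F r x ≡ true → hamiltonian F K ≡ true ⊎ length Q < longestPath F K
  close-cycle E F K ℓ expand ef uK 3≤ {Q} {x} {r} (uQ , sQ , w) K≤ h l a with ≤-<-connex (length K) (length Q)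
  ... | inj₁ K≤Q = inj₁ (ham-intro F 3≤ (unique-⊆-↭ uQ sQ K≤Q) w h l a)
  ... | inj₂ Q<K = inj₂ (result (expand D [] (unique-filter missing uK) (λ d∈ → proj₁ (∈-filter⁻ K d∈)) D≥1 D≤ z≤n))
    where
    missing : Fin n → Bool
    missing v = not (memV v Q)
    D = filterᵇ missing K
    lengths : length (filterᵇ (λ v → memV v Q) K) + length D ≡ length K
    lengths = trans (cong₂ _+_ (length-filter-∑ (λ v → memV v Q) K) (length-filter-∑ missing K)) (∑-not (λ v → memV v Q) K)
    present≤ : length (filterᵇ (λ v → memV v Q) K) ≤ length Q
    present≤ = unique-⊆-length (unique-filter _ uK) (λ v∈ → memV-true Q (proj₂ (∈-filter⁻ K v∈)))
    ≤present : length Q ≤ length (filterᵇ (λ v → memV v Q) K)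
    ≤present = unique-⊆-length {ys = filterᵇ (λ v → memV v Q) K} uQ (λ v∈ → ∈-filter⁺ {p = λ v → memV v Q} (sQ v∈) (memV-intro v∈))
    D≥1 : 1 ≤ length D
    D≥1 = +-cancelˡ-≤ (length Q) 1 (length D) (≤-trans (≤-reflexive (+-comm (length Q) 1)) (≤-trans Q<K
      (≤-trans (≤-reflexive (sym lengths)) (+-monoˡ-≤ (length D) present≤))))
    D≤ : length D ≤ ℓ
    D≤ = +-cancelˡ-≤ (length Q) (length D) ℓ (≤-trans (≤-trans (+-monoˡ-≤ (length D) ≤present) (≤-reflexive lengths)) K≤)
    result : (∃ λ u → ∃ λ y → u ∈ D × y ∈ K × y ∉ D × y ∉ [] × adj E u y ≡ true) → length Q < longestPath F K
    result (u , y , u∈ , y∈ , y∉ , _ , uy) with memV? y Q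
    ... | no y∉Q = ⊥-elim (y∉ (∈-filter⁺ y∈ (not-intro (λ e → y∉Q (memV-true Q e)))))
    ... | yes y∈Q with ∈-∃++ y∈Q
    ... | as , bs , refl = ≤-trans (≤-reflexive (cong suc (↭-length Q↭))) (longestPath-max F (unique' , sub , walk'))
      where
      Q↭ : as ++ y ∷ bs ↭ (y ∷ bs) ++ as
      Q↭ = ↭-++-comm as (y ∷ bs)
      u∉Q : u ∉ as ++ y ∷ bs
      u∉Q u∈Q = not-true (proj₂ (∈-filter⁻ K u∈)) (memV-intro u∈Q)
      unique' : Unique (u ∷ (y ∷ bs) ++ as)
      unique' = tabAll (λ z∈ e → u∉Q (∈-resp-↭ (↭-sym Q↭) (subst (_∈ (y ∷ bs) ++ as) (sym e) z∈))) ∷ unique-↭ Q↭ uQ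
      sub : ∀ {v} → v ∈ u ∷ (y ∷ bs) ++ as → v ∈ K
      sub (here refl) = proj₁ (∈-filter⁻ K u∈)
      sub (there v∈) = sQ (∈-resp-↭ (↭-sym Q↭) v∈)
      head-++ : ∀ {as : List (Fin n)} {b t} → Head as b → Head (as ++ t) b
      head-++ hd = hd
      -- The cycle is cut just before `y` and preceded by the missed vertex `u`; the closing edge
      -- `r x` becomes the step from the end of `bs` to the start of `as`.
      walk' : Walk F (u ∷ (y ∷ bs) ++ as)
      walk' here = ef u y uy
      walk' (there c) with consec-split (y ∷ bs) c
      ... | inj₁ d = w (consec-++ʳ as d)
      ... | inj₂ (inj₂ d) = w (consec-++ˡ d)
      ... | inj₂ (inj₁ (p , q)) = subst₂ (λ s t → adj F s t ≡ true) (last-functional (last-++⁻ as l) p) (head-functional h (head-++ q)) a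

  module Boosters (E : List (Edge n)) (K K₀ : List (Fin n)) (ℓ z : ℕ) (expand : Expander E K ℓ) (K-unique : Unique K) (3≤ : 3 ≤ length K)
    (K≤ : length K ≤ longestPath E K + ℓ) (outside≤ : ∑ V (λ v → 𝟙 (not (memV v K₀))) ≤ z) (¬ham : hamiltonian E K ≢ true) where

    -- Asking that the weight be halved treats a longer path and a closed Hamilton cycle alike. Both
    -- ends lie in `K₀` because the edges still to come are pairs inside `K₀`.
    booster : Fin n → Fin n → Bool
    booster i j = memV i K₀ ∧ memV j K₀ ∧ not (adj E i j) ∧ (2 * weight ((i , j) ∷ E) K ≤ᵇ weight E K)

    ∷-⊑ : ∀ e → E ⊑ (e ∷ E)
    ∷-⊑ e u v = adj-mono {E = E} {F = e ∷ E} there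

    flip-⊑ : ∀ i j → ((i , j) ∷ E) ⊑ ((j , i) ∷ E)
    flip-⊑ i j u v h with adj-true ((i , j) ∷ E) h
    ... | inj₁ (here refl) = adj-introʳ {E = (j , i) ∷ E} (here refl)
    ... | inj₁ (there p) = adj-intro {E = (j , i) ∷ E} (there p)
    ... | inj₂ (here refl) = adj-intro {E = (j , i) ∷ E} (here refl)
    ... | inj₂ (there p) = adj-introʳ {E = (j , i) ∷ E} (there p)

    booster-sym : ∀ i j → booster i j ≡ booster j i
    booster-sym i j = trans (swap∧ (memV i K₀) (memV j K₀) _) (cong₂ (λ s t → memV j K₀ ∧ memV i K₀ ∧ not s ∧ (2 * t ≤ᵇ weight E K))
        (⇔-≡ (adj-sym E) (adj-sym E)) (weight-cong ((i , j) ∷ E) ((j , i) ∷ E) K (flip-⊑ i j) (flip-⊑ j i)))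
      where
      swap∧ : ∀ a b c → a ∧ b ∧ c ≡ b ∧ a ∧ c
      swap∧ true true c = refl
      swap∧ true false c = refl
      swap∧ false true c = refl
      swap∧ false false c = refl

    inside-count : ∀ {X} → Unique X → length X ≡ suc ℓ → suc ℓ ∸ z ≤ ∑ X (λ v → 𝟙 (memV v K₀))
    inside-count {X} u len = m≤n+o⇒m∸n≤o (suc ℓ) z (≤-trans (≤-reflexive (trans (sym len) (sym (∑-not (λ v → memV v K₀) X))))
      (≤-trans (≤-reflexive (+-comm (∑ X (λ v → 𝟙 (memV v K₀))) _)) (+-monoˡ-≤ _ (≤-trans (∑-unique-⊆ _ u (λ {x} _ → ∈-allFin x)) outside≤))))

    open Posa E K ℓ expand

    -- An edge between the two ends of a longest path closes a cycle, which by `close-cycle` is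
    -- Hamiltonian or yields a longer path. In `E` both are impossible, so the ends are not
    -- adjacent; after adding the pair, either outcome halves the weight.
    pair-booster : ∀ {P Q r x} → Longest P → length P ≡ longestPath E K → Ends P x r Q → r ∈ K₀ → x ∈ K₀ → booster r x ≡ true
    pair-booster {P} {Q} {r} {x} longest len (Q↭P , walk , h , l) r∈ x∈ =
      ∧-intro (memV-intro r∈) (∧-intro (memV-intro x∈) (∧-intro (not-intro non-adj) (≤ᵇ-intro halves)))
      where
      Q-path : IsPath E K Q
      Q-path = unique-↭ (↭-sym Q↭P) (proj₁ (proj₁ longest)) , (λ v∈ → proj₁ (proj₂ (proj₁ longest)) (∈-resp-↭ Q↭P v∈)) , walk
      Q-len : length Q ≡ longestPath E K
      Q-len = trans (↭-length Q↭P) len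
      K≤' : length K ≤ length Q + ℓ
      K≤' = subst (λ s → length K ≤ s + ℓ) (sym Q-len) K≤
      non-adj : adj E r x ≢ true
      non-adj a with close-cycle E E K ℓ expand (λ _ _ e → e) K-unique 3≤ Q-path K≤' h l a
      ... | inj₁ ham = ¬ham ham
      ... | inj₂ longer = <-irrefl Q-len longer
      F = (r , x) ∷ E
      halves : 2 * weight F K ≤ weight E K
      halves with close-cycle E F K ℓ expand (∷-⊑ (r , x)) K-unique 3≤ (isPath-mono E F (∷-⊑ (r , x)) Q-path) K≤' h l (adj-intro {E = F} (here refl))
      ... | inj₁ ham = subst (λ s → 2 * s ≤ weight E K) (sym (weight-ham F K ham)) z≤n
      ... | inj₂ longer = weight-halve E F K ¬ham (subst (_< longestPath F K) Q-len longer)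

    booster-count : (suc ℓ ∸ z) * (suc ℓ ∸ z) ≤ ∑ V (λ i → ∑ V (λ j → 𝟙 (booster i j)))
    booster-count with longestPath-path E K
    ... | P , path , len = go P path len (nonempty K 3≤)
      where
      nonempty : ∀ K → 3 ≤ length K → ∃ λ (x : Fin n) → x ∈ K
      nonempty (x ∷ K) _ = x , here refl
      go : ∀ P → IsPath E K P → length P ≡ longestPath E K → ∃ (λ x → x ∈ K) → (suc ℓ ∸ z) * (suc ℓ ∸ z) ≤ ∑ V (λ i → ∑ V (λ j → 𝟙 (booster i j)))
      go [] path len (x , x∈) = case subst (1 ≤_) (sym len) (longestPath-max E {K} {x ∷ []} ([] ∷ [] , (λ { (here refl) → x∈ }) , λ { (there ()) })) of λ ()
      go P@(p ∷ ps) path len _ with last-exists p ps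
      ... | v , pl with path-end-pairs {P} (path , λ Q q → subst (length Q ≤_) (sym len) (longestPath-max E q)) hd pl
      ... | R , R-len , R-unique , ends = begin
        c * c                                              ≤⟨ *-monoˡ-≤ c (inside-count R-unique R-len) ⟩
        ∑ R (λ v → 𝟙 (memV v K₀)) * c                      ≡⟨ sym (∑-*ʳ c R _) ⟩
        ∑ R (λ v → 𝟙 (memV v K₀) * c)                      ≤⟨ ∑-mono∈ R row-count ⟩
        ∑ R (λ i → ∑ V (λ j → 𝟙 (booster i j)))            ≤⟨ ∑-unique-⊆ _ R-unique (λ {x} _ → ∈-allFin x) ⟩
        ∑ V (λ i → ∑ V (λ j → 𝟙 (booster i j)))            ∎
        where
        open ≤-Reasoning
        c = suc ℓ ∸ z
        row-count : ∀ i → i ∈ R → 𝟙 (memV i K₀) * c ≤ ∑ V (λ j → 𝟙 (booster i j))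
        row-count i i∈ with memV? i K₀
        ... | no i∉ rewrite ≢true (λ e → i∉ (memV-true K₀ e)) = z≤n
        ... | yes i∈K₀ with ends i∈
        ... | X , X-len , X-unique , paths = ≤-trans (*-monoˡ-≤ c (𝟙≤1 (memV i K₀))) (≤-trans (≤-reflexive (+-identityʳ c))
          (≤-trans (inside-count X-unique X-len) (≤-trans (∑-mono∈ X (λ j j∈ → 𝟙-mono {memV j K₀} (λ e →
            pair-booster (path , λ Q q → subst (length Q ≤_) (sym len) (longestPath-max E q)) len (proj₂ (paths j∈)) i∈K₀ (memV-true K₀ e))))
          (∑-unique-⊆ _ X-unique (λ {x} _ → ∈-allFin x)))))

    -- Ordered pairs count each pair twice and the diagonal at most `n` times; this is the origin of
    -- `2 * b + n` in the hypothesis `enough` of the sprinkling.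
    booster-pairs : (suc ℓ ∸ z) * (suc ℓ ∸ z) ≤ 2 * ∑ (allPairs n) (λ e → 𝟙 (booster (proj₁ e) (proj₂ e))) + n
    booster-pairs = ≤-trans booster-count (≤-trans (≤-reflexive (sym (∑-pairs-symmetric (λ i j → 𝟙 (booster i j)) (λ i j → cong 𝟙 (booster-sym i j)))))
      (+-mono-≤ (≤-reflexive (cong (S +_) (sym (+-identityʳ S)))) (≤-trans (∑-mono {A = Fin n} V {g = λ _ → 1} (λ i → 𝟙≤1 (booster i i))) (≤-reflexive (trans (∑-const {A = Fin n} V 1) (trans (*-identityʳ _) length-V))))))
      where
      S = ∑ (allPairs n) (λ e → 𝟙 (booster (proj₁ e) (proj₂ e)))

-- Sprinkling

length-filters : ∀ (p : A → Bool) L → length (filterᵇ p L) + length (filterᵇ (not ∘ p) L) ≡ length L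
length-filters p L = trans (cong₂ _+_ (length-filter-∑ p L) (length-filter-∑ (not ∘ p) L)) (∑-not p L)

∈-++-filters : ∀ (p : A → Bool) {L x} → x ∈ L → x ∈ filterᵇ p L ⊎ x ∈ filterᵇ (not ∘ p) L
∈-++-filters p {L} {x} x∈ with true? (p x)
... | yes e = inj₁ (∈-filter⁺ x∈ e)
... | no ¬e = inj₂ (∈-filter⁺ x∈ (not-intro ¬e))

expander-mono : ∀ {n} (E F : List (Edge n)) {K ℓ} → E ⊑ F → Expander E K ℓ → Expander F K ℓ
expander-mono E F ef ex U X u s 1≤ ≤ℓ X≤ with ex U X u s 1≤ ≤ℓ X≤
... | x , y , x∈ , y∈ , y∉U , y∉X , a = x , y , x∈ , y∈ , y∉U , y∉X , ef x y a

-- `a` marks a pair not yet added and `b` a booster; `x` and `y` are the weights after and before.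
-- One inequality covers both kinds of pair, so that it can be summed.
gain : ∀ a b {x y} → x ≤ y → (b ≡ true → 2 * x ≤ y) → 2 * (𝟙 a * x) + 𝟙 a * 𝟙 b * y ≤ 2 * (𝟙 a * y)
gain false b h h' = z≤n
gain true false {x} h h' = ≤-trans (≤-reflexive (+-identityʳ (2 * (1 * x)))) (*-monoʳ-≤ 2 (*-monoʳ-≤ 1 h))
gain true true {x} {y} h h' = ≤-trans (+-monoˡ-≤ (1 * 1 * y) (subst (_≤ y) (cong (2 *_) (sym (+-identityʳ x))) (h' refl))) (≤-reflexive (ring y))
  where
  ring : ∀ y → y + 1 * 1 * y ≡ 2 * (1 * y)
  ring = solve-∀

-- `H` is fixed. The test `good` concerns the first-stage edges, because expansion of the new core
-- is a property of `H` together with them; later it becomes the absence of dense pairs.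
module Sprinkle {n : ℕ} (k : ℕ) (H : List (Edge n)) (ℓ z : ℕ) (z≤ℓ : z ≤ ℓ)
  (core-ham : hamiltonian H (coreV n k H) ≡ true)
  (outside≤ : ∑ V (λ v → 𝟙 (not (memV v (coreV n k H)))) ≤ z)
  (enough : ∀ b → (suc ℓ ∸ z) * (suc ℓ ∸ z) ≤ 2 * b + n → length (allPairs n) ≤ 20 * b)
  (good : List (Edge n) → Bool)
  (expands : ∀ A → good A ≡ true → Expander (H ++ A) (coreV n k (H ++ A)) ℓ) where

  K₀ = coreV n k H

  outside : Edge n → Bool
  outside e = not (memV (proj₁ e) K₀ ∧ memV (proj₂ e) K₀)

  R Q : List (Edge n)
  R = filterᵇ (λ e → not (memE e H)) (allPairs n)
  Q = filterᵇ (not ∘ outside) R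

  R-unique : Unique R
  R-unique = unique-filter _ allPairs-unique

  Q-unique : Unique Q
  Q-unique = unique-filter _ R-unique

  module _ (S₁ : List (Edge n)) (good-S₁ : good S₁ ≡ true) where
    K = coreV n k (H ++ S₁)

    G : List (Edge n) → List (Edge n)
    G S = (H ++ S₁) ++ S

    w : List (Edge n) → ℕ
    w S = weight (G S) K

    H⊑G : ∀ S → H ⊑ G S
    H⊑G S u v = adj-mono {E = H} {F = G S} (λ e∈ → ∈-++⁺ˡ (∈-++⁺ˡ e∈))

    base⊑G : ∀ S → (H ++ S₁) ⊑ G S
    base⊑G S u v = adj-mono {E = H ++ S₁} {F = G S} ∈-++⁺ˡ

    ++-⊑ : ∀ {S T} → (∀ {e} → e ∈ S → e ∈ T) → G S ⊑ G T
    ++-⊑ {S} {T} s u v = adj-mono {E = G S} {F = G T} (λ e∈ → case ∈-++⁻ (H ++ S₁) e∈ of λ { (inj₁ p) → ∈-++⁺ˡ p ; (inj₂ p) → ∈-++⁺ʳ (H ++ S₁) (s p) })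

    w-↭ : ∀ {S T} → S ↭ T → w S ≡ w T
    w-↭ {S} {T} p = weight-cong (G S) (G T) K (++-⊑ (∈-resp-↭ p)) (++-⊑ (∈-resp-↭ (↭-sym p)))

    K₀⊆K : ∀ {v} → v ∈ K₀ → v ∈ K
    K₀⊆K = core-mono k {H} {H ++ S₁} (λ u v → adj-mono {E = H} {F = H ++ S₁} ∈-++⁺ˡ)

    K-unique : Unique K
    K-unique = core-unique k (H ++ S₁)

    K₀≤longestPath : ∀ S → length K₀ ≤ longestPath (G S) K
    K₀≤longestPath S with ham-elim H {K₀} core-ham
    ... | 3≤ , P , x , r , P↭ , walk , _ = subst (_≤ longestPath (G S) K) (↭-length P↭) (longestPath-max (G S)
          (unique-↭ (↭-sym P↭) (core-unique k H) , (λ v∈ → K₀⊆K (∈-resp-↭ P↭ v∈)) , λ c → H⊑G S _ _ (walk c)))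

    3≤K : 3 ≤ length K
    3≤K = ≤-trans (proj₁ (ham-elim H {K₀} core-ham)) (unique-⊆-length (core-unique k H) K₀⊆K)

    K≤K₀+z : length K ≤ length K₀ + z
    K≤K₀+z = begin
      length K ≡⟨ sym (length-filters (λ v → memV v K₀) K) ⟩
      length (filterᵇ (λ v → memV v K₀) K) + length (filterᵇ (λ v → not (memV v K₀)) K)
        ≤⟨ +-mono-≤ (unique-⊆-length (unique-filter _ K-unique) (λ v∈ → memV-true K₀ (proj₂ (∈-filter⁻ K v∈))))
             (≤-trans (≤-trans (≤-reflexive (length-filter-∑ _ K)) (∑-unique-⊆ {ys = V} _ K-unique (λ {x} _ → ∈-allFin x))) outside≤) ⟩
      length K₀ + z ∎
      where open ≤-Reasoning

    w-start : w [] ≤ 2 ^ z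
    w-start with true? (hamiltonian (G []) K)
    ... | yes h = subst (_≤ 2 ^ z) (sym (weight-ham (G []) K h)) z≤n
    ... | no ¬h = subst (_≤ 2 ^ z) (sym (weight-nonham (G []) K ¬h)) (^-monoʳ-≤ 2
          (m≤n+o⇒m∸n≤o (length K) (longestPath (G []) K) (≤-trans K≤K₀+z (+-monoˡ-≤ z (K₀≤longestPath [])))))

    module _ (S : List (Edge n)) where
      X T : ℕ
      X = ∑ Q (λ e → 𝟙 (not (memE e S)) * w (e ∷ S))
      T = ∑ Q (λ e → 𝟙 (not (memE e S)))

      w-∷≤ : ∀ e → w (e ∷ S) ≤ w S
      w-∷≤ e = weight-mono (G S) (G (e ∷ S)) K (++-⊑ {S} {e ∷ S} there)

      ∷-G : ∀ e → w (e ∷ S) ≡ weight (e ∷ G S) K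
      ∷-G e = weight-cong (G (e ∷ S)) (e ∷ G S) K
        (λ u v → adj-mono {E = G (e ∷ S)} {F = e ∷ G S} (λ f∈ → case ∈-++⁻ (H ++ S₁) f∈ of
          λ { (inj₁ p) → there (∈-++⁺ˡ p) ; (inj₂ (here p)) → here p ; (inj₂ (there p)) → there (∈-++⁺ʳ (H ++ S₁) p) }))
        (λ u v → adj-mono {E = e ∷ G S} {F = G (e ∷ S)} (λ
          { (here p) → ∈-++⁺ʳ (H ++ S₁) (here p)
          ; (there p) → case ∈-++⁻ (H ++ S₁) p of λ { (inj₁ q) → ∈-++⁺ˡ q ; (inj₂ q) → ∈-++⁺ʳ (H ++ S₁) (there q) } }))

      -- At least one pair in twenty is a booster, so adding a random pair multiplies the weight by at most 39/40 on average.
      drift-ham : hamiltonian (G S) K ≡ true → 40 * X ≤ 39 * (T * w S)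
      drift-ham h = ≤-trans (≤-reflexive (trans (cong (40 *_) (trans (∑-cong Q (λ e → trans (cong (𝟙 (not (memE e S)) *_)
        (n≤0⇒n≡0 (subst (w (e ∷ S) ≤_) (weight-ham (G S) K h) (w-∷≤ e)))) (*-zeroʳ (𝟙 (not (memE e S)))))) (∑-0 Q))) (*-zeroʳ 40))) z≤n

      drift-nonham : hamiltonian (G S) K ≢ true → 40 * X ≤ 39 * (T * w S)
      drift-nonham ¬h = +-cancelʳ-≤ (T * W) (40 * X) (39 * (T * W)) (begin
        -- `T * W` is added on both sides. As `T ≤ 20 * b`, the saving `b * W` is at least
        -- `T * W / 20`, which turns `40` into `39`.
        40 * X + T * W                 ≤⟨ +-monoʳ-≤ (40 * X) (*-monoˡ-≤ W (≤-trans T≤ (enough b booster-pairs))) ⟩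
        40 * X + 20 * b * W            ≡⟨ ring₁ 20 X b W ⟩
        20 * (2 * X + b * W)           ≤⟨ *-monoʳ-≤ 20 (≤-trans (+-monoʳ-≤ (2 * X) (*-monoˡ-≤ W b≤)) summed) ⟩
        20 * (2 * (T * W))             ≡⟨ trans (sym (*-assoc 20 2 (T * W))) (+-comm (T * W) (39 * (T * W))) ⟩
        39 * (T * W) + T * W           ∎)
        where
        open ≤-Reasoning
        W = w S
        open Boosters (G S) K K₀ ℓ z (expander-mono (H ++ S₁) (G S) (base⊑G S) (expands S₁ good-S₁)) K-unique 3≤K
          (≤-trans K≤K₀+z (+-mono-≤ (K₀≤longestPath S) z≤ℓ)) outside≤ ¬h
        β : Edge n → ℕ
        β e = 𝟙 (booster (proj₁ e) (proj₂ e))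
        b = ∑ (allPairs n) β
        ring₁ : ∀ c x b w → c * 2 * x + c * b * w ≡ c * (2 * x + b * w)
        ring₁ = solve-∀
        T≤ : T ≤ length (allPairs n)
        T≤ = ≤-trans (∑-mono Q (λ e → 𝟙≤1 (not (memE e S)))) (≤-trans (≤-reflexive (sym (length-∑ Q)))
          (unique-⊆-length Q-unique (λ e∈ → proj₁ (∈-filter⁻ (allPairs n) (proj₁ (∈-filter⁻ R e∈))))))
        b' = ∑ Q (λ e → 𝟙 (not (memE e S)) * β e)
        b≤ : b ≤ b'
        -- A booster is a non-edge of `G S` with both ends in `K₀`, hence it lies in `Q` and outside
        -- `S`: the restriction to `Q` loses none.
        b≤ = ≤-trans (∑-mono (allPairs n) pointwise) (≤-reflexive (sym (trans (∑-filter (not ∘ outside) R _) (∑-filter (λ e → not (memE e H)) (allPairs n) _))))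
          where
          pointwise : ∀ e → β e ≤ 𝟙 (not (memE e H)) * (𝟙 (not (outside e)) * (𝟙 (not (memE e S)) * β e))
          pointwise e@(i , j) = 𝟙-≤ (booster i j) (λ isb →
            let (i∈ , rest) = ∧-true {memV i K₀} isb
                (j∈ , rest') = ∧-true {memV j K₀} rest
                (na , _) = ∧-true {not (adj (G S) i j)} rest'
            in *-mono-≤ (𝟙-true (not-intro {memE e H} (λ m → not-true na (adj-intro {E = G S} (∈-++⁺ˡ (∈-++⁺ˡ (memE-true H m)))))))
              (*-mono-≤ (𝟙-true (cong not (cong not (∧-intro i∈ j∈))))
              (*-mono-≤ (𝟙-true (not-intro {memE e S} (λ m → not-true na (adj-intro {E = G S} (∈-++⁺ʳ (H ++ S₁) (memE-true S m))))))
                (𝟙-true isb))))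
        pointwise : ∀ e → 2 * (𝟙 (not (memE e S)) * w (e ∷ S)) + 𝟙 (not (memE e S)) * β e * W ≤ 2 * (𝟙 (not (memE e S)) * W)
        pointwise e@(i , j) = gain (not (memE e S)) (booster i j) (w-∷≤ e) (λ isb → subst (λ s → 2 * s ≤ W) (sym (∷-G e))
          (≤ᵇ-true (proj₂ (∧-true {not (adj (G S) i j)} (proj₂ (∧-true {memV j K₀} (proj₂ (∧-true {memV i K₀} isb))))))))
        summed : 2 * X + b' * W ≤ 2 * (T * W)
        summed = ≤-trans (≤-reflexive (sym (trans (∑-+ Q _ _) (cong₂ _+_ (∑-*ˡ 2 Q _) (∑-*ʳ W Q _)))))
          (≤-trans (∑-mono Q pointwise) (≤-reflexive (trans (∑-*ˡ 2 Q _) (cong (2 *_) (∑-*ʳ W Q _)))))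

      drift : 40 * X ≤ 39 * (T * w S)
      drift = dec (true? (hamiltonian (G S) K)) drift-ham drift-nonham

    levels : ∀ j → 40 ^ j * ∑ (subs j Q) w ≤ 39 ^ j * (binom (length Q) j * 2 ^ z)
    levels j = ≤-trans (subs-level 40 39 Q Q-unique w w-↭ (λ {S} _ → drift S) j)
      (*-monoʳ-≤ (39 ^ j) (*-monoʳ-≤ (binom (length Q) j) w-start))

  -- The weight is at least `1` when no Hamilton cycle has appeared, so it dominates the indicator
  -- of failure. First-stage sets that fail `good` count `0` here, as dense pairs are charged
  -- separately.
  Bad : List (Edge n) → List (Edge n) → ℕ
  Bad S₁ S with true? (good S₁)
  ... | yes g = w S₁ g S
  ... | no _ = 0

  levels-Bad : ∀ S₁ j → 40 ^ j * ∑ (subs j Q) (Bad S₁) ≤ 39 ^ j * (binom (length Q) j * 2 ^ z)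
  levels-Bad S₁ j with true? (good S₁)
  ... | yes g = levels S₁ g j
  ... | no _ = ≤-trans (≤-reflexive (trans (cong (40 ^ j *_) (∑-0 (subs j Q))) (*-zeroʳ (40 ^ j)))) z≤n

  rate : Edge n → ℕ
  rate e = if outside e then 40 else 39

  -- For a fixed outside part `A`, the drift gives `(39/40)^|B|` for the inside part `B` of size
  -- `t - |A|`. Written as `∏ S rate`, this bound is again a product over the edges of `S`, so the
  -- size of `B` need not be shown to concentrate.
  sprinkle : ∀ t → 40 ^ t * ∑ (subs t R) (λ S → Bad (filterᵇ outside S) (filterᵇ (not ∘ outside) S)) ≤ 2 ^ z * ∑ (subs t R) (λ S → ∏ S rate)
  sprinkle t = begin
    40 ^ t * ∑ (subs t R) (λ S → Bad (filterᵇ outside S) (filterᵇ (not ∘ outside) S))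
      ≡⟨ cong (40 ^ t *_) (split (λ A B → Bad A B)) ⟩
    40 ^ t * ∑ (sublists O) (λ A → ∑ (sublists Q) (λ B → 𝟙 (length A + length B ≡ᵇ t) * Bad A B))
      ≡⟨ sym (∑-*ˡ (40 ^ t) (sublists O) _) ⟩
    ∑ (sublists O) (λ A → 40 ^ t * ∑ (sublists Q) (λ B → 𝟙 (length A + length B ≡ᵇ t) * Bad A B))
      ≤⟨ ∑-mono (sublists O) per-A ⟩
    ∑ (sublists O) (λ A → 2 ^ z * ∑ (sublists Q) (λ B → 𝟙 (length A + length B ≡ᵇ t) * (40 ^ length A * 39 ^ length B)))
      ≡⟨ ∑-*ˡ (2 ^ z) (sublists O) _ ⟩
    2 ^ z * ∑ (sublists O) (λ A → ∑ (sublists Q) (λ B → 𝟙 (length A + length B ≡ᵇ t) * (40 ^ length A * 39 ^ length B)))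
      ≡⟨ cong (2 ^ z *_) (sym (trans (∑-cong (subs t R) ∏-rate) (split (λ A B → 40 ^ length A * 39 ^ length B)))) ⟩
    2 ^ z * ∑ (subs t R) (λ S → ∏ S rate) ∎
    where
    open ≤-Reasoning
    O = filterᵇ outside R
    split : ∀ (F : List (Edge n) → List (Edge n) → ℕ) → ∑ (subs t R) (λ S → F (filterᵇ outside S) (filterᵇ (not ∘ outside) S)) ≡
      ∑ (sublists O) (λ A → ∑ (sublists Q) (λ B → 𝟙 (length A + length B ≡ᵇ t) * F A B))
    split F = trans (∑-subs t R _) (trans (∑-cong (sublists R) (λ S → cong (λ s → 𝟙 (s ≡ᵇ t) * F (filterᵇ outside S) (filterᵇ (not ∘ outside) S)) (sym (length-filters outside S))))
      (∑-sublists-split outside R (λ A B → 𝟙 (length A + length B ≡ᵇ t) * F A B)))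
    ∏-rate : ∀ S → ∏ S rate ≡ 40 ^ length (filterᵇ outside S) * 39 ^ length (filterᵇ (not ∘ outside) S)
    ∏-rate S = trans (∏-if outside S 40 39) (cong₂ (λ s t → 40 ^ s * 39 ^ t) (sym (length-filter-∑ outside S)) (sym (length-filter-∑ (not ∘ outside) S)))
    per-A : ∀ A → 40 ^ t * ∑ (sublists Q) (λ B → 𝟙 (length A + length B ≡ᵇ t) * Bad A B) ≤
      2 ^ z * ∑ (sublists Q) (λ B → 𝟙 (length A + length B ≡ᵇ t) * (40 ^ length A * 39 ^ length B))
    per-A A with ≤-<-connex (length A) t
    ... | inj₂ t<A = ≤-trans (≤-reflexive (trans (cong (40 ^ t *_) (trans (∑-cong (sublists Q) (λ B → cong (λ s → 𝟙 s * Bad A B)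
            (≢true {length A + length B ≡ᵇ t} (λ e → <⇒≱ t<A (≤-trans (m≤m+n (length A) (length B)) (≤-reflexive (≡ᵇ-true e))))))) (∑-0 (sublists Q)))) (*-zeroʳ (40 ^ t)))) z≤n
    ... | inj₁ A≤t = subst₂ _≤_ (sym left) (sym right) (*-monoʳ-≤ (40 ^ a) (levels-Bad A j))
      where
      a = length A
      j = t ∸ a
      reindex : ∀ F → ∑ (sublists Q) (λ B → 𝟙 (a + length B ≡ᵇ t) * F B) ≡ ∑ (subs j Q) F
      reindex F = sym (trans (∑-subs j Q F) (∑-cong (sublists Q) (λ B → cong (λ s → 𝟙 s * F B) (⇔-≡
        (λ e → ≡ᵇ-intro (trans (cong (a +_) (≡ᵇ-true {length B} e)) (m+[n∸m]≡n A≤t)))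
        (λ e → ≡ᵇ-intro {length B} (+-cancelˡ-≡ a _ _ (trans (≡ᵇ-true e) (sym (m+[n∸m]≡n A≤t)))))))))
      left : 40 ^ t * ∑ (sublists Q) (λ B → 𝟙 (a + length B ≡ᵇ t) * Bad A B) ≡ 40 ^ a * (40 ^ j * ∑ (subs j Q) (Bad A))
      left = trans (cong₂ _*_ (trans (cong (40 ^_) (sym (m+[n∸m]≡n A≤t))) (^-distribˡ-+-* 40 a j)) (reindex (Bad A))) (*-assoc (40 ^ a) (40 ^ j) _)
      right : 2 ^ z * ∑ (sublists Q) (λ B → 𝟙 (a + length B ≡ᵇ t) * (40 ^ a * 39 ^ length B)) ≡ 40 ^ a * (39 ^ j * (binom (length Q) j * 2 ^ z))
      right = trans (cong (2 ^ z *_) (trans (reindex (λ B → 40 ^ a * 39 ^ length B)) (trans (∑-cong∈ (subs j Q) (λ B B∈ → cong (λ s → 40 ^ a * 39 ^ s) (proj₂ (∈-subs {L = Q} B∈))))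
        (subs-count j Q (40 ^ a * 39 ^ j))))) (ring (2 ^ z) (binom (length Q) j) (40 ^ a) (39 ^ j))
        where
        ring : ∀ p b x y → p * (b * (x * y)) ≡ x * (y * (b * p))
        ring = solve-∀

  -- Independent choices of density `t / length R`: a pair inside `K₀` has weight `39` in place of
  -- `40` when chosen, hence the factor `40 * l + 39 * t`, while an outside pair keeps the neutral
  -- factor `40 * length R`.
  sprinkle-product : ∀ t l → t + l ≡ length R →
    t ^ t * l ^ l * (40 ^ length R * ∑ (subs t R) (λ S → Bad (filterᵇ outside S) (filterᵇ (not ∘ outside) S)))
      ≤ 2 ^ z * ((40 * length R) ^ length (filterᵇ outside R) * (40 * l + 39 * t) ^ length Q)
  sprinkle-product t l e = begin
    t ^ t * l ^ l * (40 ^ length R * Σbad)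
      ≡⟨ cong (λ s → t ^ t * l ^ l * (s * Σbad)) (trans (cong (40 ^_) (sym e)) (^-distribˡ-+-* 40 t l)) ⟩
    t ^ t * l ^ l * (40 ^ t * 40 ^ l * Σbad)
      ≡⟨ ring₁ (t ^ t) (l ^ l) (40 ^ t) (40 ^ l) Σbad ⟩
    t ^ t * (40 ^ l * l ^ l) * (40 ^ t * Σbad)
      ≤⟨ *-mono-≤ (≤-reflexive (cong (t ^ t *_) (sym (^-distribʳ-* l 40 l)))) (sprinkle t) ⟩
    t ^ t * (40 * l) ^ l * (2 ^ z * ∑ (subs t R) (λ S → ∏ S rate))
      ≡⟨ ring₂ (t ^ t * (40 * l) ^ l) (2 ^ z) _ ⟩
    2 ^ z * (t ^ t * (40 * l) ^ l * ∑ (subs t R) (λ S → ∏ S rate))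
      ≤⟨ *-monoʳ-≤ (2 ^ z) (subs-∏-bound t (40 * l) rate R t l e) ⟩
    2 ^ z * ∏ R (λ e → 40 * l + t * rate e)
      ≡⟨ cong (2 ^ z *_) (trans (∏-cong R factor) (trans (∏-if outside R (40 * length R) (40 * l + 39 * t))
           (cong₂ (λ s u → (40 * length R) ^ s * (40 * l + 39 * t) ^ u) (sym (length-filter-∑ outside R)) (sym (length-filter-∑ (not ∘ outside) R))))) ⟩
    2 ^ z * ((40 * length R) ^ length (filterᵇ outside R) * (40 * l + 39 * t) ^ length Q) ∎
    where
    open ≤-Reasoning
    Σbad = ∑ (subs t R) (λ S → Bad (filterᵇ outside S) (filterᵇ (not ∘ outside) S))
    ring₁ : ∀ a b c d e → a * b * (c * d * e) ≡ a * (d * b) * (c * e)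
    ring₁ = solve-∀
    ring₂ : ∀ a b c → a * (b * c) ≡ b * (a * c)
    ring₂ = solve-∀
    ^-distribʳ-* : ∀ m a b → (a * b) ^ m ≡ a ^ m * b ^ m
    ^-distribʳ-* zero a b = refl
    ^-distribʳ-* (suc m) a b = trans (cong (a * b *_) (^-distribʳ-* m a b)) (*-interchange a b (a ^ m) (b ^ m))
    factor : ∀ f → 40 * l + t * rate f ≡ (if outside f then 40 * length R else 40 * l + 39 * t)
    factor f with outside f
    ... | true = trans (cong (40 * l +_) (*-comm t 40)) (trans (sym (*-distribˡ-+ 40 l t)) (cong (40 *_) (trans (+-comm l t) e)))
    ... | false = cong (40 * l +_) (*-comm t 39)

  outside-count : length (filterᵇ outside R) ≤ z * n
  outside-count = *-cancelˡ-≤ 2 (begin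
    2 * length (filterᵇ outside R)                     ≡⟨ cong (2 *_) (trans (length-filter-∑ outside R) (∑-filter _ (allPairs n) _)) ⟩
    2 * ∑ (allPairs n) (λ e → 𝟙 (not (memE e H)) * 𝟙 (outside e))  ≤⟨ *-monoʳ-≤ 2 (∑-mono (allPairs n) pointwise) ⟩
    2 * ∑ (allPairs n) (λ e → g (proj₁ e) (proj₂ e))   ≤⟨ ≤-trans (≤-reflexive (ring (∑ (allPairs n) (λ e → g (proj₁ e) (proj₂ e))))) (m≤m+n _ _) ⟩
    _                                                  ≡⟨ ∑-pairs-symmetric g (λ i j → +-comm (o i) (o j)) ⟩
    ∑ (V {n}) (λ i → ∑ (V {n}) (λ j → o i + o j))      ≡⟨ trans (∑-cong (V {n}) row-sum) (∑-+ (V {n}) (λ i → n * o i) (λ _ → ∑ V o)) ⟩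
    ∑ (V {n}) (λ i → n * o i) + ∑ (V {n}) (λ i → ∑ V o)  ≡⟨ cong₂ _+_ (∑-*ˡ n (V {n}) o) (∑-V-const {n} (∑ V o)) ⟩
    n * ∑ V o + n * ∑ V o                              ≤⟨ +-mono-≤ (*-monoʳ-≤ n outside≤) (*-monoʳ-≤ n outside≤) ⟩
    n * z + n * z                                      ≡⟨ ring' n z ⟩
    2 * (z * n) ∎)
    where
    open ≤-Reasoning
    o : Fin n → ℕ
    o v = 𝟙 (not (memV v K₀))
    g : Fin n → Fin n → ℕ
    g i j = o i + o j
    row-sum : ∀ i → ∑ (V {n}) (λ j → o i + o j) ≡ n * o i + ∑ V o
    row-sum i = trans (∑-+ (V {n}) (λ _ → o i) o) (cong (_+ ∑ V o) (∑-V-const {n} (o i)))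
    ring : ∀ x → 2 * x ≡ x + x
    ring = solve-∀
    ring' : ∀ n z → n * z + n * z ≡ 2 * (z * n)
    ring' = solve-∀
    pointwise : ∀ e → 𝟙 (not (memE e H)) * 𝟙 (outside e) ≤ g (proj₁ e) (proj₂ e)
    pointwise e = ≤-trans (*-monoˡ-≤ (𝟙 (outside e)) (𝟙≤1 (not (memE e H)))) (≤-trans (≤-reflexive (+-identityʳ (𝟙 (outside e)))) (h (memV (proj₁ e) K₀) (memV (proj₂ e) K₀)))
      where
      h : ∀ a b → 𝟙 (not (a ∧ b)) ≤ 𝟙 (not a) + 𝟙 (not b)
      h true b = ≤-refl
      h false b = s≤s z≤n

-- Bad events and expansion of the core

∑-at-most-one : ∀ (p : A → Bool) {L} → Unique L → (∀ {x y} → x ∈ L → y ∈ L → p x ≡ true → p y ≡ true → x ≡ y) → ∑ L (𝟙 ∘ p) ≤ 𝟙 (any p L)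
∑-at-most-one p {[]} u h = z≤n
∑-at-most-one p {x ∷ L} (x∉ ∷ u) h with p x in eq
... | false = ∑-at-most-one p u (λ x∈ y∈ → h (there x∈) (there y∈))
... | true = ≤-reflexive (cong suc (trans (∑-cong∈ L (λ y y∈ → cong 𝟙 (≢true {p y} (λ py → lookupAll x∉ y∈ (h (here refl) (there y∈) eq py))))) (∑-0 L)))

𝟙-any≤∑ : ∀ (p : A → Bool) L → 𝟙 (any p L) ≤ ∑ L (𝟙 ∘ p)
𝟙-any≤∑ p L = 𝟙-≤ (any p L) (λ h → let (x , x∈ , px) = any-true L h in ≤-trans (𝟙-true px) (∈⇒≤∑ (𝟙 ∘ p) x∈))

module _ {n : ℕ} where
  between : (p q : Fin n → Bool) → Edge n → Bool
  between p q e = (p (proj₁ e) ∧ q (proj₂ e)) ∨ (p (proj₂ e) ∧ q (proj₁ e))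

  between-cong : ∀ {p p' q q' : Fin n → Bool} → (∀ v → p v ≡ p' v) → (∀ v → q v ≡ q' v) → ∀ e → between p q e ≡ between p' q' e
  between-cong hp hq (a , b) = cong₂ _∨_ (cong₂ _∧_ (hp a) (hq b)) (cong₂ _∧_ (hp b) (hq a))

  between-count : ∀ (p q : Fin n → Bool) → (∀ v → p v ≡ true → q v ≡ true → ⊥) → ∑ (allPairs n) (𝟙 ∘ between p q) ≡ ∑ V (𝟙 ∘ p) * ∑ V (𝟙 ∘ q)
  between-count p q disjoint = *-cancelˡ-≡ _ _ 2 (begin
    2 * ∑ (allPairs n) (𝟙 ∘ between p q)
      ≡⟨ cong (2 *_) (∑-cong (allPairs n) (λ e → exclusive (p (proj₁ e)) (p (proj₂ e)) (q (proj₁ e)) (q (proj₂ e)) (disjoint (proj₁ e)))) ⟩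
    2 * S
      ≡⟨ ring S ⟩
    S + S + 0
      ≡⟨ cong (S + S +_) (sym (trans (∑-cong (V {n}) (λ i → diag (p i) (q i) (disjoint i))) (∑-0 (V {n})))) ⟩
    S + S + ∑ (V {n}) (λ i → g i i)
      ≡⟨ ∑-pairs-symmetric g (λ i j → +-comm (𝟙 (p i) * 𝟙 (q j)) (𝟙 (p j) * 𝟙 (q i))) ⟩
    ∑ (V {n}) (λ i → ∑ (V {n}) (g i))
      ≡⟨ trans (∑-cong (V {n}) (λ i → trans (∑-+ (V {n}) (λ j → 𝟙 (p i) * 𝟙 (q j)) (λ j → 𝟙 (p j) * 𝟙 (q i))) (cong₂ _+_ (∑-*ˡ (𝟙 (p i)) (V {n}) (𝟙 ∘ q)) (∑-*ʳ (𝟙 (q i)) (V {n}) (𝟙 ∘ p)))))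
           (trans (∑-+ (V {n}) (λ i → 𝟙 (p i) * b) (λ i → a * 𝟙 (q i))) (cong₂ _+_ (∑-*ʳ b (V {n}) (𝟙 ∘ p)) (∑-*ˡ a (V {n}) (𝟙 ∘ q)))) ⟩
    a * b + a * b
      ≡⟨ cong (a * b +_) (sym (+-identityʳ (a * b))) ⟩
    2 * (a * b) ∎)
    where
    open ≡-Reasoning
    a = ∑ (V {n}) (𝟙 ∘ p)
    b = ∑ (V {n}) (𝟙 ∘ q)
    g : Fin n → Fin n → ℕ
    g i j = 𝟙 (p i) * 𝟙 (q j) + 𝟙 (p j) * 𝟙 (q i)
    S = ∑ (allPairs n) (λ e → g (proj₁ e) (proj₂ e))
    ring : ∀ x → 2 * x ≡ x + x + 0
    ring = solve-∀
    exclusive : ∀ a b c d → (a ≡ true → c ≡ true → ⊥) → 𝟙 ((a ∧ d) ∨ (b ∧ c)) ≡ 𝟙 a * 𝟙 d + 𝟙 b * 𝟙 c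
    exclusive true b true d h = ⊥-elim (h refl refl)
    exclusive true true false true h = refl
    exclusive true true false false h = refl
    exclusive true false false true h = refl
    exclusive true false false false h = refl
    exclusive false true true d h = refl
    exclusive false true false d h = refl
    exclusive false false c d h = refl
    diag : ∀ a c → (a ≡ true → c ≡ true → ⊥) → 𝟙 a * 𝟙 c + 𝟙 a * 𝟙 c ≡ 0
    diag true true h = ⊥-elim (h refl refl)
    diag true false h = refl
    diag false c h = refl

  cross : (Fin n → Bool) → Edge n → Bool
  cross p = between p (not ∘ p)

  joins-oriented : ∀ {H} → H ∈ sublists (allPairs n) → ∀ v w → ∑ H (𝟙 ∘ joins v w) ≤ 𝟙 (adj H v w)
  joins-oriented {H} H∈ v w = ∑-at-most-one (joins v w) (sublists-unique allPairs-unique H∈) same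
    where
    oriented : ∀ {a b} → (a , b) ∈ H → (b , a) ∈ H → ⊥
    oriented {a} {b} p q = <-asym {toℕ a} {toℕ b} (≤ᵇ-true (∈-allPairs⁻ {n} {a , b} (sublists-⊆ (allPairs n) H∈ p))) (≤ᵇ-true (∈-allPairs⁻ {n} {b , a} (sublists-⊆ (allPairs n) H∈ q)))
    same : ∀ {x y} → x ∈ H → y ∈ H → joins v w x ≡ true → joins v w y ≡ true → x ≡ y
    same {x} {y} x∈ y∈ jx jy with joins-true {e = x} jx | joins-true {e = y} jy
    ... | inj₁ refl | inj₁ refl = refl
    ... | inj₂ refl | inj₂ refl = refl
    ... | inj₁ refl | inj₂ refl = ⊥-elim (oriented x∈ y∈)
    ... | inj₂ refl | inj₁ refl = ⊥-elim (oriented x∈ y∈)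

  -- The vertices outside the core can be peeled off one by one, each having fewer than k neighbours among those not yet peeled.
  module Peel (k : ℕ) (H : List (Edge n)) (H∈ : H ∈ sublists (allPairs n)) where
    K₀ = coreV n k H

    Peeled : ℕ → (Fin n → Bool) → Set
    Peeled s p = (∀ {v} → v ∈ K₀ → p v ≢ true) × ∑ V (𝟙 ∘ p) ≡ s × ∑ H (𝟙 ∘ cross p) ≤ (k ∸ 1) * s

    -- If every unpeeled vertex had `k` unpeeled neighbours, all of them would be in the core,
    -- contrary to the size of `p`. So some `v` has fewer, and peeling it creates crossing edges
    -- only between `v` and those neighbours.
    peel-step : ∀ {s p} → Peeled s p → s < ∑ V (λ v → 𝟙 (not (memV v K₀))) → ∃ (Peeled (suc s))
    peel-step {s} {p} (p-core , p-size , p-cut) s< with any-find (λ v → not (p v) ∧ not (memV v K₀)) V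
    ... | inj₂ none = ⊥-elim (<⇒≱ s< (≤-trans (∑-mono (V {n}) (λ v → 𝟙-mono {not (memV v K₀)} {p v} (λ v∉ → covered v v∉))) (≤-reflexive p-size)))
      where
      covered : ∀ v → not (memV v K₀) ≡ true → p v ≡ true
      covered v v∉ with true? (p v)
      ... | yes e = e
      ... | no ¬e = ⊥-elim (none (∈-allFin v) (∧-intro (not-intro ¬e) v∉))
    ... | inj₁ (v₀ , _ , v₀-out) with any-find (λ u → not (k ≤ᵇ degIn H (canon (not ∘ p)) u)) (canon (not ∘ p))
    ... | inj₂ none = ⊥-elim (not-true (proj₂ (∧-true {not (p v₀)} v₀-out)) (memV-intro (∈-core⁺ k H (canon-∈ (not ∘ p)) min-degree (∈-canon⁺ {p = not ∘ p} (proj₁ (∧-true v₀-out))))))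
      where
      min-degree : ∀ {u} → u ∈ canon (not ∘ p) → k ≤ degIn H (canon (not ∘ p)) u
      min-degree {u} u∈ with true? (k ≤ᵇ degIn H (canon (not ∘ p)) u)
      ... | yes e = ≤ᵇ-true e
      ... | no ¬e = ⊥-elim (none u∈ (not-intro ¬e))
    ... | inj₁ (v , v∈ , v-low) = p' , p'-core , p'-size , p'-cut
      where
      W = canon (not ∘ p)
      p' : Fin n → Bool
      p' x = p x ∨ (v == x)
      ¬pv : p v ≢ true
      ¬pv = not-true (∈-canon⁻ {p = not ∘ p} v∈)
      deg< : degIn H W v < k
      deg< = ≰⇒> (λ k≤ → not-true v-low (≤ᵇ-intro k≤))
      deg≤ : degIn H W v ≤ k ∸ 1
      deg≤ = ∸-monoˡ-≤ 1 deg<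
      v∉K₀ : v ∉ K₀
      v∉K₀ v∈K₀ = <⇒≱ deg< (≤-trans (core-degree k {H} v∈K₀) (degIn-mono H H K₀ W v (core-unique k H)
        (λ {w} w∈ → ∈-canon⁺ {p = not ∘ p} (not-intro (p-core w∈))) (λ w e → e)))
      p'-core : ∀ {x} → x ∈ K₀ → p' x ≢ true
      p'-core {x} x∈ e with ∨-true {p x} e
      ... | inj₁ q = p-core x∈ q
      ... | inj₂ q = v∉K₀ (subst (_∈ K₀) (sym (==-true q)) x∈)
      p'-size : ∑ V (𝟙 ∘ p') ≡ suc s
      p'-size = trans (∑-cong (V {n}) pointwise) (trans (∑-+ (V {n}) (𝟙 ∘ p) (λ x → 𝟙 (v == x) * 1))
        (trans (cong₂ _+_ p-size (∑-delta (allFin-unique n) v (λ _ → 1) (∈-allFin v))) (+-comm s 1)))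
        where
        pointwise : ∀ x → 𝟙 (p' x) ≡ 𝟙 (p x) + 𝟙 (v == x) * 1
        pointwise x with true? (v == x)
        ... | no ¬e rewrite ≢true ¬e with p x
        ... | true = refl
        ... | false = refl
        pointwise x | yes e with ==-true e
        ... | refl rewrite e | ≢true ¬pv = refl
      new-edge : ∀ e → 𝟙 (cross p' e) ≤ 𝟙 (cross p e) + ∑ W (λ w → 𝟙 (joins v w e))
      new-edge e@(a , b) = 𝟙-≤ (cross p' e) go
        where
        found : ∀ w → p' w ≢ true → joins v w e ≡ true → 1 ≤ 𝟙 (cross p e) + ∑ W (λ w → 𝟙 (joins v w e))
        found w ¬p'w j = ≤-trans (≤-trans (𝟙-true j) (∈⇒≤∑ (λ w → 𝟙 (joins v w e)) (∈-canon⁺ {p = not ∘ p} (not-intro (λ pw → ¬p'w (∨-introˡ pw)))))) (m≤n+m _ _)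
        old : cross p e ≡ true → 1 ≤ 𝟙 (cross p e) + ∑ W (λ w → 𝟙 (joins v w e))
        old c = ≤-trans (𝟙-true c) (m≤m+n _ _)
        go : cross p' e ≡ true → 1 ≤ 𝟙 (cross p e) + ∑ W (λ w → 𝟙 (joins v w e))
        go c with ∨-true {p' a ∧ not (p' b)} c
        ... | inj₁ q with ∧-true {p' a} q
        ... | p'a , ¬p'b with ∨-true {p a} p'a
        ... | inj₁ pa = old (∨-introˡ (∧-intro pa (not-intro (λ pb → not-true ¬p'b (∨-introˡ pb)))))
        ... | inj₂ va = found b (not-true ¬p'b) (subst (λ s → joins v b (s , b) ≡ true) (==-true va) (joins-intro v b))
        go c | inj₂ q with ∧-true {p' b} q
        ... | p'b , ¬p'a with ∨-true {p b} p'b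
        ... | inj₁ pb = old (∨-introʳ {p a ∧ not (p b)} (∧-intro pb (not-intro (λ pa → not-true ¬p'a (∨-introˡ pa)))))
        ... | inj₂ vb = found a (not-true ¬p'a) (subst (λ s → joins v a (a , s) ≡ true) (==-true vb) (joins-introʳ v a))
      p'-cut : ∑ H (𝟙 ∘ cross p') ≤ (k ∸ 1) * suc s
      p'-cut = begin
        ∑ H (𝟙 ∘ cross p') ≤⟨ ∑-mono H new-edge ⟩
        ∑ H (λ e → 𝟙 (cross p e) + ∑ W (λ w → 𝟙 (joins v w e))) ≡⟨ trans (∑-+ H (𝟙 ∘ cross p) _) (cong (∑ H (𝟙 ∘ cross p) +_) (∑-swap H W (λ e w → 𝟙 (joins v w e)))) ⟩
        ∑ H (𝟙 ∘ cross p) + ∑ W (λ w → ∑ H (𝟙 ∘ joins v w)) ≤⟨ +-mono-≤ p-cut (≤-trans (∑-mono W (joins-oriented H∈ v)) (≤-trans (≤-reflexive (sym (degIn-∑ H W v))) deg≤)) ⟩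
        (k ∸ 1) * s + (k ∸ 1) ≡⟨ trans (+-comm ((k ∸ 1) * s) (k ∸ 1)) (sym (*-suc (k ∸ 1) s)) ⟩
        (k ∸ 1) * suc s ∎
        where open ≤-Reasoning

    peel : ∀ s → s ≤ ∑ V (λ v → 𝟙 (not (memV v K₀))) → ∃ (Peeled s)
    peel zero _ = (λ _ → false) , (λ _ ()) , ∑-0 (V {n}) , ≤-trans (≤-reflexive (∑-0 H)) z≤n
    peel (suc s) h with peel s (<⇒≤ h)
    ... | p , pl = peel-step pl h

  -- The bad events: Z could be the vertices missing from the core; U has all its H-neighbours in U ∪ X; U sends too many edges into U ∪ X.
  sparseCut : ℕ → ℕ → List (Edge n) → List (Fin n) → ℕ
  sparseCut k z H Z = 𝟙 (length Z ≡ᵇ z) * 𝟙 (∑ H (𝟙 ∘ cross (λ v → memV v Z)) ≤ᵇ (k ∸ 1) * z)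

  sparseCuts : ℕ → ℕ → List (Edge n) → ℕ
  sparseCuts k z H = ∑ (sublists V) (sparseCut k z H)

  -- Peeling can be stopped after exactly `z` vertices, so the union bound runs over sets of the
  -- single size `z`, however many vertices the core misses.
  core-large : ∀ k z H → H ∈ sublists (allPairs n) → sparseCuts k z H ≡ 0 → ∑ V (λ v → 𝟙 (not (memV v (coreV n k H)))) ≤ z
  core-large k z H H∈ none with ≤-total z (∑ V (λ v → 𝟙 (not (memV v (coreV n k H)))))
  ... | inj₂ h = h
  ... | inj₁ h with Peel.peel k H H∈ z h
  ... | p , _ , size , cut = ⊥-elim (<⇒≱ (s≤s z≤n) (subst (1 ≤_) none (≤-trans hit (∈⇒≤∑ (sparseCut k z H) (canon-∈ p)))))
    where
    hit : 1 ≤ sparseCut k z H (canon p)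
    hit = *-mono-≤ (𝟙-true (≡ᵇ-intro {length (canon p)} (trans (length-canon p) size)))
      (𝟙-true (≤ᵇ-intro (≤-trans (≤-reflexive (∑-cong H (λ e → cong 𝟙 (between-cong (memV-canon p) (λ v → cong not (memV-canon p v)) e)))) cut)))

  escapes : List (Fin n) → List (Fin n) → Edge n → Bool
  escapes U X = between (λ v → memV v U) (λ v → not (memV v U ∨ memV v X))

  -- The indicator that no edge of `H` escapes is written as a product over `H`, the form that
  -- `subs-∏-bound` accepts. The additional `z` in the bound on `X` leaves room for the vertices
  -- missing from the core.
  closedPair : ℕ → ℕ → List (Edge n) → List (Fin n) → List (Fin n) → ℕ
  closedPair z ℓ H U X = 𝟙 ((z ≤ᵇ length U) ∧ (length U ≤ᵇ ℓ) ∧ (length X ≤ᵇ 2 * length U + z)) * ∏ H (λ e → if escapes U X e then 0 else 1)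

  closedPairs : ℕ → ℕ → List (Edge n) → ℕ
  closedPairs z ℓ H = ∑ (sublists V) (λ U → ∑ (sublists V) (closedPair z ℓ H U))

  -- The share of an edge in the degree sum over `U` within `U ∪ X`: twice for an edge inside `U`,
  -- once for an edge from `U` to the rest of `X`.
  degreeIn : List (Fin n) → List (Fin n) → Edge n → ℕ
  degreeIn U X (a , b) = 𝟙 (memV a U ∧ (memV b U ∨ memV b X)) + 𝟙 (memV b U ∧ (memV a U ∨ memV a X))

  densePair : ℕ → List (Edge n) → List (Fin n) → List (Fin n) → ℕ
  densePair z E U X = 𝟙 ((5 ≤ᵇ length U) ∧ (length U ≤ᵇ z) ∧ (length X ≤ᵇ 2 * length U)) * 𝟙 (15 * length U ≤ᵇ ∑ E (degreeIn U X))

  densePairs : ℕ → List (Edge n) → ℕ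
  densePairs z E = ∑ (sublists V) (λ U → ∑ (sublists V) (densePair z E U))

  degree-sum : ∀ E {U X} → Unique U → ∑ U (λ v → degIn E (canon (λ y → memV y U ∨ memV y X)) v) ≤ ∑ E (degreeIn U X)
  degree-sum E {U} {X} uU = begin
    ∑ U (λ v → degIn E Y v)
      ≤⟨ ∑-mono U (λ v → ≤-trans (≤-reflexive (degIn-∑ E Y v)) (∑-mono Y (λ y → 𝟙-any≤∑ (joins v y) E))) ⟩
    ∑ U (λ v → ∑ Y (λ y → ∑ E (𝟙 ∘ joins v y)))
      ≡⟨ trans (∑-cong U (λ v → ∑-swap Y E (λ y e → 𝟙 (joins v y e)))) (∑-swap U E _) ⟩
    ∑ E (λ e → ∑ U (λ v → ∑ Y (λ y → 𝟙 (joins v y e))))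
      ≤⟨ ∑-mono E per-edge ⟩
    ∑ E (degreeIn U X) ∎
    where
    open ≤-Reasoning
    Y = canon (λ y → memV y U ∨ memV y X)
    uY = canon-unique (λ y → memV y U ∨ memV y X)
    memY : ∀ y → memV y Y ≡ memV y U ∨ memV y X
    memY = memV-canon (λ y → memV y U ∨ memV y X)
    product : ∀ a b → ∑ U (λ v → ∑ Y (λ y → 𝟙 (a == v) * 𝟙 (b == y))) ≤ 𝟙 (memV a U ∧ (memV b U ∨ memV b X))
    product a b = begin
      ∑ U (λ v → ∑ Y (λ y → 𝟙 (a == v) * 𝟙 (b == y)))  ≡⟨ trans (∑-cong U (λ v → ∑-*ˡ (𝟙 (a == v)) Y (λ y → 𝟙 (b == y)))) (∑-*ʳ (∑ Y (λ y → 𝟙 (b == y))) U (λ v → 𝟙 (a == v))) ⟩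
      ∑ U (λ v → 𝟙 (a == v)) * ∑ Y (λ y → 𝟙 (b == y))  ≤⟨ *-mono-≤ (∑-delta-≤ uU a) (≤-trans (∑-delta-≤ uY b) (≤-reflexive (cong 𝟙 (memY b)))) ⟩
      𝟙 (memV a U) * 𝟙 (memV b U ∨ memV b X)          ≡⟨ 𝟙-* (memV a U) _ ⟩
      𝟙 (memV a U ∧ (memV b U ∨ memV b X)) ∎
      where
      𝟙-* : ∀ a b → 𝟙 a * 𝟙 b ≡ 𝟙 (a ∧ b)
      𝟙-* true b = +-identityʳ (𝟙 b)
      𝟙-* false b = refl
    split : ∀ a b c d → 𝟙 ((a ∧ b) ∨ (c ∧ d)) ≤ 𝟙 a * 𝟙 b + 𝟙 d * 𝟙 c
    split true true c d = s≤s z≤n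
    split true false true true = ≤-refl
    split true false true false = z≤n
    split true false false d = z≤n
    split false b true true = ≤-refl
    split false b true false = z≤n
    split false b false d = z≤n
    per-edge : ∀ e → ∑ U (λ v → ∑ Y (λ y → 𝟙 (joins v y e))) ≤ degreeIn U X e
    per-edge (a , b) = begin
      ∑ U (λ v → ∑ Y (λ y → 𝟙 (joins v y (a , b))))
        ≤⟨ ∑-mono U (λ v → ∑-mono Y (λ y → split (a == v) (b == y) (a == y) (b == v))) ⟩
      ∑ U (λ v → ∑ Y (λ y → 𝟙 (a == v) * 𝟙 (b == y) + 𝟙 (b == v) * 𝟙 (a == y)))
        ≡⟨ trans (∑-cong U (λ v → ∑-+ Y (λ y → 𝟙 (a == v) * 𝟙 (b == y)) (λ y → 𝟙 (b == v) * 𝟙 (a == y)))) (∑-+ U _ _) ⟩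
      ∑ U (λ v → ∑ Y (λ y → 𝟙 (a == v) * 𝟙 (b == y))) + ∑ U (λ v → ∑ Y (λ y → 𝟙 (b == v) * 𝟙 (a == y)))
        ≤⟨ +-mono-≤ (product a b) (product b a) ⟩
      degreeIn U X (a , b) ∎

  module CoreExpands (k z ℓ : ℕ) (15≤k : 15 ≤ k) (H S : List (Edge n))
    (outside≤ : ∑ V (λ v → 𝟙 (not (memV v (coreV n k H)))) ≤ z)
    (no-closed : closedPairs z ℓ H ≡ 0) (no-dense : densePairs z (H ++ S) ≡ 0) where

    E = H ++ S
    K = coreV n k E

    H⊑E : H ⊑ E
    H⊑E u v = adj-mono {E = H} {F = E} ∈-++⁺ˡ

    core-expands : Expander E K ℓ
    core-expands U X uU U⊆K 1≤ U≤ℓ X≤ with any-find (λ u → any (λ y → not (memV y U) ∧ not (memV y X) ∧ adj E u y) K) U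
    ... | inj₁ (u , u∈ , h) with any-true K h
    ... | y , y∈ , q with ∧-true {not (memV y U)} q
    ... | y∉U , q' with ∧-true {not (memV y X)} q'
    ... | y∉X , a = u , y , u∈ , y∈ , (λ m → not-true y∉U (memV-intro m)) , (λ m → not-true y∉X (memV-intro m)) , a
    core-expands U X uU U⊆K 1≤ U≤ℓ X≤ | inj₂ none = ⊥-elim absurd
      where
      closed : ∀ {u y} → u ∈ U → y ∈ K → adj E u y ≡ true → memV y U ∨ memV y X ≡ true
      closed {u} {y} u∈ y∈ a with true? (memV y U) | true? (memV y X)
      ... | yes e | _ = ∨-introˡ e
      ... | no _ | yes e = ∨-introʳ {memV y U} e
      ... | no ¬e | no ¬f = ⊥-elim (none u∈ (any-intro y∈ (∧-intro (not-intro ¬e) (∧-intro (not-intro ¬f) a))))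
      -- `U` and `X` are arbitrary lists; only copies in canonical order occur in `sublists V`, over
      -- which the bad events are summed.
      U' X' X'' : List (Fin n)
      U' = canon (λ v → memV v U)
      X' = canon (λ v → memV v X)
      -- Adding the vertices outside `K` turns closedness within the new core into closedness in
      -- `H`, an event that mentions no core.
      X'' = canon (λ v → memV v X ∨ not (memV v K))
      U'-length : length U' ≡ length U
      U'-length = canon-memV-length uU
      memU' : ∀ v → memV v U' ≡ memV v U
      memU' = memV-canon (λ v → memV v U)
      X'-length : length X' ≤ 2 * length U'
      X'-length = ≤-trans (unique-⊆-length (canon-unique (λ v → memV v X)) (λ x∈ → memV-true X (∈-canon⁻ {p = λ v → memV v X} x∈))) (subst (λ s → length X ≤ 2 * s) (sym U'-length) X≤)
      X''-length : length X'' ≤ 2 * length U' + z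
      X''-length = ≤-trans (≤-trans (≤-reflexive (length-canon (λ v → memV v X ∨ not (memV v K)))) (≤-trans (∑-mono (V {n}) (λ v → 𝟙-∨ (memV v X) (not (memV v K)))) (≤-reflexive (∑-+ (V {n}) (λ v → 𝟙 (memV v X)) (λ v → 𝟙 (not (memV v K)))))))
        (+-mono-≤ (≤-trans (≤-reflexive (sym (length-canon (λ v → memV v X)))) X'-length)
          (≤-trans (∑-mono (V {n}) (λ v → 𝟙-mono {not (memV v K)} (λ v∉ → not-intro (λ m → not-true v∉ (memV-intro (core-mono k {H} {E} H⊑E (memV-true _ m))))))) outside≤))
        where
        𝟙-∨ : ∀ a b → 𝟙 (a ∨ b) ≤ 𝟙 a + 𝟙 b
        𝟙-∨ true b = s≤s z≤n
        𝟙-∨ false b = ≤-refl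
      positive : ∀ {a} → a ≡ 0 → 1 ≤ a → ⊥
      positive refl ()
      degree : ∀ {v} → v ∈ U → 15 ≤ degIn E (canon (λ y → memV y U ∨ memV y X)) v
      degree {v} v∈ = ≤-trans 15≤k (≤-trans (core-degree k {E} (U⊆K v∈)) (unique-⊆-length {ys = filterᵇ (adj E v) (canon (λ y → memV y U ∨ memV y X))} (unique-filter (adj E v) (core-unique k E))
        (λ {y} y∈ → let (y∈K , a) = ∈-filter⁻ {p = adj E v} K y∈ in ∈-filter⁺ {p = adj E v} (∈-canon⁺ {p = λ y → memV y U ∨ memV y X} (closed v∈ y∈K a)) a)))
      -- At most four vertices and eight more cannot contain the `15` neighbours of a vertex of `U`.
      -- Hence dense pairs need only start at size `5`.
      tiny : length U < 5 → ⊥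
      tiny U<5 with first U 1≤
        where
        first : ∀ U → 1 ≤ length {A = Fin n} U → ∃ λ u → u ∈ U
        first (u ∷ U) _ = u , here refl
      ... | u , u∈ = <⇒≱ (≤ᵇ⇒≤ 13 15 _) (≤-trans (degree u∈) (≤-trans (unique-⊆-length {ys = U ++ X} (unique-filter (adj E u) (canon-unique (λ y → memV y U ∨ memV y X))) sub)
          (≤-trans (≤-reflexive (length-++ U {X})) (≤-trans (+-monoʳ-≤ (length U) X≤) (*-monoʳ-≤ 3 (≤-pred U<5))))))
        where
        sub : ∀ {y} → y ∈ filterᵇ (adj E u) (canon (λ y → memV y U ∨ memV y X)) → y ∈ U ++ X
        sub {y} y∈ with ∨-true {memV y U} (∈-canon⁻ {p = λ y → memV y U ∨ memV y X} (proj₁ (∈-filter⁻ (canon (λ y → memV y U ∨ memV y X)) y∈)))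
        ... | inj₁ q = ∈-++⁺ˡ (memV-true U q)
        ... | inj₂ q = ∈-++⁺ʳ U (memV-true X q)
      small : 5 ≤ length U → length U ≤ z → ⊥
      small 5≤ U≤z = positive no-dense (≤-trans (≤-trans hit (∈⇒≤∑ (densePair z E U') (canon-∈ (λ v → memV v X)))) (∈⇒≤∑ (λ U → ∑ (sublists V) (densePair z E U)) (canon-∈ (λ v → memV v U))))
        where
        hit : 1 ≤ densePair z E U' X'
        hit = *-mono-≤ (𝟙-true (∧-intro (≤ᵇ-intro (subst (5 ≤_) (sym U'-length) 5≤)) (∧-intro (≤ᵇ-intro (subst (_≤ z) (sym U'-length) U≤z)) (≤ᵇ-intro X'-length))))
          (𝟙-true (≤ᵇ-intro (≤-trans (≤-reflexive (trans (*-comm 15 (length U')) (sym (∑-const U' 15)))) (≤-trans (∑-mono∈ U' deg') (degree-sum E {U'} {X'} (canon-unique (λ v → memV v U)))))))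
          where
          same : ∀ y → memV y U' ∨ memV y X' ≡ memV y U ∨ memV y X
          same y = cong₂ _∨_ (memU' y) (memV-canon (λ v → memV v X) y)
          deg' : ∀ v → v ∈ U' → 15 ≤ degIn E (canon (λ y → memV y U' ∨ memV y X')) v
          deg' v v∈ = subst (λ Y → 15 ≤ degIn E Y v) (sym (filter-cong (V {n}) same)) (degree (memV-true U (∈-canon⁻ {p = λ v → memV v U} v∈)))
      large : z ≤ length U → ⊥
      large z≤U = positive no-closed (≤-trans (≤-trans hit (∈⇒≤∑ (closedPair z ℓ H U') (canon-∈ (λ v → memV v X ∨ not (memV v K))))) (∈⇒≤∑ (λ U → ∑ (sublists V) (closedPair z ℓ H U)) (canon-∈ (λ v → memV v U))))
        where
        stays : ∀ {a b} → adj E a b ≡ true → memV a U' ≡ true → not (memV b U' ∨ memV b X'') ≡ true → ⊥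
        stays {a} {b} e a∈ b∉ with memV? b K
        ... | no b∉K = not-true b∉ (∨-introʳ {memV b U'} (trans (memV-canon (λ v → memV v X ∨ not (memV v K)) b) (∨-introʳ {memV b X} (not-intro (λ m → b∉K (memV-true K m))))))
        ... | yes b∈K with ∨-true {memV b U} (closed (memV-true U (trans (sym (memU' a)) a∈)) b∈K e)
        ... | inj₁ q = not-true b∉ (∨-introˡ (trans (memU' b) q))
        ... | inj₂ q = not-true b∉ (∨-introʳ {memV b U'} (trans (memV-canon (λ v → memV v X ∨ not (memV v K)) b) (∨-introˡ q)))
        inside : ∀ {e} → e ∈ H → escapes U' X'' e ≢ true
        inside {a , b} e∈ h with ∨-true {memV a U' ∧ not (memV b U' ∨ memV b X'')} h
        ... | inj₁ q = stays (adj-intro {E = E} (∈-++⁺ˡ e∈)) (proj₁ (∧-true q)) (proj₂ (∧-true {memV a U'} q))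
        ... | inj₂ q = stays (adj-introʳ {E = E} (∈-++⁺ˡ e∈)) (proj₁ (∧-true q)) (proj₂ (∧-true {memV b U'} q))
        all-one : ∀ L → (∀ {e} → e ∈ L → escapes U' X'' e ≢ true) → 1 ≤ ∏ L (λ e → if escapes U' X'' e then 0 else 1)
        all-one [] h = ≤-refl
        all-one (e ∷ L) h = *-mono-≤ (subst (λ s → 1 ≤ (if s then 0 else 1)) (sym (≢true (h (here refl)))) ≤-refl) (all-one L (h ∘ there))
        hit : 1 ≤ closedPair z ℓ H U' X''
        hit = *-mono-≤ (𝟙-true (∧-intro (≤ᵇ-intro (subst (z ≤_) (sym U'-length) z≤U)) (∧-intro (≤ᵇ-intro (subst (_≤ ℓ) (sym U'-length) U≤ℓ)) (≤ᵇ-intro X''-length)))) (all-one H inside)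
      absurd : ⊥
      absurd with ≤-<-connex 5 (length U)
      ... | inj₂ U<5 = tiny U<5
      ... | inj₁ 5≤ with ≤-total (length U) z
      ... | inj₁ U≤z = small 5≤ U≤z
      ... | inj₂ z≤U = large z≤U

-- Exponential estimates

^-distribʳ-* : ∀ m a b → (a * b) ^ m ≡ a ^ m * b ^ m
^-distribʳ-* zero a b = refl
^-distribʳ-* (suc m) a b = trans (cong (a * b *_) (^-distribʳ-* m a b)) (*-interchange a b (a ^ m) (b ^ m))

≤-from-squares : ∀ {a b} → a * a ≤ b * b → a ≤ b
≤-from-squares {a} {b} h with ≤-<-connex a b
... | inj₁ a≤b = a≤b
... | inj₂ b<a = ⊥-elim (<⇒≱ (*-mono-< b<a b<a) h)

>0⇒≢0 : ∀ {m} → 0 < m → NonZero m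
>0⇒≢0 (s≤s _) = _

^-pos : ∀ {m} n → 0 < m → 0 < m ^ n
^-pos {suc m} n _ = m^n>0 (suc m) n

cancel-pos : ∀ {m a b} → 0 < m → m * a ≤ m * b → a ≤ b
cancel-pos {suc m} _ h = *-cancelˡ-≤ (suc m) h

bernoulli : ∀ a b j → a ^ j * (a + j * b) ≤ a * (a + b) ^ j
bernoulli a b zero = ≤-reflexive (trans (+-identityʳ (a + 0)) (trans (+-identityʳ a) (sym (*-identityʳ a))))
bernoulli a b (suc j) = begin
  a * a ^ j * (a + (b + j * b))                      ≤⟨ m≤m+n _ (a ^ j * (b * (j * b))) ⟩
  a * a ^ j * (a + (b + j * b)) + a ^ j * (b * (j * b)) ≡⟨ ring a b (a ^ j) (j * b) ⟩
  (a + b) * (a ^ j * (a + j * b))                    ≤⟨ *-monoʳ-≤ (a + b) (bernoulli a b j) ⟩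
  (a + b) * (a * (a + b) ^ j)                        ≡⟨ ring' a (a + b) ((a + b) ^ j) ⟩
  a * ((a + b) * (a + b) ^ j)                        ∎
  where
  open ≤-Reasoning
  ring : ∀ a b p q → a * p * (a + (b + q)) + p * (b * q) ≡ (a + b) * (p * (a + q))
  ring = solve-∀
  ring' : ∀ a c p → c * (a * p) ≡ a * (c * p)
  ring' = solve-∀

-- (1 - m/N)^j ≤ h/(h+1) as soon as j ≥ N/(h m).
bernoulli-block : ∀ l m h j → 0 < l → l ≤ h * (j * m) → l ^ j * suc h ≤ (l + m) ^ j * h
bernoulli-block l m h j 0<l l≤ = cancel-pos 0<l (begin
  l * (l ^ j * suc h)          ≡⟨ ring l (l ^ j) h ⟩
  l ^ j * (l * h + l)          ≤⟨ *-monoʳ-≤ (l ^ j) (+-monoʳ-≤ (l * h) l≤) ⟩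
  l ^ j * (l * h + h * (j * m)) ≡⟨ ring' l (l ^ j) h (j * m) ⟩
  l ^ j * (l + j * m) * h      ≤⟨ *-monoˡ-≤ h (bernoulli l m j) ⟩
  l * (l + m) ^ j * h          ≡⟨ *-assoc l _ h ⟩
  l * ((l + m) ^ j * h)        ∎)
  where
  open ≤-Reasoning
  ring : ∀ l p h → l * (p * suc h) ≡ p * (l * h + l)
  ring = solve-∀
  ring' : ∀ l p h q → p * (l * h + h * q) ≡ p * (l + q) * h
  ring' = solve-∀

-- The `q` factors are cut into `y` blocks of length `j`, each worth `h / suc h`, and the remainder
-- is bounded by `l ≤ N`. This takes the place of `e^(-x)`.
block-power : ∀ l N h j y q → l ≤ N → l ^ j * suc h ≤ N ^ j * h → y * j ≤ q → l ^ q * suc h ^ y ≤ N ^ q * h ^ y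
block-power l N h j y q l≤N block yj≤q = begin
  l ^ q * suc h ^ y                        ≡⟨ cong (λ s → l ^ s * suc h ^ y) (sym (m+[n∸m]≡n yj≤q)) ⟩
  l ^ (y * j + (q ∸ y * j)) * suc h ^ y    ≡⟨ cong (_* suc h ^ y) (split l) ⟩
  (l ^ j) ^ y * l ^ (q ∸ y * j) * suc h ^ y ≡⟨ ring ((l ^ j) ^ y) _ _ ⟩
  (l ^ j) ^ y * suc h ^ y * l ^ (q ∸ y * j) ≤⟨ *-mono-≤ (subst₂ _≤_ (^-distribʳ-* y _ _) (^-distribʳ-* y _ _) (^-monoˡ-≤ y block)) (^-monoˡ-≤ (q ∸ y * j) l≤N) ⟩
  (N ^ j) ^ y * h ^ y * N ^ (q ∸ y * j)    ≡⟨ ring ((N ^ j) ^ y) _ _ ⟩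
  (N ^ j) ^ y * N ^ (q ∸ y * j) * h ^ y    ≡⟨ cong (_* h ^ y) (sym (split N)) ⟩
  N ^ (y * j + (q ∸ y * j)) * h ^ y        ≡⟨ cong (λ s → N ^ s * h ^ y) (m+[n∸m]≡n yj≤q) ⟩
  N ^ q * h ^ y                            ∎
  where
  open ≤-Reasoning
  ring : ∀ a b c → a * b * c ≡ a * c * b
  ring = solve-∀
  split : ∀ x → x ^ (y * j + (q ∸ y * j)) ≡ (x ^ j) ^ y * x ^ (q ∸ y * j)
  split x = trans (^-distribˡ-+-* x (y * j) _) (cong (_* x ^ (q ∸ y * j)) (trans (cong (x ^_) (*-comm y j)) (sym (^-*-assoc x j y))))

-- ((v+1)/v)^(v+1) is decreasing in v.
e-decreasing : ∀ v → 0 < v → suc (suc v) ^ suc (suc v) * v ^ suc v ≤ suc v ^ suc (suc v) * suc v ^ suc v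
e-decreasing v 0<v = cancel-pos {m = v * t * s} (*-mono-≤ (*-mono-≤ 0<v (s≤s (z≤n {s}))) (s≤s (z≤n {v}))) (begin
  v * t * s * (t ^ t * v ^ s)        ≡⟨ ring v t s (t ^ t) (v ^ s) ⟩
  t ^ t * (v * v ^ s) * (t * s)      ≡⟨ cong₂ _*_ (trans (*-comm (t ^ t) _) (sym (^-distribʳ-* t v t))) (ring₂ v) ⟩
  (v * t) ^ t * (v * t + t * 1)      ≤⟨ bernoulli (v * t) 1 t ⟩
  v * t * (v * t + 1) ^ t            ≡⟨ cong (λ a → v * t * a ^ t) (ring₃ v) ⟩
  v * t * (s * s) ^ t                ≡⟨ cong (v * t *_) (^-distribʳ-* t s s) ⟩
  v * t * (s ^ t * (s * s ^ s))      ≡⟨ ring₄ (v * t) (s ^ t) s (s ^ s) ⟩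
  v * t * s * (s ^ t * s ^ s)        ∎)
  where
  open ≤-Reasoning
  s = suc v
  t = suc s
  ring : ∀ v t s a b → v * t * s * (a * b) ≡ a * (v * b) * (t * s)
  ring = solve-∀
  ring₂ : ∀ v → suc (suc v) * suc v ≡ v * suc (suc v) + suc (suc v) * 1
  ring₂ = solve-∀
  ring₃ : ∀ v → v * suc (suc v) + 1 ≡ suc v * suc v
  ring₃ = solve-∀
  ring₄ : ∀ a b c d → a * (b * (c * d)) ≡ a * c * (b * d)
  ring₄ = solve-∀

-- As `((v+1)/v)^(v+1)` decreases, one numerical check at `6` settles all larger `v`; the smaller
-- values are computed.
e≤3 : ∀ v → suc v ^ v ≤ 3 * v ^ v
e≤3 0 = ≤ᵇ⇒≤ 1 3 _
e≤3 1 = ≤ᵇ⇒≤ 2 3 _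
e≤3 2 = ≤ᵇ⇒≤ 9 12 _
e≤3 3 = ≤ᵇ⇒≤ 64 81 _
e≤3 4 = ≤ᵇ⇒≤ 625 768 _
e≤3 5 = ≤ᵇ⇒≤ 7776 9375 _
e≤3 (suc (suc (suc (suc (suc (suc i)))))) = cancel-pos {m = suc v} (s≤s z≤n) (≤-trans (strong i)
    (≤-trans (*-monoʳ-≤ 3 (*-monoˡ-≤ (v ^ v) (n≤1+n v))) (≤-reflexive (ring (suc v) (v ^ v)))))
  where
  v = 6 + i
  ring : ∀ a b → 3 * (a * b) ≡ a * (3 * b)
  ring = solve-∀
  strong : ∀ i → suc (6 + i) ^ suc (6 + i) ≤ 3 * (6 + i) ^ suc (6 + i)
  strong zero = ≤ᵇ⇒≤ (7 ^ 7) (3 * 6 ^ 7) _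
  strong (suc i) = cancel-pos {m = u ^ suc u} (^-pos (suc u) (s≤s z≤n)) (begin
    u ^ suc u * suc (suc u) ^ suc (suc u)   ≡⟨ *-comm (u ^ suc u) _ ⟩
    suc (suc u) ^ suc (suc u) * u ^ suc u   ≤⟨ e-decreasing u (s≤s z≤n) ⟩
    suc u ^ suc (suc u) * suc u ^ suc u     ≤⟨ *-monoʳ-≤ (suc u ^ suc (suc u)) (strong i) ⟩
    suc u ^ suc (suc u) * (3 * u ^ suc u)   ≡⟨ ring' (suc u ^ suc (suc u)) (u ^ suc u) ⟩
    u ^ suc u * (3 * suc u ^ suc (suc u))   ∎)
    where
    open ≤-Reasoning
    u = 6 + i
    ring' : ∀ a b → a * (3 * b) ≡ b * (3 * a)
    ring' = solve-∀

-- From `a/B ≤ y/v` follows `(1 + a/B)^v ≤ (1 + y/v)^v ≤ (1 + 1/v)^(y v) ≤ 3^y`, the middle step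
-- being Bernoulli's inequality for the exponent `y`.
exp-bound : ∀ v a B y → 0 < v → v * a ≤ y * B → (B + a) ^ v ≤ 3 ^ y * B ^ v
exp-bound v a B y 0<v h = cancel-pos {m = (v ^ y) ^ v * v ^ v} (*-mono-≤ (^-pos v (^-pos y 0<v)) (^-pos v 0<v)) (begin
  (v ^ y) ^ v * v ^ v * (B + a) ^ v     ≡⟨ trans (*-assoc ((v ^ y) ^ v) _ _) (cong ((v ^ y) ^ v *_) (sym (^-distribʳ-* v v (B + a)))) ⟩
  (v ^ y) ^ v * (v * (B + a)) ^ v       ≤⟨ *-monoʳ-≤ ((v ^ y) ^ v) (^-monoˡ-≤ v (≤-trans (≤-reflexive (*-distribˡ-+ v B a)) (≤-trans (+-monoʳ-≤ (v * B) h) (≤-reflexive (sym (*-distribʳ-+ B v y)))))) ⟩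
  (v ^ y) ^ v * ((v + y) * B) ^ v       ≡⟨ trans (sym (^-distribʳ-* v (v ^ y) _)) (trans (cong (_^ v) (sym (*-assoc (v ^ y) (v + y) B))) (^-distribʳ-* v (v ^ y * (v + y)) B)) ⟩
  (v ^ y * (v + y)) ^ v * B ^ v         ≤⟨ *-monoˡ-≤ (B ^ v) (^-monoˡ-≤ v (subst₂ _≤_ (cong (λ s → v ^ y * (v + s)) (*-identityʳ y)) (cong (λ s → v * s ^ y) (+-comm v 1)) (bernoulli v 1 y))) ⟩
  (v * suc v ^ y) ^ v * B ^ v           ≡⟨ cong (_* B ^ v) (^-distribʳ-* v v (suc v ^ y)) ⟩
  v ^ v * (suc v ^ y) ^ v * B ^ v       ≡⟨ cong (λ s → v ^ v * s * B ^ v) (flip (suc v)) ⟩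
  v ^ v * (suc v ^ v) ^ y * B ^ v       ≤⟨ *-monoˡ-≤ (B ^ v) (*-monoʳ-≤ (v ^ v) (^-monoˡ-≤ y (e≤3 v))) ⟩
  v ^ v * (3 * v ^ v) ^ y * B ^ v       ≡⟨ cong (λ s → v ^ v * s * B ^ v) (trans (^-distribʳ-* y 3 (v ^ v)) (cong (3 ^ y *_) (sym (flip v)))) ⟩
  v ^ v * (3 ^ y * (v ^ y) ^ v) * B ^ v ≡⟨ ring (v ^ v) (3 ^ y) ((v ^ y) ^ v) (B ^ v) ⟩
  (v ^ y) ^ v * v ^ v * (3 ^ y * B ^ v) ∎)
  where
  open ≤-Reasoning
  flip : ∀ x → (x ^ y) ^ v ≡ (x ^ v) ^ y
  flip x = trans (^-*-assoc x y v) (trans (cong (x ^_) (*-comm y v)) (sym (^-*-assoc x v y)))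
  ring : ∀ a b c d → a * (b * c) * d ≡ c * a * (b * d)
  ring = solve-∀

-- Give each `X` the weight `b^|X| n^(n-|X|)`. For `|X| ≤ b ≤ n` it is at least `b^b n^(n-b)`, and
-- the total is `(b + n)^n ≤ 3^b n^n`.
sublists-count : ∀ {n} b → 0 < n → b ≤ n → ∑ (sublists (V {n})) (λ X → 𝟙 (length X ≤ᵇ b)) * b ^ b ≤ (3 * n) ^ b
sublists-count {n} b 0<n b≤n = cancel-pos {m = n ^ (n ∸ b)} (^-pos (n ∸ b) 0<n) (begin
  n ^ (n ∸ b) * (∑ SV (λ X → 𝟙 (length X ≤ᵇ b)) * b ^ b)
    ≡⟨ trans (ring (n ^ (n ∸ b)) (∑ SV (λ X → 𝟙 (length X ≤ᵇ b))) (b ^ b)) (sym (∑-*ʳ (b ^ b * n ^ (n ∸ b)) SV (λ X → 𝟙 (length X ≤ᵇ b)))) ⟩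
  ∑ SV (λ X → 𝟙 (length X ≤ᵇ b) * (b ^ b * n ^ (n ∸ b)))
    ≤⟨ ∑-mono SV pointwise ⟩
  ∑ SV (λ X → b ^ length X * n ^ (n ∸ length X))
    ≡⟨ subst (λ s → ∑ SV (λ X → b ^ length X * n ^ (s ∸ length X)) ≡ (b + n) ^ s) length-V (∑-sublists-power b n (V {n})) ⟩
  (b + n) ^ n
    ≤⟨ subst (λ s → s ^ n ≤ 3 ^ b * n ^ n) (+-comm n b) (exp-bound n b n b 0<n (≤-reflexive (*-comm n b))) ⟩
  3 ^ b * n ^ n
    ≡⟨ cong (3 ^ b *_) (trans (cong (n ^_) (sym (m+[n∸m]≡n b≤n))) (^-distribˡ-+-* n b (n ∸ b))) ⟩
  3 ^ b * (n ^ b * n ^ (n ∸ b))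
    ≡⟨ trans (sym (*-assoc (3 ^ b) _ _)) (trans (cong (_* n ^ (n ∸ b)) (sym (^-distribʳ-* b 3 n))) (*-comm _ (n ^ (n ∸ b)))) ⟩
  n ^ (n ∸ b) * (3 * n) ^ b ∎)
  where
  open ≤-Reasoning
  SV = sublists (V {n})
  ring : ∀ a b c → a * (b * c) ≡ b * (c * a)
  ring = solve-∀
  pointwise : ∀ X → 𝟙 (length X ≤ᵇ b) * (b ^ b * n ^ (n ∸ b)) ≤ b ^ length X * n ^ (n ∸ length X)
  pointwise X with length X ≤ᵇ b in eq
  ... | false = z≤n
  ... | true = begin
    1 * (b ^ b * n ^ (n ∸ b))                              ≡⟨ *-identityˡ _ ⟩
    b ^ b * n ^ (n ∸ b)                                    ≡⟨ cong (λ s → b ^ s * n ^ (n ∸ b)) (sym (m+[n∸m]≡n x≤b)) ⟩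
    b ^ (x + (b ∸ x)) * n ^ (n ∸ b)                        ≡⟨ trans (cong (_* n ^ (n ∸ b)) (^-distribˡ-+-* b x (b ∸ x))) (*-assoc (b ^ x) _ _) ⟩
    b ^ x * (b ^ (b ∸ x) * n ^ (n ∸ b))                    ≤⟨ *-monoʳ-≤ (b ^ x) (*-monoˡ-≤ (n ^ (n ∸ b)) (^-monoˡ-≤ (b ∸ x) b≤n)) ⟩
    b ^ x * (n ^ (b ∸ x) * n ^ (n ∸ b))                    ≡⟨ cong (b ^ x *_) (sym (^-distribˡ-+-* n (b ∸ x) (n ∸ b))) ⟩
    b ^ x * n ^ ((b ∸ x) + (n ∸ b))                        ≡⟨ cong (λ s → b ^ x * n ^ s) (+-cancelˡ-≡ x _ _ (trans (sym (+-assoc x (b ∸ x) (n ∸ b)))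
                                                              (trans (cong (_+ (n ∸ b)) (m+[n∸m]≡n x≤b)) (trans (m+[n∸m]≡n b≤n) (sym (m+[n∸m]≡n (≤-trans x≤b b≤n))))))) ⟩
    b ^ x * n ^ (n ∸ x)                                    ∎
    where
    x = length X
    x≤b : x ≤ b
    x≤b = ≤ᵇ-true eq

-- Probabilities of closed pairs and sparse cuts

-- If `u` blocks of `v` factors cover the exponent `q`, it can be raised to `v * u`, since each
-- surplus factor `B₁ / B` is at least `1`.
power-domination : ∀ B B₁ c v u q → 0 < B → B ≤ B₁ → B₁ ^ v ≤ c * B ^ v → q ≤ v * u → B₁ ^ q ≤ c ^ u * B ^ q
power-domination B B₁ c v u q 0<B B≤ h q≤ = cancel-pos {m = B ^ d} (^-pos d 0<B) (begin
  B ^ d * B₁ ^ q            ≤⟨ *-monoˡ-≤ (B₁ ^ q) (^-monoˡ-≤ d B≤) ⟩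
  B₁ ^ d * B₁ ^ q           ≡⟨ trans (sym (^-distribˡ-+-* B₁ d q)) (cong (B₁ ^_) (m∸n+n≡m q≤)) ⟩
  B₁ ^ (v * u)              ≡⟨ sym (^-*-assoc B₁ v u) ⟩
  (B₁ ^ v) ^ u              ≤⟨ ^-monoˡ-≤ u h ⟩
  (c * B ^ v) ^ u           ≡⟨ trans (^-distribʳ-* u c (B ^ v)) (cong (c ^ u *_) (trans (^-*-assoc B v u) (trans (cong (B ^_) (sym (m∸n+n≡m q≤))) (^-distribˡ-+-* B d q)))) ⟩
  c ^ u * (B ^ d * B ^ q)   ≡⟨ ring (c ^ u) (B ^ d) (B ^ q) ⟩
  B ^ d * (c ^ u * B ^ q)   ∎)
  where
  open ≤-Reasoning
  d = v * u ∸ q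
  ring : ∀ a b c → a * (b * c) ≡ b * (a * c)
  ring = solve-∀

-- Union bound over c₁ c₂ structures of size u: a constant-factor gain per unit of size.
union-bound : ∀ {A c₁ c₂ M} u {a a' b b' T P f g} → A * P ^ u ≤ c₁ * c₂ * (T ^ u * M) → c₁ * a ^ u ≤ a' ^ u → c₂ * b ^ u ≤ b' ^ u →
  a' * b' * T * g ≤ a * b * P * f → 0 < a → 0 < b → 0 < P → A * g ^ u ≤ f ^ u * M
union-bound {A} {c₁} {c₂} {M} u {a} {a'} {b} {b'} {T} {P} {f} {g} h h₁ h₂ unit 0<a 0<b 0<P =
  cancel-pos {m = (a * b * P) ^ u} (^-pos u (*-mono-≤ (*-mono-≤ 0<a 0<b) 0<P)) (begin
    (a * b * P) ^ u * (A * g ^ u)               ≡⟨ trans (cong (_* (A * g ^ u)) (three a b P)) (ring (a ^ u) (b ^ u) (P ^ u) A (g ^ u)) ⟩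
    A * P ^ u * (a ^ u * b ^ u * g ^ u)         ≤⟨ *-monoˡ-≤ (a ^ u * b ^ u * g ^ u) h ⟩
    c₁ * c₂ * (T ^ u * M) * (a ^ u * b ^ u * g ^ u) ≡⟨ ring₂ c₁ c₂ (T ^ u) M (a ^ u) (b ^ u) (g ^ u) ⟩
    (c₁ * a ^ u) * (c₂ * b ^ u) * T ^ u * g ^ u * M ≤⟨ *-monoˡ-≤ M (*-monoˡ-≤ (g ^ u) (*-monoˡ-≤ (T ^ u) (*-mono-≤ h₁ h₂))) ⟩
    a' ^ u * b' ^ u * T ^ u * g ^ u * M         ≡⟨ cong (_* M) (trans (cong (_* g ^ u) (sym (three a' b' T))) (sym (^-distribʳ-* u (a' * b' * T) g))) ⟩
    (a' * b' * T * g) ^ u * M                   ≤⟨ *-monoˡ-≤ M (^-monoˡ-≤ u unit) ⟩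
    (a * b * P * f) ^ u * M                     ≡⟨ trans (cong (_* M) (^-distribʳ-* u (a * b * P) f)) (*-assoc ((a * b * P) ^ u) (f ^ u) M) ⟩
    (a * b * P) ^ u * (f ^ u * M)               ∎)
  where
  open ≤-Reasoning
  three : ∀ x y w → (x * y * w) ^ u ≡ x ^ u * y ^ u * w ^ u
  three x y w = trans (^-distribʳ-* u (x * y) w) (cong (_* w ^ u) (^-distribʳ-* u x y))
  ring : ∀ a b p A g → a * b * p * (A * g) ≡ A * p * (a * b * g)
  ring = solve-∀
  ring₂ : ∀ c d t M a b g → c * d * (t * M) * (a * b * g) ≡ (c * a) * (d * b) * t * g * M
  ring₂ = solve-∀

subs-count-≤ : ∀ {n} u → 0 < n → u ≤ n → ∑ (subs u (V {n})) (λ _ → 1) * u ^ u ≤ (3 * n) ^ u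
subs-count-≤ {n} u 0<n u≤n = ≤-trans (*-monoˡ-≤ (u ^ u) (≤-trans (≤-reflexive (∑-subs u (V {n}) (λ _ → 1)))
  (∑-mono (sublists (V {n})) (λ S → ≤-trans (≤-reflexive (*-identityʳ (𝟙 (length S ≡ᵇ u)))) (𝟙-mono {length S ≡ᵇ u} (λ e → ≤ᵇ-intro (≤-reflexive (≡ᵇ-true {length S} e)))))))) (sublists-count {n} u 0<n u≤n)

sublist-size : ∀ {n} {U : List (Fin n)} → U ∈ sublists V → ∑ V (λ v → 𝟙 (memV v U)) ≡ length U
sublist-size {n} {U} U∈ = trans (sym (length-canon (λ v → memV v U))) (canon-memV-length (sublists-unique (allFin-unique n) U∈))

if-weight : ∀ (b : Bool) l m → l + m * (if b then 0 else 1) ≡ (if b then l else l + m)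
if-weight true l m = trans (cong (l +_) (*-zeroʳ m)) (+-identityʳ l)
if-weight false l m = cong (l +_) (*-identityʳ m)

module _ {n m l : ℕ} (total : m + l ≡ length (allPairs n)) (0<l : 0 < l) where
  private
    L = allPairs n
    N = m + l

  N^-split : ∀ (p : Edge n → Bool) x q → ∑ L (𝟙 ∘ p) ≡ q → ∏ L (λ e → if p e then x else N) ≡ x ^ q * N ^ (N ∸ q)
  N^-split p x q refl = trans (∏-if p L x N) (cong (λ s → x ^ ∑ L (𝟙 ∘ p) * N ^ s) (trans (sym (m+n∸m≡n (∑ L (𝟙 ∘ p)) _)) (cong (_∸ ∑ L (𝟙 ∘ p)) (trans (∑-not p L) (sym total)))))

  -- At least `ρ` vertices lie outside `U ∪ X`, so at least `|U| ρ` pairs are forbidden; in the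
  -- product each contributes `l` instead of `N`.
  closed-one : ∀ U X ρ h j y → U ∈ sublists (V {n}) → X ∈ sublists (V {n}) → length U + length X + ρ ≤ n → l ^ j * suc h ≤ N ^ j * h → y * j ≤ length U * ρ →
    m ^ m * l ^ l * ∑ (subs m L) (λ H → ∏ H (λ e → if escapes U X e then 0 else 1)) * suc h ^ y ≤ N ^ N * h ^ y
  closed-one U X ρ h j y U∈ X∈ sizes block yj = begin
    m ^ m * l ^ l * ∑ (subs m L) (λ H → ∏ H (λ e → if escapes U X e then 0 else 1)) * suc h ^ y
      ≤⟨ *-monoˡ-≤ (suc h ^ y) (subs-∏-bound m l _ L m l total) ⟩
    ∏ L (λ e → l + m * (if escapes U X e then 0 else 1)) * suc h ^ y
      ≡⟨ cong (_* suc h ^ y) (trans (∏-cong L (λ e → trans (if-weight (escapes U X e) l m) (cong (λ s → if escapes U X e then l else s) (+-comm l m)))) (N^-split (escapes U X) l q refl)) ⟩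
    l ^ q * N ^ (N ∸ q) * suc h ^ y
      ≡⟨ ring (l ^ q) (N ^ (N ∸ q)) (suc h ^ y) ⟩
    l ^ q * suc h ^ y * N ^ (N ∸ q)
      ≤⟨ *-monoˡ-≤ (N ^ (N ∸ q)) (block-power l N h j y q (m≤n+m l m) block (≤-trans yj q≥)) ⟩
    N ^ q * h ^ y * N ^ (N ∸ q)
      ≡⟨ trans (ring (N ^ q) (h ^ y) (N ^ (N ∸ q))) (cong (_* h ^ y) (trans (sym (^-distribˡ-+-* N q (N ∸ q))) (cong (N ^_) (m+[n∸m]≡n q≤N)))) ⟩
    N ^ N * h ^ y ∎
    where
    open ≤-Reasoning
    q = ∑ L (𝟙 ∘ escapes U X)
    ring : ∀ a b c → a * b * c ≡ a * c * b
    ring = solve-∀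
    q≤N : q ≤ N
    q≤N = ≤-trans (∑-mono L (λ e → 𝟙≤1 (escapes U X e))) (≤-reflexive (trans (sym (length-∑ L)) (sym total)))
    far = ∑ (V {n}) (λ v → 𝟙 (not (memV v U ∨ memV v X)))
    near = ∑ (V {n}) (λ v → 𝟙 (memV v U ∨ memV v X))
    near≤ : near ≤ length U + length X
    near≤ = ≤-trans (∑-mono (V {n}) (λ v → 𝟙-∨ (memV v U) (memV v X))) (≤-reflexive (trans (∑-+ (V {n}) (λ v → 𝟙 (memV v U)) (λ v → 𝟙 (memV v X))) (cong₂ _+_ (sublist-size U∈) (sublist-size X∈))))
      where
      𝟙-∨ : ∀ a b → 𝟙 (a ∨ b) ≤ 𝟙 a + 𝟙 b
      𝟙-∨ true b = s≤s z≤n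
      𝟙-∨ false b = ≤-refl
    ρ≤far : ρ ≤ far
    ρ≤far = +-cancelˡ-≤ near ρ far (≤-trans (≤-trans (+-monoˡ-≤ ρ near≤) sizes) (≤-reflexive (sym (trans (∑-not (λ v → memV v U ∨ memV v X) (V {n})) length-V))))
    q≥ : length U * ρ ≤ q
    q≥ = ≤-trans (*-monoʳ-≤ (length U) ρ≤far) (≤-reflexive (trans (cong (_* far) (sym (sublist-size U∈)))
      (sym (between-count (λ v → memV v U) (λ v → not (memV v U ∨ memV v X)) (λ v a b → not-true b (∨-introˡ a))))))

  closed-fixed : ℕ → ℕ → ℕ → ℕ
  closed-fixed z ℓ u = ∑ (subs u (V {n})) (λ U → ∑ (sublists (V {n})) (λ X → ∑ (subs m L) (λ H → closedPair z ℓ H U X)))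

  closed-pairs-bound : ∀ z ℓ w M → (∀ u → z ≤ u → u ≤ ℓ → m ^ m * l ^ l * closed-fixed z ℓ u * w ≤ M) →
    m ^ m * l ^ l * ∑ (subs m L) (closedPairs z ℓ) * w ≤ suc n * M
  closed-pairs-bound z ℓ w M hyp = begin
    W * ∑ (subs m L) (closedPairs z ℓ) * w
      ≡⟨ cong (λ s → W * s * w) (trans (∑-swap (subs m L) SV _) (∑-cong SV (λ U → ∑-swap (subs m L) SV _))) ⟩
    W * ∑ SV F * w
      ≡⟨ cong (λ s → W * s * w) (∑-cong SV (λ U → sym (*-identityˡ (F U)))) ⟩
    W * ∑ SV (λ U → 1 * F U) * w
      ≤⟨ *-monoˡ-≤ w (*-monoʳ-≤ W (∑-by-length (λ _ → 1) (V {n}) F)) ⟩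
    W * ∑ (upTo (suc (length (V {n})))) (λ u → 1 * ∑ (subs u (V {n})) F) * w
      ≡⟨ trans (cong (_* w) (sym (∑-*ˡ W (upTo (suc (length (V {n})))) (λ u → 1 * ∑ (subs u (V {n})) F)))) (sym (∑-*ʳ w (upTo (suc (length (V {n})))) (λ u → W * (1 * ∑ (subs u (V {n})) F)))) ⟩
    ∑ (upTo (suc (length (V {n})))) (λ u → W * (1 * ∑ (subs u (V {n})) F) * w)
      ≤⟨ ∑-mono (upTo (suc (length (V {n})))) per-u ⟩
    ∑ (upTo (suc (length (V {n})))) (λ _ → M)
      ≡⟨ trans (∑-const (upTo (suc (length (V {n})))) M) (cong (λ s → s * M) (trans (length-upTo (suc (length (V {n})))) (cong suc (length-V {n})))) ⟩
    suc n * M ∎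
    where
    open ≤-Reasoning
    W = m ^ m * l ^ l
    SV = sublists (V {n})
    F : List (Fin n) → ℕ
    F U = ∑ SV (λ X → ∑ (subs m L) (λ H → closedPair z ℓ H U X))
    vanish : ∀ U → (length U < z) ⊎ (ℓ < length U) → F U ≡ 0
    vanish U out = trans (∑-cong SV (λ X → trans (∑-cong (subs m L) (λ H → cong (_* ∏ H (λ e → if escapes U X e then 0 else 1)) (zero-cond X))) (∑-0 (subs m L)))) (∑-0 SV)
      where
      zero-cond : ∀ X → 𝟙 ((z ≤ᵇ length U) ∧ (length U ≤ᵇ ℓ) ∧ (length X ≤ᵇ 2 * length U + z)) ≡ 0
      zero-cond X = cong 𝟙 (≢true (λ e → case out of λ
        { (inj₁ U<z) → <⇒≱ U<z (≤ᵇ-true {z} (proj₁ (∧-true e)))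
        ; (inj₂ ℓ<U) → <⇒≱ ℓ<U (≤ᵇ-true (proj₁ (∧-true (proj₂ (∧-true {z ≤ᵇ length U} e))))) }))
    empty : ∀ u → (u < z) ⊎ (ℓ < u) → W * (1 * ∑ (subs u (V {n})) F) * w ≤ M
    empty u out = ≤-trans (≤-reflexive (cong (_* w) (trans (cong (λ s → W * (1 * s)) (trans (∑-cong∈ (subs u (V {n})) (λ U U∈ → vanish U (subst (λ s → (s < z) ⊎ (ℓ < s)) (sym (proj₂ (∈-subs {L = V {n}} U∈))) out))) (∑-0 (subs u (V {n}))))) (*-zeroʳ W)))) z≤n
    per-u : ∀ u → W * (1 * ∑ (subs u (V {n})) F) * w ≤ M
    per-u u with ≤-<-connex z u
    ... | inj₂ u<z = empty u (inj₁ u<z)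
    ... | inj₁ z≤u with ≤-<-connex u ℓ
    ... | inj₂ ℓ<u = empty u (inj₂ ℓ<u)
    ... | inj₁ u≤ℓ = subst (λ s → W * s * w ≤ M) (sym (*-identityˡ _)) (hyp u z≤u u≤ℓ)

  closed-pair-bound : ∀ z ℓ u b ρ h j y → 2 * u + z ≤ b → u + b + ρ ≤ n → l ^ j * suc h ≤ N ^ j * h → y * j ≤ u * ρ → ∀ U X → U ∈ subs u (V {n}) → X ∈ sublists (V {n}) →
    m ^ m * l ^ l * ∑ (subs m L) (λ H → closedPair z ℓ H U X) * suc h ^ y ≤ 𝟙 (length X ≤ᵇ b) * (N ^ N * h ^ y)
  closed-pair-bound z ℓ u b ρ h j y b≥ sizes block yj U X U∈ X∈ with ∈-subs {L = V {n}} U∈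
  ... | U∈' , refl with true? (length X ≤ᵇ b)
  ... | no ¬e = ≤-trans (≤-reflexive (cong (_* suc h ^ y) (trans (cong (m ^ m * l ^ l *_) (trans (∑-cong (subs m L) (λ H → cong (_* ∏ H (λ e → if escapes U X e then 0 else 1)) zero-cond)) (∑-0 (subs m L)))) (*-zeroʳ (m ^ m * l ^ l))))) z≤n
    where
    zero-cond : 𝟙 ((z ≤ᵇ length U) ∧ (length U ≤ᵇ ℓ) ∧ (length X ≤ᵇ 2 * length U + z)) ≡ 0
    zero-cond = cong 𝟙 (≢true (λ e → ¬e (≤ᵇ-intro (≤-trans (≤ᵇ-true {length X} (proj₂ (∧-true {length U ≤ᵇ ℓ} (proj₂ (∧-true {z ≤ᵇ length U} e))))) b≥))))
  ... | yes e = subst (m ^ m * l ^ l * ∑ (subs m L) (λ H → closedPair z ℓ H U X) * suc h ^ y ≤_) (sym (trans (cong (λ s → 𝟙 s * (N ^ N * h ^ y)) e) (*-identityˡ (N ^ N * h ^ y))))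
    (≤-trans (*-monoˡ-≤ (suc h ^ y) (*-monoʳ-≤ (m ^ m * l ^ l) (∑-mono (subs m L) (λ H →
        ≤-trans (*-monoˡ-≤ (∏ H (λ e → if escapes U X e then 0 else 1)) (𝟙≤1 ((z ≤ᵇ length U) ∧ (length U ≤ᵇ ℓ) ∧ (length X ≤ᵇ 2 * length U + z)))) (≤-reflexive (*-identityˡ _))))))
      (closed-one U X ρ h j y U∈' X∈ (≤-trans (+-monoˡ-≤ ρ (+-monoʳ-≤ (length U) (≤ᵇ-true {length X} e))) sizes) block yj))

  -- Medium sets: at most 3u vertices are avoided and each vertex contributes y blocks.
  closed-medium : ∀ z ℓ u h j y → 0 < n → 0 < u → z ≤ u → 4 * u ≤ n → l ^ j * suc h ≤ N ^ j * h → y * j + 4 * u ≤ n →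
    3 * n * (3 * n) ^ 3 * h ^ y * 2 ≤ u * (3 * u) ^ 3 * suc h ^ y * 1 → m ^ m * l ^ l * closed-fixed z ℓ u * 2 ^ u ≤ N ^ N
  closed-medium z ℓ u h j y 0<n 0<u z≤u 4u≤n block yj unit = subst (m ^ m * l ^ l * closed-fixed z ℓ u * 2 ^ u ≤_) (trans (cong (_* N ^ N) (^-zeroˡ u)) (*-identityˡ (N ^ N)))
    (union-bound {A = m ^ m * l ^ l * closed-fixed z ℓ u} {c₁ = c₁} {c₂ = c₂} {M = N ^ N} u {a = u} {b = (3 * u) ^ 3} {b' = (3 * n) ^ 3} {T = h ^ y} {P = suc h ^ y} {f = 1} {g = 2} main
      (subs-count-≤ {n} u 0<n (≤-trans (m≤m+n u (3 * u)) 4u≤n)) cube unit 0<u (^-pos 3 (*-mono-≤ {1} {3} (s≤s z≤n) 0<u)) (^-pos y (s≤s z≤n)))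
    where
    W = m ^ m * l ^ l
    SV = sublists (V {n})
    c₁ = ∑ (subs u (V {n})) (λ _ → 1)
    c₂ = ∑ SV (λ X → 𝟙 (length X ≤ᵇ 3 * u))
    cube : c₂ * ((3 * u) ^ 3) ^ u ≤ ((3 * n) ^ 3) ^ u
    cube = subst₂ _≤_ (cong (c₂ *_) (sym (^-*-assoc (3 * u) 3 u))) (sym (^-*-assoc (3 * n) 3 u)) (sublists-count {n} (3 * u) 0<n (≤-trans (m≤n+m (3 * u) u) 4u≤n))
    B₀ = (h ^ y) ^ u * N ^ N
    per-UX : ∀ U X → U ∈ subs u (V {n}) → X ∈ SV → W * ∑ (subs m L) (λ H → closedPair z ℓ H U X) * (suc h ^ y) ^ u ≤ 𝟙 (length X ≤ᵇ 3 * u) * B₀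
    per-UX U X U∈ X∈ = subst₂ (λ s t → W * ∑ (subs m L) (λ H → closedPair z ℓ H U X) * s ≤ 𝟙 (length X ≤ᵇ 3 * u) * t)
      (sym (^-*-assoc (suc h) y u)) (trans (*-comm (N ^ N) _) (cong (_* N ^ N) (sym (^-*-assoc h y u))))
      (closed-pair-bound z ℓ u (3 * u) (y * j) h j (y * u) (≤-trans (+-monoʳ-≤ (2 * u) z≤u) (≤-reflexive (ring₁ u)))
        (≤-trans (≤-reflexive (+-comm (4 * u) (y * j))) yj) block (≤-reflexive (ring₂ y u j)) U X U∈ X∈)
      where
      ring₁ : ∀ u → 2 * u + u ≡ 3 * u
      ring₁ = solve-∀
      ring₂ : ∀ y u j → y * u * j ≡ u * (y * j)
      ring₂ = solve-∀
    main : W * closed-fixed z ℓ u * (suc h ^ y) ^ u ≤ c₁ * c₂ * B₀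
    main = begin
      W * closed-fixed z ℓ u * P
        ≡⟨ trans (cong (_* P) (sym (∑-*ˡ W (subs u (V {n})) _))) (sym (∑-*ʳ P (subs u (V {n})) _)) ⟩
      ∑ (subs u (V {n})) (λ U → W * ∑ SV (λ X → ∑ (subs m L) (λ H → closedPair z ℓ H U X)) * P)
        ≤⟨ ∑-mono∈ (subs u (V {n})) (λ U U∈ → ≤-trans (≤-reflexive (trans (cong (_* P) (sym (∑-*ˡ W SV _))) (sym (∑-*ʳ P SV _)))) (∑-mono∈ SV (λ X → per-UX U X U∈))) ⟩
      ∑ (subs u (V {n})) (λ U → ∑ SV (λ X → 𝟙 (length X ≤ᵇ 3 * u) * B₀))
        ≡⟨ trans (∑-cong (subs u (V {n})) (λ U → trans (∑-*ʳ B₀ SV _) (sym (*-identityˡ (c₂ * B₀))))) (∑-*ʳ (c₂ * B₀) (subs u (V {n})) (λ _ → 1)) ⟩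
      c₁ * (c₂ * B₀)
        ≡⟨ sym (*-assoc c₁ c₂ B₀) ⟩
      c₁ * c₂ * B₀ ∎
      where
      open ≤-Reasoning
      P = (suc h ^ y) ^ u

  -- Large sets: crude union over all pairs of vertex sets.
  closed-large : ∀ z ℓ u ρ h j y w → 3 * u + z + ρ ≤ n → l ^ j * suc h ≤ N ^ j * h → y * j ≤ u * ρ → 2 ^ n * 2 ^ n * h ^ y * w ≤ suc h ^ y →
    m ^ m * l ^ l * closed-fixed z ℓ u * w ≤ N ^ N
  closed-large z ℓ u ρ h j y w sizes block yj growth = cancel-pos {m = suc h ^ y} (^-pos y (s≤s z≤n)) (begin
    P * (W * closed-fixed z ℓ u * w)
      ≡⟨ ring₁ P W (closed-fixed z ℓ u) w ⟩
    W * closed-fixed z ℓ u * P * w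
      ≡⟨ cong (_* w) (trans (cong (_* P) (sym (∑-*ˡ W (subs u (V {n})) _))) (sym (∑-*ʳ P (subs u (V {n})) _))) ⟩
    ∑ (subs u (V {n})) (λ U → W * ∑ SV (λ X → ∑ (subs m L) (λ H → closedPair z ℓ H U X)) * P) * w
      ≤⟨ *-monoˡ-≤ w (∑-mono∈ (subs u (V {n})) (λ U U∈ → ≤-trans (≤-reflexive (trans (cong (_* P) (sym (∑-*ˡ W SV _))) (sym (∑-*ʳ P SV _)))) (∑-mono∈ SV (λ X X∈ →
           ≤-trans (closed-pair-bound z ℓ u (2 * u + z) ρ h j y ≤-refl (≤-trans (≤-reflexive (ring₂ u z ρ)) sizes) block yj U X U∈ X∈)
             (≤-trans (*-monoˡ-≤ B₀ (𝟙≤1 (length X ≤ᵇ 2 * u + z))) (≤-reflexive (*-identityˡ B₀))))))) ⟩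
    ∑ (subs u (V {n})) (λ U → ∑ SV (λ X → B₀)) * w
      ≤⟨ *-monoˡ-≤ w (≤-trans (≤-reflexive (∑-subs u (V {n}) (λ _ → ∑ SV (λ X → B₀)))) (∑-mono SV (λ U → ≤-trans (*-monoˡ-≤ (∑ SV (λ X → B₀)) (𝟙≤1 (length U ≡ᵇ u))) (≤-reflexive (*-identityˡ _))))) ⟩
    ∑ SV (λ U → ∑ SV (λ X → B₀)) * w
      ≡⟨ cong (_* w) (trans (∑-const SV (∑ SV (λ X → B₀))) (trans (cong (length SV *_) (∑-const SV B₀)) (cong (λ s → s * (s * B₀)) length-SV))) ⟩
    2 ^ n * (2 ^ n * (N ^ N * h ^ y)) * w
      ≡⟨ ring₃ (2 ^ n) (N ^ N) (h ^ y) w ⟩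
    2 ^ n * 2 ^ n * h ^ y * w * N ^ N
      ≤⟨ *-monoˡ-≤ (N ^ N) growth ⟩
    P * N ^ N ∎)
    where
    open ≤-Reasoning
    W = m ^ m * l ^ l
    SV = sublists (V {n})
    P = suc h ^ y
    B₀ = N ^ N * h ^ y
    length-sublists : ∀ (M : List (Fin n)) → length (sublists M) ≡ 2 ^ length M
    length-sublists [] = refl
    length-sublists (x ∷ M) = trans (length-++ (map (x ∷_) (sublists M)) {sublists M}) (trans (cong₂ _+_ (trans (length-map (x ∷_) (sublists M)) (length-sublists M)) (length-sublists M)) (cong (2 ^ length M +_) (sym (+-identityʳ _))))
    length-SV : length SV ≡ 2 ^ n
    length-SV = trans (length-sublists (V {n})) (cong (2 ^_) (length-V {n}))
    ring₁ : ∀ p w c v → p * (w * c * v) ≡ w * c * p * v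
    ring₁ = solve-∀
    ring₂ : ∀ u z ρ → u + (2 * u + z) + ρ ≡ 3 * u + z + ρ
    ring₂ = solve-∀
    ring₃ : ∀ t N h w → t * (t * (N * h)) * w ≡ t * t * h * w * N
    ring₃ = solve-∀

  -- Exponential moments for the lower tail: each crossing edge has weight `1/2`, scaled to `1`
  -- against `2`. The event of at most `(k - 1) z` crossing edges costs `2^((k-1) z)`, and each
  -- crossing pair contributes `(2l + m) / (2N)`.
  sparse-bound : ∀ k z h j y {f g} → 0 < n → 0 < z → (2 * l + m) ^ j * suc h ≤ (2 * N) ^ j * h → y * j + z ≤ n →
    3 * n * 1 * (2 ^ (k ∸ 1) * h ^ y) * g ≤ z * 1 * suc h ^ y * f → m ^ m * l ^ l * ∑ (subs m L) (sparseCuts k z) * g ^ z ≤ f ^ z * N ^ N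
  sparse-bound k z h j y {f} {g} 0<n 0<z block yj unit = union-bound {A = m ^ m * l ^ l * ∑ (subs m L) (sparseCuts k z)} {c₁ = c₁} {c₂ = 1} {M = N ^ N} z
      {a = z} {b = 1} {b' = 1} {T = 2 ^ (k ∸ 1) * h ^ y} {P = suc h ^ y} main (subs-count-≤ {n} z 0<n (≤-trans (m≤n+m z (y * j)) yj))
      (≤-reflexive (*-identityˡ (1 ^ z))) unit 0<z (s≤s z≤n) (^-pos y (s≤s z≤n))
    where
    open ≤-Reasoning
    W = m ^ m * l ^ l
    SV = sublists (V {n})
    c₁ = ∑ (subs z (V {n})) (λ _ → 1)
    c = (k ∸ 1) * z
    M₀ = (2 ^ (k ∸ 1) * h ^ y) ^ z * N ^ N
    rate : List (Fin n) → Edge n → ℕ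
    rate Z e = if cross (λ v → memV v Z) e then 1 else 2
    one-graph : ∀ Z H → H ∈ subs m L → 2 ^ m * 𝟙 (∑ H (𝟙 ∘ cross (λ v → memV v Z)) ≤ᵇ c) ≤ 2 ^ c * ∏ H (rate Z)
    one-graph Z H H∈ with ∑ H (𝟙 ∘ cross (λ v → memV v Z)) ≤ᵇ c in eq
    ... | false = ≤-trans (≤-reflexive (*-zeroʳ (2 ^ m))) z≤n
    ... | true = begin
      2 ^ m * 1 ≡⟨ trans (*-identityʳ (2 ^ m)) (cong (2 ^_) (trans (sym (proj₂ (∈-subs {L = L} H∈))) (sym (∑-not (cross (λ v → memV v Z)) H)))) ⟩
      2 ^ (a + b) ≡⟨ ^-distribˡ-+-* 2 a b ⟩
      2 ^ a * 2 ^ b ≤⟨ *-monoˡ-≤ (2 ^ b) (^-monoʳ-≤ 2 (≤ᵇ-true {a} eq)) ⟩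
      2 ^ c * 2 ^ b ≡⟨ cong (2 ^ c *_) (sym (trans (∏-if (cross (λ v → memV v Z)) H 1 2) (trans (cong (_* 2 ^ b) (^-zeroˡ a)) (*-identityˡ (2 ^ b))))) ⟩
      2 ^ c * ∏ H (rate Z) ∎
      where
      a = ∑ H (𝟙 ∘ cross (λ v → memV v Z))
      b = ∑ H (𝟙 ∘ not ∘ cross (λ v → memV v Z))
    rate-weight : ∀ b → 2 * l + m * (if b then 1 else 2) ≡ (if b then 2 * l + m else 2 * N)
    rate-weight true = cong (2 * l +_) (*-identityʳ m)
    rate-weight false = trans (cong (2 * l +_) (*-comm m 2)) (trans (sym (*-distribˡ-+ 2 l m)) (cong (2 *_) (+-comm l m)))
    per-Z : ∀ Z → Z ∈ subs z (V {n}) → W * ∑ (subs m L) (λ H → 𝟙 (∑ H (𝟙 ∘ cross (λ v → memV v Z)) ≤ᵇ c)) * (suc h ^ y) ^ z ≤ M₀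
    per-Z Z Z∈ = cancel-pos {m = 2 ^ N} (^-pos N (s≤s z≤n)) (begin
      2 ^ N * (W * D * (suc h ^ y) ^ z)
        ≡⟨ cong₂ (λ s t → s * (W * D * t)) (^-distribˡ-+-* 2 m l) (^-*-assoc (suc h) y z) ⟩
      2 ^ m * 2 ^ l * (W * D * suc h ^ (y * z))
        ≡⟨ ring₁ (2 ^ m) (2 ^ l) (m ^ m) (l ^ l) D (suc h ^ (y * z)) ⟩
      m ^ m * (2 ^ l * l ^ l) * (2 ^ m * D) * suc h ^ (y * z)
        ≤⟨ *-monoˡ-≤ (suc h ^ (y * z)) (*-mono-≤ (≤-reflexive (cong (m ^ m *_) (sym (^-distribʳ-* l 2 l)))) (≤-trans (≤-reflexive (sym (∑-*ˡ (2 ^ m) (subs m L) _)))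
             (≤-trans (∑-mono∈ (subs m L) (one-graph Z)) (≤-reflexive (∑-*ˡ (2 ^ c) (subs m L) _))))) ⟩
      m ^ m * (2 * l) ^ l * (2 ^ c * ∑ (subs m L) (λ H → ∏ H (rate Z))) * suc h ^ (y * z)
        ≡⟨ ring₂ (m ^ m * (2 * l) ^ l) (2 ^ c) _ (suc h ^ (y * z)) ⟩
      2 ^ c * (m ^ m * (2 * l) ^ l * ∑ (subs m L) (λ H → ∏ H (rate Z)) * suc h ^ (y * z))
        ≤⟨ *-monoʳ-≤ (2 ^ c) (*-monoˡ-≤ (suc h ^ (y * z)) (subs-∏-bound m (2 * l) (rate Z) L m l total)) ⟩
      2 ^ c * (∏ L (λ e → 2 * l + m * rate Z e) * suc h ^ (y * z))
        ≡⟨ cong (λ s → 2 ^ c * (s * suc h ^ (y * z))) (trans (∏-cong L (λ e → rate-weight (cross (λ v → memV v Z) e))) (trans (∏-if (cross (λ v → memV v Z)) L (2 * l + m) (2 * N)) (cong (λ s → (2 * l + m) ^ q * (2 * N) ^ s) rest))) ⟩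
      2 ^ c * ((2 * l + m) ^ q * (2 * N) ^ (N ∸ q) * suc h ^ (y * z))
        ≡⟨ ring₃ (2 ^ c) ((2 * l + m) ^ q) _ (suc h ^ (y * z)) ⟩
      2 ^ c * (((2 * l + m) ^ q * suc h ^ (y * z)) * (2 * N) ^ (N ∸ q))
        ≤⟨ *-monoʳ-≤ (2 ^ c) (*-monoˡ-≤ ((2 * N) ^ (N ∸ q)) (block-power (2 * l + m) (2 * N) h j (y * z) q l≤2N block yzj)) ⟩
      2 ^ c * ((2 * N) ^ q * h ^ (y * z) * (2 * N) ^ (N ∸ q))
        ≡⟨ ring₄ (2 ^ c) ((2 * N) ^ q) (h ^ (y * z)) _ ⟩
      2 ^ c * h ^ (y * z) * ((2 * N) ^ q * (2 * N) ^ (N ∸ q))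
        ≡⟨ cong₂ (λ s t → s * t) (trans (cong₂ _*_ (sym (^-*-assoc 2 (k ∸ 1) z)) (sym (^-*-assoc h y z))) (sym (^-distribʳ-* z (2 ^ (k ∸ 1)) (h ^ y))))
             (trans (sym (^-distribˡ-+-* (2 * N) q (N ∸ q))) (trans (cong ((2 * N) ^_) (m+[n∸m]≡n q≤N)) (^-distribʳ-* N 2 N))) ⟩
      (2 ^ (k ∸ 1) * h ^ y) ^ z * (2 ^ N * N ^ N)
        ≡⟨ ring₅ ((2 ^ (k ∸ 1) * h ^ y) ^ z) (2 ^ N) (N ^ N) ⟩
      2 ^ N * M₀ ∎)
      where
      D = ∑ (subs m L) (λ H → 𝟙 (∑ H (𝟙 ∘ cross (λ v → memV v Z)) ≤ᵇ c))
      q = ∑ L (𝟙 ∘ cross (λ v → memV v Z))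
      q≤N : q ≤ N
      q≤N = ≤-trans (∑-mono L (λ e → 𝟙≤1 (cross (λ v → memV v Z) e))) (≤-reflexive (trans (sym (length-∑ L)) (sym total)))
      rest : ∑ L (𝟙 ∘ not ∘ cross (λ v → memV v Z)) ≡ N ∸ q
      rest = trans (sym (m+n∸m≡n q _)) (cong (_∸ q) (trans (∑-not (cross (λ v → memV v Z)) L) (sym total)))
      l≤2N : 2 * l + m ≤ 2 * N
      l≤2N = ≤-trans (m≤m+n (2 * l + m) m) (≤-reflexive (ring₆ l m))
        where
        ring₆ : ∀ l m → 2 * l + m + m ≡ 2 * (m + l)
        ring₆ = solve-∀
      Z-size : ∑ (V {n}) (λ v → 𝟙 (memV v Z)) ≡ z
      Z-size = trans (sublist-size (proj₁ (∈-subs {L = V {n}} Z∈))) (proj₂ (∈-subs {L = V {n}} Z∈))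
      others = ∑ (V {n}) (λ v → 𝟙 (not (memV v Z)))
      q≡ : q ≡ z * others
      q≡ = trans (between-count (λ v → memV v Z) (λ v → not (memV v Z)) (λ v a b → not-true b a)) (cong (_* others) Z-size)
      others≥ : y * j ≤ others
      others≥ = +-cancelˡ-≤ z (y * j) others (≤-trans (≤-reflexive (+-comm z (y * j))) (≤-trans yj (≤-reflexive (trans (sym length-V) (trans (sym (∑-not (λ v → memV v Z) (V {n}))) (cong (_+ others) Z-size))))))
      yzj : y * z * j ≤ q
      yzj = ≤-trans (≤-reflexive (ring₇ y z j)) (≤-trans (*-monoʳ-≤ z others≥) (≤-reflexive (sym q≡)))
        where
        ring₇ : ∀ y z j → y * z * j ≡ z * (y * j)
        ring₇ = solve-∀
      ring₁ : ∀ a b c d e f → a * b * (c * d * e * f) ≡ c * (b * d) * (a * e) * f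
      ring₁ = solve-∀
      ring₂ : ∀ a b c d → a * (b * c) * d ≡ b * (a * c * d)
      ring₂ = solve-∀
      ring₃ : ∀ a b c d → a * (b * c * d) ≡ a * ((b * d) * c)
      ring₃ = solve-∀
      ring₄ : ∀ a b c d → a * (b * c * d) ≡ a * c * (b * d)
      ring₄ = solve-∀
      ring₅ : ∀ a b c → a * (b * c) ≡ b * (a * c)
      ring₅ = solve-∀
    main : W * ∑ (subs m L) (sparseCuts k z) * (suc h ^ y) ^ z ≤ c₁ * 1 * M₀
    main = begin
      W * ∑ (subs m L) (sparseCuts k z) * P
        ≡⟨ cong (λ s → W * s * P) (trans (∑-swap (subs m L) SV _) (trans (∑-cong SV (λ Z → ∑-*ˡ (𝟙 (length Z ≡ᵇ z)) (subs m L) _)) (sym (∑-subs z (V {n}) D)))) ⟩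
      W * ∑ (subs z (V {n})) D * P
        ≡⟨ trans (cong (_* P) (sym (∑-*ˡ W (subs z (V {n})) D))) (sym (∑-*ʳ P (subs z (V {n})) (λ Z → W * D Z))) ⟩
      ∑ (subs z (V {n})) (λ Z → W * D Z * P)
        ≤⟨ ∑-mono∈ (subs z (V {n})) (λ Z Z∈ → ≤-trans (per-Z Z Z∈) (≤-reflexive (sym (*-identityˡ M₀)))) ⟩
      ∑ (subs z (V {n})) (λ Z → 1 * M₀)
        ≡⟨ trans (∑-*ʳ M₀ (subs z (V {n})) (λ _ → 1)) (cong (_* M₀) (sym (*-identityʳ c₁))) ⟩
      c₁ * 1 * M₀ ∎
      where
      P = (suc h ^ y) ^ z
      D : List (Fin n) → ℕ
      D Z = ∑ (subs m L) (λ H → 𝟙 (∑ H (𝟙 ∘ cross (λ v → memV v Z)) ≤ᵇ c))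

-- Probability of dense pairs

module DegreeWeights {n : ℕ} (U X : List (Fin n)) (U∈ : U ∈ sublists V) (X∈ : X ∈ sublists V) (a b lam y₁ y₂ : ℕ)
  (X≤ : length X ≤ 2 * length U) (1≤lam : 1 ≤ lam) (0<B : 0 < b + a) (0<U : 0 < length U)
  (linear : 2 * length U * (a * lam) ≤ y₁ * (b + a)) (quadratic : length U * (a * (lam * lam)) ≤ 2 * y₂ * (b + a)) where

  private
    L = allPairs n
    u = length U
    base = b + a
    F₁ = base + a * lam
    F₂ = base + a * (lam * lam)
    inU inX : Fin n → Bool
    inU v = memV v U
    inX v = not (memV v U) ∧ memV v X
    straddles within : Edge n → Bool
    straddles = between inU inX
    within e = inU (proj₁ e) ∧ inU (proj₂ e)

  -- One spare factor `base` separates the pairs inside `U`, of weight `lam²`, from those between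
  -- `U` and `X`, of weight `lam`, so that each kind is estimated by its own product.
  factor : ∀ p q r s → base * (b + a * lam ^ (𝟙 (p ∧ (q ∨ s)) + 𝟙 (q ∧ (p ∨ r)))) ≤
    (if (p ∧ (not q ∧ s)) ∨ (q ∧ (not p ∧ r)) then F₁ else base) * (if p ∧ q then F₂ else base)
  factor true true r s = *-monoʳ-≤ base (+-mono-≤ (m≤m+n b a) (*-monoʳ-≤ a (≤-reflexive (cong (lam *_) (*-identityʳ lam)))))
  factor true false r true = ≤-trans (≤-reflexive (*-comm base _)) (*-monoˡ-≤ base (+-mono-≤ (m≤m+n b a) (*-monoʳ-≤ a (≤-reflexive (*-identityʳ lam)))))
  factor true false r false = *-monoʳ-≤ base (+-monoʳ-≤ b (≤-reflexive (*-identityʳ a)))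
  factor false true true s = ≤-trans (≤-reflexive (*-comm base _)) (*-monoˡ-≤ base (+-mono-≤ (m≤m+n b a) (*-monoʳ-≤ a (≤-reflexive (*-identityʳ lam)))))
  factor false true false s = *-monoʳ-≤ base (+-monoʳ-≤ b (≤-reflexive (*-identityʳ a)))
  factor false false r s = *-monoʳ-≤ base (+-monoʳ-≤ b (≤-reflexive (*-identityʳ a)))

  q₁ = ∑ L (𝟙 ∘ straddles)
  q₂ = ∑ L (𝟙 ∘ within)

  size-U : ∑ (V {n}) (𝟙 ∘ inU) ≡ u
  size-U = sublist-size U∈

  q₁≤ : q₁ ≤ 2 * u * u
  q₁≤ = ≤-trans (≤-reflexive (trans (between-count inU inX (λ v x y → not-true (proj₁ (∧-true y)) x)) (*-comm (∑ (V {n}) (𝟙 ∘ inU)) _)))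
    (*-mono-≤ (≤-trans (∑-mono (V {n}) (λ v → 𝟙-mono {inX v} {memV v X} (λ e → proj₂ (∧-true {not (memV v U)} e)))) (≤-trans (≤-reflexive (sublist-size X∈)) X≤)) (≤-reflexive size-U))

  q₂≤ : q₂ + q₂ ≤ u * u
  q₂≤ = ≤-trans (m≤m+n _ (∑ (V {n}) (λ i → 𝟙 (inU i ∧ inU i)))) (≤-reflexive (trans (∑-pairs-symmetric (λ i j → 𝟙 (inU i ∧ inU j)) (λ i j → cong 𝟙 (∧-swap (inU i) (inU j))))
    (trans (∑-cong (V {n}) (λ i → trans (∑-cong (V {n}) (λ j → 𝟙-∧ (inU i) (inU j))) (trans (∑-*ˡ (𝟙 (inU i)) (V {n}) (𝟙 ∘ inU)) (cong (𝟙 (inU i) *_) size-U))))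
      (trans (∑-*ʳ u (V {n}) (𝟙 ∘ inU)) (cong (_* u) size-U)))))
    where
    ∧-swap : ∀ a b → a ∧ b ≡ b ∧ a
    ∧-swap true true = refl
    ∧-swap true false = refl
    ∧-swap false true = refl
    ∧-swap false false = refl
    𝟙-∧ : ∀ a b → 𝟙 (a ∧ b) ≡ 𝟙 a * 𝟙 b
    𝟙-∧ true b = sym (+-identityʳ (𝟙 b))
    𝟙-∧ false b = refl

  N = length L

  first : ∏ L (λ e → if straddles e then F₁ else base) ≤ (3 ^ y₁) ^ u * base ^ N
  first = begin
    ∏ L (λ e → if straddles e then F₁ else base)          ≡⟨ ∏-if straddles L F₁ base ⟩
    F₁ ^ q₁ * base ^ ∑ L (𝟙 ∘ not ∘ straddles)            ≤⟨ *-monoˡ-≤ _ (power-domination base F₁ (3 ^ y₁) (2 * u) u q₁ 0<B (m≤m+n base (a * lam))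
                                                          (exp-bound (2 * u) (a * lam) base y₁ (*-mono-≤ {1} {2} (s≤s z≤n) 0<U) linear) q₁≤) ⟩
    (3 ^ y₁) ^ u * base ^ q₁ * base ^ ∑ L (𝟙 ∘ not ∘ straddles) ≡⟨ trans (*-assoc ((3 ^ y₁) ^ u) _ _) (cong ((3 ^ y₁) ^ u *_) (trans (sym (^-distribˡ-+-* base q₁ _)) (cong (base ^_) (∑-not straddles L)))) ⟩
    (3 ^ y₁) ^ u * base ^ N ∎
    where open ≤-Reasoning

  second : ∏ L (λ e → if within e then F₂ else base) ≤ (3 ^ y₂) ^ u * base ^ N
  second = begin
    ∏ L (λ e → if within e then F₂ else base)          ≡⟨ ∏-if within L F₂ base ⟩
    F₂ ^ q₂ * base ^ ∑ L (𝟙 ∘ not ∘ within)            ≤⟨ *-monoˡ-≤ _ half ⟩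
    (3 ^ y₂) ^ u * base ^ q₂ * base ^ ∑ L (𝟙 ∘ not ∘ within) ≡⟨ trans (*-assoc ((3 ^ y₂) ^ u) _ _) (cong ((3 ^ y₂) ^ u *_) (trans (sym (^-distribˡ-+-* base q₂ _)) (cong (base ^_) (∑-not within L)))) ⟩
    (3 ^ y₂) ^ u * base ^ N ∎
    where
    open ≤-Reasoning
    square : ∀ c x → (c * x) * (c * x) ≡ (c * c) * (x * x)
    square = solve-∀
    -- At most `u²/2` pairs lie inside `U`. To avoid halves the bound is proved for the squares,
    -- where the exponent `q₂ + q₂` is at most `u * u`.
    half : F₂ ^ q₂ ≤ (3 ^ y₂) ^ u * base ^ q₂
    half = ≤-from-squares (begin
      F₂ ^ q₂ * F₂ ^ q₂                            ≡⟨ sym (^-distribˡ-+-* F₂ q₂ q₂) ⟩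
      F₂ ^ (q₂ + q₂)                               ≤⟨ power-domination base F₂ (3 ^ (2 * y₂)) u u (q₂ + q₂) 0<B (m≤m+n base (a * (lam * lam))) (exp-bound u (a * (lam * lam)) base (2 * y₂) 0<U quadratic) q₂≤ ⟩
      (3 ^ (2 * y₂)) ^ u * base ^ (q₂ + q₂)        ≡⟨ cong₂ _*_ (trans (cong (_^ u) (trans (cong (3 ^_) (cong (y₂ +_) (+-identityʳ y₂))) (^-distribˡ-+-* 3 y₂ y₂))) (^-distribʳ-* u (3 ^ y₂) (3 ^ y₂))) (^-distribˡ-+-* base q₂ q₂) ⟩
      (3 ^ y₂) ^ u * (3 ^ y₂) ^ u * (base ^ q₂ * base ^ q₂) ≡⟨ sym (square ((3 ^ y₂) ^ u) (base ^ q₂)) ⟩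
      (3 ^ y₂) ^ u * base ^ q₂ * ((3 ^ y₂) ^ u * base ^ q₂) ∎)

  degree-product : ∏ L (λ e → b + a * lam ^ degreeIn U X e) ≤ (3 ^ (y₁ + y₂)) ^ u * base ^ N
  degree-product = cancel-pos {m = base ^ N} (^-pos N 0<B) (begin
    base ^ N * ∏ L (λ e → b + a * lam ^ degreeIn U X e)     ≡⟨ trans (cong (_* ∏ L (λ e → b + a * lam ^ degreeIn U X e)) (sym (∏-const L base))) (sym (∏-* L (λ _ → base) _)) ⟩
    ∏ L (λ e → base * (b + a * lam ^ degreeIn U X e))       ≤⟨ ∏-mono∈ L (λ { (i , j) _ → factor (memV i U) (memV j U) (memV i X) (memV j X) }) ⟩
    ∏ L (λ e → (if straddles e then F₁ else base) * (if within e then F₂ else base)) ≡⟨ ∏-* L _ _ ⟩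
    ∏ L (λ e → if straddles e then F₁ else base) * ∏ L (λ e → if within e then F₂ else base) ≤⟨ *-mono-≤ first second ⟩
    (3 ^ y₁) ^ u * base ^ N * ((3 ^ y₂) ^ u * base ^ N)     ≡⟨ ring ((3 ^ y₁) ^ u) ((3 ^ y₂) ^ u) (base ^ N) ⟩
    base ^ N * ((3 ^ y₁) ^ u * (3 ^ y₂) ^ u * base ^ N)     ≡⟨ cong (λ s → base ^ N * (s * base ^ N)) (trans (sym (^-distribʳ-* u (3 ^ y₁) (3 ^ y₂))) (cong (_^ u) (sym (^-distribˡ-+-* 3 y₁ y₂)))) ⟩
    base ^ N * ((3 ^ (y₁ + y₂)) ^ u * base ^ N) ∎)
    where
    open ≤-Reasoning
    ring : ∀ p q b → p * b * (q * b) ≡ b * (p * q * b)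
    ring = solve-∀

nonEdges : ∀ {n} → List (Edge n) → List (Edge n)
nonEdges {n} H = filterᵇ (λ e → not (memE e H)) (allPairs n)

nonEdges-length : ∀ {n m l} {H : List (Edge n)} → m + l ≡ length (allPairs n) → H ∈ subs m (allPairs n) → length (nonEdges H) ≡ l
nonEdges-length {n} {m} {l} {H} total H∈ with ∈-subs {L = allPairs n} H∈
... | H∈' , refl = +-cancelʳ-≡ m _ _ (trans (cong (_+ m) (length-filter-∑ (λ e → not (memE e H)) (allPairs n)))
  (trans (∑-∉-sublist (allPairs n) allPairs-unique H∈') (trans (sym total) (+-comm m l))))

module Dense {n m l t l' : ℕ} (total : m + l ≡ length (allPairs n)) (total' : t + l' ≡ l) (0<l : 0 < l) where
  private
    L = allPairs n
    N = m + l
    SV = sublists (V {n})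
    W = m ^ m * l ^ l
    W' = t ^ t * l' ^ l'

  pairs-sum : (List (Edge n) → List (Edge n) → ℕ) → ℕ
  pairs-sum f = ∑ (subs m L) (λ H → ∑ (subs t (nonEdges H)) (f H))

  dense-fixed : ℕ → ℕ → ℕ
  dense-fixed z u = ∑ (subs u (V {n})) (λ U → ∑ SV (λ X → pairs-sum (λ H S → densePair z (H ++ S) U X)))

  dense-pairs-bound : ∀ z w M → (∀ u → 5 ≤ u → u ≤ z → W * W' * dense-fixed z u * w ≤ M) →
    W * W' * pairs-sum (λ H S → densePairs z (H ++ S)) * w ≤ suc n * M
  dense-pairs-bound z w M hyp = begin
    W * W' * pairs-sum (λ H S → densePairs z (H ++ S)) * w
      ≡⟨ cong (λ s → W * W' * s * w) (trans (∑-cong (subs m L) (λ H → ∑-swap (subs t (nonEdges H)) SV _)) (trans (∑-swap (subs m L) SV _)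
           (∑-cong SV (λ U → trans (∑-cong (subs m L) (λ H → ∑-swap (subs t (nonEdges H)) SV _)) (∑-swap (subs m L) SV _))))) ⟩
    W * W' * ∑ SV F * w
      ≡⟨ cong (λ s → W * W' * s * w) (∑-cong SV (λ U → sym (*-identityˡ (F U)))) ⟩
    W * W' * ∑ SV (λ U → 1 * F U) * w
      ≤⟨ *-monoˡ-≤ w (*-monoʳ-≤ (W * W') (∑-by-length (λ _ → 1) (V {n}) F)) ⟩
    W * W' * ∑ (upTo (suc (length (V {n})))) (λ u → 1 * ∑ (subs u (V {n})) F) * w
      ≡⟨ trans (cong (_* w) (sym (∑-*ˡ (W * W') (upTo (suc (length (V {n})))) (λ u → 1 * ∑ (subs u (V {n})) F)))) (sym (∑-*ʳ w (upTo (suc (length (V {n})))) (λ u → W * W' * (1 * ∑ (subs u (V {n})) F)))) ⟩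
    ∑ (upTo (suc (length (V {n})))) (λ u → W * W' * (1 * ∑ (subs u (V {n})) F) * w)
      ≤⟨ ∑-mono (upTo (suc (length (V {n})))) per-u ⟩
    ∑ (upTo (suc (length (V {n})))) (λ _ → M)
      ≡⟨ trans (∑-const (upTo (suc (length (V {n})))) M) (cong (λ s → s * M) (trans (length-upTo (suc (length (V {n})))) (cong suc (length-V {n})))) ⟩
    suc n * M ∎
    where
    open ≤-Reasoning
    F : List (Fin n) → ℕ
    F U = ∑ SV (λ X → pairs-sum (λ H S → densePair z (H ++ S) U X))
    vanish : ∀ U → (length U < 5) ⊎ (z < length U) → F U ≡ 0
    vanish U out = trans (∑-cong SV (λ X → trans (∑-cong (subs m L) (λ H → trans (∑-cong (subs t (nonEdges H)) (λ S → cong (_* 𝟙 (15 * length U ≤ᵇ ∑ (H ++ S) (degreeIn U X))) (zero-cond X)))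
        (∑-0 (subs t (nonEdges H))))) (∑-0 (subs m L)))) (∑-0 SV)
      where
      zero-cond : ∀ X → 𝟙 ((5 ≤ᵇ length U) ∧ (length U ≤ᵇ z) ∧ (length X ≤ᵇ 2 * length U)) ≡ 0
      zero-cond X = cong 𝟙 (≢true (λ e → case out of λ
        { (inj₁ U<z) → <⇒≱ U<z (≤ᵇ-true {5} (proj₁ (∧-true e)))
        ; (inj₂ ℓ<U) → <⇒≱ ℓ<U (≤ᵇ-true (proj₁ (∧-true (proj₂ (∧-true {5 ≤ᵇ length U} e))))) }))
    empty : ∀ u → (u < 5) ⊎ (z < u) → W * W' * (1 * ∑ (subs u (V {n})) F) * w ≤ M
    empty u out = ≤-trans (≤-reflexive (cong (_* w) (trans (cong (λ s → W * W' * (1 * s)) (trans (∑-cong∈ (subs u (V {n})) (λ U U∈ → vanish U (subst (λ s → (s < 5) ⊎ (z < s)) (sym (proj₂ (∈-subs {L = V {n}} U∈))) out))) (∑-0 (subs u (V {n}))))) (*-zeroʳ (W * W'))))) z≤n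
    per-u : ∀ u → W * W' * (1 * ∑ (subs u (V {n})) F) * w ≤ M
    per-u u with ≤-<-connex 5 u
    ... | inj₂ u<z = empty u (inj₁ u<z)
    ... | inj₁ z≤u with ≤-<-connex u z
    ... | inj₂ ℓ<u = empty u (inj₂ ℓ<u)
    ... | inj₁ u≤ℓ = subst (λ s → W * W' * s * w ≤ M) (sym (*-identityˡ _)) (hyp u z≤u u≤ℓ)

  -- Exponential moments: the edges counted by degreeIn get weight lam each, in H and in S separately.
  dense-pair-bound : ∀ z u lam y₁ y₂ y₁' y₂' → 1 ≤ lam → 0 < u → 2 * u * (m * lam) ≤ y₁ * N → u * (m * (lam * lam)) ≤ 2 * y₂ * N →
    2 * u * (t * lam) ≤ y₁' * l → u * (t * (lam * lam)) ≤ 2 * y₂' * l → ∀ U X → U ∈ subs u (V {n}) → X ∈ SV →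
    W * W' * pairs-sum (λ H S → densePair z (H ++ S) U X) * (lam ^ 15) ^ u ≤ 𝟙 (length X ≤ᵇ 2 * u) * ((3 ^ (y₁ + y₂ + (y₁' + y₂'))) ^ u * (N ^ N * l ^ l))
  dense-pair-bound z u lam y₁ y₂ y₁' y₂' 1≤lam 0<u lin quad lin' quad' U X U∈ X∈ with ∈-subs {L = V {n}} U∈
  ... | U∈' , refl with true? (length X ≤ᵇ 2 * length U)
  ... | no ¬e = ≤-trans (≤-reflexive (cong (_* (lam ^ 15) ^ u) (trans (cong (W * W' *_) (trans (∑-cong (subs m L) (λ H → trans (∑-cong (subs t (nonEdges H))
          (λ S → cong (_* 𝟙 (15 * length U ≤ᵇ ∑ (H ++ S) (degreeIn U X))) zero-cond)) (∑-0 (subs t (nonEdges H))))) (∑-0 (subs m L)))) (*-zeroʳ (W * W'))))) z≤n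
    where
    zero-cond : 𝟙 ((5 ≤ᵇ length U) ∧ (length U ≤ᵇ z) ∧ (length X ≤ᵇ 2 * length U)) ≡ 0
    zero-cond = cong 𝟙 (≢true (λ e → ¬e (proj₂ (∧-true {length U ≤ᵇ z} (proj₂ (∧-true {5 ≤ᵇ length U} e))))))
  ... | yes e = subst (W * W' * pairs-sum (λ H S → densePair z (H ++ S) U X) * (lam ^ 15) ^ u ≤_) (sym (trans (cong (λ s → 𝟙 s * M₀) e) (*-identityˡ M₀))) (begin
      W * W' * pairs-sum (λ H S → densePair z (H ++ S) U X) * (lam ^ 15) ^ u
        ≡⟨ trans (*-assoc (W * W') _ _) (cong (W * W' *_) (trans (cong (pairs-sum (λ H S → densePair z (H ++ S) U X) *_) (^-*-assoc lam 15 u)) (sym (∑-*ʳ (lam ^ (15 * u)) (subs m L) _)))) ⟩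
      W * W' * ∑ (subs m L) (λ H → ∑ (subs t (nonEdges H)) (λ S → densePair z (H ++ S) U X) * lam ^ (15 * u))
        ≤⟨ *-monoʳ-≤ (W * W') (∑-mono (subs m L) (λ H → ≤-trans (≤-reflexive (sym (∑-*ʳ (lam ^ (15 * u)) (subs t (nonEdges H)) _)))
             (≤-trans (∑-mono (subs t (nonEdges H)) (moment H)) (≤-reflexive (∑-*ˡ (∏ H f) (subs t (nonEdges H)) _))))) ⟩
      W * W' * ∑ (subs m L) (λ H → ∏ H f * ∑ (subs t (nonEdges H)) (λ S → ∏ S f))
        ≡⟨ trans (*-assoc W W' _) (cong (W *_) (sym (∑-*ˡ W' (subs m L) _))) ⟩
      W * ∑ (subs m L) (λ H → W' * (∏ H f * ∑ (subs t (nonEdges H)) (λ S → ∏ S f)))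
        ≤⟨ *-monoʳ-≤ W (∑-mono∈ (subs m L) (λ H H∈ → ≤-trans (≤-reflexive (ring₁ W' (∏ H f) _)) (*-monoʳ-≤ (∏ H f) (sprinkled H H∈)))) ⟩
      W * ∑ (subs m L) (λ H → ∏ H f * (c' * l ^ l))
        ≡⟨ trans (cong (W *_) (∑-*ʳ (c' * l ^ l) (subs m L) _)) (sym (*-assoc W _ _)) ⟩
      W * ∑ (subs m L) (λ H → ∏ H f) * (c' * l ^ l)
        ≤⟨ *-monoˡ-≤ (c' * l ^ l) (≤-trans (subs-∏-bound m l f L m l total) weights) ⟩
      c * N ^ N * (c' * l ^ l)
        ≡⟨ trans (ring₂ c (N ^ N) c' (l ^ l)) (cong (_* (N ^ N * l ^ l)) (trans (sym (^-distribʳ-* u _ _)) (cong (_^ u) (sym (^-distribˡ-+-* 3 (y₁ + y₂) (y₁' + y₂')))))) ⟩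
      M₀ ∎)
    where
    open ≤-Reasoning
    M₀ = (3 ^ (y₁ + y₂ + (y₁' + y₂'))) ^ u * (N ^ N * l ^ l)
    c = (3 ^ (y₁ + y₂)) ^ u
    c' = (3 ^ (y₁' + y₂')) ^ u
    f : Edge n → ℕ
    f e = lam ^ degreeIn U X e
    ring₁ : ∀ w p s → w * (p * s) ≡ p * (w * s)
    ring₁ = solve-∀
    ring₂ : ∀ c n d l → c * n * (d * l) ≡ c * d * (n * l)
    ring₂ = solve-∀
    X≤ : length X ≤ 2 * length U
    X≤ = ≤ᵇ-true {length X} e
    moment : ∀ H S → densePair z (H ++ S) U X * lam ^ (15 * u) ≤ ∏ H f * ∏ S f
    moment H S = ≤-trans (*-monoˡ-≤ (lam ^ (15 * u)) (*-monoˡ-≤ (𝟙 (15 * u ≤ᵇ ∑ (H ++ S) (degreeIn U X))) (𝟙≤1 ((5 ≤ᵇ length U) ∧ (length U ≤ᵇ z) ∧ (length X ≤ᵇ 2 * length U)))))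
      (subst (1 * 𝟙 (15 * u ≤ᵇ ∑ (H ++ S) (degreeIn U X)) * lam ^ (15 * u) ≤_) (trans (sym (∏-^ lam (H ++ S) (degreeIn U X))) (∏-++ H S f)) (go (15 * u ≤ᵇ ∑ (H ++ S) (degreeIn U X)) refl))
      where
      go : ∀ b → (15 * u ≤ᵇ ∑ (H ++ S) (degreeIn U X)) ≡ b → 1 * 𝟙 b * lam ^ (15 * u) ≤ lam ^ ∑ (H ++ S) (degreeIn U X)
      go false _ = z≤n
      go true h = ≤-trans (≤-reflexive (*-identityˡ (lam ^ (15 * u)))) (^-monoʳ-≤ lam {{>0⇒≢0 1≤lam}} (≤ᵇ-true {15 * u} h))
    weights : ∏ L (λ e → l + m * f e) ≤ c * N ^ N
    weights = subst₂ (λ s t → ∏ L (λ e → l + m * f e) ≤ c * s ^ t) (+-comm l m) (sym total)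
      (DegreeWeights.degree-product U X U∈' X∈ m l lam y₁ y₂ X≤ 1≤lam (≤-trans 0<l (m≤m+n l m)) 0<u
        (subst (2 * u * (m * lam) ≤_) (cong (y₁ *_) (+-comm m l)) lin) (subst (u * (m * (lam * lam)) ≤_) (cong (2 * y₂ *_) (+-comm m l)) quad))
    l'+t : l' + t ≡ l
    l'+t = trans (+-comm l' t) total'
    weights' : ∏ L (λ e → l' + t * f e) ≤ c' * l ^ length L
    weights' = subst (λ s → ∏ L (λ e → l' + t * f e) ≤ c' * s ^ length L) l'+t
      (DegreeWeights.degree-product U X U∈' X∈ t l' lam y₁' y₂' X≤ 1≤lam (subst (0 <_) (sym l'+t) 0<l) 0<u
        (subst (λ s → 2 * u * (t * lam) ≤ y₁' * s) (sym l'+t) lin') (subst (λ s → u * (t * (lam * lam)) ≤ 2 * y₂' * s) (sym l'+t) quad'))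
    -- `S` uses only non-edges of `H`, but the product over them is completed to all pairs: each
    -- missing factor is at least `l` because `lam ≥ 1`. The bound becomes independent of `H`.
    sprinkled : ∀ H → H ∈ subs m L → W' * ∑ (subs t (nonEdges H)) (λ S → ∏ S f) ≤ c' * l ^ l
    sprinkled H H∈ = ≤-trans (subs-∏-bound t l' f R t l' (trans total' (sym R-length))) (cancel-pos {m = l ^ length R'} (^-pos (length R') 0<l) (begin
      l ^ length R' * ∏ R (λ e → l' + t * f e)
        ≤⟨ *-monoˡ-≤ (∏ R (λ e → l' + t * f e)) (≤-trans (≤-reflexive (sym (∏-const R' l))) (∏-mono∈ R' (λ e _ → ≤-trans (≤-reflexive (trans (sym l'+t) (cong (l' +_) (sym (*-identityʳ t)))))
             (+-monoʳ-≤ l' (*-monoʳ-≤ t (m^n>0 lam {{>0⇒≢0 1≤lam}} (degreeIn U X e))))))) ⟩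
      ∏ R' (λ e → l' + t * f e) * ∏ R (λ e → l' + t * f e)
        ≡⟨ trans (*-comm _ (∏ R (λ e → l' + t * f e))) (∏-filters (λ e → not (memE e H)) L) ⟩
      ∏ L (λ e → l' + t * f e)
        ≤⟨ weights' ⟩
      c' * l ^ length L
        ≡⟨ cong (c' *_) (trans (cong (l ^_) (trans (sym (length-filters (λ e → not (memE e H)) L)) (trans (cong (_+ length R') R-length) (+-comm l (length R'))))) (^-distribˡ-+-* l (length R') l)) ⟩
      c' * (l ^ length R' * l ^ l)
        ≡⟨ ring₁ c' (l ^ length R') (l ^ l) ⟩
      l ^ length R' * (c' * l ^ l) ∎))
      where
      R = nonEdges H
      R' = filterᵇ (λ e → not (not (memE e H))) L
      R-length : length R ≡ l
      R-length = nonEdges-length {m = m} total H∈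
      ∏-filters : ∀ (p : Edge n → Bool) M {g} → ∏ (filterᵇ p M) g * ∏ (filterᵇ (not ∘ p) M) g ≡ ∏ M g
      ∏-filters p [] = refl
      ∏-filters p (x ∷ M) {g} with p x
      ... | true = trans (*-assoc (g x) _ _) (cong (g x *_) (∏-filters p M))
      ... | false = trans (ring₁ (∏ (filterᵇ p M) g) (g x) _) (cong (g x *_) (∏-filters p M))

  dense-bound : ∀ z u lam y₁ y₂ y₁' y₂' {g h} → 0 < n → 1 ≤ lam → 0 < u → 2 * u ≤ n → 2 * u * (m * lam) ≤ y₁ * N → u * (m * (lam * lam)) ≤ 2 * y₂ * N →
    2 * u * (t * lam) ≤ y₁' * l → u * (t * (lam * lam)) ≤ 2 * y₂' * l →
    3 * n * (3 * n) ^ 2 * 3 ^ (y₁ + y₂ + (y₁' + y₂')) * g ≤ u * (2 * u) ^ 2 * lam ^ 15 * h →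
    W * W' * dense-fixed z u * g ^ u ≤ h ^ u * (N ^ N * l ^ l)
  dense-bound z u lam y₁ y₂ y₁' y₂' {g} {h} 0<n 1≤lam 0<u 2u≤n lin quad lin' quad' unit =
    union-bound {A = W * W' * dense-fixed z u} {c₁ = c₁} {c₂ = c₂} {M = N ^ N * l ^ l} u {a = u} {b = (2 * u) ^ 2} {b' = (3 * n) ^ 2} {T = T} {P = lam ^ 15} {f = h} {g = g}
      main (subs-count-≤ {n} u 0<n (≤-trans (m≤m+n u (u + 0)) 2u≤n)) square unit 0<u (^-pos 2 (*-mono-≤ {1} {2} (s≤s z≤n) 0<u)) (^-pos 15 1≤lam)
    where
    T = 3 ^ (y₁ + y₂ + (y₁' + y₂'))
    c₁ = ∑ (subs u (V {n})) (λ _ → 1)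
    c₂ = ∑ SV (λ X → 𝟙 (length X ≤ᵇ 2 * u))
    M₀ = T ^ u * (N ^ N * l ^ l)
    square : c₂ * ((2 * u) ^ 2) ^ u ≤ ((3 * n) ^ 2) ^ u
    square = subst₂ _≤_ (cong (c₂ *_) (sym (^-*-assoc (2 * u) 2 u))) (sym (^-*-assoc (3 * n) 2 u)) (sublists-count {n} (2 * u) 0<n 2u≤n)
    main : W * W' * dense-fixed z u * (lam ^ 15) ^ u ≤ c₁ * c₂ * M₀
    main = begin
      W * W' * dense-fixed z u * P
        ≡⟨ trans (cong (_* P) (sym (∑-*ˡ (W * W') (subs u (V {n})) _))) (sym (∑-*ʳ P (subs u (V {n})) _)) ⟩
      ∑ (subs u (V {n})) (λ U → W * W' * ∑ SV (λ X → pairs-sum (λ H S → densePair z (H ++ S) U X)) * P)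
        ≤⟨ ∑-mono∈ (subs u (V {n})) (λ U U∈ → ≤-trans (≤-reflexive (trans (cong (_* P) (sym (∑-*ˡ (W * W') SV _))) (sym (∑-*ʳ P SV _))))
             (∑-mono∈ SV (λ X X∈ → dense-pair-bound z u lam y₁ y₂ y₁' y₂' 1≤lam 0<u lin quad lin' quad' U X U∈ X∈))) ⟩
      ∑ (subs u (V {n})) (λ U → ∑ SV (λ X → 𝟙 (length X ≤ᵇ 2 * u) * M₀))
        ≡⟨ trans (∑-cong (subs u (V {n})) (λ U → trans (∑-*ʳ M₀ SV (λ X → 𝟙 (length X ≤ᵇ 2 * u))) (sym (*-identityˡ (c₂ * M₀))))) (∑-*ʳ (c₂ * M₀) (subs u (V {n})) (λ _ → 1)) ⟩
      c₁ * (c₂ * M₀)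
        ≡⟨ sym (*-assoc c₁ c₂ M₀) ⟩
      c₁ * c₂ * M₀ ∎
      where
      open ≤-Reasoning
      P = (lam ^ 15) ^ u

-- Assembling the union bound

∑-filter-≤ : ∀ (p : A → Bool) L f → ∑ (filterᵇ p L) f ≤ ∑ L f
∑-filter-≤ p L f = ≤-trans (≤-reflexive (∑-filter p L f)) (∑-mono L (λ x → ≤-trans (*-monoˡ-≤ (f x) (𝟙≤1 (p x))) (≤-reflexive (*-identityˡ (f x)))))

≢0⇒1≤ : ∀ {m} → m ≢ 0 → 1 ≤ m
≢0⇒1≤ {zero} h = ⊥-elim (h refl)
≢0⇒1≤ {suc m} h = s≤s z≤n

densePairs-mono : ∀ {n} z (E F : List (Edge n)) → (∀ c → ∑ E c ≤ ∑ F c) → densePairs z E ≤ densePairs z F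
densePairs-mono z E F h = ∑-mono (sublists V) (λ U → ∑-mono (sublists V) (λ X →
  *-monoʳ-≤ (𝟙 ((5 ≤ᵇ length U) ∧ (length U ≤ᵇ z) ∧ (length X ≤ᵇ 2 * length U)))
    (𝟙-mono {15 * length U ≤ᵇ ∑ E (degreeIn U X)} {15 * length U ≤ᵇ ∑ F (degreeIn U X)} (λ e → ≤ᵇ-intro (≤-trans (≤ᵇ-true {15 * length U} e) (h (degreeIn U X)))))))

module Count {n m l l' k z ℓ D : ℕ} (total : m + l ≡ length (allPairs n)) (total' : n / 8 + l' ≡ l)
  (0<m : 0 < m) (0<t : 0 < n / 8) (0<l' : 0 < l') (15≤k : 15 ≤ k) (z≤ℓ : z ≤ ℓ)
  (enough : ∀ b → (suc ℓ ∸ z) * (suc ℓ ∸ z) ≤ 2 * b + n → length (allPairs n) ≤ 20 * b) where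

  private
    t = n / 8
    L = allPairs n
    N = m + l
    W = m ^ m * l ^ l
    W' = t ^ t * l' ^ l'

  0<l : 0 < l
  0<l = subst (0 <_) total' (≤-trans 0<t (m≤m+n t l'))

  0<W : 0 < W
  0<W = *-mono-≤ (^-pos m 0<m) (^-pos l 0<l)

  0<W' : 0 < W'
  0<W' = *-mono-≤ (^-pos t 0<t) (^-pos l' 0<l')

  record Typical (H : List (Edge n)) : Set where
    constructor typical
    field
      core-ham : hamiltonian H (coreV n k H) ≡ true
      core-big : ∑ V (λ v → 𝟙 (not (memV v (coreV n k H)))) ≤ z
      no-closed : closedPairs z ℓ H ≡ 0

  typical? : ∀ H → Dec (Typical H)
  typical? H with true? (hamiltonian H (coreV n k H)) | ∑ V (λ v → 𝟙 (not (memV v (coreV n k H)))) ≤? z | closedPairs z ℓ H ≟ 0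
  ... | yes a | yes b | yes c = yes (typical a b c)
  ... | no ¬a | _ | _ = no (λ { (typical a b c) → ¬a a })
  ... | yes _ | no ¬b | _ = no (λ { (typical a b c) → ¬b b })
  ... | yes _ | yes _ | no ¬c = no (λ { (typical a b c) → ¬c c })

  sparse-edges : List (Edge n) → List (Edge n) → Bool
  sparse-edges H S = densePairs z (H ++ S) ≡ᵇ 0

  module Sprinkled (H : List (Edge n)) (T : Typical H) = Sprinkle k H ℓ z z≤ℓ (Typical.core-ham T) (Typical.core-big T) enough (sparse-edges H)
    (λ S₁ good → CoreExpands.core-expands k z ℓ 15≤k H S₁ (Typical.core-big T) (Typical.no-closed T) (≡ᵇ-true {densePairs z (H ++ S₁)} good))

  stuckAt : ∀ H → Typical H → List (Edge n) → ℕ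
  stuckAt H T S = Sprinkled.Bad H T (filterᵇ (Sprinkled.outside H T) S) (filterᵇ (not ∘ Sprinkled.outside H T) S)

  stuck : List (Edge n) → List (Edge n) → ℕ
  stuck H S = dec (typical? H) (λ T → stuckAt H T S) (λ _ → 0)

  -- The edges of `S₂` have both ends in the core of `H`, so `core-absorb` gives `H ++ S` and
  -- `H ++ S₁` the same core. A Hamilton cycle found by the sprinkling would then be one of `G`'s
  -- core, so in the event the final weight is positive.
  event-stuck : ∀ H S → (T : Typical H) → densePairs z (H ++ S) ≡ 0 → event n k (H , S) ≡ true → 1 ≤ stuckAt H T S
  event-stuck H S T no-dense ev = result (true? (sparse-edges H S₁))
    where
    open Sprinkled H T using (K₀; outside; Bad)
    S₁ = filterᵇ outside S
    S₂ = filterᵇ (not ∘ outside) S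
    -- Dense pairs are monotone in the edges. The bad event can therefore be stated for all of `S`,
    -- without reference to the splitting, and still yields the test for `S₁`.
    good-A : sparse-edges H S₁ ≡ true
    good-A = ≡ᵇ-intro (n≤0⇒n≡0 (subst (densePairs z (H ++ S₁) ≤_) no-dense (densePairs-mono z (H ++ S₁) (H ++ S)
      (λ c → subst₂ _≤_ (sym (∑-++ H S₁ c)) (sym (∑-++ H S c)) (+-monoʳ-≤ (∑ H c) (∑-filter-≤ outside S c))))))
    H⊑A : H ⊑ (H ++ S₁)
    H⊑A u v = adj-mono {E = H} {F = H ++ S₁} ∈-++⁺ˡ
    A⊑S : (H ++ S₁) ⊑ (H ++ S)
    A⊑S u v = adj-mono {E = H ++ S₁} {F = H ++ S} (λ e∈ → case ∈-++⁻ H e∈ of λ { (inj₁ p) → ∈-++⁺ˡ p ; (inj₂ p) → ∈-++⁺ʳ H (proj₁ (∈-filter⁻ S p)) })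
    AB⊑S : ((H ++ S₁) ++ S₂) ⊑ (H ++ S)
    AB⊑S u v = adj-mono {E = (H ++ S₁) ++ S₂} {F = H ++ S} (λ e∈ → case ∈-++⁻ (H ++ S₁) e∈ of λ
      { (inj₁ p) → case ∈-++⁻ H p of λ { (inj₁ q) → ∈-++⁺ˡ q ; (inj₂ q) → ∈-++⁺ʳ H (proj₁ (∈-filter⁻ S q)) }
      ; (inj₂ p) → ∈-++⁺ʳ H (proj₁ (∈-filter⁻ S p)) })
    edge : ∀ {e} → e ∈ H ++ S → e ∈ H ++ S₁ ⊎ (proj₁ e ∈ K₀ × proj₂ e ∈ K₀)
    edge {e} e∈ with ∈-++⁻ H e∈
    ... | inj₁ p = inj₁ (∈-++⁺ˡ p)
    ... | inj₂ p with ∈-++-filters outside p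
    ... | inj₁ q = inj₁ (∈-++⁺ʳ H q)
    ... | inj₂ q with ∧-true {memV (proj₁ e) K₀} (not-not (proj₂ (∈-filter⁻ S q)))
      where
      not-not : ∀ {b} → not (not b) ≡ true → b ≡ true
      not-not {true} _ = refl
    ... | a , b = inj₂ (memV-true K₀ a , memV-true K₀ b)
    new-inside : ∀ u v → adj (H ++ S) u v ≡ true → adj (H ++ S₁) u v ≡ true ⊎ u ∈ K₀
    new-inside u v h with adj-true (H ++ S) h
    ... | inj₁ p = case edge p of λ { (inj₁ q) → inj₁ (adj-intro {E = H ++ S₁} q) ; (inj₂ q) → inj₂ (proj₁ q) }
    ... | inj₂ p = case edge p of λ { (inj₁ q) → inj₁ (adj-introʳ {E = H ++ S₁} q) ; (inj₂ q) → inj₂ (proj₂ q) }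
    same-core : coreV n k (H ++ S) ≡ coreV n k (H ++ S₁)
    same-core = core-absorb k {H} {H ++ S₁} {H ++ S} H⊑A A⊑S new-inside
    non-ham : hamiltonian (H ++ S) (coreV n k (H ++ S)) ≢ true
    non-ham = not-true (proj₂ (∧-true {connected (H ++ S) (coreV n k (H ++ S))} (proj₂ (∧-true {hamiltonian H (coreV n k H)} ev))))
    result : Dec (sparse-edges H S₁ ≡ true) → 1 ≤ Bad S₁ S₂
    result (no ¬g) = ⊥-elim (¬g good-A)
    result (yes _) with true? (sparse-edges H S₁)
    ... | no ¬g = ⊥-elim (¬g good-A)
    ... | yes g = subst (1 ≤_) (sym (weight-nonham ((H ++ S₁) ++ S₂) (coreV n k (H ++ S₁)) (λ h → non-ham
            (subst (λ K → hamiltonian (H ++ S) K ≡ true) (sym same-core) (ham-mono ((H ++ S₁) ++ S₂) (H ++ S) {coreV n k (H ++ S₁)} AB⊑S h)))))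
            (m^n>0 2 (length (coreV n k (H ++ S₁)) ∸ longestPath ((H ++ S₁) ++ S₂) (coreV n k (H ++ S₁))))

  event-bound : ∀ {H} S → H ∈ subs m L → 𝟙 (event n k (H , S)) ≤ sparseCuts k z H + closedPairs z ℓ H + (densePairs z (H ++ S) + stuck H S)
  event-bound {H} S H∈ = 𝟙-≤ (event n k (H , S)) go
    where
    s = sparseCuts k z H
    c = closedPairs z ℓ H
    d = densePairs z (H ++ S)
    go : event n k (H , S) ≡ true → 1 ≤ s + c + (d + stuck H S)
    go ev = cases (s ≟ 0) (c ≟ 0) (d ≟ 0)
      where
      bad : s ≡ 0 → c ≡ 0 → d ≡ 0 → (q : Dec (Typical H)) → 1 ≤ dec q (λ T → stuckAt H T S) (λ _ → 0)
      bad s≡0 c≡0 d≡0 (yes T) = event-stuck H S T d≡0 ev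
      bad s≡0 c≡0 d≡0 (no ¬T) = ⊥-elim (¬T (typical (proj₁ (∧-true {hamiltonian H (coreV n k H)} ev)) (core-large k z H (proj₁ (∈-subs {L = L} H∈)) s≡0) c≡0))
      cases : Dec (s ≡ 0) → Dec (c ≡ 0) → Dec (d ≡ 0) → 1 ≤ s + c + (d + stuck H S)
      cases (no s≢0) _ _ = ≤-trans (≢0⇒1≤ s≢0) (≤-trans (m≤m+n s c) (m≤m+n (s + c) (d + stuck H S)))
      cases (yes _) (no c≢0) _ = ≤-trans (≢0⇒1≤ c≢0) (≤-trans (m≤n+m c s) (m≤m+n (s + c) (d + stuck H S)))
      cases (yes _) (yes _) (no d≢0) = ≤-trans (≢0⇒1≤ d≢0) (≤-trans (m≤m+n d (stuck H S)) (m≤n+m (d + stuck H S) (s + c)))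
      cases (yes s≡0) (yes c≡0) (yes d≡0) = ≤-trans (bad s≡0 c≡0 d≡0 (typical? H)) (≤-trans (m≤n+m (stuck H S) d) (m≤n+m (d + stuck H S) (s + c)))

  samples-sum : (List (Edge n) → List (Edge n) → ℕ) → ℕ
  samples-sum f = ∑ (subs m L) (λ H → ∑ (subs t (nonEdges H)) (f H))

  ∑-samples : ∀ f → ∑ (samples n m) f ≡ samples-sum (λ H S → f (H , S))
  ∑-samples f = trans (∑-concatMap (λ H → map (H ,_) (addSets H t)) (graphsWith n m) f) (∑-cong (graphsWith n m) (λ H → ∑-map (H ,_) (addSets H t) f))

  inner-const : ∀ {H} c → H ∈ subs m L → ∑ (subs t (nonEdges H)) (λ _ → c) ≡ binom l t * c
  inner-const {H} c H∈ = trans (subs-count t (nonEdges H) c) (cong (λ s → binom s t * c) (nonEdges-length {m = m} total H∈))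

  graphs-const : ∀ c → ∑ (subs m L) (λ _ → c) ≡ binom N m * c
  graphs-const c = trans (subs-count m L c) (cong (λ s → binom s m * c) (sym total))

  total-samples : length (samples n m) ≡ binom N m * binom l t
  total-samples = trans (length-∑ (samples n m)) (trans (∑-samples (λ _ → 1)) (trans (∑-cong∈ (subs m L) (λ H H∈ → trans (inner-const 1 H∈) (*-identityʳ _))) (graphs-const (binom l t))))

  mode-N : N ^ N ≤ suc N * (binom N m * W)
  mode-N = Mode.mode m l L (sym total)

  mode-l : l ^ l ≤ suc l * (binom l t * W')
  mode-l = subst (λ s → s ^ s ≤ suc s * (binom s t * W')) total' (Mode.mode t l' (upTo (t + l')) (length-upTo (t + l')))

  -- The hypothesis is a bound for the product measure, and passing to the uniform one costs
  -- `suc N`. The `4` allots a quarter of the allowed probability `1 / D` to each of the four bad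
  -- events.
  graph-event : ∀ (f : List (Edge n) → ℕ) → W * ∑ (subs m L) f * (suc N * (4 * D)) ≤ N ^ N → samples-sum (λ H S → f H) * (4 * D) ≤ binom N m * binom l t
  graph-event f h = begin
    samples-sum (λ H S → f H) * (4 * D)
      ≡⟨ cong (_* (4 * D)) (trans (∑-cong∈ (subs m L) (λ H H∈ → trans (inner-const (f H) H∈) (*-comm (binom l t) (f H)))) (∑-*ʳ (binom l t) (subs m L) f)) ⟩
    ∑ (subs m L) f * binom l t * (4 * D)
      ≡⟨ ring (∑ (subs m L) f) (binom l t) (4 * D) ⟩
    ∑ (subs m L) f * (4 * D) * binom l t
      ≤⟨ *-monoˡ-≤ (binom l t) (cancel-pos {m = W * suc N} (*-mono-≤ 0<W (s≤s (z≤n {N}))) (≤-trans (≤-reflexive (ring₂ W (suc N) (∑ (subs m L) f) (4 * D))) (≤-trans h (≤-trans mode-N (≤-reflexive (ring₃ (suc N) (binom N m) W)))))) ⟩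
    binom N m * binom l t ∎
    where
    open ≤-Reasoning
    ring : ∀ a b c → a * b * c ≡ a * c * b
    ring = solve-∀
    ring₂ : ∀ w s a d → w * s * (a * d) ≡ w * a * (s * d)
    ring₂ = solve-∀
    ring₃ : ∀ s b w → s * (b * w) ≡ w * s * b
    ring₃ = solve-∀

  pair-event : ∀ (f : List (Edge n) → List (Edge n) → ℕ) → W * W' * samples-sum f * (suc N * suc l * (4 * D)) ≤ N ^ N * l ^ l → samples-sum f * (4 * D) ≤ binom N m * binom l t
  pair-event f h = cancel-pos {m = W * W' * (suc N * suc l)} (*-mono-≤ (*-mono-≤ 0<W 0<W') (s≤s (z≤n {l + N * suc l})))
    (≤-trans (≤-reflexive (ring (W * W') (suc N * suc l) (samples-sum f) (4 * D))) (≤-trans h (≤-trans (*-mono-≤ mode-N mode-l) (≤-reflexive (ring₂ (suc N) (binom N m) W (suc l) (binom l t) W')))))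
    where
    ring : ∀ w s a d → w * s * (a * d) ≡ w * a * (s * d)
    ring = solve-∀
    ring₂ : ∀ s b w s' b' w' → s * (b * w) * (s' * (b' * w')) ≡ w * w' * (s * s') * (b * b')
    ring₂ = solve-∀

  stuck-event : (∀ a b → a + b ≡ l → a ≤ z * n → 2 ^ z * ((40 * l) ^ a * (40 * l' + 39 * t) ^ b) * (suc l * (4 * D)) ≤ (40 * l) ^ l) → samples-sum stuck * (4 * D) ≤ binom N m * binom l t
  stuck-event gain-l = ≤-trans (≤-reflexive (sym (∑-*ʳ (4 * D) (subs m L) _))) (≤-trans (∑-mono∈ (subs m L) (λ H H∈ → per-H H H∈ (typical? H))) (≤-reflexive (graphs-const (binom l t))))
    where
    per-H : ∀ H → H ∈ subs m L → (q : Dec (Typical H)) → ∑ (subs t (nonEdges H)) (λ S → dec q (λ T → stuckAt H T S) (λ _ → 0)) * (4 * D) ≤ binom l t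
    per-H H H∈ (no _) = ≤-trans (≤-reflexive (cong (_* (4 * D)) (∑-0 (subs t (nonEdges H))))) z≤n
    per-H H H∈ (yes T) = cancel-pos {m = W' * suc l} (*-mono-≤ 0<W' (s≤s (z≤n {l}))) (≤-trans (≤-reflexive (ring₂ W' (suc l) Σbad (4 * D))) (≤-trans scaled (≤-trans mode-l (≤-reflexive (ring₃ (suc l) (binom l t) W')))))
      where
      open Sprinkled H T using (R; Q; outside; sprinkle-product; outside-count)
      Σbad = ∑ (subs t (nonEdges H)) (stuckAt H T)
      R-length : length R ≡ l
      R-length = nonEdges-length {m = m} total H∈
      a = length (filterᵇ outside R)
      b = length Q
      scaled : W' * Σbad * (suc l * (4 * D)) ≤ l ^ l
      scaled = cancel-pos {m = 40 ^ l} (^-pos l (s≤s z≤n)) (begin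
        40 ^ l * (W' * Σbad * (suc l * (4 * D)))
          ≡⟨ ring₄ (40 ^ l) W' Σbad _ ⟩
        W' * (40 ^ l * Σbad) * (suc l * (4 * D))
          ≤⟨ *-monoˡ-≤ (suc l * (4 * D)) (subst (λ s → W' * (40 ^ s * Σbad) ≤ 2 ^ z * ((40 * s) ^ a * (40 * l' + 39 * t) ^ b)) R-length (sprinkle-product t l' (trans total' (sym R-length)))) ⟩
        2 ^ z * ((40 * l) ^ a * (40 * l' + 39 * t) ^ b) * (suc l * (4 * D))
          ≤⟨ gain-l a b (trans (length-filters outside R) R-length) outside-count ⟩
        (40 * l) ^ l
          ≡⟨ ^-distribʳ-* l 40 l ⟩
        40 ^ l * l ^ l ∎)
        where
        open ≤-Reasoning
        ring₄ : ∀ p w s d → p * (w * s * d) ≡ w * (p * s) * d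
        ring₄ = solve-∀
      ring₂ : ∀ w s a d → w * s * (a * d) ≡ w * a * (s * d)
      ring₂ = solve-∀
      ring₃ : ∀ s b w → s * (b * w) ≡ w * s * b
      ring₃ = solve-∀

  count-bound : W * ∑ (subs m L) (sparseCuts k z) * (suc N * (4 * D)) ≤ N ^ N → W * ∑ (subs m L) (closedPairs z ℓ) * (suc N * (4 * D)) ≤ N ^ N →
    W * W' * samples-sum (λ H S → densePairs z (H ++ S)) * (suc N * suc l * (4 * D)) ≤ N ^ N * l ^ l →
    (∀ a b → a + b ≡ l → a ≤ z * n → 2 ^ z * ((40 * l) ^ a * (40 * l' + 39 * t) ^ b) * (suc l * (4 * D)) ≤ (40 * l) ^ l) →
    favourable n m k * D ≤ length (samples n m)
  count-bound h₁ h₂ h₃ h₄ = cancel-pos {m = 4} (s≤s z≤n) (begin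
    4 * (favourable n m k * D)
      ≡⟨ trans (ring (favourable n m k) D) (cong (_* (4 * D)) (trans (length-filter-∑ (event n k) (samples n m)) (∑-samples (𝟙 ∘ event n k)))) ⟩
    samples-sum (λ H S → 𝟙 (event n k (H , S))) * (4 * D)
      ≤⟨ *-monoˡ-≤ (4 * D) (∑-mono∈ (subs m L) (λ H H∈ → ∑-mono (subs t (nonEdges H)) (λ S → event-bound S H∈))) ⟩
    samples-sum (λ H S → sparseCuts k z H + closedPairs z ℓ H + (densePairs z (H ++ S) + stuck H S)) * (4 * D)
      ≡⟨ cong (_* (4 * D)) (trans (split (λ H S → sparseCuts k z H + closedPairs z ℓ H) (λ H S → densePairs z (H ++ S) + stuck H S))
           (cong₂ _+_ (split (λ H S → sparseCuts k z H) (λ H S → closedPairs z ℓ H)) (split (λ H S → densePairs z (H ++ S)) stuck))) ⟩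
    (samples-sum (λ H S → sparseCuts k z H) + samples-sum (λ H S → closedPairs z ℓ H) + (samples-sum (λ H S → densePairs z (H ++ S)) + samples-sum stuck)) * (4 * D)
      ≡⟨ distribute (samples-sum (λ H S → sparseCuts k z H)) (samples-sum (λ H S → closedPairs z ℓ H)) (samples-sum (λ H S → densePairs z (H ++ S))) (samples-sum stuck) (4 * D) ⟩
    samples-sum (λ H S → sparseCuts k z H) * (4 * D) + samples-sum (λ H S → closedPairs z ℓ H) * (4 * D) + (samples-sum (λ H S → densePairs z (H ++ S)) * (4 * D) + samples-sum stuck * (4 * D))
      ≤⟨ +-mono-≤ (+-mono-≤ (graph-event (sparseCuts k z) h₁) (graph-event (closedPairs z ℓ) h₂)) (+-mono-≤ (pair-event (λ H S → densePairs z (H ++ S)) h₃) (stuck-event h₄)) ⟩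
    Tot + Tot + (Tot + Tot)
      ≡⟨ ring₂ Tot ⟩
    4 * Tot
      ≡⟨ cong (4 *_) (sym total-samples) ⟩
    4 * length (samples n m) ∎)
    where
    open ≤-Reasoning
    Tot = binom N m * binom l t
    split : ∀ f g → samples-sum (λ H S → f H S + g H S) ≡ samples-sum f + samples-sum g
    split f g = trans (∑-cong (subs m L) (λ H → ∑-+ (subs t (nonEdges H)) (f H) (g H))) (∑-+ (subs m L) _ _)
    ring : ∀ f d → 4 * (f * d) ≡ f * (4 * d)
    ring = solve-∀
    ring₂ : ∀ x → x + x + (x + x) ≡ 4 * x
    ring₂ = solve-∀
    distribute : ∀ a b c e d → (a + b + (c + e)) * d ≡ a * d + b * d + (c * d + e * d)
    distribute = solve-∀

-- Growth estimates

-- Integer parts by search along a strictly increasing sequence. Quotients, logarithms and square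
-- roots, and so all parameters, are obtained as pairs of inequalities.
bracket : ∀ (f : ℕ → ℕ) → (∀ i → f i < f (suc i)) → ∀ a → f 0 ≤ a → ∃ λ j → f j ≤ a × a < f (suc j)
bracket f inc zero h = 0 , h , ≤-trans (s≤s z≤n) (inc 0)
bracket f inc (suc a) h with ≤-<-connex (f 0) a
... | inj₂ a<f0 = 0 , h , ≤-trans (s≤s a<f0) (inc 0)
... | inj₁ f0≤a with bracket f inc a f0≤a
... | j , fj≤ , a< with ≤-<-connex (f (suc j)) (suc a)
... | inj₂ sa< = j , m≤n⇒m≤1+n fj≤ , sa<
... | inj₁ ≤sa = suc j , ≤sa , ≤-trans (s≤s a<) (inc (suc j))

floor-div : ∀ c a → 0 < c → ∃ λ j → c * j ≤ a × a < c * suc j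
floor-div c a 0<c = bracket (c *_) (λ i → ≤-trans (+-monoˡ-≤ (c * i) 0<c) (≤-reflexive (sym (*-suc c i)))) a (≤-trans (≤-reflexive (*-zeroʳ c)) z≤n)

ceil-div : ∀ c a → 0 < c → ∃ λ j → c * j ≤ a + c × a < c * j
ceil-div c a 0<c with floor-div c a 0<c
... | j , lo , hi = suc j , ≤-trans (≤-reflexive (trans (*-suc c j) (+-comm c (c * j)))) (+-monoˡ-≤ c lo) , hi

log₂ : ∀ n → 0 < n → ∃ λ b → 2 ^ b ≤ n × n < 2 ^ suc b
log₂ n 0<n = bracket (2 ^_) (λ i → ^-monoʳ-< 2 ≤-refl (n<1+n i)) n 0<n

square-root : ∀ c a → 0 < c → ∃ λ s → s * s * c ≤ a × a < suc s * suc s * c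
square-root c a 0<c = bracket (λ s → s * s * c) (λ i → *-monoˡ-< c {{>0⇒≢0 0<c}} (*-mono-< (n<1+n i) (n<1+n i))) a z≤n

-- The ratio `((18+i)/(17+i))^e` is largest at `i = 0`, so the numerical check at `17` and the
-- single check for `18` against `17` suffice for every `D = 17 + i`.
exponential-growth : ∀ e c₁ c₂ p q → 17 ^ e * c₁ ≤ c₂ → 18 ^ e * p ≤ 17 ^ e * q → ∀ i → (17 + i) ^ e * p ^ i * c₁ ≤ q ^ i * c₂
exponential-growth e c₁ c₂ p q base step zero = ≤-trans (≤-reflexive (cong (_* c₁) (*-identityʳ (17 ^ e)))) (≤-trans base (≤-reflexive (sym (*-identityˡ c₂))))
exponential-growth e c₁ c₂ p q base step (suc i) = cancel-pos {m = 17 ^ e} (^-pos e (s≤s z≤n)) (begin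
  17 ^ e * ((17 + suc i) ^ e * (p * p ^ i) * c₁)       ≡⟨ ring (17 ^ e) ((17 + suc i) ^ e) p (p ^ i) c₁ ⟩
  17 ^ e * (17 + suc i) ^ e * p * (p ^ i * c₁)         ≤⟨ *-monoˡ-≤ (p ^ i * c₁) (*-monoˡ-≤ p (subst₂ _≤_ (^-distribʳ-* e 17 (17 + suc i)) (^-distribʳ-* e 18 (17 + i)) (^-monoˡ-≤ e ratio))) ⟩
  18 ^ e * (17 + i) ^ e * p * (p ^ i * c₁)             ≡⟨ ring₂ (18 ^ e) ((17 + i) ^ e) p (p ^ i) c₁ ⟩
  18 ^ e * p * ((17 + i) ^ e * p ^ i * c₁)             ≤⟨ *-mono-≤ step (exponential-growth e c₁ c₂ p q base step i) ⟩
  17 ^ e * q * (q ^ i * c₂)                            ≡⟨ ring₃ (17 ^ e) q (q ^ i) c₂ ⟩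
  17 ^ e * (q * q ^ i * c₂)                            ∎)
  where
  open ≤-Reasoning
  ring : ∀ a b p r c → a * (b * (p * r) * c) ≡ a * b * p * (r * c)
  ring = solve-∀
  ring₂ : ∀ a b p r c → a * b * p * (r * c) ≡ a * p * (b * r * c)
  ring₂ = solve-∀
  ring₃ : ∀ a q r c → a * q * (r * c) ≡ a * (q * r * c)
  ring₃ = solve-∀
  ratio : 17 * (17 + suc i) ≤ 18 * (17 + i)
  ratio = ≤-trans (≤-reflexive (cong (17 *_) (+-suc 17 i))) (≤-trans (≤-reflexive (trans (*-suc 17 (17 + i)) refl)) (+-monoˡ-≤ (17 * (17 + i)) (m≤m+n 17 i)))

-- Every four factors `Y / X` pay for one factor `2`; in this way geometric gains absorb polynomial
-- losses written as powers of two.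
doubling : ∀ X Y s v → X ≤ Y → 2 * X ^ 4 ≤ Y ^ 4 → 4 * s ≤ v → 2 ^ s * X ^ v ≤ Y ^ v
doubling X Y s v X≤Y h 4s≤v = begin
  2 ^ s * X ^ v                       ≡⟨ cong (2 ^ s *_) (split X) ⟩
  2 ^ s * ((X ^ 4) ^ s * X ^ (v ∸ 4 * s)) ≡⟨ sym (*-assoc (2 ^ s) ((X ^ 4) ^ s) _) ⟩
  2 ^ s * (X ^ 4) ^ s * X ^ (v ∸ 4 * s) ≤⟨ *-mono-≤ (≤-trans (≤-reflexive (sym (^-distribʳ-* s 2 (X ^ 4)))) (^-monoˡ-≤ s h)) (^-monoˡ-≤ (v ∸ 4 * s) X≤Y) ⟩
  (Y ^ 4) ^ s * Y ^ (v ∸ 4 * s)       ≡⟨ sym (split Y) ⟩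
  Y ^ v                               ∎
  where
  open ≤-Reasoning
  split : ∀ x → x ^ v ≡ (x ^ 4) ^ s * x ^ (v ∸ 4 * s)
  split x = trans (cong (x ^_) (sym (m+[n∸m]≡n 4s≤v))) (trans (^-distribˡ-+-* x (4 * s) (v ∸ 4 * s)) (cong (_* x ^ (v ∸ 4 * s)) (sym (^-*-assoc x 4 s))))

factorial-power : ∀ m → 2 ^ m * (suc m) ! ≤ suc m ^ suc m
factorial-power zero = ≤ᵇ⇒≤ 1 1 _
factorial-power (suc m) = begin
  2 * 2 ^ m * (s * (suc m) !)          ≡⟨ ring (2 ^ m) s ((suc m) !) ⟩
  s * (2 * (2 ^ m * (suc m) !))        ≤⟨ *-monoʳ-≤ s (*-monoʳ-≤ 2 (factorial-power m)) ⟩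
  s * (2 * suc m ^ suc m)              ≤⟨ *-monoʳ-≤ s (cancel-pos {m = suc m} (s≤s z≤n) (≤-trans (≤-reflexive (ring₂ (suc m) (suc m ^ suc m)))
                                            (≤-trans (bernoulli (suc m) 1 (suc m)) (≤-reflexive (cong (λ x → suc m * x ^ suc m) (+-comm (suc m) 1)))))) ⟩
  s * s ^ suc m                        ∎
  where
  open ≤-Reasoning
  s = suc (suc m)
  ring : ∀ p s f → 2 * p * (s * f) ≡ s * (2 * (p * f))
  ring = solve-∀
  ring₂ : ∀ a p → a * (2 * p) ≡ p * (a + a * 1)
  ring₂ = solve-∀

-- Only the last term of the partial sum at `suc m` is kept, and `factorial-power` bounds it below.
-- Replacing `e` by `2` loses a constant factor in `m / (n log n)`, which the later estimates can
-- afford.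
LeNLogN⇒2^ : ∀ m n → LeNLogN (suc m) n → 2 ^ m ≤ n ^ n
LeNLogN⇒2^ m n h = *-cancelʳ-≤ (2 ^ m) (n ^ n) ((suc m) !) {{>0⇒≢0 (1≤! (suc m))}} (≤-trans (factorial-power m) (≤-trans (m≤n+m (suc m ^ suc m) (suc m * expPart (suc m) m)) (h (suc m))))
  where
  1≤! : ∀ n → 1 ≤ n !
  1≤! zero = ≤-refl
  1≤! (suc n) = *-mono-≤ {1} {suc n} (s≤s z≤n) (1≤! n)

square≤2^ : ∀ i → (4 + i) * (4 + i) ≤ 2 ^ (4 + i)
square≤2^ zero = ≤-refl
square≤2^ (suc i) = ≤-trans (≤-trans (≤-trans (m≤m+n _ (i * i + 6 * i + 7)) (≤-reflexive (ring i))) (*-monoʳ-≤ 2 (square≤2^ i))) ≤-refl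
  where
  ring : ∀ i → (4 + suc i) * (4 + suc i) + (i * i + 6 * i + 7) ≡ 2 * ((4 + i) * (4 + i))
  ring = solve-∀

-- With `c = ⌊b/16⌋`, the linear form in `b` is at most `c² ≤ 2^c`, so its eighth power takes half
-- of the exponent `16 c`; the other half covers `2^(d+20)`.
exponential-dominates : ∀ d → ∃ λ B → ∀ b → B ≤ b → 2 ^ (d + 20) * (10 * b + 5 * d + 30) ^ 8 ≤ 2 ^ b
exponential-dominates d = 16 * c₀ , λ b B≤b → main b (floor-div 16 b (s≤s z≤n)) B≤b
  where
  -- Chosen so that `10 * 16 * (c + 1) + 5 * d + 30 ≤ c₀ * c` for `c ≥ 1`.
  c₀ = 350 + 5 * d
  main : ∀ b → (∃ λ c → 16 * c ≤ b × b < 16 * suc c) → 16 * c₀ ≤ b → 2 ^ (d + 20) * (10 * b + 5 * d + 30) ^ 8 ≤ 2 ^ b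
  main b (c , c≤ , b<) B≤b = begin
    2 ^ (d + 20) * (10 * b + 5 * d + 30) ^ 8  ≤⟨ *-mono-≤ (^-monoʳ-≤ 2 d≤) (^-monoˡ-≤ 8 q≤) ⟩
    2 ^ (8 * c) * (2 ^ c) ^ 8                 ≡⟨ trans (cong (2 ^ (8 * c) *_) (trans (^-*-assoc 2 c 8) (cong (2 ^_) (*-comm c 8)))) (sym (^-distribˡ-+-* 2 (8 * c) (8 * c))) ⟩
    2 ^ (8 * c + 8 * c)                       ≤⟨ ^-monoʳ-≤ 2 (≤-trans (≤-reflexive (sym (*-distribʳ-+ c 8 8))) c≤) ⟩
    2 ^ b ∎
    where
    open ≤-Reasoning
    c₀≤c : c₀ ≤ c
    c₀≤c = ≤-pred (*-cancelˡ-< 16 c₀ (suc c) (≤-trans (s≤s B≤b) b<))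
    d≤ : d + 20 ≤ 8 * c
    d≤ = ≤-trans (≤-trans (+-mono-≤ (m≤n*m d 5) (≤ᵇ⇒≤ 20 350 _)) (≤-reflexive (+-comm (5 * d) 350))) (≤-trans c₀≤c (m≤n*m c 8))
    4≤c : 4 ≤ c
    4≤c = ≤-trans (≤-trans (≤ᵇ⇒≤ 4 350 _) (m≤m+n 350 (5 * d))) c₀≤c
    q≤ : 10 * b + 5 * d + 30 ≤ 2 ^ c
    q≤ = begin
      10 * b + 5 * d + 30                 ≤⟨ +-monoˡ-≤ 30 (+-monoˡ-≤ (5 * d) (*-monoʳ-≤ 10 (<⇒≤ b<))) ⟩
      10 * (16 * suc c) + 5 * d + 30      ≡⟨ cong (λ s → s + 5 * d + 30) (trans (sym (*-assoc 10 16 (suc c))) (*-suc 160 c)) ⟩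
      160 + 160 * c + 5 * d + 30          ≡⟨ ring (160 * c) (5 * d) 160 30 ⟩
      160 * c + (190 + 5 * d)             ≤⟨ +-monoʳ-≤ (160 * c) (≤-trans (≤-reflexive (sym (*-identityʳ (190 + 5 * d)))) (*-monoʳ-≤ (190 + 5 * d) (≤-trans (s≤s z≤n) 4≤c))) ⟩
      160 * c + (190 + 5 * d) * c         ≡⟨ trans (sym (*-distribʳ-+ c 160 (190 + 5 * d))) refl ⟩
      (350 + 5 * d) * c                   ≤⟨ *-monoˡ-≤ c c₀≤c ⟩
      c * c                               ≤⟨ subst (λ s → s * s ≤ 2 ^ s) (m+[n∸m]≡n 4≤c) (square≤2^ (c ∸ 4)) ⟩
      2 ^ c ∎
      where
      ring : ∀ x y a b → a + x + y + b ≡ x + (a + b + y)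
      ring = solve-∀

-- Numerical inequalities per vertex of the union bounds

sparse-base : 17 ^ 3 * (101 * (3 * 6) * 2 ^ 14 * 60 ^ 1015) ≤ 16 * 100 * 5 * 61 ^ 1015
-- The case `D = 17`: `17^3 / 16` stands for `n / z`, `101 / 100` covers its rounding, `2^14` is
-- `2^(k-1)` at the largest admissible `k = 15`, `1015 = 60 * 17 - 5`, and `6 / 5` is the gain per
-- vertex.
sparse-base = ≤ᵇ⇒≤ _ _ _

sparse-step : 18 ^ 3 * (2 * 60 ^ 60) ≤ 17 ^ 3 * 61 ^ 60
sparse-step = ≤ᵇ⇒≤ _ _ _

-- Again `D = 17`. Choosing `U` and `3u` further vertices costs four powers of `n / u`, hence
-- `(17^3)^4` and four rounding factors `101 / 100`; the exponent is `93 = 5 * 17 + 8`, and `2` is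
-- the gain.
closed-base : 17 ^ 12 * (101 * 101 * (101 * 101) * (3 * 3 * (3 * 3) * 2) * 3 ^ 93) ≤ 16 * 100 * (16 * 100) * (16 * 100 * (16 * 100)) * (3 * 3 * 3) * 4 ^ 93
closed-base = ≤ᵇ⇒≤ _ _ _

closed-step : 18 ^ 12 * 3 ^ 5 ≤ 17 ^ 12 * 4 ^ 5
closed-step = ≤ᵇ⇒≤ _ _ _

closed-base₂ : 50 * 50 * (50 * 50) * (3 * 3 * (3 * 3)) * 2 ^ 49 * 2 ≤ 3 * 3 * 3 * 3 ^ 49
closed-base₂ = ≤ᵇ⇒≤ _ _ _

dense-base : 82 * 10 * (82 * 10) * (82 * 10) * (3 * 3 * 3 * 3 ^ 8) ≤ 64 * 8 * (64 * 8) * (64 * 8) * (2 * 2 * 2) * (2 * 2 * 2 ^ 15)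
dense-base = ≤ᵇ⇒≤ _ _ _

split-power : ∀ x c p i → x ^ (c + p * i) ≡ x ^ c * (x ^ p) ^ i
split-power x c p i = trans (^-distribˡ-+-* x c (p * i)) (cong (x ^ c *_) (sym (^-*-assoc x p i)))

round-up : ∀ h z → h ≤ z → suc z * h ≤ z * suc h
round-up h z h≤z = ≤-trans (+-monoˡ-≤ (z * h) h≤z) (≤-reflexive (sym (*-suc z h)))

-- Bookkeeping with the numerals kept as variables, so that large powers remain symbols; the
-- inequality with content is the last hypothesis but the order of `h` and `z`.
sparse-combine : ∀ {s h t g f a z n K E I C P C' P'} → 0 < s * h → s * n ≤ a * suc z → h ≤ z → K ≤ E * I →
  a * (I * P) * (suc h * (t * g) * E * C) ≤ P' * (s * h * f * C') → t * n * 1 * (K * (C * P)) * g ≤ z * 1 * (C' * P') * f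
sparse-combine {s} {h} {t} {g} {f} {a} {z} {n} {K} {E} {I} {C} {P} {C'} {P'} pos n≤ h≤z K≤ core = cancel-pos pos (begin
  s * h * (t * n * 1 * (K * (C * P)) * g)           ≡⟨ ring₁ s h t g n K (C * P) ⟩
  s * n * h * (t * g) * (K * (C * P))               ≤⟨ *-mono-≤ (*-monoˡ-≤ (t * g) (*-monoˡ-≤ h n≤)) (*-monoˡ-≤ (C * P) K≤) ⟩
  a * suc z * h * (t * g) * (E * I * (C * P))       ≡⟨ ring₂ a (suc z) h (t * g) E I C P ⟩
  suc z * h * (a * (I * P) * ((t * g) * E * C))     ≤⟨ *-monoˡ-≤ (a * (I * P) * ((t * g) * E * C)) (round-up h z h≤z) ⟩
  z * suc h * (a * (I * P) * ((t * g) * E * C))     ≡⟨ ring₃ z (suc h) (a * (I * P)) (t * g) E C ⟩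
  z * (a * (I * P) * (suc h * (t * g) * E * C))     ≤⟨ *-monoʳ-≤ z core ⟩
  z * (P' * (s * h * f * C'))                       ≡⟨ ring₄ z P' s h f C' ⟩
  s * h * (z * 1 * (C' * P') * f)                   ∎)
  where
  open ≤-Reasoning
  ring₁ : ∀ s h t x n k w → s * h * (t * n * 1 * (k * w) * x) ≡ s * n * h * (t * x) * (k * w)
  ring₁ = solve-∀
  ring₂ : ∀ a z h t e i c p → a * z * h * t * (e * i * (c * p)) ≡ z * h * (a * (i * p) * (t * e * c))
  ring₂ = solve-∀
  ring₃ : ∀ z h a t e c → z * h * (a * (t * e * c)) ≡ z * (a * (h * t * e * c))
  ring₃ = solve-∀
  ring₄ : ∀ z r s h f c → z * (r * (s * h * f * c)) ≡ s * h * (z * 1 * (c * r) * f)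
  ring₄ = solve-∀

-- k - 1 ≤ D - 3 for D = 17 + i, and the exponent is 60 D - 5.
sparse-unit : ∀ i k z n h h₁ y → h ≡ 60 → h₁ ≡ 61 → y ≡ 1015 + 60 * i → k ∸ 1 ≤ 14 + i → 16 * n ≤ (17 + i) ^ 3 * suc z → 100 ≤ z →
  3 * n * 1 * (2 ^ (k ∸ 1) * h ^ y) * 6 ≤ z * 1 * h₁ ^ y * 5
sparse-unit i k z n h h₁ y h≡ h₁≡ y≡ k≤ n≤ 100≤z = subst₂ (λ s t → 3 * n * 1 * (2 ^ (k ∸ 1) * s) * 6 ≤ z * 1 * t * 5)
  (sym (trans (cong₂ _^_ h≡ y≡) (split-power 60 1015 60 i))) (sym (trans (cong₂ _^_ h₁≡ y≡) (split-power 61 1015 60 i)))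
  (sparse-combine {s = 16} {h = 100} {t = 3} {g = 6} {f = 5} {a = (17 + i) ^ 3} {z = z} {n = n} {K = 2 ^ (k ∸ 1)} {E = 2 ^ 14} {I = 2 ^ i} {C = 60 ^ 1015} {P = (60 ^ 60) ^ i} {C' = 61 ^ 1015} {P' = (61 ^ 60) ^ i}
    (s≤s z≤n) n≤ 100≤z (≤-trans (^-monoʳ-≤ 2 k≤) (≤-reflexive (^-distribˡ-+-* 2 14 i)))
    (subst (λ s → (17 + i) ^ 3 * s * (101 * (3 * 6) * 2 ^ 14 * 60 ^ 1015) ≤ (61 ^ 60) ^ i * (16 * 100 * 5 * 61 ^ 1015)) (^-distribʳ-* i 2 (60 ^ 60))
      (exponential-growth 3 (101 * (3 * 6) * 2 ^ 14 * 60 ^ 1015) (16 * 100 * 5 * 61 ^ 1015) (2 * 60 ^ 60) (61 ^ 60) sparse-base sparse-step i)))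

closed-combine : ∀ {s h c w a u n Y Z C P C' P'} → 0 < s * h → s * n ≤ a * suc u → h ≤ u → Y ≡ C * P → Z ≡ C' * P' →
  a * a * (a * a) * P * (suc h * suc h * (suc h * suc h) * (c * c * (c * c) * w) * C) ≤ P' * (s * h * (s * h) * (s * h * (s * h)) * (c * c * c) * C') →
  c * n * (c * n) ^ 3 * Y * w ≤ u * (c * u) ^ 3 * Z * 1
closed-combine {s} {h} {c} {w} {a} {u} {n} {C = C} {P} {C'} {P'} pos n≤ h≤u refl refl core = cancel-pos (*-mono-≤ (*-mono-≤ pos pos) (*-mono-≤ pos pos)) (begin
  s * h * (s * h) * (s * h * (s * h)) * (c * n * (c * n) ^ 3 * (C * P) * w)
    ≡⟨ ring₁ (s * h) c n (C * P) w ⟩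
  s * h * n * (s * h * n) * (s * h * n * (s * h * n)) * (c * c * (c * c) * (C * P) * w)
    ≤⟨ *-monoˡ-≤ (c * c * (c * c) * (C * P) * w) (*-mono-≤ (*-mono-≤ step step) (*-mono-≤ step step)) ⟩
  a * (u * suc h) * (a * (u * suc h)) * (a * (u * suc h) * (a * (u * suc h))) * (c * c * (c * c) * (C * P) * w)
    ≡⟨ ring₂ a u (suc h) c C P w ⟩
  u * u * (u * u) * (a * a * (a * a) * P * (suc h * suc h * (suc h * suc h) * (c * c * (c * c) * w) * C))
    ≤⟨ *-monoʳ-≤ (u * u * (u * u)) core ⟩
  u * u * (u * u) * (P' * (s * h * (s * h) * (s * h * (s * h)) * (c * c * c) * C'))
    ≡⟨ ring₃ u P' (s * h) c C' ⟩
  s * h * (s * h) * (s * h * (s * h)) * (u * (c * u) ^ 3 * (C' * P') * 1) ∎)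
  where
  open ≤-Reasoning
  step : s * h * n ≤ a * (u * suc h)
  step = ≤-trans (≤-reflexive (ring s h n)) (≤-trans (*-monoˡ-≤ h n≤) (≤-trans (≤-reflexive (*-assoc a (suc u) h)) (*-monoʳ-≤ a (round-up h u h≤u))))
    where
    ring : ∀ s h n → s * h * n ≡ s * n * h
    ring = solve-∀
  ring₁ : ∀ s c n y w → s * s * (s * s) * (c * n * (c * n * (c * n * (c * n * 1))) * y * w) ≡ s * n * (s * n) * (s * n * (s * n)) * (c * c * (c * c) * y * w)
  ring₁ = solve-∀
  ring₂ : ∀ a u h c C P w → a * (u * h) * (a * (u * h)) * (a * (u * h) * (a * (u * h))) * (c * c * (c * c) * (C * P) * w) ≡ u * u * (u * u) * (a * a * (a * a) * P * (h * h * (h * h) * (c * c * (c * c) * w) * C))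
  ring₂ = solve-∀
  ring₃ : ∀ u p s c C → u * u * (u * u) * (p * (s * s * (s * s) * (c * c * c) * C)) ≡ s * s * (s * s) * (u * (c * u * (c * u * (c * u * 1))) * (C * p) * 1)
  ring₃ = solve-∀

closed-unit : ∀ i u n h h₁ y → h ≡ 3 → h₁ ≡ 4 → y ≡ 93 + 5 * i → 16 * n ≤ (17 + i) ^ 3 * suc u → 100 ≤ u →
  3 * n * (3 * n) ^ 3 * h ^ y * 2 ≤ u * (3 * u) ^ 3 * h₁ ^ y * 1
closed-unit i u n h h₁ y h≡ h₁≡ y≡ n≤ 100≤u = closed-combine {s = 16} {h = 100} {c = 3} {w = 2} {a = (17 + i) ^ 3} {u = u} {n = n} {C = 3 ^ 93} {P = (3 ^ 5) ^ i} {C' = 4 ^ 93} {P' = (4 ^ 5) ^ i}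
  (s≤s z≤n) n≤ 100≤u (trans (cong₂ _^_ h≡ y≡) (split-power 3 93 5 i)) (trans (cong₂ _^_ h₁≡ y≡) (split-power 4 93 5 i))
  (subst (λ s → s * (3 ^ 5) ^ i * (101 * 101 * (101 * 101) * (3 * 3 * (3 * 3) * 2) * 3 ^ 93) ≤ (4 ^ 5) ^ i * (16 * 100 * (16 * 100) * (16 * 100 * (16 * 100)) * (3 * 3 * 3) * 4 ^ 93)) (sym (fourth (17 + i)))
    (exponential-growth 12 (101 * 101 * (101 * 101) * (3 * 3 * (3 * 3) * 2) * 3 ^ 93) (16 * 100 * (16 * 100) * (16 * 100 * (16 * 100)) * (3 * 3 * 3) * 4 ^ 93) (3 ^ 5) (4 ^ 5) closed-base closed-step i))
  where
  fourth : ∀ x → x ^ 3 * x ^ 3 * (x ^ 3 * x ^ 3) ≡ x ^ 12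
  fourth x = trans (cong₂ _*_ (sym (^-distribˡ-+-* x 3 3)) (sym (^-distribˡ-+-* x 3 3))) (sym (^-distribˡ-+-* x 6 6))

closed-combine₂ : ∀ {r c w u n Y Z} → n ≤ r * u → r * r * (r * r) * (c * c * (c * c)) * Y * w ≤ c * c * c * Z → c * n * (c * n) ^ 3 * Y * w ≤ u * (c * u) ^ 3 * Z * 1
closed-combine₂ {r} {c} {w} {u} {n} {Y} {Z} n≤ core = begin
  c * n * (c * n) ^ 3 * Y * w                         ≡⟨ ring₁ c n Y w ⟩
  n * n * (n * n) * (c * c * (c * c) * Y * w)         ≤⟨ *-monoˡ-≤ (c * c * (c * c) * Y * w) (*-mono-≤ (*-mono-≤ n≤ n≤) (*-mono-≤ n≤ n≤)) ⟩
  r * u * (r * u) * (r * u * (r * u)) * (c * c * (c * c) * Y * w) ≡⟨ ring₂ r u (c * c * (c * c)) Y w ⟩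
  u * u * (u * u) * (r * r * (r * r) * (c * c * (c * c)) * Y * w) ≤⟨ *-monoʳ-≤ (u * u * (u * u)) core ⟩
  u * u * (u * u) * (c * c * c * Z)                   ≡⟨ ring₃ u c Z ⟩
  u * (c * u) ^ 3 * Z * 1                             ∎
  where
  open ≤-Reasoning
  ring₁ : ∀ c n y w → c * n * (c * n * (c * n * (c * n * 1))) * y * w ≡ n * n * (n * n) * (c * c * (c * c) * y * w)
  ring₁ = solve-∀
  ring₂ : ∀ r u c y w → r * u * (r * u) * (r * u * (r * u)) * (c * y * w) ≡ u * u * (u * u) * (r * r * (r * r) * c * y * w)
  ring₂ = solve-∀
  ring₃ : ∀ u c z → u * u * (u * u) * (c * c * c * z) ≡ u * (c * u * (c * u * (c * u * 1))) * z * 1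
  ring₃ = solve-∀

closed-unit₂ : ∀ u n h h₁ y → h ≡ 2 → h₁ ≡ 3 → y ≡ 49 → n ≤ 50 * u → 3 * n * (3 * n) ^ 3 * h ^ y * 2 ≤ u * (3 * u) ^ 3 * h₁ ^ y * 1
closed-unit₂ u n h h₁ y refl refl refl n≤ = closed-combine₂ {r = 50} {c = 3} {w = 2} {u = u} {n = n} {Y = 2 ^ 49} {Z = 3 ^ 49} n≤ closed-base₂

-- With `n / u` at most a constant times `lam³`, the three powers of `n / u` spent on choosing `U`
-- and `X` cost `lam^9`. Of `lam^15` this leaves the gain `lam^6`, up to the constant `H`.
dense-combine : ∀ {a b c t x y u n lam S R W H} → 0 < a * b → t * n ≤ S * R * u → a * S ≤ x * (lam * lam) → b * R ≤ y * lam →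
  x * y * (x * y) * (x * y) * (c * c * c * W) ≤ a * b * (a * b) * (a * b) * (t * t * t) * (t * t * H) → 0 < t →
  c * n * (c * n) ^ 2 * W * lam ^ 6 ≤ u * (t * u) ^ 2 * lam ^ 15 * H
dense-combine {a} {b} {c} {t} {x} {y} {u} {n} {lam} {S} {R} {W} {H} pos n≤ S≤ R≤ core 0<t = cancel-pos (*-mono-≤ (*-mono-≤ (*-mono-≤ pos pos) pos) (*-mono-≤ (*-mono-≤ 0<t 0<t) 0<t)) (begin
  a * b * (a * b) * (a * b) * (t * t * t) * (c * n * (c * n) ^ 2 * W * lam ^ 6)
    ≡⟨ ring₁ (a * b) t c n W (lam ^ 6) ⟩
  a * b * (t * n) * (a * b * (t * n)) * (a * b * (t * n)) * (c * c * c * W * lam ^ 6)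
    ≤⟨ *-monoˡ-≤ (c * c * c * W * lam ^ 6) (*-mono-≤ (*-mono-≤ bound bound) bound) ⟩
  x * y * (lam * lam * lam * u) * (x * y * (lam * lam * lam * u)) * (x * y * (lam * lam * lam * u)) * (c * c * c * W * lam ^ 6)
    ≡⟨ ring₂ (x * y) u lam (c * c * c * W) (lam ^ 6) ⟩
  x * y * (x * y) * (x * y) * (c * c * c * W) * (u * u * u * (lam ^ 9 * lam ^ 6))
    ≤⟨ *-monoˡ-≤ (u * u * u * (lam ^ 9 * lam ^ 6)) core ⟩
  a * b * (a * b) * (a * b) * (t * t * t) * (t * t * H) * (u * u * u * (lam ^ 9 * lam ^ 6))
    ≡⟨ cong (λ s → a * b * (a * b) * (a * b) * (t * t * t) * (t * t * H) * (u * u * u * s)) (sym (^-distribˡ-+-* lam 9 6)) ⟩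
  a * b * (a * b) * (a * b) * (t * t * t) * (t * t * H) * (u * u * u * lam ^ 15)
    ≡⟨ ring₃ (a * b * (a * b) * (a * b) * (t * t * t)) t H u (lam ^ 15) ⟩
  a * b * (a * b) * (a * b) * (t * t * t) * (u * (t * u) ^ 2 * lam ^ 15 * H) ∎)
  where
  open ≤-Reasoning
  bound : a * b * (t * n) ≤ x * y * (lam * lam * lam * u)
  bound = ≤-trans (*-monoʳ-≤ (a * b) n≤) (≤-trans (≤-reflexive (ring a b S R u)) (≤-trans (*-monoˡ-≤ u (*-mono-≤ S≤ R≤)) (≤-reflexive (ring' x y lam u))))
    where
    ring : ∀ a b x y u → a * b * (x * y * u) ≡ a * x * (b * y) * u
    ring = solve-∀
    ring' : ∀ a b x u → a * (x * x) * (b * x) * u ≡ a * b * (x * x * x * u)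
    ring' = solve-∀
  ring₁ : ∀ s t c n w r → s * s * s * (t * t * t) * (c * n * (c * n * (c * n * 1)) * w * r) ≡ s * (t * n) * (s * (t * n)) * (s * (t * n)) * (c * c * c * w * r)
  ring₁ = solve-∀
  ring₂ : ∀ a u x c w → a * (x * x * x * u) * (a * (x * x * x * u)) * (a * (x * x * x * u)) * (c * w) ≡ a * a * a * c * (u * u * u * (x * (x * (x * (x * (x * (x * (x * (x * (x * 1)))))))) * w))
  ring₂ = solve-∀
  ring₃ : ∀ a t w u x → a * (t * t * w) * (u * u * u * x) ≡ a * (u * (t * u * (t * u * 1)) * x * w)
  ring₃ = solve-∀

-- For lam ≥ 8: (lam + 1)² + 1 ≤ (82/64) lam² and lam + 2 ≤ (10/8) lam.
dense-unit : ∀ u n lam → 8 ≤ lam → 2 * n ≤ (suc lam * suc lam + 1) * (lam + 2) * u →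
  3 * n * (3 * n) ^ 2 * 3 ^ 8 * lam ^ 6 ≤ u * (2 * u) ^ 2 * lam ^ 15 * 2 ^ 15
dense-unit u n lam 8≤lam n≤ = dense-combine {a = 64} {b = 8} {c = 3} {t = 2} {x = 82} {y = 10} {u = u} {n = n} {lam = lam} {S = suc lam * suc lam + 1} {R = lam + 2} {W = 3 ^ 8} {H = 2 ^ 15}
    (s≤s z≤n) n≤ lam₁ lam₂ dense-base (s≤s z≤n)
  where
  open ≤-Reasoning
  lam₂ : 8 * (lam + 2) ≤ 10 * lam
  lam₂ = ≤-trans (≤-reflexive (*-distribˡ-+ 8 lam 2)) (≤-trans (+-monoʳ-≤ (8 * lam) (*-monoʳ-≤ 2 8≤lam)) (≤-reflexive (sym (*-distribʳ-+ lam 8 2))))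
  ring : ∀ c x → c * (suc x * suc x + 1) ≡ c * (x * x) + (c * 2 * x + c * 2)
  ring = solve-∀
  lam₁ : 64 * (suc lam * suc lam + 1) ≤ 82 * (lam * lam)
  lam₁ = begin
    64 * (suc lam * suc lam + 1)                ≡⟨ ring 64 lam ⟩
    64 * (lam * lam) + (128 * lam + 16 * 8)     ≤⟨ +-monoʳ-≤ (64 * (lam * lam)) (+-monoʳ-≤ (128 * lam) (*-monoʳ-≤ 16 8≤lam)) ⟩
    64 * (lam * lam) + (128 * lam + 16 * lam)   ≡⟨ cong (64 * (lam * lam) +_) (trans (sym (*-distribʳ-+ lam 128 16)) (*-assoc 18 8 lam)) ⟩
    64 * (lam * lam) + 18 * (8 * lam)           ≤⟨ +-monoʳ-≤ (64 * (lam * lam)) (*-monoʳ-≤ 18 (*-monoˡ-≤ lam 8≤lam)) ⟩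
    64 * (lam * lam) + 18 * (lam * lam)         ≡⟨ sym (*-distribʳ-+ (lam * lam) 64 18) ⟩
    82 * (lam * lam)                            ∎

-- Choice of parameters

-- D = ⌊m/n⌋ is the edge density, b = ⌊log₂ n⌋, and q majorises every logarithmic quantity.
record Setting (n m k D b d q : ℕ) : Set where
  field
    17≤D  : 17 ≤ D
    q≡    : q ≡ 10 * b + 5 * d + 30
    2^b≤n : 2 ^ b ≤ n
    n<2^  : n < 2 ^ suc b
    Dn≤m  : D * n ≤ m
    m<    : m < suc D * n
    k≤    : k + 2 ≤ D
    15≤k  : 15 ≤ k
    D≤    : D ≤ b + 1
    big   : 2 ^ (d + 20) * q ^ 8 ≤ n

module Logs {n m k D b d q : ℕ} (setting : Setting n m k D b d q) where
  open Setting setting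
  open ≤-Reasoning

  N = length (allPairs n)

  16≤b : 16 ≤ b
  16≤b = ≤-pred (≤-trans 17≤D (≤-trans D≤ (≤-reflexive (+-comm b 1))))

  100≤q : 100 ≤ q
  100≤q = ≤-trans (≤ᵇ⇒≤ 100 160 _) (≤-trans (*-monoʳ-≤ 10 16≤b) (≤-trans (≤-trans (m≤m+n (10 * b) (5 * d)) (m≤m+n (10 * b + 5 * d) 30)) (≤-reflexive (sym q≡))))

  b+2≤q : b + 2 ≤ q
  b+2≤q = ≤-trans (+-mono-≤ (≤-trans (m≤n*m b 10) (m≤m+n (10 * b) (5 * d))) (≤ᵇ⇒≤ 2 30 _)) (≤-reflexive (sym q≡))

  sD≤b+2 : suc D ≤ b + 2
  sD≤b+2 = ≤-trans (s≤s D≤) (≤-reflexive (sym (+-suc b 1)))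

  sD≤q : suc D ≤ q
  sD≤q = ≤-trans sD≤b+2 b+2≤q

  0<D : 0 < D
  0<D = ≤-trans (s≤s z≤n) 17≤D

  D≤q : D ≤ q
  D≤q = <⇒≤ sD≤q

  0<q : 0 < q
  0<q = ≤-trans (s≤s z≤n) 100≤q

  polynomial : ∀ c e → c ≤ 2 ^ 20 → e ≤ 8 → c * q ^ e ≤ n
  polynomial c e c≤ e≤ = ≤-trans (*-mono-≤ (≤-trans c≤ (^-monoʳ-≤ 2 (m≤n+m 20 d))) (^-monoʳ-≤ q {{>0⇒≢0 0<q}} e≤)) big

  linear : ∀ c → c ≤ 2 ^ 20 → c * q ≤ n
  linear c c≤ = subst (λ s → c * s ≤ n) (*-identityʳ q) (polynomial c 1 c≤ (s≤s z≤n))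

  100≤n : 100 ≤ n
  100≤n = ≤-trans 100≤q (≤-trans (m≤n*m q 1) (linear 1 (≤ᵇ⇒≤ 1 (2 ^ 20) _)))

  0<n : 0 < n
  0<n = ≤-trans (s≤s z≤n) 100≤n

  NN : N + N + n ≡ n * n
  NN = length-allPairs {n}

  m≤qn : m ≤ q * n
  m≤qn = ≤-trans (<⇒≤ m<) (*-monoˡ-≤ n sD≤q)

  sparse-total : 100 * (n + 2 * m) ≤ n * n
  sparse-total = ≤-trans (*-monoʳ-≤ 100 (+-mono-≤ (m≤n*m n q {{>0⇒≢0 0<q}}) (*-monoʳ-≤ 2 m≤qn)))
    (≤-trans (≤-reflexive (trans (cong (100 *_) (ring (q * n))) (trans (sym (*-assoc 100 3 (q * n))) (sym (*-assoc 300 q n))))) (*-monoˡ-≤ n (linear 300 (≤ᵇ⇒≤ 300 (2 ^ 20) _))))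
    where
    ring : ∀ x → x + 2 * x ≡ 3 * x
    ring = solve-∀

  n+m≤N : n + m ≤ N
  n+m≤N = *-cancelˡ-≤ 2 (+-cancelˡ-≤ n (2 * (n + m)) (2 * N) (begin
    n + 2 * (n + m)                            ≤⟨ m≤m+n (n + 2 * (n + m)) (97 * n + 198 * m) ⟩
    n + 2 * (n + m) + (97 * n + 198 * m)       ≡⟨ ring₁ 97 198 n m ⟩
    (1 + 2 + 97) * n + (2 + 198) * m           ≡⟨ cong (100 * n +_) (*-assoc 100 2 m) ⟩
    100 * n + 100 * (2 * m)                    ≡⟨ sym (*-distribˡ-+ 100 n (2 * m)) ⟩
    100 * (n + 2 * m)                          ≤⟨ sparse-total ⟩
    n * n                                      ≡⟨ trans (sym NN) (ring₂ N n) ⟩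
    n + 2 * N                                  ∎))
    where
    ring₁ : ∀ a b n m → n + 2 * (n + m) + (a * n + b * m) ≡ (1 + 2 + a) * n + (2 + b) * m
    ring₁ = solve-∀
    ring₂ : ∀ x n → x + x + n ≡ n + 2 * x
    ring₂ = solve-∀

  2N≤nn : 2 * N ≤ n * n
  2N≤nn = ≤-trans (m≤m+n (2 * N) n) (≤-reflexive (trans (cong (λ s → N + s + n) (+-identityʳ N)) NN))

  t = n / 8

  8t≤n : 8 * t ≤ n
  8t≤n = ≤-trans (≤-reflexive (*-comm 8 t)) (Data.Nat.DivMod.m/n*n≤m n 8)

  n<8t+8 : n < 8 * suc t
  n<8t+8 = begin-strict
    n                                 ≡⟨ Data.Nat.DivMod.m≡m%n+[m/n]*n n 8 ⟩
    n Data.Nat.% 8 + t * 8            <⟨ +-monoˡ-< (t * 8) (Data.Nat.DivMod.m%n<n n 8) ⟩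
    8 + t * 8                         ≡⟨ trans (cong (8 +_) (*-comm t 8)) (sym (*-suc 8 t)) ⟩
    8 * suc t                         ∎

  0<t : 0 < t
  0<t = ≤-pred (*-cancelˡ-< 8 1 (suc t) (≤-<-trans (≤-trans (≤ᵇ⇒≤ 8 100 _) 100≤n) n<8t+8))

  t≤n : t ≤ n
  t≤n = ≤-trans (m≤n*m t 8) 8t≤n

-- The hypotheses make `z = ⌊16n/D³⌋`. For sparse cuts the number of choices per vertex is then
-- cubic in `D`, against an exponential gain; for dense pairs, `u ≤ z` will force `lam ≥ 8` and
-- `suc D ≤ 2 (lam + 2)`.
module Sizes {n m k D b d q l l' z : ℕ} (setting : Setting n m k D b d q) (total : m + l ≡ length (allPairs n)) (total' : n / 8 + l' ≡ l)
  (z-lo : D ^ 3 * z ≤ 16 * n) (z-hi : 16 * n < D ^ 3 * suc z) where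
  open Setting setting public
  open Logs setting public
  open ≤-Reasoning

  nn≡ : n * n ≡ 2 * l + (n + 2 * m)
  nn≡ = trans (sym NN) (trans (cong (λ s → s + s + n) (sym total)) (ring m l n))
    where
    ring : ∀ m l n → m + l + (m + l) + n ≡ 2 * l + (n + 2 * m)
    ring = solve-∀

  99nn≤200l : 99 * (n * n) ≤ 200 * l
  99nn≤200l = +-cancelʳ-≤ (n * n) (99 * (n * n)) (200 * l) (begin
    99 * (n * n) + n * n             ≡⟨ +-comm (99 * (n * n)) (n * n) ⟩
    100 * (n * n)                    ≡⟨ cong (100 *_) nn≡ ⟩
    100 * (2 * l + (n + 2 * m))      ≡⟨ trans (*-distribˡ-+ 100 (2 * l) (n + 2 * m)) (cong (_+ 100 * (n + 2 * m)) (sym (*-assoc 100 2 l))) ⟩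
    200 * l + 100 * (n + 2 * m)      ≤⟨ +-monoʳ-≤ (200 * l) sparse-total ⟩
    200 * l + n * n                  ∎)

  2[m+l]≤nn : 2 * (m + l) ≤ n * n
  2[m+l]≤nn = subst (λ s → 2 * s ≤ n * n) (sym total) 2N≤nn

  2l≤nn : 2 * l ≤ n * n
  2l≤nn = ≤-trans (*-monoʳ-≤ 2 (m≤n+m l m)) 2[m+l]≤nn

  n<l : n < l
  n<l = *-cancelˡ-< 200 n l (<-≤-trans (*-monoˡ-< n {{>0⇒≢0 0<n}} (≤ᵇ⇒≤ 201 9900 _)) (≤-trans (≤-trans (≤-reflexive (*-assoc 99 100 n)) (*-monoʳ-≤ 99 (*-monoˡ-≤ n 100≤n))) 99nn≤200l))

  0<l : 0 < l
  0<l = ≤-trans 0<n (<⇒≤ n<l)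

  0<l' : 0 < l'
  0<l' = +-cancelˡ-< t 0 l' (≤-<-trans (≤-reflexive (+-identityʳ t)) (≤-<-trans t≤n (subst (n <_) (sym total') n<l)))

  0<m : 0 < m
  0<m = ≤-trans (*-mono-≤ {1} {D} 0<D 0<n) Dn≤m

  -- `307` is the integer part of `17^3 / 16`.
  307z≤n : 307 * z ≤ n
  307z≤n = cancel-pos {m = 16} (s≤s z≤n) (≤-trans (≤-reflexive (sym (*-assoc 16 307 z)))
    (≤-trans (*-monoˡ-≤ z (≤-trans (≤ᵇ⇒≤ (16 * 307) (17 ^ 3) _) (^-monoˡ-≤ 3 17≤D))) z-lo))

  400q≤z : 400 * q ≤ z
  400q≤z with ≤-<-connex (400 * q) z
  ... | inj₁ h = h
  ... | inj₂ z< = ⊥-elim (<-irrefl refl (begin-strict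
    16 * n                <⟨ z-hi ⟩
    D ^ 3 * suc z         ≤⟨ *-mono-≤ (^-monoˡ-≤ 3 D≤q) z< ⟩
    q ^ 3 * (400 * q)     ≡⟨ ring (q ^ 3) 400 q ⟩
    400 * q ^ 4           ≤⟨ polynomial 400 4 (≤ᵇ⇒≤ 400 (2 ^ 20) _) (≤ᵇ⇒≤ 4 8 _) ⟩
    n                     ≤⟨ m≤n*m n 16 ⟩
    16 * n                ∎))
    where
    ring : ∀ p c q → p * (c * q) ≡ c * (q * p)
    ring = solve-∀

  100≤z : 100 ≤ z
  100≤z = ≤-trans 100≤q (≤-trans (m≤n*m q 400) 400q≤z)

  0<z : 0 < z
  0<z = ≤-trans (s≤s z≤n) 100≤z

  -- `2^Λ` bounds all polynomial losses together. The form `5 (2b + d + 4)` is divisible by the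
  -- least size of a dense pair, so that five vertices can share the loss equally.
  Λ = 10 * b + 5 * d + 20

  Λ≤q : Λ ≤ q
  Λ≤q = ≤-trans (+-monoʳ-≤ (10 * b + 5 * d) (≤ᵇ⇒≤ 20 30 _)) (≤-reflexive (sym q≡))

  4Λ≤z : 4 * Λ ≤ z
  4Λ≤z = ≤-trans (*-mono-≤ (≤ᵇ⇒≤ 4 400 _) Λ≤q) 400q≤z

  Λ≤z : Λ ≤ z
  Λ≤z = ≤-trans (m≤n*m Λ 4) 4Λ≤z

  scale = n ^ 3 * suc d
  loss = suc (m + l) * suc l * (4 * scale)

  loss-bound : suc n * loss ≤ 2 ^ Λ
  loss-bound = begin
    suc n * (suc (m + l) * suc l * (4 * (n ^ 3 * suc d)))
      ≤⟨ *-mono-≤ n<2^ (*-mono-≤ (*-mono-≤ sN≤ (≤-trans (s≤s (m≤n+m l m)) sN≤)) (*-monoʳ-≤ 4 (*-mono-≤ (^-monoˡ-≤ 3 (<⇒≤ n<2^)) (d<2^d d)))) ⟩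
    P * (P * P * (P * P) * (4 * (P ^ 3 * 2 ^ d)))
      ≡⟨ ring P (2 ^ d) 4 ⟩
    4 * 2 ^ d * P ^ 8
      ≡⟨ trans (cong₂ _*_ (sym (^-distribˡ-+-* 2 2 d)) (^-*-assoc 2 (suc b) 8)) (sym (^-distribˡ-+-* 2 (2 + d) (suc b * 8))) ⟩
    2 ^ (2 + d + suc b * 8)
      ≤⟨ ^-monoʳ-≤ 2 (≤-trans (≤-reflexive (trans (cong (2 + d +_) (cong (8 +_) (*-comm b 8))) (ring₂ d (8 * b) 2 8)))
           (+-mono-≤ (+-mono-≤ (*-monoˡ-≤ b (≤ᵇ⇒≤ 8 10 _)) (m≤n*m d 5)) (≤ᵇ⇒≤ 10 20 _))) ⟩
    2 ^ Λ ∎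
    where
    P = 2 ^ suc b
    d<2^d : ∀ d → suc d ≤ 2 ^ d
    d<2^d zero = ≤-refl
    d<2^d (suc d) = ≤-trans (s≤s (d<2^d d)) (≤-trans (+-monoˡ-≤ (2 ^ d) (m^n>0 2 d)) (≤-reflexive (cong (2 ^ d +_) (sym (+-identityʳ (2 ^ d))))))
    sN≤ : suc (m + l) ≤ P * P
    sN≤ = ≤-trans (subst (λ s → suc s ≤ n * n) (sym total) (≤-trans (≤-trans (≤-trans (≤-reflexive (+-comm 1 N)) (+-monoʳ-≤ N 0<n)) (+-monoˡ-≤ n (m≤m+n N N))) (≤-reflexive NN)))
      (*-mono-≤ (<⇒≤ n<2^) (<⇒≤ n<2^))
    ring : ∀ p d c → p * (p * p * (p * p) * (c * (p * (p * (p * 1)) * d))) ≡ c * d * (p * (p * (p * (p * (p * (p * (p * (p * 1))))))))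
    ring = solve-∀
    ring₂ : ∀ d x a c → a + d + (c + x) ≡ x + d + (a + c)
    ring₂ = solve-∀

  graph-loss≤ : suc n * (suc (m + l) * (4 * scale)) ≤ 2 ^ Λ
  graph-loss≤ = ≤-trans (*-monoʳ-≤ (suc n) (*-monoˡ-≤ (4 * scale) (m≤m*n (suc (m + l)) (suc l)))) loss-bound

  block : ∀ h j → 0 < l → n * n ≤ 2 * (h * D * j * n) → l ^ j * suc h ≤ (m + l) ^ j * h
  block h j 0<l nn≤ = subst (λ s → l ^ j * suc h ≤ s ^ j * h) (+-comm l m) (bernoulli-block l m h j 0<l (*-cancelˡ-≤ 2 (begin
    2 * l                  ≤⟨ 2l≤nn ⟩
    n * n                  ≤⟨ nn≤ ⟩
    2 * (h * D * j * n)    ≡⟨ cong (2 *_) (ring h D j n) ⟩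
    2 * (h * (j * (D * n))) ≤⟨ *-monoʳ-≤ 2 (*-monoʳ-≤ h (*-monoʳ-≤ j Dn≤m)) ⟩
    2 * (h * (j * m))      ∎)))
    where
    ring : ∀ h d j n → h * d * j * n ≡ h * (j * (d * n))
    ring = solve-∀

  sparse-block : ∀ h j → n < h * D * j → (2 * l + m) ^ j * suc h ≤ (2 * (m + l)) ^ j * h
  sparse-block h j hi = subst (λ s → (2 * l + m) ^ j * suc h ≤ s ^ j * h) (ring₁ l m) (bernoulli-block (2 * l + m) m h j (≤-trans 0<m (m≤n+m m (2 * l))) (begin
    2 * l + m                   ≤⟨ ≤-trans (m≤m+n (2 * l + m) m) (≤-reflexive (ring₁ l m)) ⟩
    2 * (m + l)                 ≤⟨ 2[m+l]≤nn ⟩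
    n * n                       ≤⟨ *-monoˡ-≤ n (<⇒≤ hi) ⟩
    h * D * j * n               ≡⟨ ring₂ h D j n ⟩
    h * (j * (D * n))           ≤⟨ *-monoʳ-≤ h (*-monoʳ-≤ j Dn≤m) ⟩
    h * (j * m)                 ∎))
    where
    ring₁ : ∀ l m → 2 * l + m + m ≡ 2 * (m + l)
    ring₁ = solve-∀
    ring₂ : ∀ h d j n → h * d * j * n ≡ h * (j * (d * n))
    ring₂ = solve-∀

  12D[60D+z]≤n : 12 * D * (60 * D + z) ≤ n
  12D[60D+z]≤n = cancel-pos {m = D * D} (*-mono-≤ 0<D 0<D) (begin
    D * D * (12 * D * (60 * D + z))        ≡⟨ ring D 12 60 z ⟩
    12 * 60 * D ^ 4 + 12 * (D ^ 3 * z)     ≤⟨ +-mono-≤ (≤-trans (*-monoʳ-≤ (12 * 60) (^-monoˡ-≤ 4 D≤q)) (polynomial (12 * 60) 4 (≤ᵇ⇒≤ (12 * 60) (2 ^ 20) _) (≤ᵇ⇒≤ 4 8 _))) (*-monoʳ-≤ 12 z-lo) ⟩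
    n + 12 * (16 * n)                      ≡⟨ cong (n +_) (sym (*-assoc 12 16 n)) ⟩
    n + 12 * 16 * n                        ≤⟨ *-monoˡ-≤ n (≤-trans (≤ᵇ⇒≤ (suc (12 * 16)) (17 * 17) _) (*-mono-≤ 17≤D 17≤D)) ⟩
    D * D * n                              ∎)
    where
    ring : ∀ d a c z → d * d * (a * d * (c * d + z)) ≡ a * c * (d * (d * (d * (d * 1)))) + a * (d * (d * (d * 1)) * z)
    ring = solve-∀

  -- There are `y = 60 D - 5` blocks where `60 D` would fill `n`: the five omitted blocks absorb the
  -- rounding of `j` and the `z` vertices of the cut itself.
  sparse-fits : ∀ h y j → h ≡ 60 → y + 5 ≡ h * D → h * D * j ≤ n + h * D → n < h * D * j → y * j + z ≤ n
  sparse-fits h y j h≡ y+5 lo hi = +-cancelʳ-≤ (5 * j) (y * j + z) n (begin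
    y * j + z + 5 * j                ≡⟨ ring₁ y j z 5 ⟩
    (y + 5) * j + z                  ≡⟨ cong (λ s → s * j + z) y+5 ⟩
    h * D * j + z                    ≤⟨ +-monoˡ-≤ z lo ⟩
    n + h * D + z                    ≡⟨ +-assoc n (h * D) z ⟩
    n + (h * D + z)                  ≤⟨ +-monoʳ-≤ n c+z≤5j ⟩
    n + 5 * j                        ∎)
    where
    ring₁ : ∀ y j z c → y * j + z + c * j ≡ (y + c) * j + z
    ring₁ = solve-∀
    ring₂ : ∀ f e d j → f * e * d * j ≡ e * d * (f * j)
    ring₂ = solve-∀
    c+z≤5j : h * D + z ≤ 5 * j
    c+z≤5j = cancel-pos {m = 12 * D} (*-mono-≤ {1} {12} (s≤s z≤n) 0<D) (begin
      12 * D * (h * D + z)           ≡⟨ cong (λ s → 12 * D * (s * D + z)) h≡ ⟩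
      12 * D * (60 * D + z)          ≤⟨ 12D[60D+z]≤n ⟩
      n                              ≤⟨ <⇒≤ hi ⟩
      h * D * j                      ≡⟨ cong (λ s → s * D * j) h≡ ⟩
      5 * 12 * D * j                 ≡⟨ ring₂ 5 12 D j ⟩
      12 * D * (5 * j)               ∎)

  i = D ∸ 17

  D≡17+i : D ≡ 17 + i
  D≡17+i = sym (m+[n∸m]≡n 17≤D)

  W = m ^ m * l ^ l

  sparse-with : ∀ h y j → h ≡ 60 → y ≡ 1015 + 60 * i → y + 5 ≡ h * D → h * D * j ≤ n + h * D → n < h * D * j →
    W * ∑ (subs m (allPairs n)) (sparseCuts k z) * 6 ^ z ≤ 5 ^ z * (m + l) ^ (m + l)
  sparse-with h y j h≡ y≡ y+5 lo hi = sparse-bound {n} {m} {l} total 0<l k z h j y {5} {6} 0<n 0<z (sparse-block h j hi) (sparse-fits h y j h≡ y+5 lo hi)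
    (sparse-unit i k z n h (suc h) y h≡ (cong suc h≡) y≡ k-1≤ (subst (λ s → 16 * n ≤ s ^ 3 * suc z) D≡17+i (<⇒≤ z-hi)) 100≤z)
    where
    k-1≤ : k ∸ 1 ≤ 14 + i
    k-1≤ = m≤n+o⇒m∸n≤o k 1 (+-cancelʳ-≤ 2 k (15 + i) (≤-trans k≤ (≤-reflexive (trans D≡17+i (+-comm 2 (15 + i))))))

  sparse-ok : W * ∑ (subs m (allPairs n)) (sparseCuts k z) * (suc (m + l) * (4 * scale)) ≤ (m + l) ^ (m + l)
  sparse-ok with ceil-div (60 * D) n (*-mono-≤ {1} {60} (s≤s z≤n) 0<D)
  ... | j , lo , hi = cancel-pos {m = 5 ^ z} (^-pos z (s≤s z≤n)) (begin
    5 ^ z * (A₀ * (suc (m + l) * (4 * scale)))   ≤⟨ *-monoʳ-≤ (5 ^ z) (*-monoʳ-≤ A₀ (≤-trans (m≤n*m (suc (m + l) * (4 * scale)) (suc n)) graph-loss≤)) ⟩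
    5 ^ z * (A₀ * 2 ^ Λ)                         ≡⟨ ring (5 ^ z) A₀ (2 ^ Λ) ⟩
    A₀ * (2 ^ Λ * 5 ^ z)                         ≤⟨ *-monoʳ-≤ A₀ (doubling 5 6 Λ z (≤ᵇ⇒≤ 5 6 _) (≤ᵇ⇒≤ (2 * 5 ^ 4) (6 ^ 4) _) 4Λ≤z) ⟩
    A₀ * 6 ^ z                                   ≤⟨ sparse-with 60 (1015 + 60 * i) j refl refl y+5 lo hi ⟩
    5 ^ z * (m + l) ^ (m + l)                    ∎)
    where
    A₀ = W * ∑ (subs m (allPairs n)) (sparseCuts k z)
    ring : ∀ a b c → a * (b * c) ≡ b * (c * a)
    ring = solve-∀
    y+5 : 1015 + 60 * i + 5 ≡ 60 * D
    y+5 = trans (ring' 1015 (60 * i) 5) (trans (sym (*-distribˡ-+ 60 17 i)) (cong (60 *_) (sym D≡17+i)))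
      where
      ring' : ∀ a b c → a + b + c ≡ (a + c) + b
      ring' = solve-∀

-- The identity behind concavity of u (n - z - 3u): (bu - n)(cn - au) ≥ 0, with both sides moved so that no subtraction occurs.
chord : ∀ a b c {u n p r} → b * u ≡ n + p → c * n ≡ a * u + r → c * (n * n) + p * r + a * b * (u * u) ≡ (b * c + a) * (u * n)
chord a b c {u} {n} {p} {r} pe re = begin
  c * (n * n) + p * r + a * b * (u * u)          ≡⟨ ring₁ a b c u n (p * r) ⟩
  n * (c * n) + p * r + a * u * (b * u)          ≡⟨ cong₂ (λ s t → n * s + p * r + a * u * t) re pe ⟩
  n * (a * u + r) + p * r + a * u * (n + p)      ≡⟨ ring₂ a u n p r ⟩
  (n + p) * (a * u + r) + a * (u * n)            ≡⟨ cong₂ (λ s t → s * t + a * (u * n)) (sym pe) (sym re) ⟩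
  b * u * (c * n) + a * (u * n)                  ≡⟨ ring₃ a b c u n ⟩
  (b * c + a) * (u * n)                          ∎
  where
  open ≡-Reasoning
  ring₁ : ∀ a b c u n x → c * (n * n) + x + a * b * (u * u) ≡ n * (c * n) + x + a * u * (b * u)
  ring₁ = solve-∀
  ring₂ : ∀ a u n p r → n * (a * u + r) + p * r + a * u * (n + p) ≡ (n + p) * (a * u + r) + a * (u * n)
  ring₂ = solve-∀
  ring₃ : ∀ a b c u n → b * u * (c * n) + a * (u * n) ≡ (b * c + a) * (u * n)
  ring₃ = solve-∀

-- The chord over `n/15 ≤ u ≤ 6n/25`: the two ends of the range enter through the nonnegative
-- product `p * r`, which is dropped.
concave : ∀ {u n z ρ} → n ≤ 15 * u → 25 * u ≤ 6 * n → 3 * u + z + ρ ≡ n →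
  125 * (u * n) + 6 * (n * n) ≤ 125 * (u * ρ) + 125 * (u * z) + 115 * (u * n)
concave {u} {n} {z} {ρ} n≤ u≤ ne = +-cancelʳ-≤ (25 * 15 * (u * u)) (125 * (u * n) + 6 * (n * n)) (125 * (u * ρ) + 125 * (u * z) + 115 * (u * n)) (begin
  125 * (u * n) + 6 * (n * n) + 25 * 15 * (u * u)
    ≤⟨ ≤-trans (m≤m+n _ (p * r)) (≤-reflexive (ring₁ (125 * (u * n)) (6 * (n * n)) (25 * 15 * (u * u)) (p * r))) ⟩
  125 * (u * n) + (6 * (n * n) + p * r + 25 * 15 * (u * u))
    ≡⟨ cong₂ (λ s t → 125 * (u * s) + t) (sym ne) (chord 25 15 6 {u} {n} {p} {r} (sym (m+[n∸m]≡n n≤)) (sym (m+[n∸m]≡n u≤))) ⟩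
  125 * (u * (3 * u + z + ρ)) + 115 * (u * n)
    ≡⟨ ring₂ 125 3 u z ρ (115 * (u * n)) ⟩
  125 * (u * ρ) + 125 * (u * z) + 115 * (u * n) + 125 * 3 * (u * u) ∎)
  where
  open ≤-Reasoning
  p = 15 * u ∸ n
  r = 6 * n ∸ 25 * u
  ring₁ : ∀ a b c d → a + b + c + d ≡ a + (b + d + c)
  ring₁ = solve-∀
  ring₂ : ∀ a c u z ρ y → a * (u * (c * u + z + ρ)) + y ≡ a * (u * ρ) + a * (u * z) + y + a * c * (u * u)
  ring₂ = solve-∀

-- Makes `7 n` blocks of length about `n / 136` fit into `X = u ρ` forbidden pairs. At the lower end
-- `u = n/15` there are about `4n²/75` of them, above `7n²/136`; the difference pays for `z` and for
-- rounding.
concave-bound : ∀ {u n z X} → n ≤ 15 * u → 307 * z ≤ n → 125 * (u * n) + 6 * (n * n) ≤ 125 * X + 125 * (u * z) + 115 * (u * n) →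
  100000 ≤ n → 7 * (n * (n + 136)) ≤ 136 * X
concave-bound {u} {n} {z} {X} n≤ z≤ h big = cancel-pos {m = 38375} (s≤s z≤n) (begin
  38375 * (7 * (n * (n + 136)))            ≡⟨ ring₁ 38375 7 136 n ⟩
  38375 * 7 * (n * n) + 38375 * 7 * 136 * n ≤⟨ +-monoʳ-≤ (38375 * 7 * (n * n)) (≤-trans (*-monoˡ-≤ n (≤-trans (≤ᵇ⇒≤ (38375 * 7 * 136) (8543 * 100000) _) (*-monoʳ-≤ 8543 big))) (≤-reflexive (*-assoc 8543 n n))) ⟩
  38375 * 7 * (n * n) + 8543 * (n * n)     ≡⟨ sym (*-distribʳ-+ (n * n) (38375 * 7) 8543) ⟩
  136 * 2038 * (n * n)                     ≡⟨ *-assoc 136 2038 (n * n) ⟩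
  136 * (2038 * (n * n))                   ≤⟨ *-monoʳ-≤ 136 step₂ ⟩
  136 * (38375 * X)                        ≡⟨ ring₂ 136 38375 X ⟩
  38375 * (136 * X)                        ∎)
  where
  open ≤-Reasoning
  ring₁ : ∀ a b c n → a * (b * (n * (n + c))) ≡ a * b * (n * n) + a * b * c * n
  ring₁ = solve-∀
  ring₂ : ∀ a b x → a * (b * x) ≡ b * (a * x)
  ring₂ = solve-∀
  uz : 307 * (125 * (u * z)) ≤ 125 * (u * n)
  uz = ≤-trans (≤-reflexive (ring 307 125 u z)) (*-monoʳ-≤ 125 (*-monoʳ-≤ u z≤))
    where
    ring : ∀ a b u z → a * (b * (u * z)) ≡ b * (u * (a * z))
    ring = solve-∀
  scaled : 307 * 125 * (u * n) + 307 * 6 * (n * n) ≤ 307 * 125 * X + (125 + 307 * 115) * (u * n)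
  scaled = begin
    307 * 125 * (u * n) + 307 * 6 * (n * n)                     ≡⟨ ring 307 125 6 (u * n) (n * n) ⟩
    307 * (125 * (u * n) + 6 * (n * n))                         ≤⟨ *-monoʳ-≤ 307 h ⟩
    307 * (125 * X + 125 * (u * z) + 115 * (u * n))             ≡⟨ ring' 307 (125 * (u * z)) 125 115 X (u * n) ⟩
    307 * 125 * X + (307 * (125 * (u * z)) + 307 * 115 * (u * n)) ≤⟨ +-monoʳ-≤ (307 * 125 * X) (+-monoˡ-≤ (307 * 115 * (u * n)) uz) ⟩
    307 * 125 * X + (125 * (u * n) + 307 * 115 * (u * n))       ≡⟨ cong (307 * 125 * X +_) (sym (*-distribʳ-+ (u * n) 125 (307 * 115))) ⟩
    307 * 125 * X + (125 + 307 * 115) * (u * n)                 ∎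
    where
    ring : ∀ a b c x y → a * b * x + a * c * y ≡ a * (b * x + c * y)
    ring = solve-∀
    ring' : ∀ a w b c x y → a * (b * x + w + c * y) ≡ a * b * x + (a * w + a * c * y)
    ring' = solve-∀
  step₁ : 2945 * (u * n) + 1842 * (n * n) ≤ 38375 * X
  step₁ = +-cancelʳ-≤ (35430 * (u * n)) (2945 * (u * n) + 1842 * (n * n)) (38375 * X) (≤-trans (≤-reflexive (trans (ring (2945 * (u * n)) (1842 * (n * n)) (35430 * (u * n)))
      (cong (_+ 1842 * (n * n)) (sym (*-distribʳ-+ (u * n) 2945 35430))))) scaled)
    where
    ring : ∀ a b c → a + b + c ≡ a + c + b
    ring = solve-∀
  step₂ : 2038 * (n * n) ≤ 38375 * X
  step₂ = begin
    2038 * (n * n)                       ≡⟨ *-distribʳ-+ (n * n) 196 1842 ⟩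
    196 * (n * n) + 1842 * (n * n)       ≤⟨ +-monoˡ-≤ (1842 * (n * n)) (≤-trans (*-monoʳ-≤ 196 (*-monoˡ-≤ n n≤)) (≤-trans (≤-reflexive (ring 196 15 u n)) (*-monoˡ-≤ (u * n) (≤ᵇ⇒≤ (196 * 15) 2945 _)))) ⟩
    2945 * (u * n) + 1842 * (n * n)      ≤⟨ step₁ ⟩
    38375 * X                            ∎
    where
    ring : ∀ a b u n → a * (b * u * n) ≡ a * b * (u * n)
    ring = solve-∀

-- Closed pairs at the chosen parameters

module ClosedSets {n m k D b d q l l' z ℓ : ℕ} (setting : Setting n m k D b d q) (total : m + l ≡ length (allPairs n)) (total' : n / 8 + l' ≡ l)
  (z-lo : D ^ 3 * z ≤ 16 * n) (z-hi : 16 * n < D ^ 3 * suc z) (ℓ-lo : 25 * ℓ ≤ 6 * n) where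
  open Sizes {l' = l'} setting total total' z-lo z-hi
  open ≤-Reasoning

  100000≤n : 100000 ≤ n
  100000≤n = ≤-trans (≤-trans (≤-reflexive refl) (*-monoʳ-≤ 1000 100≤q)) (linear 1000 (≤ᵇ⇒≤ 1000 (2 ^ 20) _))

  ceil-block : ∀ h j → n < 2 * (h * D) * j → l ^ j * suc h ≤ (m + l) ^ j * h
  ceil-block h j hi = block h j 0<l (≤-trans (*-monoˡ-≤ n (<⇒≤ hi)) (≤-reflexive (ring 2 (h * D) j n)))
    where
    ring : ∀ c a j n → c * a * j * n ≡ c * (a * j * n)
    ring = solve-∀

  weaken : ∀ {A w} e → A * 2 ^ e ≤ (m + l) ^ (m + l) → Λ ≤ e → w ≤ 2 ^ Λ → A * w ≤ (m + l) ^ (m + l)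
  weaken {A} e h Λ≤ w≤ = ≤-trans (*-monoʳ-≤ A (≤-trans w≤ (^-monoʳ-≤ 2 Λ≤))) h

  -- As `j` is about `n / (6D)` and `D ≥ 17`, the `5 D + 8` blocks fill less than `0.92 n` apart
  -- from rounding, which leaves room for `4 u ≤ 0.08 n` vertices in `U` and `X`.
  fits₁ : ∀ y j u → y ≡ 5 * D + 8 → 2 * (3 * D) * j ≤ n + 2 * (3 * D) → 50 * u ≤ n → y * j + 4 * u ≤ n
  fits₁ y j u y≡ lo u≤ = cancel-pos {m = 50 * (6 * D)} (*-mono-≤ {1} {50} (s≤s z≤n) (*-mono-≤ {1} {6} (s≤s z≤n) 0<D)) (begin
    50 * (6 * D) * (y * j + 4 * u)              ≡⟨ cong (λ s → 50 * s * (y * j + 4 * u)) (*-assoc 2 3 D) ⟩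
    50 * c * (y * j + 4 * u)                    ≡⟨ ring₁ 50 c y j 4 u ⟩
    50 * y * (c * j) + 4 * c * (50 * u)         ≤⟨ +-mono-≤ (*-monoʳ-≤ (50 * y) lo) (*-monoʳ-≤ (4 * c) u≤) ⟩
    50 * y * (n + c) + 4 * c * n                ≡⟨ cong₂ (λ s t → 50 * s * (n + t) + 4 * t * n) y≡ (sym (*-assoc 2 3 D)) ⟩
    50 * (5 * D + 8) * (n + 6 * D) + 4 * (6 * D) * n ≡⟨ ring₂ 50 5 8 6 4 D n ⟩
    (50 * 5 + 4 * 6) * (D * n) + (50 * 8 * n + 50 * 6 * D * (5 * D + 8)) ≤⟨ +-monoʳ-≤ ((50 * 5 + 4 * 6) * (D * n)) small ⟩
    274 * (D * n) + 26 * (D * n)                ≡⟨ trans (sym (*-distribʳ-+ (D * n) 274 26)) (ring₃ 50 6 D n) ⟩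
    50 * (6 * D) * n                            ∎)
    where
    c = 2 * (3 * D)
    ring₁ : ∀ e c y j f u → e * c * (y * j + f * u) ≡ e * y * (c * j) + f * c * (e * u)
    ring₁ = solve-∀
    ring₂ : ∀ e a b c f d n → e * (a * d + b) * (n + c * d) + f * (c * d) * n ≡ (e * a + f * c) * (d * n) + (e * b * n + e * c * d * (a * d + b))
    ring₂ = solve-∀
    ring₃ : ∀ e c d n → e * c * (d * n) ≡ e * (c * d) * n
    ring₃ = solve-∀
    small : 50 * 8 * n + 50 * 6 * D * (5 * D + 8) ≤ 26 * (D * n)
    small = begin
      400 * n + 300 * D * (5 * D + 8)     ≤⟨ +-monoʳ-≤ (400 * n) (*-monoʳ-≤ (300 * D) (≤-trans (+-monoʳ-≤ (5 * D) (≤-trans (≤ᵇ⇒≤ 8 17 _) 17≤D)) (≤-reflexive (+-comm (5 * D) D)))) ⟩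
      400 * n + 300 * D * (6 * D)         ≡⟨ cong (400 * n +_) (ring₄ 300 6 D) ⟩
      400 * n + 300 * 6 * D ^ 2           ≤⟨ +-monoʳ-≤ (400 * n) (≤-trans (*-monoʳ-≤ (300 * 6) (^-monoˡ-≤ 2 D≤q)) (polynomial (300 * 6) 2 (≤ᵇ⇒≤ (300 * 6) (2 ^ 20) _) (≤ᵇ⇒≤ 2 8 _))) ⟩
      400 * n + n                         ≡⟨ +-comm (400 * n) n ⟩
      401 * n                             ≤⟨ *-monoˡ-≤ n (≤-trans (≤ᵇ⇒≤ 401 (26 * 17) _) (*-monoʳ-≤ 26 17≤D)) ⟩
      26 * D * n                          ≡⟨ *-assoc 26 D n ⟩
      26 * (D * n)                        ∎
      where
      ring₄ : ∀ a b d → a * d * (b * d) ≡ a * b * (d * (d * 1))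
      ring₄ = solve-∀

  medium₁ : ∀ u h y j → h ≡ 3 → y ≡ 93 + 5 * i → y ≡ 5 * D + 8 → 2 * (h * D) * j ≤ n + 2 * (h * D) → n < 2 * (h * D) * j → z ≤ u → 50 * u ≤ n →
    W * closed-fixed {n} {m} {l} total 0<l z ℓ u * 2 ^ u ≤ (m + l) ^ (m + l)
  medium₁ u h y j h≡ y≡ y≡' lo hi z≤u u≤ = closed-medium total 0<l z ℓ u h j y 0<n (≤-trans 0<z z≤u) z≤u (≤-trans (*-monoˡ-≤ u (≤ᵇ⇒≤ 4 50 _)) u≤) (ceil-block h j hi)
    (fits₁ y j u y≡' (subst (λ s → 2 * (s * D) * j ≤ n + 2 * (s * D)) h≡ lo) u≤)
    (closed-unit i u n h (suc h) y h≡ (cong suc h≡) y≡ (≤-trans (subst (λ s → 16 * n ≤ s ^ 3 * suc z) D≡17+i (<⇒≤ z-hi)) (*-monoʳ-≤ ((17 + i) ^ 3) (s≤s z≤u))) (≤-trans 100≤z z≤u))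

  -- Here `49/68 + 4/15` is just below `1`. The `68` is `2 h D` with `h = 2` and the least value
  -- `17` of `D`.
  fits₂ : ∀ y j u → y ≡ 49 → 68 * j ≤ n + 68 → 15 * u ≤ n → y * j + 4 * u ≤ n
  fits₂ y j u y≡ lo u≤ = cancel-pos {m = 68 * 15} (s≤s z≤n) (begin
    68 * 15 * (y * j + 4 * u)                  ≡⟨ cong (λ s → 68 * 15 * (s * j + 4 * u)) y≡ ⟩
    68 * 15 * (49 * j + 4 * u)                 ≡⟨ ring₁ 68 15 49 4 j u ⟩
    15 * 49 * (68 * j) + 68 * 4 * (15 * u)     ≤⟨ +-mono-≤ (*-monoʳ-≤ (15 * 49) lo) (*-monoʳ-≤ (68 * 4) u≤) ⟩
    15 * 49 * (n + 68) + 68 * 4 * n            ≡⟨ ring₂ (15 * 49) 68 (68 * 4) n ⟩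
    (15 * 49 + 68 * 4) * n + 15 * 49 * 68      ≤⟨ +-monoʳ-≤ ((15 * 49 + 68 * 4) * n) (≤-trans (≤-trans (≤ᵇ⇒≤ (15 * 49 * 68) 100000 _) 100000≤n) (m≤n*m n 13)) ⟩
    (15 * 49 + 68 * 4) * n + 13 * n            ≡⟨ sym (*-distribʳ-+ n (15 * 49 + 68 * 4) 13) ⟩
    68 * 15 * n                                ∎)
    where
    ring₁ : ∀ a b c d j u → a * b * (c * j + d * u) ≡ b * c * (a * j) + a * d * (b * u)
    ring₁ = solve-∀
    ring₂ : ∀ a b c n → a * (n + b) + c * n ≡ (a + c) * n + a * b
    ring₂ = solve-∀

  medium₂ : ∀ u h y j → h ≡ 2 → y ≡ 49 → 68 * j ≤ n + 68 → n < 68 * j → z ≤ u → 15 * u ≤ n → n ≤ 50 * u →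
    W * closed-fixed {n} {m} {l} total 0<l z ℓ u * 2 ^ u ≤ (m + l) ^ (m + l)
  medium₂ u h y j h≡ y≡ lo hi z≤u u≤ n≤ = closed-medium total 0<l z ℓ u h j y 0<n (≤-trans 0<z z≤u) z≤u (≤-trans (*-monoˡ-≤ u (≤ᵇ⇒≤ 4 15 _)) u≤)
    (ceil-block h j (≤-trans hi (*-monoˡ-≤ j (subst (λ s → 68 ≤ 2 * (s * D)) (sym h≡) (*-monoʳ-≤ 2 (*-monoʳ-≤ 2 17≤D))))))
    (fits₂ y j u y≡ lo u≤) (closed-unit₂ u n h (suc h) y h≡ (cong suc h≡) y≡ n≤)

  large : ∀ u h y j w → h ≡ 4 → y ≡ 7 * n → 136 * j ≤ n + 136 → n < 136 * j → n ≤ 15 * u → u ≤ ℓ → w ≤ 2 ^ Λ →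
    W * closed-fixed {n} {m} {l} total 0<l z ℓ u * w ≤ (m + l) ^ (m + l)
  large u h y j w h≡ y≡ lo hi n≤ u≤ w≤ = closed-large total 0<l z ℓ u ρ h j y w (≤-reflexive sizes)
    (ceil-block h j (≤-trans hi (*-monoˡ-≤ j (subst (λ s → 136 ≤ 2 * (s * D)) (sym h≡) (*-monoʳ-≤ 2 (*-monoʳ-≤ 4 17≤D)))))) yj growth
    where
    ρ = n ∸ (3 * u + z)
    25u≤6n : 25 * u ≤ 6 * n
    25u≤6n = ≤-trans (*-monoʳ-≤ 25 u≤) ℓ-lo
    3u+z≤n : 3 * u + z ≤ n
    3u+z≤n = cancel-pos {m = 25} (s≤s z≤n) (begin
      25 * (3 * u + z)               ≡⟨ ring 25 3 u z ⟩
      3 * (25 * u) + 25 * z          ≤⟨ +-mono-≤ (*-monoʳ-≤ 3 25u≤6n) (≤-trans (*-monoˡ-≤ z (≤ᵇ⇒≤ 25 307 _)) 307z≤n) ⟩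
      3 * (6 * n) + n                ≡⟨ trans (cong (_+ n) (sym (*-assoc 3 6 n))) (+-comm (18 * n) n) ⟩
      19 * n                         ≤⟨ *-monoˡ-≤ n (≤ᵇ⇒≤ 19 25 _) ⟩
      25 * n                         ∎)
      where
      ring : ∀ a b u z → a * (b * u + z) ≡ b * (a * u) + a * z
      ring = solve-∀
    sizes : 3 * u + z + ρ ≡ n
    sizes = m+[n∸m]≡n 3u+z≤n
    yj : y * j ≤ u * ρ
    yj = cancel-pos {m = 136} (s≤s z≤n) (begin
      136 * (y * j)                  ≡⟨ cong (λ s → 136 * (s * j)) y≡ ⟩
      136 * (7 * n * j)              ≡⟨ ring 136 7 n j ⟩
      7 * (n * (136 * j))            ≤⟨ *-monoʳ-≤ 7 (*-monoʳ-≤ n lo) ⟩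
      7 * (n * (n + 136))            ≤⟨ concave-bound {u} {n} {z} {u * ρ} n≤ 307z≤n (concave {u} {n} {z} {ρ} n≤ 25u≤6n sizes) 100000≤n ⟩
      136 * (u * ρ)                  ∎)
      where
      ring : ∀ a b n j → a * (b * n * j) ≡ b * (n * (a * j))
      ring = solve-∀
    4Λ≤n : 4 * Λ ≤ n
    4Λ≤n = ≤-trans 4Λ≤z (≤-trans (m≤n*m z 307) 307z≤n)
    power : ∀ c h' → h' ≡ c → h' ^ y ≡ (c ^ 7) ^ n
    power c h' refl = trans (cong (c ^_) y≡) (sym (^-*-assoc c 7 n))
    growth : 2 ^ n * 2 ^ n * h ^ y * w ≤ suc h ^ y
    growth = begin
      2 ^ n * 2 ^ n * h ^ y * w            ≤⟨ *-monoʳ-≤ (2 ^ n * 2 ^ n * h ^ y) w≤ ⟩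
      2 ^ n * 2 ^ n * h ^ y * 2 ^ Λ        ≡⟨ *-comm (2 ^ n * 2 ^ n * h ^ y) (2 ^ Λ) ⟩
      2 ^ Λ * (2 ^ n * 2 ^ n * h ^ y)      ≡⟨ cong (λ s → 2 ^ Λ * (2 ^ n * 2 ^ n * s)) (power 4 h h≡) ⟩
      2 ^ Λ * (2 ^ n * 2 ^ n * (4 ^ 7) ^ n) ≡⟨ cong (2 ^ Λ *_) (trans (cong (_* (4 ^ 7) ^ n) (sym (^-distribʳ-* n 2 2))) (sym (^-distribʳ-* n (2 * 2) (4 ^ 7)))) ⟩
      2 ^ Λ * (2 * 2 * 4 ^ 7) ^ n          ≤⟨ doubling (2 * 2 * 4 ^ 7) (5 ^ 7) Λ n (≤ᵇ⇒≤ (2 * 2 * 4 ^ 7) (5 ^ 7) _) (≤ᵇ⇒≤ (2 * (2 * 2 * 4 ^ 7) ^ 4) ((5 ^ 7) ^ 4) _) 4Λ≤n ⟩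
      (5 ^ 7) ^ n                          ≡⟨ sym (power 5 (suc h) (cong suc h≡)) ⟩
      suc h ^ y                            ∎

  -- Below `n/50` the ratio `n / u` can be of order `D³`, so the number of blocks per vertex grows
  -- with `D`. Up to `n/15` the ratio is at most `50` and a constant number suffices. Above, the
  -- forbidden pairs outweigh all `4^n` choices, because `4 * 4^7 < 5^7`.
  closed-size : ∀ u w → w ≤ 2 ^ Λ → z ≤ u → u ≤ ℓ → W * closed-fixed {n} {m} {l} total 0<l z ℓ u * w ≤ (m + l) ^ (m + l)
  closed-size u w w≤ z≤u u≤ with ≤-total (50 * u) n
  ... | inj₁ 50u≤n = let (j , lo , hi) = ceil-div (2 * (3 * D)) n (*-mono-≤ {1} {2} (s≤s z≤n) (*-mono-≤ {1} {3} (s≤s z≤n) 0<D)) in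
        weaken {W * closed-fixed {n} {m} {l} total 0<l z ℓ u} u (medium₁ u 3 (5 * D + 8) j refl 5D+8≡ refl lo hi z≤u 50u≤n) (≤-trans Λ≤z z≤u) w≤
    where
    5D+8≡ : 5 * D + 8 ≡ 93 + 5 * i
    5D+8≡ = trans (cong (λ s → 5 * s + 8) D≡17+i) (trans (cong (_+ 8) (*-distribˡ-+ 5 17 i)) (ring 85 (5 * i) 8))
      where
      ring : ∀ a b c → a + b + c ≡ (a + c) + b
      ring = solve-∀
  ... | inj₂ n≤50u with ≤-total (15 * u) n
  ... | inj₁ 15u≤n = let (j , lo , hi) = ceil-div 68 n (s≤s z≤n) in weaken {W * closed-fixed {n} {m} {l} total 0<l z ℓ u} u (medium₂ u 2 49 j refl refl lo hi z≤u 15u≤n n≤50u) (≤-trans Λ≤z z≤u) w≤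
  ... | inj₂ n≤15u = let (j , lo , hi) = ceil-div 136 n (s≤s z≤n) in large u 4 (7 * n) j w refl refl lo hi n≤15u u≤ w≤

  closed-ok : W * ∑ (subs m (allPairs n)) (closedPairs z ℓ) * (suc (m + l) * (4 * scale)) ≤ (m + l) ^ (m + l)
  closed-ok = cancel-pos {m = suc n} (s≤s z≤n) (≤-trans (≤-reflexive (ring (suc n) (W * ∑ (subs m (allPairs n)) (closedPairs z ℓ)) (suc (m + l) * (4 * scale))))
    (closed-pairs-bound {n} {m} {l} total 0<l z ℓ (suc n * (suc (m + l) * (4 * scale))) ((m + l) ^ (m + l)) (λ u → closed-size u (suc n * (suc (m + l) * (4 * scale))) graph-loss≤)))
    where
    ring : ∀ a b c → a * (b * c) ≡ b * (a * c)
    ring = solve-∀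

-- Dense pairs and sprinkling at the chosen parameters

module Endgame {n m k D b d q l l' z ℓ : ℕ} (setting : Setting n m k D b d q) (total : m + l ≡ length (allPairs n)) (total' : n / 8 + l' ≡ l)
  (z-lo : D ^ 3 * z ≤ 16 * n) (z-hi : 16 * n < D ^ 3 * suc z) (ℓ-lo : 25 * ℓ ≤ 6 * n) (ℓ-hi : 6 * n < 25 * suc ℓ) where
  open ClosedSets {l' = l'} {ℓ = ℓ} setting total total' z-lo z-hi ℓ-lo using (closed-ok; 100000≤n) public
  open Sizes {l' = l'} setting total total' z-lo z-hi public
  open Dense {n} {m} {l} {t} {l'} total total' 0<l
  open ≤-Reasoning

  W' = t ^ t * l' ^ l'

  n₁ = n ∸ 1

  n≡ : n ≡ suc n₁
  n≡ = sym (m+[n∸m]≡n 0<n)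

  8[m+l]≡ : 2 * 4 * (m + l) ≡ 4 * n₁ * n
  8[m+l]≡ = trans (*-assoc 2 4 (m + l)) (trans (ring 2 4 (m + l)) (trans (cong (4 *_) half) (sym (*-assoc 4 n₁ n))))
    where
    ring : ∀ a b x → a * (b * x) ≡ b * (a * x)
    ring = solve-∀
    half : 2 * (m + l) ≡ n₁ * n
    half = +-cancelʳ-≡ n (2 * (m + l)) (n₁ * n) (trans (cong (λ s → m + l + s + n) (+-identityʳ (m + l)))
      (trans (cong (λ s → s + s + n) total) (trans NN (trans (cong (_* n) n≡) (+-comm n (n₁ * n))))))

  -- `lam` is the largest tilt for which the exponent of pairs inside `U` stays within `2 * 4` per
  -- vertex: `m < (D+1) n` and `N = n (n-1) / 2` turn `lam² u (D+1) ≤ 4 (n-1)` into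
  -- `u m lam² ≤ 8 N`.
  module Tilt (u lam : ℕ) (5≤u : 5 ≤ u) (u≤z : u ≤ z) (lam-lo : lam * lam * (u * suc D) ≤ 4 * n₁) (lam-hi : 4 * n₁ < suc lam * suc lam * (u * suc D)) where
    S = suc lam * suc lam

    0<u : 0 < u
    0<u = ≤-trans (s≤s z≤n) 5≤u

    4n≤ : 4 * n ≤ (S + 1) * (u * suc D)
    4n≤ = begin
      4 * n                                ≡⟨ trans (cong (4 *_) n≡) (*-suc 4 n₁) ⟩
      4 + 4 * n₁                           ≡⟨ +-comm 4 (4 * n₁) ⟩
      4 * n₁ + 4                           ≤⟨ ≤-trans (≤-reflexive (+-suc (4 * n₁) 3)) (+-monoˡ-≤ 3 lam-hi) ⟩
      S * (u * suc D) + 3                  ≤⟨ +-monoʳ-≤ (S * (u * suc D)) (≤-trans (≤-trans (≤ᵇ⇒≤ 3 5 _) 5≤u) (m≤m*n u (suc D))) ⟩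
      S * (u * suc D) + u * suc D          ≡⟨ ring S (u * suc D) ⟩
      (S + 1) * (u * suc D)                ∎
      where
      ring : ∀ s x → s * x + x ≡ (s + 1) * x
      ring = solve-∀

    D³≤ : D ^ 3 ≤ 4 * (S + 1) * suc D
    D³≤ = cancel-pos {m = 4 * n} (*-mono-≤ {1} {4} (s≤s z≤n) 0<n) (begin
      4 * n * D ^ 3                            ≤⟨ *-monoˡ-≤ (D ^ 3) 4n≤ ⟩
      (S + 1) * (u * suc D) * D ^ 3            ≡⟨ ring₁ (S + 1) u (suc D) (D ^ 3) ⟩
      (S + 1) * suc D * (D ^ 3 * u)            ≤⟨ *-monoʳ-≤ ((S + 1) * suc D) (≤-trans (*-monoʳ-≤ (D ^ 3) u≤z) z-lo) ⟩
      (S + 1) * suc D * (16 * n)               ≡⟨ cong ((S + 1) * suc D *_) (*-assoc 4 4 n) ⟩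
      (S + 1) * suc D * (4 * (4 * n))          ≡⟨ ring₂ (S + 1) (suc D) 4 (4 * n) ⟩
      4 * n * (4 * (S + 1) * suc D)            ∎)
      where
      ring₁ : ∀ s u d x → s * (u * d) * x ≡ s * d * (x * u)
      ring₁ = solve-∀
      ring₂ : ∀ s d c x → s * d * (c * x) ≡ x * (c * s * d)
      ring₂ = solve-∀

    8≤lam : 8 ≤ lam
    8≤lam with ≤-<-connex 8 lam
    ... | inj₁ h = h
    ... | inj₂ (s≤s lam≤7) = ⊥-elim (<-irrefl refl (begin-strict
      D ^ 3                              ≤⟨ D³≤ ⟩
      4 * (S + 1) * suc D                ≤⟨ *-monoˡ-≤ (suc D) (*-monoʳ-≤ 4 (+-monoˡ-≤ 1 (*-mono-≤ (s≤s lam≤7) (s≤s lam≤7)))) ⟩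
      260 * suc D                        ≡⟨ *-suc 260 D ⟩
      260 + 260 * D                      <⟨ +-monoˡ-< (260 * D) (≤-trans (≤ᵇ⇒≤ 261 (29 * 17) _) (*-monoʳ-≤ 29 17≤D)) ⟩
      29 * D + 260 * D                   ≡⟨ sym (*-distribʳ-+ D 29 260) ⟩
      289 * D                            ≤⟨ *-monoˡ-≤ D (*-mono-≤ 17≤D 17≤D) ⟩
      D * D * D                          ≡⟨ ring D ⟩
      D ^ 3                              ∎))
      where
      ring : ∀ x → x * x * x ≡ x * (x * (x * 1))
      ring = solve-∀

    -- `D³≤` says that `D²` is at most about `4 lam²`; exactly, `4 (S + 1) + 8 (lam + 1)` is the
    -- square of `2 (lam + 2)`. Trading `D` for `lam` makes `n / u` cubic in `lam`.
    sD≤ : suc D ≤ 2 * (lam + 2)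
    sD≤ with ≤-<-connex (suc D) (2 * (lam + 2))
    ... | inj₁ h = h
    ... | inj₂ (s≤s h) = ⊥-elim (<-irrefl refl (begin-strict
      D ^ 3                                          ≤⟨ D³≤ ⟩
      4 * (S + 1) * suc D                            ≡⟨ *-suc (4 * (S + 1)) D ⟩
      4 * (S + 1) + 4 * (S + 1) * D                  <⟨ +-monoˡ-< (4 * (S + 1) * D) gap ⟩
      8 * suc lam * D + 4 * (S + 1) * D              ≡⟨ ring₁ (8 * suc lam) (4 * (S + 1)) D ⟩
      (4 * (S + 1) + 8 * suc lam) * D                ≡⟨ cong (_* D) (ring₂ lam) ⟩
      2 * (lam + 2) * (2 * (lam + 2)) * D            ≤⟨ *-monoˡ-≤ D (*-mono-≤ h h) ⟩
      D * D * D                                      ≡⟨ ring₃ D ⟩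
      D ^ 3                                          ∎))
      where
      ring₁ : ∀ a b d → a * d + b * d ≡ (b + a) * d
      ring₁ = solve-∀
      ring₂ : ∀ x → 4 * (suc x * suc x + 1) + 8 * suc x ≡ 2 * (x + 2) * (2 * (x + 2))
      ring₂ = solve-∀
      ring₃ : ∀ x → x * x * x ≡ x * (x * (x * 1))
      ring₃ = solve-∀
      ring₄ : ∀ x → suc (4 * (suc x * suc x + 1)) + (12 * x * x + 40 * x + 23) ≡ 8 * suc x * (2 * (x + 2))
      ring₄ = solve-∀
      gap : 4 * (S + 1) < 8 * suc lam * D
      gap = ≤-trans (≤-trans (m≤m+n (suc (4 * (S + 1))) (12 * lam * lam + 40 * lam + 23)) (≤-reflexive (ring₄ lam))) (*-monoʳ-≤ (8 * suc lam) h)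

    2n≤ : 2 * n ≤ (S + 1) * (lam + 2) * u
    2n≤ = *-cancelˡ-≤ 2 (begin
      2 * (2 * n)                        ≡⟨ sym (*-assoc 2 2 n) ⟩
      4 * n                              ≤⟨ 4n≤ ⟩
      (S + 1) * (u * suc D)              ≤⟨ *-monoʳ-≤ (S + 1) (*-monoʳ-≤ u sD≤) ⟩
      (S + 1) * (u * (2 * (lam + 2)))    ≡⟨ ring (S + 1) u 2 (lam + 2) ⟩
      2 * ((S + 1) * (lam + 2) * u)      ∎)
      where
      ring : ∀ s u c x → s * (u * (c * x)) ≡ c * (s * x * u)
      ring = solve-∀

    quadratic : u * (m * (lam * lam)) ≤ 2 * 4 * (m + l)
    quadratic = begin
      u * (m * (lam * lam))              ≤⟨ *-monoʳ-≤ u (*-monoˡ-≤ (lam * lam) (<⇒≤ m<)) ⟩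
      u * (suc D * n * (lam * lam))      ≡⟨ ring u (suc D) n (lam * lam) ⟩
      lam * lam * (u * suc D) * n        ≤⟨ *-monoˡ-≤ n lam-lo ⟩
      4 * n₁ * n                         ≡⟨ sym 8[m+l]≡ ⟩
      2 * 4 * (m + l)                    ∎
      where
      ring : ∀ u d n x → u * (d * n * x) ≡ x * (u * d) * n
      ring = solve-∀

    raise : ∀ x → 8 * (u * (x * lam)) ≤ u * (x * (lam * lam))
    raise x = ≤-trans (*-monoˡ-≤ (u * (x * lam)) 8≤lam) (≤-reflexive (ring lam u x))
      where
      ring : ∀ a u x → a * (u * (x * a)) ≡ u * (x * (a * a))
      ring = solve-∀

    -- Since `lam ≥ 8`, the linear term is at most one eighth of the quadratic one, which is already
    -- bounded by `8 N`.
    linear₁ : 2 * u * (m * lam) ≤ 2 * (m + l)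
    linear₁ = ≤-trans (≤-reflexive (*-assoc 2 u (m * lam))) (*-monoʳ-≤ 2 {u * (m * lam)} {m + l} (cancel-pos {m = 8} {a = u * (m * lam)} {b = m + l} (s≤s z≤n) (≤-trans (raise m) quadratic)))

    quadratic' : u * (t * (lam * lam)) ≤ 2 * 1 * l
    quadratic' = cancel-pos {m = 100} (s≤s z≤n) (begin
      100 * X                                   ≤⟨ *-monoˡ-≤ X (≤ᵇ⇒≤ 100 (99 * 36) _) ⟩
      99 * 36 * X                               ≡⟨ *-assoc 99 36 X ⟩
      99 * (36 * X)                             ≤⟨ *-monoʳ-≤ 99 36X≤ ⟩
      99 * (n * n)                              ≤⟨ 99nn≤200l ⟩
      100 * 2 * l                               ≡⟨ *-assoc 100 2 l ⟩
      100 * (2 * l)                             ∎)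
      where
      X = u * (t * (lam * lam))
      ring₁ : ∀ a b u t x → a * b * (u * (t * x)) ≡ (a * t) * (x * (u * b))
      ring₁ = solve-∀
      ring₂ : ∀ a n → n * (a * n) ≡ a * (n * n)
      ring₂ = solve-∀
      36X≤ : 36 * X ≤ n * n
      36X≤ = *-cancelˡ-≤ 4 (begin
        4 * (36 * X)                            ≡⟨ trans (sym (*-assoc 4 36 X)) (ring₁ 8 18 u t (lam * lam)) ⟩
        8 * t * (lam * lam * (u * 18))          ≤⟨ *-mono-≤ 8t≤n (≤-trans (*-monoʳ-≤ (lam * lam) (*-monoʳ-≤ u (s≤s 17≤D))) (≤-trans lam-lo (*-monoʳ-≤ 4 (m∸n≤m n 1)))) ⟩
        n * (4 * n)                             ≡⟨ ring₂ 4 n ⟩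
        4 * (n * n)                             ∎)

    linear' : 2 * u * (t * lam) ≤ 1 * l
    linear' = cancel-pos {m = 4} (s≤s z≤n) (begin
      4 * (2 * u * (t * lam))            ≡⟨ trans (cong (4 *_) (*-assoc 2 u (t * lam))) (sym (*-assoc 4 2 (u * (t * lam)))) ⟩
      8 * (u * (t * lam))                ≤⟨ ≤-trans (raise t) quadratic' ⟩
      2 * 1 * l                          ≤⟨ *-monoˡ-≤ l (≤ᵇ⇒≤ 2 4 _) ⟩
      4 * l                              ≡⟨ cong (4 *_) (sym (*-identityˡ l)) ⟩
      4 * (1 * l)                        ∎)

    2u≤n : 2 * u ≤ n
    2u≤n = ≤-trans (*-mono-≤ (≤ᵇ⇒≤ 2 307 _) u≤z) 307z≤n

    tilted : ∀ y₁ y₂ y₁' y₂' → y₁ + y₂ + (y₁' + y₂') ≡ 8 → 2 * u * (m * lam) ≤ y₁ * (m + l) → u * (m * (lam * lam)) ≤ 2 * y₂ * (m + l) →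
      2 * u * (t * lam) ≤ y₁' * l → u * (t * (lam * lam)) ≤ 2 * y₂' * l →
      W * W' * dense-fixed z u * (lam ^ 6) ^ u ≤ (2 ^ 15) ^ u * ((m + l) ^ (m + l) * l ^ l)
    tilted y₁ y₂ y₁' y₂' sum lin quad lin' quad' = dense-bound z u lam y₁ y₂ y₁' y₂' 0<n (≤-trans (s≤s z≤n) 8≤lam) 0<u 2u≤n lin quad lin' quad'
      (subst (λ s → 3 * n * (3 * n) ^ 2 * 3 ^ s * lam ^ 6 ≤ u * (2 * u) ^ 2 * lam ^ 15 * 2 ^ 15) (sym sum) (dense-unit u n lam 8≤lam 2n≤))

    -- `lam^6 ≥ 8^6 = 2^18` leaves a factor `2^3` per vertex, enough as soon as `3 u ≥ Λ`.
    gain-big : Λ ≤ 3 * u → (2 ^ 15) ^ u * 2 ^ Λ ≤ (lam ^ 6) ^ u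
    gain-big h = begin
      (2 ^ 15) ^ u * 2 ^ Λ              ≤⟨ *-monoʳ-≤ ((2 ^ 15) ^ u) (^-monoʳ-≤ 2 h) ⟩
      (2 ^ 15) ^ u * 2 ^ (3 * u)        ≡⟨ cong ((2 ^ 15) ^ u *_) (sym (^-*-assoc 2 3 u)) ⟩
      (2 ^ 15) ^ u * (2 ^ 3) ^ u        ≡⟨ sym (^-distribʳ-* u (2 ^ 15) (2 ^ 3)) ⟩
      (2 ^ 15 * 2 ^ 3) ^ u              ≤⟨ ^-monoˡ-≤ u (≤-trans (≤ᵇ⇒≤ (2 ^ 15 * 2 ^ 3) (8 ^ 6) _) (^-monoˡ-≤ 6 8≤lam)) ⟩
      (lam ^ 6) ^ u                     ∎

    -- For small `u`, possibly only `5`, a constant gain per vertex does not reach `2^Λ`. But then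
    -- `lam²` is of order `n` up to powers of `q`, so `lam^6` exceeds `2^15 * 2^e` with `2^e` of
    -- order `n²`, and five vertices already give `2^(5e) = 2^Λ`.
    gain-small : u ≤ q → (2 ^ 15) ^ u * 2 ^ Λ ≤ (lam ^ 6) ^ u
    gain-small u≤q = begin
      (2 ^ 15) ^ u * 2 ^ Λ              ≡⟨ cong (λ s → (2 ^ 15) ^ u * 2 ^ s) (ring₁ b d) ⟩
      (2 ^ 15) ^ u * 2 ^ (e * 5)        ≤⟨ *-monoʳ-≤ ((2 ^ 15) ^ u) (≤-trans (^-monoʳ-≤ 2 (*-monoʳ-≤ e 5≤u)) (≤-reflexive (sym (^-*-assoc 2 e u)))) ⟩
      (2 ^ 15) ^ u * (2 ^ e) ^ u        ≡⟨ sym (^-distribʳ-* u (2 ^ 15) (2 ^ e)) ⟩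
      (2 ^ 15 * 2 ^ e) ^ u              ≤⟨ ^-monoˡ-≤ u lam-big ⟩
      (lam ^ 6) ^ u                     ∎
      where
      e = 2 * b + d + 4
      ring₁ : ∀ b d → 10 * b + 5 * d + 20 ≡ (2 * b + d + 4) * 5
      ring₁ = solve-∀
      S+1≤ : S + 1 ≤ 2 * (lam * lam)
      S+1≤ = begin
        suc lam * suc lam + 1           ≡⟨ ring₂ lam ⟩
        lam * lam + (2 * lam + 2)       ≤⟨ +-monoʳ-≤ (lam * lam) (≤-trans (+-monoʳ-≤ (2 * lam) (≤-trans (≤ᵇ⇒≤ 2 8 _) 8≤lam)) (≤-trans (≤-reflexive (+-comm (2 * lam) lam)) (*-monoˡ-≤ lam (≤-trans (≤ᵇ⇒≤ 3 8 _) 8≤lam)))) ⟩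
        lam * lam + lam * lam           ≡⟨ cong (lam * lam +_) (sym (+-identityʳ (lam * lam))) ⟩
        2 * (lam * lam)                 ∎
        where
        ring₂ : ∀ x → suc x * suc x + 1 ≡ x * x + (2 * x + 2)
        ring₂ = solve-∀
      2n≤q : 2 * n ≤ lam * lam * (q * q)
      2n≤q = *-cancelˡ-≤ 2 (begin
        2 * (2 * n)                     ≡⟨ sym (*-assoc 2 2 n) ⟩
        4 * n                           ≤⟨ 4n≤ ⟩
        (S + 1) * (u * suc D)           ≤⟨ *-mono-≤ S+1≤ (*-mono-≤ u≤q sD≤q) ⟩
        2 * (lam * lam) * (q * q)       ≡⟨ *-assoc 2 (lam * lam) (q * q) ⟩
        2 * (lam * lam * (q * q))       ∎)
      lam-big : 2 ^ 15 * 2 ^ e ≤ lam ^ 6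
      lam-big = cancel-pos {m = q ^ 6} (^-pos 6 0<q) (begin
        q ^ 6 * (2 ^ 15 * 2 ^ e)                    ≤⟨ *-monoʳ-≤ (q ^ 6) exponents ⟩
        q ^ 6 * (8 * (2 ^ (d + 20) * (2 ^ b * 2 ^ b))) ≡⟨ ring₃ (q ^ 6) 8 (2 ^ (d + 20)) (2 ^ b) ⟩
        8 * (2 ^ (d + 20) * q ^ 6 * 2 ^ b * 2 ^ b)  ≤⟨ *-monoʳ-≤ 8 (*-mono-≤ (*-mono-≤ (≤-trans (*-monoʳ-≤ (2 ^ (d + 20)) (^-monoʳ-≤ q {{>0⇒≢0 0<q}} (≤ᵇ⇒≤ 6 8 _))) big) 2^b≤n) 2^b≤n) ⟩
        2 * 2 * 2 * (n * n * n)                     ≡⟨ ring₄ 2 n ⟩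
        2 * n * (2 * n) * (2 * n)                   ≤⟨ *-mono-≤ (*-mono-≤ 2n≤q 2n≤q) 2n≤q ⟩
        lam * lam * (q * q) * (lam * lam * (q * q)) * (lam * lam * (q * q)) ≡⟨ ring₅ lam q ⟩
        q ^ 6 * lam ^ 6                             ∎)
        where
        ring₃ : ∀ a c x y → a * (c * (x * (y * y))) ≡ c * (x * a * y * y)
        ring₃ = solve-∀
        ring₄ : ∀ c n → c * c * c * (n * n * n) ≡ c * n * (c * n) * (c * n)
        ring₄ = solve-∀
        ring₅ : ∀ x y → x * x * (y * y) * (x * x * (y * y)) * (x * x * (y * y)) ≡ y * (y * (y * (y * (y * (y * 1))))) * (x * (x * (x * (x * (x * (x * 1))))))
        ring₅ = solve-∀
        exponents : 2 ^ 15 * 2 ^ e ≤ 8 * (2 ^ (d + 20) * (2 ^ b * 2 ^ b))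
        exponents = begin
          2 ^ 15 * 2 ^ e                            ≡⟨ sym (^-distribˡ-+-* 2 15 e) ⟩
          2 ^ (15 + e)                              ≤⟨ ^-monoʳ-≤ 2 (≤-trans (m≤m+n (15 + e) 4) (≤-reflexive (ring₆ b d))) ⟩
          2 ^ (3 + (d + 20 + (b + b)))              ≡⟨ trans (^-distribˡ-+-* 2 3 (d + 20 + (b + b))) (cong (8 *_) (trans (^-distribˡ-+-* 2 (d + 20) (b + b)) (cong (2 ^ (d + 20) *_) (^-distribˡ-+-* 2 b b)))) ⟩
          8 * (2 ^ (d + 20) * (2 ^ b * 2 ^ b))      ∎
          where
          ring₆ : ∀ b d → 15 + (2 * b + d + 4) + 4 ≡ 3 + (d + 20 + (b + b))
          ring₆ = solve-∀

    gain-all : (2 ^ 15) ^ u * 2 ^ Λ ≤ (lam ^ 6) ^ u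
    gain-all with ≤-total Λ (3 * u)
    ... | inj₁ h = gain-big h
    ... | inj₂ h = gain-small (≤-trans (m≤n*m u 3) (≤-trans h Λ≤q))

    dense-size : W * W' * dense-fixed z u * (suc n * loss) ≤ (m + l) ^ (m + l) * l ^ l
    dense-size = cancel-pos {m = (2 ^ 15) ^ u} (^-pos u (^-pos {2} 15 (s≤s z≤n))) (begin
      (2 ^ 15) ^ u * (A₀ * (suc n * loss))      ≤⟨ *-monoʳ-≤ ((2 ^ 15) ^ u) (*-monoʳ-≤ A₀ loss-bound) ⟩
      (2 ^ 15) ^ u * (A₀ * 2 ^ Λ)               ≡⟨ ring ((2 ^ 15) ^ u) A₀ (2 ^ Λ) ⟩
      A₀ * ((2 ^ 15) ^ u * 2 ^ Λ)               ≤⟨ *-monoʳ-≤ A₀ gain-all ⟩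
      -- The exponents of `3` are `2` and `4` for straddling and inner pairs in `H`, and `1` and `1`
      -- in `S`; their sum is the `8` of `dense-base`.
      A₀ * (lam ^ 6) ^ u                        ≤⟨ tilted 2 4 1 1 refl linear₁ quadratic linear' quadratic' ⟩
      (2 ^ 15) ^ u * ((m + l) ^ (m + l) * l ^ l) ∎)
      where
      A₀ = W * W' * dense-fixed z u
      ring : ∀ a b c → a * (b * c) ≡ b * (a * c)
      ring = solve-∀

  dense-ok : W * W' * pairs-sum (λ H S → densePairs z (H ++ S)) * loss ≤ (m + l) ^ (m + l) * l ^ l
  dense-ok = cancel-pos {m = suc n} (s≤s z≤n) (≤-trans (≤-reflexive (ring (suc n) (W * W' * pairs-sum (λ H S → densePairs z (H ++ S))) loss))
    (dense-pairs-bound z (suc n * loss) ((m + l) ^ (m + l) * l ^ l) per-u))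
    where
    ring : ∀ a b c → a * (b * c) ≡ b * (a * c)
    ring = solve-∀
    per-u : ∀ u → 5 ≤ u → u ≤ z → W * W' * dense-fixed z u * (suc n * loss) ≤ (m + l) ^ (m + l) * l ^ l
    per-u u 5≤u u≤z with square-root (u * suc D) (4 * n₁) (*-mono-≤ {1} {u} (≤-trans (s≤s z≤n) 5≤u) (s≤s (z≤n {D})))
    ... | lam , lo , hi = Tilt.dense-size u lam 5≤u u≤z lo hi

  module Sprinkling (v : ℕ) (v-lo : 600 * v ≤ n) (v-hi : n < 600 * suc v) where
    100≤v : 100 ≤ v
    100≤v with ≤-<-connex 100 v
    ... | inj₁ h = h
    ... | inj₂ v<100 = ⊥-elim (<-irrefl refl (<-≤-trans v-hi (≤-trans (*-monoʳ-≤ 600 v<100) (≤-trans (≤ᵇ⇒≤ (600 * 100) 100000 _) 100000≤n))))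

    4Λ≤v : 4 * Λ ≤ v
    4Λ≤v with ≤-<-connex (4 * Λ) v
    ... | inj₁ h = h
    ... | inj₂ v< = ⊥-elim (<-irrefl refl (<-≤-trans v-hi (≤-trans (*-monoʳ-≤ 600 (≤-trans v< (*-monoʳ-≤ 4 Λ≤q))) (≤-trans (≤-reflexive (sym (*-assoc 600 4 q))) (linear (600 * 4) (≤ᵇ⇒≤ (600 * 4) (2 ^ 20) _))))))

    z≤2v : z ≤ 2 * v
    z≤2v with ≤-<-connex z (2 * v)
    ... | inj₁ h = h
    ... | inj₂ 2v<z = ⊥-elim (<-irrefl refl (begin-strict
      n                              <⟨ v-hi ⟩
      600 * suc v                    ≡⟨ *-suc 600 v ⟩
      600 + 600 * v                  ≤⟨ +-monoˡ-≤ (600 * v) (≤-trans (≤ᵇ⇒≤ 600 (307 + 14 * 100) _) (+-monoʳ-≤ 307 (*-monoʳ-≤ 14 100≤v))) ⟩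
      307 + 14 * v + 600 * v         ≡⟨ trans (+-assoc 307 (14 * v) (600 * v)) (cong (307 +_) (trans (sym (*-distribʳ-+ v 14 600)) (*-assoc 307 2 v))) ⟩
      307 + 307 * (2 * v)            ≡⟨ sym (*-suc 307 (2 * v)) ⟩
      307 * suc (2 * v)              ≤⟨ *-monoʳ-≤ 307 2v<z ⟩
      307 * z                        ≤⟨ 307z≤n ⟩
      n                              ∎))

    stays : ℕ
    stays = 40 * l' + 39 * t

    stays+t : stays + t ≡ 40 * l
    stays+t = trans (ring 40 39 l' t) (trans (cong (40 * l' +_) (+-comm (39 * t) t)) (trans (sym (*-distribˡ-+ 40 l' t)) (cong (40 *_) (trans (+-comm l' t) total'))))
      where
      ring : ∀ a b x y → a * x + b * y + y ≡ a * x + (b * y + y)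
      ring = solve-∀

    -- `40 l / t` is about `40 (n²/2) / (n/8) = 160 n`, and `4 * 41 n = 164 n`. The excess absorbs
    -- the floor in `t = n / 8`, so `41 n` pairs form one block of factor `4/5`.
    rounds : stays ≤ 4 * (41 * n * t)
    rounds = *-cancelˡ-≤ 8 (begin
      8 * stays                             ≤⟨ *-monoʳ-≤ 8 (≤-trans (m≤m+n stays t) (≤-reflexive stays+t)) ⟩
      8 * (40 * l)                          ≡⟨ trans (cong (8 *_) (*-assoc 20 2 l)) (sym (*-assoc 8 20 (2 * l))) ⟩
      160 * (2 * l)                         ≤⟨ *-monoʳ-≤ 160 2l≤nn ⟩
      160 * (n * n)                         ≤⟨ +-cancelʳ-≤ (4 * (n * n)) (160 * (n * n)) (164 * n * (8 * t)) main ⟩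
      4 * 41 * n * (8 * t)                  ≡⟨ ring₁ 4 41 n 8 t ⟩
      8 * (4 * (41 * n * t))                ∎)
      where
      ring₁ : ∀ a b n c t → a * b * n * (c * t) ≡ c * (a * (b * n * t))
      ring₁ = solve-∀
      ring₂ : ∀ a n c t → a * n * (c * suc t) ≡ a * n * (c * t) + a * c * n
      ring₂ = solve-∀
      main : 160 * (n * n) + 4 * (n * n) ≤ 164 * n * (8 * t) + 4 * (n * n)
      main = begin
        160 * (n * n) + 4 * (n * n)         ≡⟨ trans (sym (*-distribʳ-+ (n * n) 160 4)) (sym (*-assoc 164 n n)) ⟩
        164 * n * n                         ≤⟨ *-monoʳ-≤ (164 * n) (<⇒≤ n<8t+8) ⟩
        164 * n * (8 * suc t)               ≡⟨ ring₂ 164 n 8 t ⟩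
        164 * n * (8 * t) + 164 * 8 * n     ≤⟨ +-monoʳ-≤ (164 * n * (8 * t)) (≤-trans (*-monoˡ-≤ n (≤-trans (≤ᵇ⇒≤ (164 * 8) (4 * 100000) _) (*-monoʳ-≤ 4 100000≤n))) (≤-reflexive (*-assoc 4 n n))) ⟩
        164 * n * (8 * t) + 4 * (n * n)     ∎

    -- Origin of `600`: the `7 v` blocks of `41 n` pairs take `287 v n`, and with `v ≤ n/600` this
    -- is below `0.49 n²`, which remains of `l ≥ 0.495 n²` after removing the at most `z n` outside
    -- pairs. The same scale gives `z ≤ 2 v`, as `307 > 300`.
    room : ∀ a c → a + c ≡ l → a ≤ z * n → 7 * v * (41 * n) ≤ c
    room a c ac a≤ = +-cancelˡ-≤ (z * n) (7 * v * (41 * n)) c (≤-trans (cancel-pos {m = 200} (s≤s z≤n) (begin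
      200 * (z * n + 7 * v * (41 * n))              ≡⟨ ring 200 z n 7 v 41 ⟩
      200 * z * n + 200 * 7 * 41 * v * n            ≤⟨ +-mono-≤ (*-monoˡ-≤ n (≤-trans (*-monoˡ-≤ z (≤ᵇ⇒≤ 200 307 _)) 307z≤n)) (*-monoˡ-≤ n (≤-trans (*-monoˡ-≤ v (≤ᵇ⇒≤ (200 * 7 * 41) (98 * 600) _)) (≤-trans (≤-reflexive (*-assoc 98 600 v)) (*-monoʳ-≤ 98 v-lo)))) ⟩
      n * n + 98 * n * n                            ≡⟨ cong (n * n +_) (*-assoc 98 n n) ⟩
      99 * (n * n)                                  ≤⟨ 99nn≤200l ⟩
      200 * l                                       ∎))
      (≤-trans (≤-reflexive (sym ac)) (+-monoˡ-≤ c a≤)))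
      where
      ring : ∀ e z n a v b → e * (z * n + a * v * (b * n)) ≡ e * z * n + e * a * b * v * n
      ring = solve-∀

    growth : ∀ h y → h ≡ 4 → y ≡ 7 * v → 2 ^ z * h ^ y * 2 ^ Λ ≤ suc h ^ y
    growth h y h≡ y≡ = begin
      2 ^ z * h ^ y * 2 ^ Λ               ≤⟨ *-monoˡ-≤ (2 ^ Λ) (*-monoˡ-≤ (h ^ y) (≤-trans (^-monoʳ-≤ 2 z≤2v) (≤-reflexive (sym (^-*-assoc 2 2 v))))) ⟩
      (2 ^ 2) ^ v * h ^ y * 2 ^ Λ         ≡⟨ cong (λ s → (2 ^ 2) ^ v * s * 2 ^ Λ) (power 4 h h≡) ⟩
      (2 ^ 2) ^ v * (4 ^ 7) ^ v * 2 ^ Λ   ≡⟨ trans (*-comm ((2 ^ 2) ^ v * (4 ^ 7) ^ v) (2 ^ Λ)) (cong (2 ^ Λ *_) (sym (^-distribʳ-* v (2 ^ 2) (4 ^ 7)))) ⟩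
      2 ^ Λ * (2 ^ 2 * 4 ^ 7) ^ v         ≤⟨ doubling (2 ^ 2 * 4 ^ 7) (5 ^ 7) Λ v (≤ᵇ⇒≤ (2 ^ 2 * 4 ^ 7) (5 ^ 7) _) (≤ᵇ⇒≤ (2 * (2 ^ 2 * 4 ^ 7) ^ 4) ((5 ^ 7) ^ 4) _) 4Λ≤v ⟩
      (5 ^ 7) ^ v                         ≡⟨ sym (power 5 (suc h) (cong suc h≡)) ⟩
      suc h ^ y                           ∎
      where
      power : ∀ c h' → h' ≡ c → h' ^ y ≡ (c ^ 7) ^ v
      power c h' refl = trans (cong (c ^_) y≡) (sym (^-*-assoc c 7 v))

    stuck-with : ∀ h y j → h ≡ 4 → y ≡ 7 * v → j ≡ 41 * n → ∀ a c → a + c ≡ l → a ≤ z * n →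
      2 ^ z * ((40 * l) ^ a * stays ^ c) * (suc l * (4 * scale)) ≤ (40 * l) ^ l
    stuck-with h y j h≡ y≡ j≡ a c ac a≤ = cancel-pos {m = suc h ^ y} (^-pos y (s≤s z≤n)) (begin
      suc h ^ y * (2 ^ z * (F ^ a * stays ^ c) * (suc l * (4 * scale)))
        ≤⟨ *-monoʳ-≤ (suc h ^ y) (*-monoʳ-≤ (2 ^ z * (F ^ a * stays ^ c)) loss≤) ⟩
      suc h ^ y * (2 ^ z * (F ^ a * stays ^ c) * 2 ^ Λ)
        ≡⟨ ring₁ (suc h ^ y) (2 ^ z) (F ^ a) (stays ^ c) (2 ^ Λ) ⟩
      stays ^ c * suc h ^ y * (2 ^ z * F ^ a * 2 ^ Λ)
        ≤⟨ *-monoˡ-≤ (2 ^ z * F ^ a * 2 ^ Λ) (block-power stays F h j y c (≤-trans (m≤m+n stays t) (≤-reflexive stays+t)) blocks yj≤c) ⟩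
      F ^ c * h ^ y * (2 ^ z * F ^ a * 2 ^ Λ)
        ≡⟨ ring₂ (F ^ c) (h ^ y) (2 ^ z) (F ^ a) (2 ^ Λ) ⟩
      2 ^ z * h ^ y * 2 ^ Λ * (F ^ a * F ^ c)
        ≤⟨ *-monoˡ-≤ (F ^ a * F ^ c) (growth h y h≡ y≡) ⟩
      suc h ^ y * (F ^ a * F ^ c)
        ≡⟨ cong (suc h ^ y *_) (trans (sym (^-distribˡ-+-* F a c)) (cong (F ^_) ac)) ⟩
      suc h ^ y * F ^ l ∎)
      where
      F = 40 * l
      loss≤ : suc l * (4 * scale) ≤ 2 ^ Λ
      loss≤ = ≤-trans (*-monoˡ-≤ (4 * scale) (m≤n*m (suc l) (suc (m + l)))) (≤-trans (m≤n*m loss (suc n)) loss-bound)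
      blocks : stays ^ j * suc h ≤ F ^ j * h
      blocks = subst (λ s → stays ^ j * suc h ≤ s ^ j * h) stays+t (bernoulli-block stays t h j (≤-trans (*-mono-≤ {1} {40} (s≤s z≤n) 0<l') (m≤m+n (40 * l') (39 * t)))
        (subst₂ (λ s r → stays ≤ s * (r * t)) (sym h≡) (sym j≡) rounds))
      yj≤c : y * j ≤ c
      yj≤c = subst₂ (λ s r → s * r ≤ c) (sym y≡) (sym j≡) (room a c ac a≤)
      ring₁ : ∀ s z f r g → s * (z * (f * r) * g) ≡ r * s * (z * f * g)
      ring₁ = solve-∀
      ring₂ : ∀ f h z a g → f * h * (z * a * g) ≡ z * h * g * (a * f)
      ring₂ = solve-∀

  stuck-ok : ∀ a c → a + c ≡ l → a ≤ z * n → 2 ^ z * ((40 * l) ^ a * (40 * l' + 39 * t) ^ c) * (suc l * (4 * scale)) ≤ (40 * l) ^ l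
  stuck-ok = let (v , lo , hi) = floor-div 600 n (s≤s z≤n) in Sprinkling.stuck-with v lo hi 4 (7 * v) (41 * n) refl refl refl

  z≤ℓ : z ≤ ℓ
  z≤ℓ = ≤-pred (*-cancelˡ-< 25 z (suc ℓ) (≤-<-trans (≤-trans (*-monoˡ-≤ z (≤ᵇ⇒≤ 25 (6 * 307) _)) (≤-trans (≤-reflexive (*-assoc 6 307 z)) (*-monoʳ-≤ 6 307z≤n))) ℓ-hi))

  -- At least `23n/100` ends lie in the old core, namely `6/25 - 1/100` of `n`. As
  -- `(23/100)² = 529/10000` exceeds `1/20`, the surplus `29/10000` of `n²` covers the diagonal term
  -- `n`.
  enough : ∀ b → (suc ℓ ∸ z) * (suc ℓ ∸ z) ≤ 2 * b + n → length (allPairs n) ≤ 20 * b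
  enough β h = *-cancelˡ-≤ 2 (≤-trans 2N≤nn (≤-trans nn≤ (≤-reflexive (*-assoc 2 20 β))))
    where
    c = suc ℓ ∸ z
    100c : 23 * n ≤ 100 * c
    100c = +-cancelʳ-≤ n (23 * n) (100 * c) (begin
      23 * n + n                 ≡⟨ +-comm (23 * n) n ⟩
      4 * 6 * n                  ≡⟨ *-assoc 4 6 n ⟩
      4 * (6 * n)                ≤⟨ *-monoʳ-≤ 4 (<⇒≤ ℓ-hi) ⟩
      4 * (25 * suc ℓ)           ≡⟨ sym (*-assoc 4 25 (suc ℓ)) ⟩
      100 * suc ℓ                ≤⟨ *-monoʳ-≤ 100 (m≤n+m∸n (suc ℓ) z) ⟩
      100 * (z + c)              ≡⟨ *-distribˡ-+ 100 z c ⟩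
      100 * z + 100 * c          ≤⟨ +-monoˡ-≤ (100 * c) (≤-trans (*-monoˡ-≤ z (≤ᵇ⇒≤ 100 307 _)) 307z≤n) ⟩
      n + 100 * c                ≡⟨ +-comm n (100 * c) ⟩
      100 * c + n                ∎)
    nn≤ : n * n ≤ 40 * β
    nn≤ = cancel-pos {m = 500} (s≤s z≤n) (+-cancelʳ-≤ (29 * (n * n)) (500 * (n * n)) (500 * (40 * β)) (begin
      500 * (n * n) + 29 * (n * n)         ≡⟨ sym (*-distribʳ-+ (n * n) 500 29) ⟩
      23 * 23 * (n * n)                    ≡⟨ ring₁ 23 n ⟩
      23 * n * (23 * n)                    ≤⟨ *-mono-≤ 100c 100c ⟩
      100 * c * (100 * c)                  ≡⟨ sym (ring₁ 100 c) ⟩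
      100 * 100 * (c * c)                  ≤⟨ *-monoʳ-≤ (100 * 100) h ⟩
      100 * 100 * (2 * β + n)              ≡⟨ trans (*-distribˡ-+ (100 * 100) (2 * β) n) (cong (_+ 100 * 100 * n) (trans (sym (*-assoc (100 * 100) 2 β)) (*-assoc 500 40 β))) ⟩
      500 * (40 * β) + 100 * 100 * n       ≤⟨ +-monoʳ-≤ (500 * (40 * β)) (≤-trans (*-monoˡ-≤ n (≤-trans (≤ᵇ⇒≤ (100 * 100) (29 * 100000) _) (*-monoʳ-≤ 29 100000≤n))) (≤-reflexive (*-assoc 29 n n))) ⟩
      500 * (40 * β) + 29 * (n * n)        ∎))
      where
      ring₁ : ∀ a x → a * a * (x * x) ≡ a * x * (a * x)
      ring₁ = solve-∀

-- From the hypotheses on the density to the parameters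

density-bound : ∀ {k n m D} → 15 ≤ k → (7 * k ∸ 1) * n ≤ 6 * m → m < n * suc D → k + 2 ≤ D
density-bound {k} {n} {m} {D} 15≤k density hi with ≤-<-connex (k + 2) D
... | inj₁ h = h
-- If `suc D ≤ k + 2`, then `7 k ≤ 6 (D + 1) ≤ 6 k + 12`, so `k ≤ 12`.
... | inj₂ h = ⊥-elim (<⇒≱ (≤-trans (≤ᵇ⇒≤ 13 15 _) 15≤k) (+-cancelˡ-≤ (6 * k) k 12 (begin
    6 * k + k          ≡⟨ +-comm (6 * k) k ⟩
    7 * k              ≤⟨ 7k≤ ⟩
    6 * suc D          ≤⟨ *-monoʳ-≤ 6 h ⟩
    6 * (k + 2)        ≡⟨ *-distribˡ-+ 6 k 2 ⟩
    6 * k + 12         ∎)))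
  where
  open ≤-Reasoning
  ring : ∀ c n d → c * (n * d) ≡ c * d * n
  ring = solve-∀
  7k≤ : 7 * k ≤ 6 * suc D
  7k≤ = ≤-trans (m≤n+m∸n (7 * k) 1) (*-cancelʳ-< n (7 * k ∸ 1) (6 * suc D) (<-≤-trans (≤-<-trans density (*-monoʳ-< 6 hi)) (≤-reflexive (ring 6 n (suc D)))))

-- If `m` exceeded `(b+1) n`, then `2^(m-1) ≤ n^n < 2^((b+1) n) ≤ 2^(m-1)`; the strict inequality
-- `n < 2^(b+1)` pays for the shift by one.
log-bound : ∀ {n m b D} → 0 < n → 0 < D → n * D ≤ m → n < 2 ^ suc b → LeNLogN m n → D ≤ b + 1
log-bound {n} {zero} {b} {D} 0<n 0<D lo n<2^ sparse = ⊥-elim (<⇒≱ (*-mono-≤ {1} {n} 0<n 0<D) lo)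
log-bound {n} {suc m'} {b} {D} 0<n 0<D lo n<2^ sparse = subst (D ≤_) (+-comm 1 b) (*-cancelˡ-≤ n {{>0⇒≢0 0<n}} (≤-trans lo (≤-trans m'< (≤-reflexive (*-comm (suc b) n)))))
  where
  open ≤-Reasoning
  m'< : suc m' ≤ suc b * n
  m'< with ≤-<-connex (suc b * n) m'
  ... | inj₂ h = h
  ... | inj₁ h = ⊥-elim (<-irrefl refl (begin-strict
    2 ^ m'               ≤⟨ LeNLogN⇒2^ m' n sparse ⟩
    n ^ n                <⟨ ^-monoˡ-< n {{>0⇒≢0 0<n}} n<2^ ⟩
    (2 ^ suc b) ^ n      ≡⟨ ^-*-assoc 2 (suc b) n ⟩
    2 ^ (suc b * n)      ≤⟨ ^-monoʳ-≤ 2 h ⟩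
    2 ^ m'               ∎))

setting-from : ∀ {k d B₀ n m b D} → 15 ≤ k → (∀ b → B₀ ≤ b → 2 ^ (d + 20) * (10 * b + 5 * d + 30) ^ 8 ≤ 2 ^ b) → 2 ^ B₀ ≤ n →
  (7 * k ∸ 1) * n ≤ 6 * m → LeNLogN m n → 0 < n → 2 ^ b ≤ n → n < 2 ^ suc b → n * D ≤ m → m < n * suc D → Setting n m k D b d (10 * b + 5 * d + 30)
setting-from {k} {d} {B₀} {n} {m} {b} {D} 15≤k dominates N₀≤n density sparse 0<n 2^b≤n n<2^ lo hi = record
  { 17≤D = 17≤D ; q≡ = refl ; 2^b≤n = 2^b≤n ; n<2^ = n<2^ ; Dn≤m = ≤-trans (≤-reflexive (*-comm D n)) lo ; m< = subst (m <_) (*-comm n (suc D)) hi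
  ; k≤ = k+2≤D ; 15≤k = 15≤k ; D≤ = log-bound 0<n (≤-trans (s≤s z≤n) 17≤D) lo n<2^ sparse ; big = ≤-trans (dominates b B₀≤b) 2^b≤n }
  where
  k+2≤D : k + 2 ≤ D
  k+2≤D = density-bound 15≤k density hi
  17≤D : 17 ≤ D
  17≤D = ≤-trans (+-monoˡ-≤ 2 15≤k) k+2≤D
  B₀≤b : B₀ ≤ b
  B₀≤b with ≤-<-connex B₀ b
  ... | inj₁ h = h
  ... | inj₂ h = ⊥-elim (<-irrefl refl (<-≤-trans n<2^ (≤-trans (^-monoʳ-≤ 2 h) N₀≤n)))

parameters-bound : ∀ {n m k D b d q l l' z ℓ} → Setting n m k D b d q → m + l ≡ length (allPairs n) → n / 8 + l' ≡ l →
  D ^ 3 * z ≤ 16 * n → 16 * n < D ^ 3 * suc z → 25 * ℓ ≤ 6 * n → 6 * n < 25 * suc ℓ → favourable n m k * (n ^ 3 * suc d) ≤ length (samples n m)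
parameters-bound {n} {m} {k} {d = d} {l = l} {l'} {z} {ℓ} setting total total' z-lo z-hi ℓ-lo ℓ-hi =
  Count.count-bound {n} {m} {l} {l'} {k} {z} {ℓ} {n ^ 3 * suc d} total total' 0<m 0<t 0<l' 15≤k z≤ℓ enough sparse-ok closed-ok dense-ok stuck-ok
  where open Endgame {l' = l'} {ℓ = ℓ} setting total total' z-lo z-hi ℓ-lo ℓ-hi

setting-bound : ∀ {n m k D b d q} → Setting n m k D b d q → favourable n m k * (n ^ 3 * suc d) ≤ length (samples n m)
setting-bound {n} {m} {k} {D} setting = from (floor-div (D ^ 3) (16 * n) (^-pos 3 (Logs.0<D setting))) (floor-div 25 (6 * n) (s≤s z≤n))
  where
  -- The truncated subtractions are exact, because `n + m ≤ N` and `n / 8 ≤ n`.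
  total : m + (length (allPairs n) ∸ m) ≡ length (allPairs n)
  total = m+[n∸m]≡n (≤-trans (m≤n+m m n) (Logs.n+m≤N setting))
  total' : n / 8 + (length (allPairs n) ∸ m ∸ n / 8) ≡ length (allPairs n) ∸ m
  total' = m+[n∸m]≡n (≤-trans (Logs.t≤n setting) (m+n≤o⇒m≤o∸n n (Logs.n+m≤N setting)))
  from : (∃ λ z → D ^ 3 * z ≤ 16 * n × 16 * n < D ^ 3 * suc z) → (∃ λ ℓ → 25 * ℓ ≤ 6 * n × 6 * n < 25 * suc ℓ) → _
  from (z , z-lo , z-hi) (ℓ , ℓ-lo , ℓ-hi) = parameters-bound setting total total' z-lo z-hi ℓ-lo ℓ-hi

-- `1 / suc d` plays the part of `ε` in the little-o. The threshold `2^B₀` comes from an inequality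
-- in `b` and `d` only; `k` is controlled through `k + 2 ≤ D ≤ b + 1`.
theorem-from : ∀ k → 15 ≤ k → ∀ d → (∃ λ B₀ → ∀ b → B₀ ≤ b → 2 ^ (d + 20) * (10 * b + 5 * d + 30) ^ 8 ≤ 2 ^ b) →
  Σ ℕ (λ N → (n m : ℕ) → N ≤ n → (7 * k ∸ 1) * n ≤ 6 * m → LeNLogN m n → favourable n m k * (n ^ 3) * suc d ≤ length (samples n m))
theorem-from k 15≤k d (B₀ , dominates) = 2 ^ B₀ , bound
  where
  bound : (n m : ℕ) → 2 ^ B₀ ≤ n → (7 * k ∸ 1) * n ≤ 6 * m → LeNLogN m n → favourable n m k * (n ^ 3) * suc d ≤ length (samples n m)
  bound n m N₀≤n density sparse = from (log₂ n 0<n) (floor-div n m 0<n)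
    where
    0<n : 0 < n
    0<n = ≤-trans (m^n>0 2 B₀) N₀≤n
    from : (∃ λ b → 2 ^ b ≤ n × n < 2 ^ suc b) → (∃ λ D → n * D ≤ m × m < n * suc D) → favourable n m k * (n ^ 3) * suc d ≤ length (samples n m)
    from (b , 2^b≤n , n<2^) (D , lo , hi) = ≤-trans (≤-reflexive (*-assoc (favourable n m k) (n ^ 3) (suc d)))
      (setting-bound (setting-from {k} {d} {B₀} {n} {m} {b} {D} 15≤k dominates N₀≤n density sparse 0<n 2^b≤n n<2^ lo hi))

theorem2p2 : (k : ℕ) → 15 ≤ k → (d : ℕ) → Σ ℕ (λ N → (n m : ℕ) → N ≤ n → (7 * k ∸ 1) * n ≤ 6 * m → LeNLogN m n → favourable n m k * (n ^ 3) * suc d ≤ length (samples n m))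
theorem2p2 k 15≤k d = theorem-from k 15≤k d (exponential-dominates d)
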